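{- Let $\mu=(\mu_1,\ldots,\mu_n)\in\mathbb{Z}_{\ge 0}^n$, and suppose $n=\sum_{i=1}^n i\mu_i$; set $k=\sum_{i=1}^n\mu_i$. Let $\mathcal{A}_\mu$ be the set of dissections of the polygon $P_{n+2}$ whose subgons consist of exactly $\mu_i$ subgons with $i+2$ vertices for each $1\le i\le n$ (such dissections use $k-1$ diagonals), let $G_{n+2}=\langle\sigma\rangle$ be the cyclic group of order $n+2$ acting on $\mathcal{A}_\mu$ by rotation, and let $$a_\mu(q)=\frac{1}{[n+1]_q}\begin{bmatrix} n+k\\ k\end{bmatrix}_q\begin{bmatrix} k\\ \mu_1,\mu_2,\ldots,\mu_n\end{bmatrix}_q .$$ Then the triple $(\mathcal{A}_\mu,G_{n+2},a_\mu(q))$ exhibits the cyclic sieving phenomenon.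
   Context: $P_N$ denotes a convex polygon with vertices $v_0,\ldots,v_{N-1}$ in clockwise order, indices taken modulo $N$. A dissection of $P_N$ is a set of pairwise non-crossing diagonals; its subgons are the connected components of $P_N$ minus the diagonals. The rotation $\sigma$ sends $v_i\mapsto v_{i-1}$ for all $i$, and acts on dissections by sending each diagonal $(v_i,v_j)$ to $(v_{i-1},v_{j-1})$. $q$-notation: $[a]_q=1+q+\cdots+q^{a-1}$, $[a]_q!=[1]_q\cdots[a]_q$, $\begin{bmatrix} a\\ b\end{bmatrix}_q=\frac{[a]_q!}{[b]_q![a-b]_q!}$, and $\begin{bmatrix} k\\ \mu_1,\ldots,\mu_n\end{bmatrix}_q=\frac{[k]_q!}{[\mu_1]_q!\cdots[\mu_n]_q!}$. A triple $(X,G,X(q))$ consisting of a finite set $X$ with an action of a cyclic group $G=\langle\sigma\rangle$ of order $N$ and a polynomial $X(q)\in\mathbb{Z}[q]$ exhibits the cyclic sieving phenomenon if for every integer $j$, $X(\zeta_N^j)$ equals the number of elements of $X$ fixed by $\sigma^j$, where $\zeta_N$ is a primitive $N$-th root of unity. -}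

module Defs where

open import Algebra.Apartness.Bundles using (HeytingField; HeytingCommutativeRing)
open import Algebra.Bundles using (CommutativeRing; RawSemiring; Semiring)
open import Algebra.Definitions.RawSemiring using () renaming (_×_ to multiple; _^_ to power)
open import Data.Fin.Base using (Fin; toℕ) renaming (_<_ to _<ᶠ_)
open import Data.Fin.Permutation using (Permutation′; permutation; _⟨$⟩ʳ_; _⟨$⟩ˡ_; flip;
  inverseˡ; inverseʳ)
open import Data.Fin.Properties using (toℕ-injective; toℕ-fromℕ<; toℕ<n)
open import Data.Fin.Subset using (Subset; _∈_; ∣_∣)
open import Data.Integer.Base as ℤ using (ℤ; +_; -[1+_])
open import Data.List.Base as List using (List; []; _∷_; length; replicate)
import Data.List.Membership.Propositional as ListMem
open import Data.List.Relation.Unary.Unique.Propositional using (Unique)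
open import Data.Nat.Base using (ℕ; zero; suc; _+_; _*_; _∸_; _<_; NonZero; pred)
open import Data.Nat.DivMod using (_%_; _mod_; m%n<n; m%n%n≡m%n; %-distribˡ-+; m<n⇒m%n≡m; [m+n]%n≡m%n)
open import Data.Nat.Properties using (+-comm; +-suc; suc-pred)
open import Data.Product.Base using (Σ; ∃-syntax; _×_; _,_)
open import Data.Sum.Base using (_⊎_)
open import Data.Vec.Base as Vec using (Vec; lookup; tabulate)
open import Data.Vec.Properties using (lookup∘tabulate; tabulate∘lookup; tabulate-cong)
open import Function.Base using (_∘_)
open import Function.Bundles using (_↔_; _⇔_; Inverse; mk↔ₛ′)
open import Function.Endo.Propositional using () renaming (_^_ to iterate)
open import Level using (Level; _⊔_) renaming (suc to lsuc)
open import Relation.Binary.PropositionalEquality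
open import Relation.Nullary.Negation using (¬_)
open import Relation.Unary using (Pred)

HasCard : ∀ {a p} {A : Set a} → Pred A p → ℕ → Set (a ⊔ p)
HasCard {A = A} P m =
  ∃[ xs ] Unique xs × (∀ (x : A) → (x ListMem.∈ xs) ⇔ P x) × length xs ≡ m

-- Coefficients, constant term first; trailing zeros are allowed, so equality
-- of polynomials is _≈ₚ_ and not _≡_.
Poly : Set
Poly = List ℤ

coeff : Poly → ℕ → ℤ
coeff []      _       = + 0
coeff (a ∷ _) zero    = a
coeff (_ ∷ p) (suc i) = coeff p i

infix 4 _≈ₚ_
_≈ₚ_ : Poly → Poly → Set
p ≈ₚ r = ∀ i → coeff p i ≡ coeff r i

infixl 6 _+ₚ_
_+ₚ_ : Poly → Poly → Poly
[]      +ₚ r       = r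
(a ∷ p) +ₚ []      = a ∷ p
(a ∷ p) +ₚ (b ∷ r) = (a ℤ.+ b) ∷ (p +ₚ r)

infixl 7 _*ₚ_
_*ₚ_ : Poly → Poly → Poly
[]      *ₚ r = []
(a ∷ p) *ₚ r = List.map (a ℤ.*_) r +ₚ (+ 0 ∷ (p *ₚ r))

1ₚ : Poly
1ₚ = + 1 ∷ []

-- A fraction of polynomials.  All denominators built below are products of
-- [a]_q with a ≥ 1, hence nonzero.
record Fraction : Set where
  constructor _//_
  field
    numerator   : Poly
    denominator : Poly

infix  5 _//_
infixl 7 _·_
_·_ : Fraction → Fraction → Fraction
(a // b) · (c // d) = (a *ₚ c) // (b *ₚ d)

infix 4 _≐_
_≐_ : Poly → Fraction → Set
f ≐ (a // b) = f *ₚ b ≈ₚ a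

[_]q : ℕ → Poly
[ a ]q = replicate a (+ 1)

[_]q! : ℕ → Poly
[ zero  ]q! = 1ₚ
[ suc a ]q! = [ a ]q! *ₚ [ suc a ]q

qBinomial : ℕ → ℕ → Fraction
qBinomial a b = [ a ]q! // ([ b ]q! *ₚ [ a ∸ b ]q!)

qMultinomial : ∀ {n} → ℕ → Vec ℕ n → Fraction
qMultinomial k μ = [ k ]q! // Vec.foldr′ _*ₚ_ 1ₚ (Vec.map [_]q! μ)

-- Positions are 0-based: lookup μ i is μ_{i+1}, hence the coefficient suc i.
weight : ∀ {n} → Vec ℕ n → ℕ
weight μ = Vec.sum (tabulate λ i → suc (toℕ i) * lookup μ i)

aμ : ∀ {n} → Vec ℕ n → Fraction
aμ {n} μ = (1ₚ // [ n + 1 ]q) · qBinomial (n + k) k · qMultinomial k μ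
  where
  k : ℕ
  k = Vec.sum μ

module _ {c ℓ₁ ℓ₂} (F : HeytingField c ℓ₁ ℓ₂) where
  open HeytingField F
    using (Carrier; _≈_; 0#; 1#; -_; heytingCommutativeRing)
    renaming (_+_ to _⊕_; _*_ to _⊛_)

  semiring : RawSemiring c ℓ₁
  semiring = Semiring.rawSemiring (CommutativeRing.semiring
    (HeytingCommutativeRing.commutativeRing heytingCommutativeRing))

  fromℕ : ℕ → Carrier
  fromℕ n = multiple semiring n 1#

  fromℤ : ℤ → Carrier
  fromℤ (+ n)    = fromℕ n
  fromℤ -[1+ n ] = - fromℕ (suc n)

  eval : Poly → Carrier → Carrier
  eval []      x = 0#
  eval (a ∷ p) x = fromℤ a ⊕ (x ⊛ eval p x)

  CharacteristicZero : Set ℓ₁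
  CharacteristicZero = ∀ n → ¬ (fromℕ (suc n) ≈ 0#)

  -- The inverse is recorded so that integer powers can be formed.
  record PrimitiveRoot (N : ℕ) : Set (c ⊔ ℓ₁) where
    field
      ζ       : Carrier
      ζ⁻¹     : Carrier
      inverse : ζ ⊛ ζ⁻¹ ≈ 1#
      root    : power semiring ζ N ≈ 1#
      minimal : ∀ m → 0 < m → m < N → ¬ (power semiring ζ m ≈ 1#)

    ζ^ : ℤ → Carrier
    ζ^ (+ n)    = power semiring ζ n
    ζ^ -[1+ n ] = power semiring ζ⁻¹ (suc n)

infixr 8 _^ℤ_
_^ℤ_ : ∀ {a} {A : Set a} → A ↔ A → ℤ → A → A
σ ^ℤ (+ n)    = iterate _ (Inverse.to σ) n
σ ^ℤ -[1+ n ] = iterate _ (Inverse.from σ) (suc n)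

-- X is a finite set of elements of A on which the cyclic group of order N acts
-- through its generator σ (the action need not be faithful).  ζ_N ranges over
-- the primitive N-th roots of unity of all fields of characteristic zero at
-- the given levels, in place of ℂ.
record ExhibitsCSP {a x} {A : Set a} (X : Pred A x) (N : ℕ) (σ : A ↔ A) (f : Poly)
                   (c ℓ₁ ℓ₂ : Level) : Set (a ⊔ x ⊔ lsuc (c ⊔ ℓ₁ ⊔ ℓ₂)) where
  field
    closed : ∀ {D} → X D → X (Inverse.to σ D)
    order  : ∀ {D} → X D → (σ ^ℤ + N) D ≡ D
    sieve  : ∀ (j : ℤ) → ∃[ m ]
      HasCard (λ D → X D × (σ ^ℤ j) D ≡ D) m ×
      (∀ (F : HeytingField c ℓ₁ ℓ₂) → CharacteristicZero F →
       ∀ (z : PrimitiveRoot F N) →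
       HeytingField._≈_ F (eval F f (PrimitiveRoot.ζ^ z j)) (fromℕ F m))

module _ {N : ℕ} .{{_ : NonZero N}} where

  next prev : Fin N → Fin N
  next i = suc (toℕ i) mod N
  prev i = (pred N + toℕ i) mod N

  private
    toℕ-mod : ∀ m → toℕ (m mod N) ≡ m % N
    toℕ-mod m = toℕ-fromℕ< (m%n<n m N)

    +-%ʳ : ∀ a b → (a + b % N) % N ≡ (a + b) % N
    +-%ʳ a b = trans (%-distribˡ-+ a (b % N) N)
      (trans (cong (λ t → (a % N + t) % N) (m%n%n≡m%n b N)) (sym (%-distribˡ-+ a b N)))

    cancel : ∀ (i : Fin N) m → m ≡ toℕ i + N → m mod N ≡ i
    cancel i m eq = toℕ-injective (trans (toℕ-mod m) (trans (cong (_% N) eq)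
      (trans ([m+n]%n≡m%n (toℕ i) N) (m<n⇒m%n≡m (toℕ<n i)))))

    mod-cong : ∀ {a b} → a % N ≡ b % N → a mod N ≡ b mod N
    mod-cong {a} {b} eq = toℕ-injective (trans (toℕ-mod a) (trans eq (sym (toℕ-mod b))))

    next-prev : ∀ i → next (prev i) ≡ i
    next-prev i = trans
      (mod-cong (trans (cong (λ t → suc t % N) (toℕ-mod (pred N + toℕ i)))
                       (+-%ʳ 1 (pred N + toℕ i))))
      (cancel i _ (trans (cong (_+ toℕ i) (suc-pred N)) (+-comm N (toℕ i))))

    prev-next : ∀ i → prev (next i) ≡ i
    prev-next i = trans
      (mod-cong (trans (cong (λ t → (pred N + t) % N) (toℕ-mod (suc (toℕ i))))
                       (+-%ʳ (pred N) (suc (toℕ i)))))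
      (cancel i _ (trans (+-suc (pred N) (toℕ i))
        (trans (cong (_+ toℕ i) (suc-pred N)) (+-comm N (toℕ i)))))

  -- v_i ↦ v_{i-1}
  vertexRotation : Permutation′ N
  vertexRotation = permutation prev next prev-next next-prev

ChordSet : ℕ → Set
ChordSet N = Vec (Subset N) N

infix 4 _─_∈ᶜ_
_─_∈ᶜ_ : ∀ {N} → Fin N → Fin N → ChordSet N → Set
a ─ b ∈ᶜ D = b ∈ lookup D a

-- The image of D under π: a ─ b is in it iff π⁻¹ a ─ π⁻¹ b is in D.
image : ∀ {N} → Permutation′ N → ChordSet N → ChordSet N
image π D = tabulate λ a → tabulate λ b → lookup (lookup D (π ⟨$⟩ˡ a)) (π ⟨$⟩ˡ b)

private
  image-image : ∀ {N} (π ρ : Permutation′ N) → (∀ a → ρ ⟨$⟩ˡ (π ⟨$⟩ˡ a) ≡ a) →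
                ∀ D → image π (image ρ D) ≡ D
  image-image π ρ inv D = trans
    (tabulate-cong λ a → trans
      (tabulate-cong λ b → trans
        (cong (λ r → lookup r (π ⟨$⟩ˡ b)) (lookup∘tabulate _ (π ⟨$⟩ˡ a)))
        (trans (lookup∘tabulate _ (π ⟨$⟩ˡ b))
               (cong₂ (λ s t → lookup (lookup D s) t) (inv a) (inv b))))
      (tabulate∘lookup (lookup D a)))
    (tabulate∘lookup D)

rotation : ∀ {N} .{{_ : NonZero N}} → ChordSet N ↔ ChordSet N
rotation = mk↔ₛ′ (image π) (image (flip π))
  (image-image π (flip π) (λ _ → inverseʳ π))
  (image-image (flip π) π (λ _ → inverseˡ π))
  where
  π = vertexRotation

-- a, b, c are distinct and met in this order when going round the polygon once.
Cyclic : ∀ {N} → Fin N → Fin N → Fin N → Set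
Cyclic a b c = (a <ᶠ b × b <ᶠ c) ⊎ (b <ᶠ c × c <ᶠ a) ⊎ (c <ᶠ a × a <ᶠ b)

-- By convexity, the chords ab and cd cross in their interiors iff c and d lie
-- strictly on opposite sides of ab.
Crosses : ∀ {N} → Fin N → Fin N → Fin N → Fin N → Set
Crosses a b c d = (Cyclic a c b × Cyclic b d a) ⊎ (Cyclic a d b × Cyclic b c a)

IsDiagonal : ∀ {N} .{{_ : NonZero N}} → Fin N → Fin N → Set
IsDiagonal a b = a ≢ b × next a ≢ b × next b ≢ a

-- Symmetry makes D a set of unordered pairs; thus two dissections are the same
-- set of diagonals iff they are _≡_.
record IsDissection {N : ℕ} .{{_ : NonZero N}} (D : ChordSet N) : Set where
  field
    symmetric   : ∀ {a b} → a ─ b ∈ᶜ D → b ─ a ∈ᶜ D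
    diagonals   : ∀ {a b} → a ─ b ∈ᶜ D → IsDiagonal a b
    noncrossing : ∀ {a b c d} → a ─ b ∈ᶜ D → c ─ d ∈ᶜ D → ¬ Crosses a b c d

-- A subgon is given by its vertex set.  The connected components of the polygon
-- minus the diagonals are its intersections with one open side of each diagonal.
-- So a set of vertices lies on the closure of a common component iff no diagonal
-- has two of them strictly on opposite sides, and the vertex sets of the
-- components are the maximal such sets.
record IsSubgon {N : ℕ} (D : ChordSet N) (S : Subset N) : Set where
  field
    unseparated : ∀ {s t a b} → s ∈ S → t ∈ S → a ─ b ∈ᶜ D → ¬ Crosses a b s t
    maximal     : ∀ {v} → (∀ {s a b} → s ∈ S → a ─ b ∈ᶜ D → ¬ Crosses a b v s) → v ∈ S

-- Every subgon of the (n+2)-gon has between 3 and n+2 vertices, so the counts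
-- below account for all of them.
record 𝒜 {n : ℕ} (μ : Vec ℕ n) (D : ChordSet (2 + n)) : Set where
  field
    dissection : IsDissection D
    type       : ∀ (i : Fin n) →
                 HasCard (λ S → IsSubgon D S × ∣ S ∣ ≡ toℕ i + 3) (lookup μ i)

{-# OPTIONS --safe #-}
module Submission where

-- Choose a subgon or an edge as root, direct every other diagonal so that the root lies on
-- its right, and lift the polygon to the line of all integers: a dissection becomes a
-- periodic noncrossing family of arcs.  Listing at each vertex, in order of length, the
-- sizes of the subgons directly under the arcs that start there turns such a family into a
-- word.  The word determines the family, because the arcs are the first passages of the
-- height "vertices minus sizes read so far".
--
-- Let d be the order of ω = ζ^j and N = n + 2 = d M.  If d ≥ 2, a dissection fixed by σ^j
-- has a central subgon or diagonal, which serves as root; the words are the arrangements of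
-- the parts μᵢ / d around M vertices, so their number is a multinomial coefficient, and
-- there are none unless at most one μᵢ is not divisible by d, with remainder 1.  If d = 1,
-- the root is a side and the words are ballot sequences.
--
-- On the other side, a_μ(q) = [n+k]! / ([n+1]! ∏ [μᵢ]!) is a polynomial.  A factorial
-- [c d + e]! is the product of [d]^c, which vanishes at ω for c > 0, and a cofactor whose
-- value at ω is ([d-1]!)^c c! [e]!.  The powers of [d] cancel in ℤ[q], and what remains is 0
-- or the same multinomial coefficient.

-- On the circle an arc has no inside and a first passage has no start. On the line both are clear,
-- rotation by M steps becomes translation by M, and a dissection fixed by it is one whose word has
-- period M. Hence d ≥ 2 needs no further condition: one period may be filled freely. With d = 1 a
-- particular side is the root, and asking that its arc be a first passage is exactly the ballot
-- condition. The recurring constant r is the number of vertices per period that lie under no arc,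
-- which is N minus the sizes of one period. It is the number of vertices of the root: 2 for a side
-- or a central diagonal, at least 3 for a central subgon. Heights rise by r per period, so r > 0
-- makes every needed level reached, and r ≥ 2 keeps arcs shorter than N. At ω the numerator and the
-- denominator may both vanish, so an equation between values cannot be divided; but [d] has
-- constant term 1 and can be cancelled between polynomials before evaluation. The exponent of [d]
-- left over is positive exactly when the remainders of the μᵢ modulo d add up to 2 or more, which
-- is when no dissection is fixed.

-- Linear arithmetic over ℕ with explicit certificates

module Linear where
  open import Algebra.Properties.CommutativeSemigroup using (interchange)
  open import Data.Bool.Base using (Bool; true; _∧_; T)
  open import Data.Bool.Properties using (T-∧)
  open import Data.Empty using (⊥)
  open import Data.Fin.Base using (Fin)
  open import Data.List.Base using (List; []; _∷_; _++_)
  open import Data.List.Relation.Unary.All using (All; []; _∷_)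
  open import Data.List.Relation.Unary.All.Properties using (++⁺)
  open import Data.Nat.Base
  open import Data.Nat.Properties
  open import Data.Product.Base using (_×_; _,_; proj₁; proj₂)
  open import Data.Vec.Base as Vec using (Vec; []; _∷_; lookup; zipWith; allFin)
  open import Data.Vec.N-ary using (N-ary; _$ⁿ_; ∀ⁿ; curryⁿ)
  open import Function.Base using (_∘_)
  open import Function.Bundles using (Equivalence)
  open import Relation.Binary.PropositionalEquality

  infixl 6 _⊕_
  infix  4 _≼_ _≺_ _≂_
  infixr 3 _⇒_
  infix  3 ⊢_

  data Expr (n : ℕ) : Set where
    var : Fin n → Expr n
    #_  : ℕ → Expr n
    _⊕_ : Expr n → Expr n → Expr n

  data Atom (n : ℕ) : Set where
    _≼_ _≺_ _≂_ : Expr n → Expr n → Atom n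

  data Form (n : ℕ) : Set where
    _⇒_ : Atom n → Form n → Form n
    ⊢_  : Atom n → Form n
    ⊢⊥  : Form n

  ⟦_⟧ₑ : ∀ {n} → Expr n → Vec ℕ n → ℕ
  ⟦ var i ⟧ₑ ρ = lookup ρ i
  ⟦ # c   ⟧ₑ ρ = c
  ⟦ e ⊕ f ⟧ₑ ρ = ⟦ e ⟧ₑ ρ + ⟦ f ⟧ₑ ρ

  ⟦_⟧ₐ : ∀ {n} → Atom n → Vec ℕ n → Set
  ⟦ e ≼ f ⟧ₐ ρ = ⟦ e ⟧ₑ ρ ≤ ⟦ f ⟧ₑ ρ
  ⟦ e ≺ f ⟧ₐ ρ = ⟦ e ⟧ₑ ρ < ⟦ f ⟧ₑ ρ
  ⟦ e ≂ f ⟧ₐ ρ = ⟦ e ⟧ₑ ρ ≡ ⟦ f ⟧ₑ ρ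

  ⟦_⟧ : ∀ {n} → Form n → Vec ℕ n → Set
  ⟦ a ⇒ f ⟧ ρ = ⟦ a ⟧ₐ ρ → ⟦ f ⟧ ρ
  ⟦ ⊢ a ⟧   ρ = ⟦ a ⟧ₐ ρ
  ⟦ ⊢⊥ ⟧    ρ = ⊥

  Linear : ℕ → Set
  Linear n = ℕ × Vec ℕ n

  value : ∀ {n} → Linear n → Vec ℕ n → ℕ
  value (c , cs) ρ = c + Vec.sum (zipWith _*_ cs ρ)

  private
    infixl 6 _∔_
    _∔_ : ∀ {n} → Linear n → Linear n → Linear n
    (c , cs) ∔ (d , ds) = c + d , zipWith _+_ cs ds

    scale : ∀ {n} → ℕ → Linear n → Linear n
    scale k (c , cs) = k * c , Vec.map (k *_) cs

    swap₄ : ∀ a b c d → (a + b) + (c + d) ≡ (a + c) + (b + d)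
    swap₄ = interchange +-commutativeSemigroup

    zero-sum : ∀ {n} (ρ : Vec ℕ n) → Vec.sum (zipWith _*_ (Vec.replicate n 0) ρ) ≡ 0
    zero-sum []      = refl
    zero-sum (_ ∷ ρ) = zero-sum ρ

    add-sum : ∀ {n} (cs ds ρ : Vec ℕ n) → Vec.sum (zipWith _*_ (zipWith _+_ cs ds) ρ) ≡
              Vec.sum (zipWith _*_ cs ρ) + Vec.sum (zipWith _*_ ds ρ)
    add-sum []       []       []      = refl
    add-sum (c ∷ cs) (d ∷ ds) (x ∷ ρ) = trans (cong₂ _+_ (*-distribʳ-+ x c d) (add-sum cs ds ρ))
      (swap₄ (c * x) (d * x) _ _)

    scale-sum : ∀ {n} k (cs ρ : Vec ℕ n) → Vec.sum (zipWith _*_ (Vec.map (k *_) cs) ρ) ≡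
                k * Vec.sum (zipWith _*_ cs ρ)
    scale-sum k []       []      = sym (*-zeroʳ k)
    scale-sum k (c ∷ cs) (x ∷ ρ) = trans (cong₂ _+_ (*-assoc k c x) (scale-sum k cs ρ))
      (sym (*-distribˡ-+ k (c * x) _))

    value-∔ : ∀ {n} (l r : Linear n) ρ → value (l ∔ r) ρ ≡ value l ρ + value r ρ
    value-∔ (c , cs) (d , ds) ρ = trans (cong (c + d +_) (add-sum cs ds ρ)) (swap₄ c d _ _)

    value-scale : ∀ {n} k (l : Linear n) ρ → value (scale k l) ρ ≡ k * value l ρ
    value-scale k (c , cs) ρ = trans (cong (k * c +_) (scale-sum k cs ρ)) (sym (*-distribˡ-+ k c _))

    unit : ∀ {n} → Fin n → Vec ℕ n
    unit Fin.zero    = 1 ∷ Vec.replicate _ 0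
    unit (Fin.suc i) = 0 ∷ unit i

    unit-sum : ∀ {n} (i : Fin n) ρ → Vec.sum (zipWith _*_ (unit i) ρ) ≡ lookup ρ i
    unit-sum Fin.zero    (x ∷ ρ) = trans (cong₂ _+_ (*-identityˡ x) (zero-sum ρ)) (+-identityʳ x)
    unit-sum (Fin.suc i) (x ∷ ρ) = unit-sum i ρ

    linear : ∀ {n} → Expr n → Linear n
    linear (var i) = 0 , unit i
    linear (# c)   = c , Vec.replicate _ 0
    linear (e ⊕ f) = linear e ∔ linear f

    linear-correct : ∀ {n} (e : Expr n) ρ → value (linear e) ρ ≡ ⟦ e ⟧ₑ ρ
    linear-correct (var i) ρ = unit-sum i ρ
    linear-correct (# c)   ρ = trans (cong (c +_) (zero-sum ρ)) (+-identityʳ c)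
    linear-correct (e ⊕ f) ρ =
      trans (value-∔ (linear e) (linear f) ρ) (cong₂ _+_ (linear-correct e ρ) (linear-correct f ρ))

    Constraint : ℕ → Set
    Constraint n = Linear n × Linear n

    Holds : ∀ {n} → Vec ℕ n → Constraint n → Set
    Holds ρ (l , r) = value l ρ ≤ value r ρ

    combine : ∀ {n} → List ℕ → List (Constraint n) → Constraint n
    combine (k ∷ ks) ((l , r) ∷ cs) with combine ks cs
    ... | l′ , r′ = scale k l ∔ l′ , scale k r ∔ r′
    -- Missing multipliers count as 0, so a certificate may stop early.
    combine _ _ = (0 , Vec.replicate _ 0) , (0 , Vec.replicate _ 0)

    combine-holds : ∀ {n} ks {cs : List (Constraint n)} {ρ} → All (Holds ρ) cs → Holds ρ (combine ks cs)
    combine-holds (k ∷ ks) {(l , r) ∷ cs} {ρ} (h ∷ hs) = subst₂ _≤_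
      (sym (trans (value-∔ (scale k l) (proj₁ (combine ks cs)) ρ)
        (cong (_+ value (proj₁ (combine ks cs)) ρ) (value-scale k l ρ))))
      (sym (trans (value-∔ (scale k r) (proj₂ (combine ks cs)) ρ)
        (cong (_+ value (proj₂ (combine ks cs)) ρ) (value-scale k r ρ))))
      (+-mono-≤ (*-monoʳ-≤ k h) (combine-holds ks hs))
    combine-holds []       _  = ≤-refl
    combine-holds (_ ∷ ks) [] = ≤-refl

    dominates : ∀ {n} → Vec ℕ n → Vec ℕ n → Bool
    dominates []       []       = true
    dominates (c ∷ cs) (d ∷ ds) = (d ≤ᵇ c) ∧ dominates cs ds

    dominates-sum : ∀ {n} (cs ds ρ : Vec ℕ n) → T (dominates cs ds) →
                    Vec.sum (zipWith _*_ ds ρ) ≤ Vec.sum (zipWith _*_ cs ρ)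
    dominates-sum []       []       []      _ = z≤n
    dominates-sum (c ∷ cs) (d ∷ ds) (x ∷ ρ) t with Equivalence.to (T-∧ {d ≤ᵇ c}) t
    ... | p , q = +-mono-≤ (*-monoˡ-≤ x (≤ᵇ⇒≤ d c p)) (dominates-sum cs ds ρ q)

    -- Variables range over ℕ, so an inequality is absurd as soon as its left side has the larger
    -- constant and no smaller coefficient.
    contradictory : ∀ {n} → Constraint n → Bool
    contradictory ((c , cs) , (d , ds)) = (suc d ≤ᵇ c) ∧ dominates cs ds

    contradiction : ∀ {n} (c : Constraint n) ρ → T (contradictory c) → Holds ρ c → ⊥
    contradiction ((c , cs) , (d , ds)) ρ t h with Equivalence.to (T-∧ {suc d ≤ᵇ c}) t
    ... | p , q = ≤⇒≯ h (+-mono-<-≤ (≤ᵇ⇒≤ (suc d) c p) (dominates-sum cs ds ρ q))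

    1+ : ∀ {n} → Linear n → Linear n
    1+ (c , cs) = suc c , cs

    constraints : ∀ {n} → Atom n → List (Constraint n)
    constraints (e ≼ f) = (linear e , linear f) ∷ []
    constraints (e ≺ f) = (1+ (linear e) , linear f) ∷ []
    constraints (e ≂ f) = (linear e , linear f) ∷ (linear f , linear e) ∷ []

    to-linear : ∀ {n} (e f : Expr n) {ρ} → ⟦ e ⟧ₑ ρ ≤ ⟦ f ⟧ₑ ρ → Holds ρ (linear e , linear f)
    to-linear e f {ρ} = subst₂ _≤_ (sym (linear-correct e ρ)) (sym (linear-correct f ρ))

    constraints-hold : ∀ {n} (a : Atom n) {ρ} → ⟦ a ⟧ₐ ρ → All (Holds ρ) (constraints a)
    constraints-hold (e ≼ f) h = to-linear e f h ∷ []
    constraints-hold (e ≺ f) {ρ} h =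
      subst₂ _<_ (sym (linear-correct e ρ)) (sym (linear-correct f ρ)) h ∷ []
    constraints-hold (e ≂ f) h = to-linear e f (≤-reflexive h) ∷ to-linear f e (≤-reflexive (sym h)) ∷ []

    refutes : ∀ {n} → List (Constraint n) → List ℕ → Bool
    refutes cs ks = contradictory (combine ks cs)

    refuted : ∀ {n} {cs : List (Constraint n)} {ρ} ks → T (refutes cs ks) → All (Holds ρ) cs → ⊥
    refuted {cs = cs} {ρ} ks t hs = contradiction (combine ks cs) ρ t (combine-holds ks hs)

    entails : ∀ {n} → List (Constraint n) → Atom n → List ℕ → List ℕ → Bool
    entails cs (e ≼ f) ks _  = refutes (constraints (f ≺ e) ++ cs) ks
    entails cs (e ≺ f) ks _  = refutes (constraints (f ≼ e) ++ cs) ks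
    entails cs (e ≂ f) ks ls = entails cs (e ≼ f) ks [] ∧ entails cs (f ≼ e) ls []

    entailed : ∀ {n} {cs : List (Constraint n)} {ρ} (a : Atom n) ks ls →
               T (entails cs a ks ls) → All (Holds ρ) cs → ⟦ a ⟧ₐ ρ
    entailed (e ≼ f) ks ls t hs = ≮⇒≥ λ h → refuted ks t (++⁺ (constraints-hold (f ≺ e) h) hs)
    entailed (e ≺ f) ks ls t hs = ≰⇒> λ h → refuted ks t (++⁺ (constraints-hold (f ≼ e) h) hs)
    entailed {cs = cs} (e ≂ f) ks ls t hs with Equivalence.to (T-∧ {entails cs (e ≼ f) ks []}) t
    ... | p , q = ≤-antisym (entailed (e ≼ f) ks [] p hs) (entailed (f ≼ e) ls [] q hs)

  valid : ∀ {n} → List (Constraint n) → Form n → List ℕ → List ℕ → Bool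
  valid cs (a ⇒ f) ks ls = valid (constraints a ++ cs) f ks ls
  valid cs (⊢ a)   ks ls = entails cs a ks ls
  valid cs ⊢⊥      ks ls = refutes cs ks

  lia-sound : ∀ {n} {cs : List (Constraint n)} {ρ} f ks ls →
          T (valid cs f ks ls) → All (Holds ρ) cs → ⟦ f ⟧ ρ
  lia-sound (a ⇒ f) ks ls t hs h = lia-sound f ks ls t (++⁺ (constraints-hold a h) hs)
  lia-sound (⊢ a)   ks ls t hs   = entailed a ks ls t hs
  lia-sound ⊢⊥      ks ls t hs   = refuted ks t hs

  private
    ∀ⁿ-curry : ∀ n {P : Vec ℕ n → Set} → (∀ ρ → P ρ) → ∀ⁿ n (curryⁿ P)
    ∀ⁿ-curry zero    h   = h []
    ∀ⁿ-curry (suc n) h x = ∀ⁿ-curry n (h ∘ (x ∷_))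

  close : ∀ n → N-ary n (Expr n) (Form n) → Form n
  close n f = f $ⁿ Vec.map var (allFin n)

  abstract
    -- The constraints are the two-sided inequalities of the hypotheses, last
    -- hypothesis first, preceded by the negated conclusion; ks are multipliers for
    -- which they add up to an absurdity (Farkas), ls those for the second inequality
    -- of a conclusion that is an equation.
    lia : ∀ n (f : N-ary n (Expr n) (Form n)) (ks ls : List ℕ) →
          {T (valid [] (close n f) ks ls)} → ∀ⁿ n (curryⁿ ⟦ close n f ⟧)
    lia n f ks ls {t} = ∀ⁿ-curry n λ ρ → lia-sound {ρ = ρ} (close n f) ks ls t []

-- Finite sums, sums over periods, indicators

module Sums where
  open import Algebra.Properties.CommutativeSemigroup using (interchange)
  open import Data.List.Base using ([]; _∷_)
  open import Data.Nat.Base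
  open import Data.Nat.Properties
  open import Data.Product.Base using (∃-syntax; _×_; _,_; proj₁; proj₂)
  open import Data.Sum.Base using (inj₁; inj₂)
  open import Data.Vec.Base using (Vec; []; _∷_)
  open import Function.Base using (_∘_)
  open import Relation.Binary.PropositionalEquality
  open import Relation.Nullary.Decidable.Core using (Dec; yes; no)
  open import Relation.Nullary.Negation using (¬_; contradiction)

  open Linear

  offset : ∀ {m n} → m ≤ n → ∃[ k ] n ≡ m + k
  offset {m} {n} m≤n = n ∸ m , sym (m+[n∸m]≡n m≤n)

  Σ< : ℕ → (ℕ → ℕ) → ℕ
  Σ< zero    f = 0
  Σ< (suc n) f = Σ< n f + f n

  Periodic : ∀ {A : Set} → ℕ → (ℕ → A) → Set
  Periodic p f = ∀ i → f (p + i) ≡ f i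

  Σ-cong : ∀ n {f g} → (∀ i → i < n → f i ≡ g i) → Σ< n f ≡ Σ< n g
  Σ-cong zero    h = refl
  Σ-cong (suc n) h = cong₂ _+_ (Σ-cong n λ i i<n → h i (m<n⇒m<1+n i<n)) (h n ≤-refl)

  Σ-ext : ∀ n {f g} → (∀ i → f i ≡ g i) → Σ< n f ≡ Σ< n g
  Σ-ext n h = Σ-cong n λ i _ → h i

  Σ-+ : ∀ n f g → Σ< n (λ i → f i + g i) ≡ Σ< n f + Σ< n g
  Σ-+ zero    f g = refl
  Σ-+ (suc n) f g = trans (cong (_+ (f n + g n)) (Σ-+ n f g))
    (interchange +-commutativeSemigroup (Σ< n f) _ _ _)

  Σ-0 : ∀ n → Σ< n (λ _ → 0) ≡ 0
  Σ-0 zero    = refl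
  Σ-0 (suc n) = trans (+-identityʳ _) (Σ-0 n)

  Σ-zero : ∀ n {f} → (∀ i → i < n → f i ≡ 0) → Σ< n f ≡ 0
  Σ-zero n h = trans (Σ-cong n h) (Σ-0 n)

  Σ-1 : ∀ n → Σ< n (λ _ → 1) ≡ n
  Σ-1 zero    = refl
  Σ-1 (suc n) = trans (+-comm _ 1) (cong suc (Σ-1 n))

  Σ-mono : ∀ n {f g} → (∀ i → i < n → f i ≤ g i) → Σ< n f ≤ Σ< n g
  Σ-mono zero    h = z≤n
  Σ-mono (suc n) h = +-mono-≤ (Σ-mono n λ i i<n → h i (m<n⇒m<1+n i<n)) (h n ≤-refl)

  Σ-≤ : ∀ n i f → i < n → f i ≤ Σ< n f
  Σ-≤ (suc n) i f i<1+n with i ≟ n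
  ... | yes refl = m≤n+m (f n) _
  ... | no i≢n   = ≤-trans (Σ-≤ n i f (≤∧≢⇒< (≤-pred i<1+n) i≢n)) (m≤m+n _ (f n))

  Σ-swap : ∀ m n (f : ℕ → ℕ → ℕ) → Σ< m (λ i → Σ< n (f i)) ≡ Σ< n (λ j → Σ< m (λ i → f i j))
  Σ-swap zero    n f = sym (Σ-0 n)
  Σ-swap (suc m) n f = trans (cong (_+ Σ< n (f m)) (Σ-swap m n f))
    (sym (Σ-+ n (λ j → Σ< m (λ i → f i j)) (f m)))

  Σ-split : ∀ m n f → Σ< (m + n) f ≡ Σ< m f + Σ< n (λ i → f (m + i))
  Σ-split m zero    f = trans (cong (λ k → Σ< k f) (+-identityʳ m)) (sym (+-identityʳ _))
  Σ-split m (suc n) f = trans (cong (λ k → Σ< k f) (+-suc m n))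
    (trans (cong (_+ f (m + n)) (Σ-split m n f)) (+-assoc (Σ< m f) _ _))

  Σ-extend : ∀ {m n} f → m ≤ n → (∀ i → m ≤ i → f i ≡ 0) → Σ< n f ≡ Σ< m f
  Σ-extend {m} {n} f m≤n h = trans (cong (λ k → Σ< k f) (sym (m+[n∸m]≡n m≤n)))
    (trans (Σ-split m (n ∸ m) f)
      (trans (cong (Σ< m f +_) (Σ-zero (n ∸ m) λ i _ → h (m + i) (m≤m+n m i))) (+-identityʳ _)))

  Σ-single : ∀ n k f → k < n → (∀ i → i < n → i ≢ k → f i ≡ 0) → Σ< n f ≡ f k
  Σ-single (suc n) k f k<1+n h with k ≟ n
  ... | yes refl = cong (_+ f k) (Σ-zero n λ i i<n → h i (m<n⇒m<1+n i<n) (<⇒≢ i<n))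
  ... | no k≢n   = trans (cong₂ _+_ (Σ-single n k f (≤∧≢⇒< (≤-pred k<1+n) k≢n) λ i i<n → h i (m<n⇒m<1+n i<n))
                                    (h n ≤-refl (k≢n ∘ sym)))
                         (+-identityʳ _)

  -- Moving the window by one loses f u and gains f (u + p), which has the same value.
  Σ-window : ∀ p f → Periodic p f → ∀ u → Σ< p (λ t → f (u + t)) ≡ Σ< p f
  Σ-window p f per zero    = refl
  Σ-window p f per (suc u) = trans (step u) (Σ-window p f per u)
    where
    step : ∀ u → Σ< p (λ t → f (suc u + t)) ≡ Σ< p (λ t → f (u + t))
    step u = +-cancelʳ-≡ (f u) _ _ (begin
      Σ< p (λ t → f (suc u + t)) + f u       ≡⟨ +-comm _ (f u) ⟩
      f u + Σ< p (λ t → f (suc u + t))       ≡⟨ cong₂ _+_ (cong f (sym (+-identityʳ u))) (Σ-ext p λ t → cong f (sym (+-suc u t))) ⟩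
      f (u + 0) + Σ< p (λ t → f (u + suc t)) ≡⟨ Σ-split 1 p (λ t → f (u + t)) ⟨
      Σ< p (λ t → f (u + t)) + f (u + p)     ≡⟨ cong (Σ< p (λ t → f (u + t)) +_) (trans (cong f (+-comm u p)) (per u)) ⟩
      Σ< p (λ t → f (u + t)) + f u           ∎)
      where open ≡-Reasoning

  periodic-* : ∀ {A : Set} {p} {f : ℕ → A} → Periodic p f → ∀ k → Periodic (k * p) f
  periodic-* per zero    i = refl
  periodic-* {p = p} {f} per (suc k) i =
    trans (cong f (+-assoc p (k * p) i)) (trans (per (k * p + i)) (periodic-* per k i))

  Σ-periods : ∀ d p f → Periodic p f → Σ< (d * p) f ≡ d * Σ< p f
  Σ-periods zero    p f per = refl
  Σ-periods (suc d) p f per = trans (Σ-split p (d * p) f)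
    (cong (Σ< p f +_) (trans (Σ-ext (d * p) per) (Σ-periods d p f per)))

  𝟙 : ∀ {P : Set} → Dec P → ℕ
  𝟙 (yes _) = 1
  𝟙 (no _)  = 0

  𝟙-yes : ∀ {P : Set} (d : Dec P) → P → 𝟙 d ≡ 1
  𝟙-yes (yes _) p = refl
  𝟙-yes (no ¬p) p = contradiction p ¬p

  𝟙-no : ∀ {P : Set} (d : Dec P) → ¬ P → 𝟙 d ≡ 0
  𝟙-no (yes p) ¬p = contradiction p ¬p
  𝟙-no (no _)  ¬p = refl

  𝟙-cong : ∀ {P Q : Set} (d : Dec P) (e : Dec Q) → (P → Q) → (Q → P) → 𝟙 d ≡ 𝟙 e
  𝟙-cong (yes p) e f g = sym (𝟙-yes e (f p))
  𝟙-cong (no ¬p) e f g = sym (𝟙-no e (¬p ∘ g))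

  𝟙≤1 : ∀ {P : Set} (d : Dec P) → 𝟙 d ≤ 1
  𝟙≤1 (yes _) = ≤-refl
  𝟙≤1 (no _)  = z≤n

  Σ-support : ∀ m n f → (∀ i → m ≤ i → f i ≡ 0) → (∀ i → n ≤ i → f i ≡ 0) → Σ< m f ≡ Σ< n f
  Σ-support m n f h k with ≤-total m n
  ... | inj₁ m≤n = sym (Σ-extend f m≤n h)
  ... | inj₂ n≤m = Σ-extend f n≤m k

  least : ∀ {P : ℕ → Set} → (∀ i → Dec (P i)) → ∀ n → P n → ∃[ m ] m ≤ n × P m × (∀ i → i < m → ¬ P i)
  least P? n p = go P? n n ≤-refl p
    where
    go : ∀ {P : ℕ → Set} → (∀ i → Dec (P i)) → ∀ k n → n ≤ k → P n →
         ∃[ m ] m ≤ n × P m × (∀ i → i < m → ¬ P i)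
    go P? k n n≤k p with anyUpTo? P? n
    ... | no ¬q = n , ≤-refl , p , λ i i<n q → ¬q (i , i<n , q)
    go P? zero    n n≤k p | yes (i , i<n , q) = contradiction (≤-trans i<n n≤k) λ ()
    go P? (suc k) n n≤k p | yes (i , i<n , q) with go P? k i (≤-pred (≤-trans i<n n≤k)) q
    ... | m , m≤i , r , h = m , ≤-trans m≤i (<⇒≤ i<n) , r , h

  any-pair? : ∀ {R : ℕ → ℕ → Set} (R? : ∀ a b → Dec (R a b)) m n →
              Dec (∃[ a ] a < m × ∃[ b ] b < n × R a b)
  any-pair? R? m n = anyUpTo? (λ a → anyUpTo? (R? a) n) m

  module _ {R : ℕ → ℕ → Set} (R? : ∀ a b → Dec (R a b))
           (unique : ∀ {a b c d} → R a b → R c d → a ≡ c × b ≡ d) where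

    ΣΣ-hit : ∀ m n {a b} → a < m → b < n → R a b → Σ< m (λ i → Σ< n (λ j → 𝟙 (R? i j))) ≡ 1
    ΣΣ-hit m n {a} {b} a<m b<n r =
      trans (Σ-single m a _ a<m λ i _ i≢a → Σ-zero n λ j _ → 𝟙-no (R? i j) λ r′ → i≢a (proj₁ (unique r′ r)))
        (trans (Σ-single n b _ b<n λ j _ j≢b → 𝟙-no (R? a j) λ r′ → j≢b (proj₂ (unique r′ r)))
          (𝟙-yes (R? a b) r))

    ΣΣ-miss : ∀ m n → (∀ a b → a < m → b < n → ¬ R a b) → Σ< m (λ i → Σ< n (λ j → 𝟙 (R? i j))) ≡ 0
    ΣΣ-miss m n h = Σ-zero m λ i i<m → Σ-zero n λ j j<n → 𝟙-no (R? i j) (h i j i<m j<n)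

    ΣΣ≤1 : ∀ m n → Σ< m (λ i → Σ< n (λ j → 𝟙 (R? i j))) ≤ 1
    ΣΣ≤1 m n with any-pair? R? m n
    ... | yes (a , a<m , b , b<n , r) = ≤-reflexive (ΣΣ-hit m n a<m b<n r)
    ... | no ¬r = ≤-trans (≤-reflexive (ΣΣ-miss m n λ a b a<m b<n r → ¬r (a , a<m , b , b<n , r))) z≤n

  ∏! : ∀ {k} → Vec ℕ k → ℕ
  ∏! []      = 1
  ∏! (m ∷ μ) = m ! * ∏! μ

  ∏!≢0 : ∀ {k} (μ : Vec ℕ k) → NonZero (∏! μ)
  ∏!≢0 []      = _
  ∏!≢0 (m ∷ μ) = m*n≢0 (m !) (∏! μ) {{m !≢0}} {{∏!≢0 μ}}

-- Cardinalities of predicates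

module Card where
  open import Data.Empty using (⊥; ⊥-elim)
  open import Data.Fin.Base using (Fin; zero; suc)
  open import Data.List.Base using (List; []; _∷_; map; _++_)
  open import Data.List.Membership.Propositional using (_∈_)
  open import Data.List.Membership.Propositional.Properties
  open import Data.List.Membership.Propositional.Properties.WithK using (unique∧set⇒bag)
  open import Data.List.Properties using (length-++; length-map)
  open import Data.List.Relation.Binary.BagAndSetEquality using (∼bag⇒↭)
  open import Data.List.Relation.Binary.Permutation.Propositional.Properties using (↭-length)
  open import Data.List.Relation.Unary.All as All using (All; []; _∷_)
  open import Data.List.Relation.Unary.AllPairs using ([]; _∷_)
  open import Data.List.Relation.Unary.Any using (here; there)
  open import Data.List.Relation.Unary.Unique.Propositional using (Unique)
  open import Data.List.Relation.Unary.Unique.Propositional.Properties using (++⁺)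
  open import Data.Nat.Base
  open import Data.Nat.Properties
  open import Data.Product.Base using (∃-syntax; _×_; _,_; proj₁; proj₂)
  open import Data.Sum.Base using (_⊎_; inj₁; inj₂; [_,_]′)
  open import Function.Base using (_∘_)
  open import Function.Bundles using (_⇔_; mk⇔; Equivalence)
  open import Relation.Binary.PropositionalEquality
  open import Relation.Nullary.Decidable.Core using (Dec; yes; no)
  open import Relation.Nullary.Negation using (¬_)
  open import Relation.Unary using (Pred)

  open import Defs using (HasCard)
  open Sums

  open Equivalence using (to; from)

  module _ {a} {A : Set a} where

    -- Two duplicate-free lists with the same members are permutations of each other.
    card-unique : ∀ {p q} {P : Pred A p} {Q : Pred A q} {m n} → (∀ x → P x ⇔ Q x) →
                  HasCard P m → HasCard Q n → m ≡ n
    card-unique e (xs , u , h , refl) (ys , v , k , refl) = ↭-length (∼bag⇒↭ (unique∧set⇒bag u v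
      (λ {x} → mk⇔ (from (k x) ∘ to (e x) ∘ to (h x)) (from (h x) ∘ from (e x) ∘ to (k x)))))

    card-⇔ : ∀ {p q} {P : Pred A p} {Q : Pred A q} {m} → (∀ x → P x ⇔ Q x) → HasCard P m → HasCard Q m
    card-⇔ e (xs , u , h , l) =
      xs , u , (λ x → mk⇔ (to (e x) ∘ to (h x)) (from (h x) ∘ from (e x))) , l

    card-∅ : ∀ {p} {P : Pred A p} → (∀ x → ¬ P x) → HasCard P 0
    card-∅ h = [] , [] , (λ x → mk⇔ (λ ()) (⊥-elim ∘ h x)) , refl

    card-singleton : ∀ {p} {P : Pred A p} x → P x → (∀ {y} → P y → y ≡ x) → HasCard P 1
    card-singleton {P = P} x p h = x ∷ [] , [] ∷ [] ,
      (λ y → mk⇔ (λ { (here e) → subst P (sym e) p ; (there ()) }) (here ∘ h)) , refl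

    card-⊎ : ∀ {p q} {P : Pred A p} {Q : Pred A q} {m n} → (∀ {x} → P x → ¬ Q x) →
             HasCard P m → HasCard Q n → HasCard (λ x → P x ⊎ Q x) (m + n)
    card-⊎ {P = P} {Q} disj (xs , u , h , refl) (ys , v , k , refl) =
      xs ++ ys , ++⁺ u v (λ {x} (i , j) → disj (to (h x) i) (to (k x) j)) ,
      (λ x → mk⇔ (λ i → [ inj₁ ∘ to (h x) , inj₂ ∘ to (k x) ]′ (∈-++⁻ xs i))
                 [ ∈-++⁺ˡ ∘ from (h x) , ∈-++⁺ʳ xs ∘ from (k x) ]′) ,
      length-++ xs

  unique-map : ∀ {a b} {A : Set a} {B : Set b} {xs : List A} (f : A → B) →
               (∀ {x y} → x ∈ xs → y ∈ xs → f x ≡ f y → x ≡ y) → Unique xs → Unique (map f xs)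
  unique-map f inj [] = []
  unique-map {xs = x ∷ xs} f inj (x∉xs ∷ u) =
    All.tabulate (λ {z} z∈ fx≡z → let (y , y∈ , z≡fy) = ∈-map⁻ f z∈ in
      All.lookup x∉xs y∈ (inj (here refl) (there y∈) (trans fx≡z z≡fy)))
    ∷ unique-map f (λ i j → inj (there i) (there j)) u

  card-image : ∀ {a b p q} {A : Set a} {B : Set b} {P : Pred A p} {Q : Pred B q} {m} (f : A → B) →
               (∀ {x y} → P x → P y → f x ≡ f y → x ≡ y) →
               (∀ {x} → P x → Q (f x)) → (∀ {y} → Q y → ∃[ x ] P x × f x ≡ y) →
               HasCard P m → HasCard Q m
  card-image {Q = Q} f inj sound complete (xs , u , h , refl) =
    map f xs ,
    unique-map f (λ {x} {y} i j → inj (to (h x) i) (to (h y) j)) u ,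
    (λ y → mk⇔ (λ i → let (x , x∈ , y≡fx) = ∈-map⁻ f i in subst Q (sym y≡fx) (sound (to (h x) x∈)))
               (λ q → let (x , p , fx≡y) = complete q in subst (_∈ map f xs) fx≡y (∈-map⁺ f (from (h x) p)))) ,
    length-map f xs

  ΣF : ∀ k → (Fin k → ℕ) → ℕ
  ΣF zero    f = 0
  ΣF (suc k) f = f zero + ΣF k (f ∘ suc)

  card-⋃ : ∀ {a p} {A : Set a} k {P : Fin k → Pred A p} {m : Fin k → ℕ} →
           (∀ {i j x} → P i x → P j x → i ≡ j) → (∀ i → HasCard (P i) (m i)) →
           HasCard (λ x → ∃[ i ] P i x) (ΣF k m)
  card-⋃ zero    disj h = card-∅ λ { _ (() , _) }
  card-⋃ (suc k) {P} disj h = card-⇔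
    (λ x → mk⇔ [ (zero ,_) , (λ (i , p) → suc i , p) ]′ λ { (zero , p) → inj₁ p ; (suc i , p) → inj₂ (i , p) })
    (card-⊎ (λ p (i , q) → case-zero (disj p q)) (h zero)
      (card-⋃ k (λ p q → suc-inj (disj p q)) (h ∘ suc)))
    where
    case-zero : ∀ {i : Fin k} → zero ≡ Fin.suc i → ⊥
    case-zero ()
    suc-inj : ∀ {i j : Fin k} → Fin.suc i ≡ suc j → i ≡ j
    suc-inj refl = refl

  card-< : ∀ n {P : ℕ → Set} (P? : ∀ i → Dec (P i)) →
           HasCard (λ i → i < n × P i) (Σ< n (λ i → 𝟙 (P? i)))
  card-< zero    P? = card-∅ λ { _ (() , _) }
  card-< (suc n) {P} P? = card-⇔
    (λ i → mk⇔ [ (λ (i<n , p) → m<n⇒m<1+n i<n , p) , (λ { (refl , p) → ≤-refl , p }) ]′ back)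
    (card-⊎ (λ { (n<n , _) (refl , _) → <-irrefl refl n<n }) (card-< n P?) (last (P? n)))
    where
    back : ∀ {i} → i < suc n × P i → (i < n × P i) ⊎ (i ≡ n × P i)
    back {i} (i<1+n , p) with i ≟ n
    ... | yes i≡n = inj₂ (i≡n , p)
    ... | no i≢n  = inj₁ (≤∧≢⇒< (≤-pred i<1+n) i≢n , p)
    last : (d : Dec (P n)) → HasCard (λ i → i ≡ n × P i) (𝟙 d)
    last (yes p) = card-singleton n (refl , p) proj₁
    last (no ¬p) = card-∅ λ { _ (refl , p) → ¬p p }

  card-<< : ∀ m n {P : ℕ → ℕ → Set} (P? : ∀ i j → Dec (P i j)) →
            HasCard {A = ℕ × ℕ} (λ (i , j) → i < m × j < n × P i j) (Σ< m (λ i → Σ< n (λ j → 𝟙 (P? i j))))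
  card-<< zero    n P? = card-∅ λ { _ (() , _) }
  card-<< (suc m) n {P} P? = card-⇔
    (λ (i , j) → mk⇔ [ (λ (i<m , q) → m<n⇒m<1+n i<m , q) , (λ { (refl , q) → ≤-refl , q }) ]′ back)
    (card-⊎ (λ { (m<m , _) (refl , _) → <-irrefl refl m<m }) (card-<< m n P?)
      (card-image (m ,_) (λ _ _ e → cong proj₂ e) (refl ,_) (λ { {i , j} (refl , q) → j , q , refl })
        (card-< n (P? m))))
    where
    back : ∀ {i j} → i < suc m × j < n × P i j → (i < m × j < n × P i j) ⊎ (i ≡ m × j < n × P i j)
    back {i} (i<1+m , q) with i ≟ m
    ... | yes i≡m = inj₂ (i≡m , q)
    ... | no i≢m  = inj₁ (≤∧≢⇒< (≤-pred i<1+m) i≢m , q)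

-- Noncrossing families of arcs on the line

module Arcs where
  open import Data.Bool.Base using (Bool; true; false; if_then_else_)
  import Data.Bool.Properties as Bool
  open import Data.Empty using (⊥; ⊥-elim)
  open import Data.List.Base using (List; []; _∷_; _++_)
  open import Data.List.Properties using (++-identityʳ)
  open import Data.Nat.Base
  open import Data.Nat.ListAction using (sum)
  open import Data.Nat.ListAction.Properties using (sum-++)
  open import Data.Nat.Properties
  open import Data.Product.Base using (∃-syntax; _×_; _,_; proj₁; proj₂)
  open import Data.Sum.Base using (inj₁; inj₂)
  open import Function.Base using (_∘_)
  open import Relation.Binary.Definitions using (tri<; tri≈; tri>)
  open import Relation.Binary.PropositionalEquality
  open import Relation.Nullary.Decidable.Core using (Dec; yes; no; _×-dec_; ¬?)
  open import Relation.Nullary.Negation using (¬_; contradiction)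

  open Linear
  open Sums

  Arcs : Set
  Arcs = ℕ → ℕ → Bool

  Arc : Arcs → ℕ → ℕ → Set
  Arc E a b = E a b ≡ true

  -- An arc is a chord directed so that the root is not under it, and lifted to the line. Lengths up
  -- to N - 1 are allowed because the root side itself becomes an arc of length N - 1 when there is
  -- no symmetry.
  record Family (N : ℕ) (E : Arcs) : Set where
    field
      long     : ∀ {a b} → Arc E a b → 2 + a ≤ b
      short    : ∀ {a b} → Arc E a b → b < N + a
      periodic : ∀ a b → E (N + a) (N + b) ≡ E a b
      nested   : ∀ {a b c d} → Arc E a b → Arc E c d → a < c → c < b → d ≤ b

  -- The vertex x belongs to the subgon directly under the arc. Only arcs inside [a , b] compete,
  -- which keeps the condition decidable without any assumption on `E`; for a family `nested`
  -- extends the comparison to all arcs.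
  record Own (E : Arcs) (a b x : ℕ) : Set where
    field
      arc      : Arc E a b
      left     : a < x
      right    : x < b
      smallest : ∀ {c d} → Arc E c d → a ≤ c → c < x → x < d → d ≤ b → c ≡ a × d ≡ b

  module _ (E : Arcs) where

    arc? : ∀ a b → Dec (Arc E a b)
    arc? a b = E a b Bool.≟ true

    private
      Smaller : ℕ → ℕ → ℕ → ℕ → ℕ → Set
      Smaller a b x c d = Arc E c d × a ≤ c × x < d × ¬ (c ≡ a × d ≡ b)

      smaller? : ∀ a b x → Dec (∃[ c ] c < x × ∃[ d ] d < suc b × Smaller a b x c d)
      smaller? a b x = any-pair?
        (λ c d → arc? c d ×-dec (a ≤? c) ×-dec (x <? d) ×-dec ¬? (c ≟ a ×-dec d ≟ b)) x (suc b)

      own : ∀ {a b x} → Arc E a b → a < x → x < b →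
            ¬ (∃[ c ] c < x × ∃[ d ] d < suc b × Smaller a b x c d) → Own E a b x
      own {a} {b} e a<x x<b none = record
        { arc = e ; left = a<x ; right = x<b ; smallest = smallest }
        where
        smallest : ∀ {c d} → Arc E c d → a ≤ c → c < _ → _ < d → d ≤ b → c ≡ a × d ≡ b
        smallest {c} {d} f a≤c c<x x<d d≤b with c ≟ a ×-dec d ≟ b
        ... | yes eq = eq
        ... | no neq = ⊥-elim (none (c , c<x , d , s≤s d≤b , f , a≤c , x<d , neq))

    abstract
      own? : ∀ a b x → Dec (Own E a b x)
      own? a b x with arc? a b ×-dec (a <? x) ×-dec (x <? b)
      ... | no ¬p = no λ o → ¬p (Own.arc o , Own.left o , Own.right o)
      ... | yes (e , a<x , x<b) with smaller? a b x
      ...   | no none = yes (own e a<x x<b none)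
      ...   | yes (c , c<x , d , s≤s d≤b , f , a≤c , x<d , neq) =
                no λ o → neq (Own.smallest o f a≤c c<x x<d d≤b)

    -- The number of vertices of the subgon under an arc, its two ends excluded.
    size : ℕ → ℕ → ℕ
    size a b = Σ< b λ x → 𝟙 (own? a b x)

    -- Appending keeps the arcs in order of their ends, so the initial segments of the list belong
    -- to the arcs that end before a given vertex.
    sizes : ℕ → ℕ → List ℕ
    sizes zero    a = []
    sizes (suc b) a = sizes b a ++ (if E a b then size a b ∷ [] else [])

    size-0 : ∀ a b → ¬ Arc E a b → size a b ≡ 0
    size-0 a b ¬e = Σ-zero b λ x _ → 𝟙-no (own? a b x) (¬e ∘ Own.arc)

    sum-sizes : ∀ B a → sum (sizes B a) ≡ Σ< B (size a)
    sum-sizes zero    a = refl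
    sum-sizes (suc b) a with E a b in eq
    ... | true  = trans (sum-++ (sizes b a) _) (cong₂ _+_ (sum-sizes b a) (+-identityʳ _))
    ... | false = trans (cong sum (++-identityʳ (sizes b a)))
      (trans (sum-sizes b a) (sym (trans (cong (Σ< b (size a) +_) (size-0 a b ¬arc)) (+-identityʳ _))))
      where
      ¬arc : ¬ Arc E a b
      ¬arc e with () ← trans (sym e) eq

    -- Pass to a smaller arc over x as long as there is one; k bounds the length and decreases.
    own-exists : ∀ {a b x} → Arc E a b → a < x → x < b → ∃[ c ] ∃[ d ] a ≤ c × d ≤ b × Own E c d x
    own-exists {a} {b} = go b a b (m≤n+m b a)
      where
      go : ∀ k a b {x} → b ≤ a + k → Arc E a b → a < x → x < b → ∃[ c ] ∃[ d ] a ≤ c × d ≤ b × Own E c d x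
      go zero a b {x} b≤a e a<x x<b =
        ⊥-elim (lia 3 (λ a b x → b ≼ a ⊕ # 0 ⇒ a ≺ x ⇒ x ≺ b ⇒ ⊢⊥) (1 ∷ 1 ∷ 1 ∷ []) [] a b x b≤a a<x x<b)
      go (suc k) a b {x} b≤ e a<x x<b with smaller? a b x
      ... | no none = a , b , ≤-refl , ≤-refl , own e a<x x<b none
      ... | yes (c , c<x , d , s≤s d≤b , f , a≤c , x<d , neq) =
        let (c′ , d′ , c≤c′ , d′≤d , o) = go k c d shorter f c<x x<d
        in c′ , d′ , ≤-trans a≤c c≤c′ , ≤-trans d′≤d d≤b , o
        where
        shorter : d ≤ c + k
        shorter with c ≟ a | d ≟ b
        ... | yes c≡a | yes d≡b = contradiction (c≡a , d≡b) neq
        ... | no c≢a | _ = lia 5 (λ a b c d k → b ≼ a ⊕ (# 1 ⊕ k) ⇒ a ≺ c ⇒ d ≼ b ⇒ ⊢ d ≼ c ⊕ k) (1 ∷ 1 ∷ 1 ∷ 1 ∷ []) []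
          a b c d k b≤ (≤∧≢⇒< a≤c (c≢a ∘ sym)) d≤b
        ... | yes refl | no d≢b = lia 4 (λ a b d k → b ≼ a ⊕ (# 1 ⊕ k) ⇒ d ≺ b ⇒ ⊢ d ≼ a ⊕ k) (1 ∷ 1 ∷ 1 ∷ []) []
          a b d k b≤ (≤∧≢⇒< d≤b d≢b)

  translate : ℕ → Arcs → Arcs
  translate k E a b = E (k + a) (k + b)

  own-translate : ∀ k {E a b x} → Own (translate k E) a b x → Own E (k + a) (k + b) (k + x)
  own-translate k {E} {a} {b} {x} o = record
    { arc = arc ; left = +-monoʳ-< k left ; right = +-monoʳ-< k right ; smallest = small }
    where
    open Own o
    small : ∀ {c d} → Arc E c d → k + a ≤ c → c < k + x → k + x < d → d ≤ k + b → c ≡ k + a × d ≡ k + b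
    small {c} {d} f ka≤c c<kx kx<d d≤kb
      with c′ , refl ← offset (≤-trans (m≤m+n k a) ka≤c)
      with d′ , refl ← offset (≤-trans (m≤m+n k x) (<⇒≤ kx<d))
      with smallest f (+-cancelˡ-≤ k _ _ ka≤c) (+-cancelˡ-< k _ _ c<kx) (+-cancelˡ-< k _ _ kx<d) (+-cancelˡ-≤ k _ _ d≤kb)
    ... | p , q = cong (k +_) p , cong (k +_) q

  own-untranslate : ∀ k {E a b x} → Own E (k + a) (k + b) (k + x) → Own (translate k E) a b x
  own-untranslate k o = record
    { arc = arc ; left = +-cancelˡ-< k _ _ left ; right = +-cancelˡ-< k _ _ right
    ; smallest = λ f a≤c c<x x<d d≤b →
        let (p , q) = smallest f (+-monoʳ-≤ k a≤c) (+-monoʳ-< k c<x) (+-monoʳ-< k x<d) (+-monoʳ-≤ k d≤b)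
        in +-cancelˡ-≡ k _ _ p , +-cancelˡ-≡ k _ _ q }
    where open Own o

  size-translate : ∀ k E a b → size (translate k E) a b ≡ size E (k + a) (k + b)
  size-translate k E a b = sym (trans (Σ-split k b _)
    (cong₂ _+_ (Σ-zero k λ x x<k → 𝟙-no (own? E _ _ x) λ o →
                 <⇒≱ (≤-trans (Own.left o) (<⇒≤ x<k)) (m≤m+n k a))
           (Σ-ext b λ x → 𝟙-cong (own? E _ _ (k + x)) (own? (translate k E) a b x)
             (own-untranslate k) (own-translate k))))

  module _ {E : Arcs} (proper : ∀ {a b} → Arc E a b → a < b) where

    sizes-[] : ∀ {B a} → B ≤ suc a → sizes E B a ≡ []
    sizes-[] {zero}          _      = refl
    sizes-[] {suc b} {a} (s≤s b≤a) with E a b in eq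
    ... | true  = contradiction b≤a (<⇒≱ (proper eq))
    ... | false = trans (++-identityʳ _) (sizes-[] (m≤n⇒m≤1+n b≤a))

    sizes-translate : ∀ k B a → sizes (translate k E) B a ≡ sizes E (k + B) (k + a)
    sizes-translate k zero    a = sym (sizes-[] (≤-trans (≤-reflexive (+-identityʳ k)) (m≤n⇒m≤1+n (m≤m+n k a))))
    sizes-translate k (suc b) a = trans
      (cong₂ (λ l n → l ++ (if E (k + a) (k + b) then n ∷ [] else [])) (sizes-translate k b a) (size-translate k E a b))
      (cong (λ B → sizes E B (k + a)) (sym (+-suc k b)))

  own-cong : ∀ {E F a b x} → (∀ a b → E a b ≡ F a b) → Own E a b x → Own F a b x
  own-cong E≗F o = record
    { arc = trans (sym (E≗F _ _)) arc ; left = left ; right = right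
    ; smallest = λ f → smallest (trans (E≗F _ _) f) }
    where open Own o

  sizes-cong : ∀ {E F} → (∀ a b → E a b ≡ F a b) → ∀ B a → sizes E B a ≡ sizes F B a
  sizes-cong E≗F zero    a = refl
  sizes-cong {E} {F} E≗F (suc b) a = cong₂ _++_ (sizes-cong E≗F b a)
    (cong₂ (λ e n → if e then n ∷ [] else []) (E≗F a b)
      (Σ-ext b λ x → 𝟙-cong (own? E a b x) (own? F a b x) (own-cong E≗F) (own-cong (λ a b → sym (E≗F a b)))))

  module FamilyProperties {N : ℕ} {E : Arcs} (family : Family N E) where
    open Family family public

    proper : ∀ {a b} → Arc E a b → a < b
    proper e = <⇒≤ (long e)

    word : ℕ → List ℕ
    word a = sizes E (N + a) a

    total : ℕ → ℕ
    total a = sum (word a)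

    -- If an arc from a ends at b, this is the partial sum of the word at a that belongs to it, and
    -- the level at which b turns out to be a first passage.
    upto : ℕ → ℕ → ℕ
    upto a b = sum (sizes E (suc b) a)

    word-periodic : ∀ p → (∀ a b → E (p + a) (p + b) ≡ E a b) → Periodic p word
    word-periodic p per a = begin
      sizes E (N + (p + a)) (p + a)   ≡⟨ cong (λ B → sizes E B (p + a)) (x∙yz≈y∙xz N p a) ⟩
      sizes E (p + (N + a)) (p + a)   ≡⟨ sizes-translate proper p (N + a) a ⟨
      sizes (translate p E) (N + a) a ≡⟨ sizes-cong per (N + a) a ⟩
      sizes E (N + a) a               ∎
      where
      open ≡-Reasoning
      open import Algebra.Properties.CommutativeSemigroup +-commutativeSemigroup using (x∙yz≈y∙xz)

    total≡Σ : ∀ a B → (∀ {b} → Arc E a b → b < B) → total a ≡ Σ< B (size E a)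
    total≡Σ a B bound = trans (sum-sizes E (N + a) a)
      (Σ-support (N + a) B (size E a)
        (λ b Na≤b → size-0 E a b λ e → <⇒≱ (short e) Na≤b)
        (λ b B≤b → size-0 E a b λ e → <⇒≱ (bound e) B≤b))

    -- If the starts differ, `nested` puts one arc inside the other, against `smallest` for the
    -- outer one. With equal starts the ends are compared directly.
    own-unique : ∀ {a b c d x} → Own E a b x → Own E c d x → a ≡ c × b ≡ d
    own-unique {a} {b} {c} {d} o o′ with <-cmp a c
    ... | tri< a<c _ _ = contradiction
      (proj₁ (O.smallest O′.arc (<⇒≤ a<c) O′.left O′.right (nested O.arc O′.arc a<c (<-trans O′.left O.right))))
      (<⇒≢ a<c ∘ sym)
      where
      module O = Own o
      module O′ = Own o′
    ... | tri> _ _ c<a = contradiction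
      (proj₁ (O′.smallest O.arc (<⇒≤ c<a) O.left O.right (nested O′.arc O.arc c<a (<-trans O.left O′.right))))
      (<⇒≢ c<a ∘ sym)
      where
      module O = Own o
      module O′ = Own o′
    ... | tri≈ _ refl _ with ≤-total b d
    ...   | inj₁ b≤d = refl , proj₂ (Own.smallest o′ (Own.arc o) ≤-refl (Own.left o) (Own.right o) b≤d)
    ...   | inj₂ d≤b = refl , sym (proj₂ (Own.smallest o (Own.arc o′) ≤-refl (Own.left o′) (Own.right o′) d≤b))

    -- Following the arcs from a outwards ends at a vertex directly under (a , b).
    directly-under : ∀ {a b} → Arc E a b → ∃[ x ] Own E a b x
    directly-under {a} {b} e = go (b ∸ suc a) (suc a) (lia 3 (λ b k a → # 1 ⊕ a ⊕ k ≂ b ⇒ ⊢ b ≼ # 1 ⊕ a ⊕ k) (1 ∷ 0 ∷ 1 ∷ []) [] b (b ∸ suc a) a (m+[n∸m]≡n (proper e)))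
      ≤-refl (long e) λ _ a≤c c<1+a _ _ → ≤-antisym (≤-pred c<1+a) a≤c
      where
      go : ∀ k x → b ≤ x + k → a < x → x < b →
           (∀ {c d} → Arc E c d → a ≤ c → c < x → x < d → d ≤ b → c ≡ a) → ∃[ x ] Own E a b x
      go k x b≤ a<x x<b from-a with own-exists E e a<x x<b
      ... | c , d , a≤c , d≤b , o with from-a (Own.arc o) a≤c (Own.left o) (Own.right o) d≤b | d ≟ b
      ...   | refl | yes refl = x , o
      go zero x b≤ a<x x<b from-a | c , d , a≤c , d≤b , o | refl | no d≢b =
        ⊥-elim (lia 2 (λ b x → b ≼ x ⊕ # 0 ⇒ x ≺ b ⇒ ⊢⊥) (1 ∷ 1 ∷ []) [] b x b≤ x<b)
      go (suc k) x b≤ a<x x<b from-a | c , d , a≤c , d≤b , o | refl | no d≢b =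
        go k d (lia 4 (λ b x d k → b ≼ x ⊕ (# 1 ⊕ k) ⇒ x ≺ d ⇒ ⊢ b ≼ d ⊕ k) (1 ∷ 1 ∷ 1 ∷ []) [] b x d k b≤ (Own.right o))
          (<-trans a<x (Own.right o)) (≤∧≢⇒< d≤b d≢b) from-a′
        where
        from-a′ : ∀ {c′ d′} → Arc E c′ d′ → c ≤ c′ → c′ < d → d < d′ → d′ ≤ b → c′ ≡ c
        from-a′ {c′} f c≤c′ c′<d d<d′ d′≤b with c′ ≟ c
        ... | yes c′≡c = c′≡c
        ... | no c′≢c = contradiction d<d′ (≤⇒≯ (nested (Own.arc o) f (≤∧≢⇒< c≤c′ (c′≢c ∘ sym)) c′<d))

    size>0 : ∀ {a b} → Arc E a b → 0 < size E a b
    size>0 {a} {b} e with directly-under e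
    ... | x , o = ≤-trans (≤-reflexive (sym (𝟙-yes (own? E a b x) o))) (Σ-≤ b x _ (Own.right o))

    private
      -- Summed over x it counts the same pairs of an arc and an owned vertex as the sizes summed
      -- over the arcs; both double counts below rest on this.
      owners : ℕ → ℕ → ℕ → ℕ → ℕ
      owners p k B x = Σ< k λ t → Σ< B λ b → 𝟙 (own? E (p + t) b x)

      shifted-unique : ∀ p {x s t b d} → Own E (p + s) b x → Own E (p + t) d x → s ≡ t × b ≡ d
      shifted-unique p o o′ = let (q , r) = own-unique o o′ in +-cancelˡ-≡ p _ _ q , r

      owners-outside : ∀ p k B {x} → x ≤ p → owners p k B x ≡ 0
      owners-outside p k B {x} x≤p = Σ-zero k λ t _ → Σ-zero B λ b _ →
        𝟙-no (own? E (p + t) b x) λ o → <⇒≱ (Own.left o) (≤-trans x≤p (m≤m+n p t))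

      size-extend : ∀ a b {v} → b ≤ v → size E a b ≡ Σ< v (λ x → 𝟙 (own? E a b x))
      size-extend a b b≤v = sym (Σ-extend _ b≤v λ x b≤x → 𝟙-no (own? E a b x) λ o → <⇒≱ (Own.right o) b≤x)

      swap-owners : ∀ p k v → Σ< k (λ t → Σ< (suc v) (λ b → Σ< v (λ x → 𝟙 (own? E (p + t) b x)))) ≡
                    Σ< v (owners p k (suc v))
      swap-owners p k v = trans (Σ-ext k λ t → Σ-swap (suc v) v _) (Σ-swap k v _)

      sizes-upto : ∀ a v → Σ< (suc v) (size E a) ≡ Σ< (suc v) (λ b → Σ< v (λ x → 𝟙 (own? E a b x)))
      sizes-upto a v = Σ-cong (suc v) λ b b<1+v → size-extend a b (≤-pred b<1+v)

      -- When no arc that starts in the interval leaves it, ends up to p + k suffice and the sums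
      -- over arcs and vertices can be exchanged.
      totals-of-interval : ∀ p k → (∀ {a b} → p ≤ a → a < p + k → Arc E a b → b ≤ p + k) →
                           Σ< k (λ t → total (p + t)) ≡ Σ< (p + k) (owners p k (suc (p + k)))
      totals-of-interval p k closed = trans
        (Σ-cong k λ t t<k → trans
          (total≡Σ (p + t) (suc (p + k)) λ e → s≤s (closed (m≤m+n p t) (+-monoʳ-< p t<k) e))
          (sizes-upto (p + t) (p + k)))
        (swap-owners p k (p + k))

    -- Each vertex strictly under an arc is counted by exactly one subgon under it.
    under-arc : ∀ u k → Arc E u (suc u + k) →
                k ≡ upto u (suc u + k) + Σ< k (λ t → total (suc u + t))
    under-arc u k e = sym (begin
      upto u v + Σ< k (λ t → total (suc u + t))
        ≡⟨ cong₂ _+_ (trans (sum-sizes E (suc v) u) (sizes-upto u v)) tail ⟩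
      W u + Σ< k (λ t → W (suc u + t))
        ≡⟨ cong₂ _+_ (cong W (sym (+-identityʳ u))) (Σ-ext k λ t → cong W (sym (+-suc u t))) ⟩
      W (u + 0) + Σ< k (λ t → W (u + suc t))
        ≡⟨ Σ-split 1 k (λ t → W (u + t)) ⟨
      Σ< (suc k) (λ t → W (u + t))
        ≡⟨ swap-owners u (suc k) v ⟩
      Σ< (suc u + k) (owners u (suc k) (suc v))
        ≡⟨ Σ-split (suc u) k _ ⟩
      Σ< (suc u) (owners u (suc k) (suc v)) + Σ< k (λ t → owners u (suc k) (suc v) (suc u + t))
        ≡⟨ cong₂ _+_ (Σ-zero (suc u) λ x x≤u → owners-outside u (suc k) (suc v) (≤-pred x≤u))
                     (trans (Σ-cong k λ t t<k → once t t<k) (Σ-1 k)) ⟩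
      k ∎)
      where
      open ≡-Reasoning
      v : ℕ
      v = suc u + k
      W : ℕ → ℕ
      W a = Σ< (suc v) (λ b → Σ< v (λ x → 𝟙 (own? E a b x)))
      -- By `nested`, arcs that start strictly inside end by v, so bounding the ends by v loses
      -- nothing.
      tail : Σ< k (λ t → total (suc u + t)) ≡ Σ< k (λ t → W (suc u + t))
      tail = Σ-cong k λ t t<k → trans
        (total≡Σ (suc u + t) (suc v) λ f → s≤s (nested e f (s≤s (m≤m+n u t)) (+-monoʳ-< (suc u) t<k)))
        (sizes-upto (suc u + t) v)
      once : ∀ t → t < k → owners u (suc k) (suc v) (suc u + t) ≡ 1
      once t t<k with own-exists E e (s≤s (m≤m+n u t)) (+-monoʳ-< (suc u) t<k)
      ... | c , d , u≤c , d≤v , o with s , refl ← offset u≤c =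
        ΣΣ-hit (λ s b → own? E (u + s) b (suc u + t)) (shifted-unique u) (suc k) (suc v)
          (lia 4 (λ u s t k → u ⊕ s ≺ # 1 ⊕ u ⊕ t ⇒ t ≺ k ⇒ ⊢ s ≺ # 1 ⊕ k) (1 ∷ 1 ∷ 1 ∷ []) [] u s t k (Own.left o) t<k) (s≤s d≤v) o

    -- The arcs that start in [v , v + k] end by suc v + k, so they own only the k vertices strictly
    -- between, each at most once. This makes the end of an arc a first passage: every earlier
    -- vertex is lower.
    before-end : ∀ u v k → Arc E u (suc v + k) → u < v → Σ< (suc k) (λ t → total (v + t)) ≤ k
    before-end u v k e u<v = subst (_≤ k) (sym (totals-of-interval v (suc k) closed))
      (subst (λ w → Σ< w (owners v (suc k) (suc (v + suc k))) ≤ k) (sym (+-suc v k))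
        (subst (_≤ k) (sym (Σ-split (suc v) k _))
          (+-mono-≤ (≤-reflexive (Σ-zero (suc v) λ x x≤v → owners-outside v (suc k) _ (≤-pred x≤v)))
            (≤-trans (Σ-mono k λ t _ → ΣΣ≤1 (λ s b → own? E (v + s) b (suc v + t)) (shifted-unique v) (suc k) _)
              (≤-reflexive (Σ-1 k))))))
      where
      closed : ∀ {a b} → v ≤ a → a < v + suc k → Arc E a b → b ≤ v + suc k
      closed {a} {b} v≤a a< f = subst (b ≤_) (sym (+-suc v k))
        (nested e f (≤-trans u<v v≤a) (subst (a <_) (+-suc v k) a<))

    Covered : ℕ → Set
    Covered x = ∃[ a ] a < x × ∃[ b ] b < N + x × (Arc E a b × x < b)

    covered? : ∀ x → Dec (Covered x)
    covered? x = any-pair? (λ a b → arc? E a b ×-dec (x <? b)) x (N + x)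

    own-periodic : ∀ {a b x} → Own E a b x → Own E (N + a) (N + b) (N + x)
    own-periodic o = own-translate N (own-cong (λ a b → sym (periodic a b)) o)

    size-window : ∀ a l → l < N → size E a (a + l) ≡ Σ< N (λ t → 𝟙 (own? E a (a + l) (a + t)))
    size-window a l l<N = trans (Σ-split a l _)
      (cong₂ _+_ (Σ-zero a λ x x<a → 𝟙-no (own? E _ _ x) λ o → <⇒≱ (Own.left o) (<⇒≤ x<a))
        (sym (Σ-extend _ (<⇒≤ l<N) λ t l≤t → 𝟙-no (own? E _ _ _) λ o → <⇒≱ (Own.right o) (+-monoʳ-≤ a l≤t))))

    private

      own-periodic⁻ : ∀ {a b x} → Own E (N + a) (N + b) (N + x) → Own E a b x
      own-periodic⁻ o = own-cong periodic (own-untranslate N o)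

      owns : ℕ → ℕ → ℕ → ℕ
      owns t l a = 𝟙 (own? E a (a + l) (a + t))

      owns-periodic : ∀ t l → Periodic N (owns t l)
      owns-periodic t l a = 𝟙-cong (own? E _ _ _) (own? E _ _ _)
        (λ o → own-periodic⁻ (subst₂ (Own E (N + a)) (+-assoc N a l) (+-assoc N a t) o))
        (λ o → subst₂ (Own E (N + a)) (sym (+-assoc N a l)) (sym (+-assoc N a t)) (own-periodic o))

      -- A covered vertex has exactly one owner, indexed here by the distance t back to its start
      -- and by its length l. Working at N + y makes that start, (N ∸ t) + y, a natural number for
      -- every t < N.
      covered-once : ∀ y → 𝟙 (covered? (N + y)) ≡ Σ< N (λ t → Σ< N (λ l → owns t l ((N ∸ t) + y)))
      covered-once y with covered? (N + y)
      ... | no ¬c = sym (Σ-zero N λ t t<N → Σ-zero N λ l l<N → 𝟙-no (own? E _ _ _) λ o →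
          ¬c (uncover t t<N l (Own.arc o) (Own.left o) (Own.right o)))
        where
        uncover : ∀ t → t < N → ∀ l → let a = (N ∸ t) + y in Arc E a (a + l) → a < a + t → a + t < a + l → Covered (N + y)
        uncover t t<N l e p q = a , subst (a <_) eq p , a + l ,
          lia 4 (λ n a l x → a ⊕ l ≺ n ⊕ a ⇒ a ≺ x ⇒ ⊢ a ⊕ l ≺ n ⊕ x) (1 ∷ 1 ∷ 1 ∷ []) [] N a l (N + y) (short e) (subst (a <_) eq p) ,
          e , subst (_< a + l) eq q
          where
          a : ℕ
          a = (N ∸ t) + y
          eq : a + t ≡ N + y
          eq = lia 4 (λ m t n y → m ⊕ t ≂ n ⇒ ⊢ m ⊕ y ⊕ t ≂ n ⊕ y) (1 ∷ 1 ∷ []) (1 ∷ 0 ∷ 1 ∷ []) (N ∸ t) t N y (m∸n+n≡m (<⇒≤ t<N))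
      ... | yes (a , a<x , b , _ , e , x<b) = sym (go (own-exists E e a<x x<b))
        where
        x : ℕ
        x = N + y
        cell : ∀ {t l c d} → t < N → (N ∸ t) + y ≡ c → c + l ≡ d → Own E c d x → l < N →
               Σ< N (λ t → Σ< N (λ l → owns t l ((N ∸ t) + y))) ≡ 1
        cell {t} {l} t<N refl refl o l<N = trans
          (Σ-cong N λ t t<N → Σ-ext N λ l → 𝟙-cong (own? E _ _ _) (own? E _ _ x)
            (subst (Own E _ _) (eq t t<N)) (subst (Own E _ _) (sym (eq t t<N))))
          (trans (Σ-single N t _ t<N λ s s<N s≢t → Σ-zero N λ l _ → 𝟙-no (own? E _ _ x) λ o′ →
                   s≢t (same s s<N (proj₁ (own-unique o′ o))))
            (trans (Σ-single N l _ l<N λ k _ k≢l → 𝟙-no (own? E _ _ x) λ o′ →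
                     k≢l (+-cancelˡ-≡ _ _ _ (proj₂ (own-unique o′ o))))
              (𝟙-yes (own? E _ _ x) o)))
          where
          eq : ∀ t → t < N → (N ∸ t) + y + t ≡ N + y
          eq t t<N = lia 4 (λ m t n y → m ⊕ t ≂ n ⇒ ⊢ m ⊕ y ⊕ t ≂ n ⊕ y) (1 ∷ 1 ∷ []) (1 ∷ 0 ∷ 1 ∷ []) (N ∸ t) t N y (m∸n+n≡m (<⇒≤ t<N))
          same : ∀ s → s < N → (N ∸ s) + y ≡ (N ∸ t) + y → s ≡ t
          same s s<N h = lia 6 (λ n y m k s t → m ⊕ s ≂ n ⇒ k ⊕ t ≂ n ⇒ m ⊕ y ≂ k ⊕ y ⇒ ⊢ s ≂ t) (1 ∷ 0 ∷ 1 ∷ 0 ∷ 1 ∷ 1 ∷ []) (1 ∷ 1 ∷ 0 ∷ 1 ∷ 0 ∷ 0 ∷ 1 ∷ [])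
            N y (N ∸ s) (N ∸ t) s t (m∸n+n≡m (<⇒≤ s<N)) (m∸n+n≡m (<⇒≤ t<N)) h
        go : ∃[ c ] ∃[ d ] a ≤ c × d ≤ b × Own E c d x → _
        go (c , d , _ , _ , o) = cell {x ∸ c} {d ∸ c} t<N
          (lia 5 (λ n t m y c → m ⊕ t ≂ n ⇒ t ⊕ c ≂ n ⊕ y ⇒ ⊢ m ⊕ y ≂ c) (1 ∷ 0 ∷ 1 ∷ 1 ∷ []) (1 ∷ 1 ∷ 0 ∷ 0 ∷ 1 ∷ []) N (x ∸ c) (N ∸ (x ∸ c)) y c
            (m∸n+n≡m (<⇒≤ t<N)) (m∸n+n≡m (<⇒≤ (Own.left o))))
          (m+[n∸m]≡n c≤d) o
          (lia 4 (λ c l d n → c ⊕ l ≂ d ⇒ d ≺ n ⊕ c ⇒ ⊢ l ≺ n) (1 ∷ 1 ∷ 1 ∷ []) [] c (d ∸ c) d N (m+[n∸m]≡n c≤d) (short (Own.arc o)))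
          where
          c≤d : c ≤ d
          c≤d = <⇒≤ (proper (Own.arc o))
          t<N : x ∸ c < N
          t<N = lia 5 (λ c x t d n → t ⊕ c ≂ x ⇒ x ≺ d ⇒ d ≺ n ⊕ c ⇒ ⊢ t ≺ n) (1 ∷ 1 ∷ 1 ∷ 1 ∷ []) [] c x (x ∸ c) d N
            (m∸n+n≡m (<⇒≤ (Own.left o))) (Own.right o) (short (Own.arc o))

      -- With arcs indexed by distance and length, summing over the vertex y amounts to summing over
      -- all starts in a window, and `Σ-window` removes the shift by N ∸ t. The rest is exchange of
      -- sums.
      totals : Σ< N (λ y → 𝟙 (covered? (N + y))) ≡ Σ< N total
      totals = begin
        Σ< N (λ y → 𝟙 (covered? (N + y)))
          ≡⟨ Σ-ext N covered-once ⟩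
        Σ< N (λ y → Σ< N (λ t → Σ< N (λ l → owns t l ((N ∸ t) + y))))
          ≡⟨ Σ-swap N N _ ⟩
        Σ< N (λ t → Σ< N (λ y → Σ< N (λ l → owns t l ((N ∸ t) + y))))
          ≡⟨ Σ-ext N (λ t → Σ-swap N N _) ⟩
        Σ< N (λ t → Σ< N (λ l → Σ< N (λ y → owns t l ((N ∸ t) + y))))
          ≡⟨ Σ-ext N (λ t → Σ-ext N λ l → Σ-window N (owns t l) (owns-periodic t l) (N ∸ t)) ⟩
        Σ< N (λ t → Σ< N (λ l → Σ< N (λ a → owns t l a)))
          ≡⟨ Σ-ext N (λ t → Σ-swap N N _) ⟩
        Σ< N (λ t → Σ< N (λ a → Σ< N (λ l → owns t l a)))
          ≡⟨ Σ-swap N N _ ⟩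
        Σ< N (λ a → Σ< N (λ t → Σ< N (λ l → owns t l a)))
          ≡⟨ Σ-ext N (λ a → Σ-swap N N _) ⟩
        Σ< N (λ a → Σ< N (λ l → Σ< N (λ t → owns t l a)))
          ≡⟨ Σ-ext N (λ a → trans (Σ-cong N (λ l l<N → sym (size-window a l l<N))) (sym (row a))) ⟩
        Σ< N total ∎
        where
        open ≡-Reasoning
        row : ∀ a → total a ≡ Σ< N (λ l → size E a (a + l))
        row a = trans (total≡Σ a (a + N) (λ {b} e → subst (b <_) (+-comm N a) (short e)))
          (trans (Σ-split a N _)
            (cong₂ _+_ (Σ-zero a λ b b<a → size-0 E a b λ e → <⇒≱ b<a (<⇒≤ (proper e))) refl))

    uncovered : ℕ
    uncovered = Σ< N (λ y → 𝟙 (¬? (covered? (N + y))))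

    uncovered-count : uncovered + Σ< N total ≡ N
    uncovered-count = trans (cong (uncovered +_) (sym totals))
      (trans (sym (Σ-+ N _ _)) (trans (Σ-ext N λ y → one (covered? (N + y))) (Σ-1 N)))
      where
      one : ∀ {P : Set} (d : Dec P) → 𝟙 (¬? d) + 𝟙 d ≡ 1
      one (yes _) = refl
      one (no _)  = refl

-- The correspondence between words and families of arcs

module Words where
  open import Data.Bool.Base using (Bool; true; false; if_then_else_)
  open import Data.Empty using (⊥; ⊥-elim)
  open import Data.List.Base using (List; []; _∷_; _++_)
  open import Data.List.Membership.Propositional using (_∈_; find; lose)
  open import Data.List.Membership.Propositional.Properties using (∈-++⁻; ∈-++⁺ˡ; ∈-++⁺ʳ)
  open import Data.List.Properties using (++-identityʳ)
  open import Data.List.Relation.Unary.All as All using (All; []; _∷_)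
  import Data.List.Relation.Unary.All.Properties as All
  open import Data.List.Relation.Unary.Any as Any using (Any; here; there; any?)
  open import Data.Nat.Base
  open import Data.Nat.ListAction using (sum)
  open import Data.Nat.Properties
  open import Data.Product.Base using (∃-syntax; _×_; _,_)
  open import Data.Sum.Base using (inj₁; inj₂)
  open import Function.Base using (_∘_)
  open import Relation.Binary.PropositionalEquality
  open import Relation.Nullary.Decidable.Core using (Dec; yes; no; _×-dec_; _→-dec_; does)
  open import Relation.Nullary.Negation using (contradiction)

  open Linear
  open Sums
  open Arcs

  prefixes : ℕ → List ℕ → List ℕ
  prefixes s []      = []
  prefixes s (i ∷ l) = s + i ∷ prefixes (s + i) l

  prefixes-snoc : ∀ s l i → prefixes s (l ++ i ∷ []) ≡ prefixes s l ++ (s + sum (l ++ i ∷ [])) ∷ []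
  prefixes-snoc s []      i = cong (λ n → s + n ∷ []) (sym (+-identityʳ i))
  prefixes-snoc s (j ∷ l) i = cong (s + j ∷_)
    (trans (prefixes-snoc (s + j) l i) (cong (λ n → prefixes (s + j) l ++ n ∷ []) (+-assoc s j _)))

  prefixes-> : ∀ {s l p} → All (0 <_) l → p ∈ prefixes s l → s < p
  prefixes-> {s} {i ∷ l} (0<i ∷ _) (here refl) = m<m+n s 0<i
  prefixes-> {s} {i ∷ l} (0<i ∷ h) (there p∈)  = <-trans (m<m+n s 0<i) (prefixes-> h p∈)

  prefixes-≤ : ∀ {s l p} → p ∈ prefixes s l → p ≤ s + sum l
  prefixes-≤ {s} {i ∷ l} (here refl) = +-monoʳ-≤ s (m≤m+n i _)
  prefixes-≤ {s} {i ∷ l} (there p∈)  = ≤-trans (prefixes-≤ p∈) (≤-reflexive (+-assoc s i _))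

  sum-prefix : ∀ s l → 0 < sum l → s + sum l ∈ prefixes s l
  sum-prefix s (i ∷ l) _ with sum l in eq
  ... | zero  = here (cong (s +_) (+-identityʳ i))
  ... | suc n = there (subst (_∈ prefixes (s + i) l) (trans (+-assoc s i _) (cong (λ n → s + (i + n)) eq))
                  (sum-prefix (s + i) l (subst (0 <_) (sym eq) z<s)))

  prefixes-head : ∀ {s i l p} → All (0 <_) l → p ∈ prefixes s (i ∷ l) → s + i ≤ p
  prefixes-head h (here refl) = ≤-refl
  prefixes-head h (there p∈)  = <⇒≤ (prefixes-> h p∈)

  prefixes-tail : ∀ {s i l p} → s + i < p → p ∈ prefixes s (i ∷ l) → p ∈ prefixes (s + i) l
  prefixes-tail lt (here refl) = contradiction lt (<-irrefl refl)
  prefixes-tail lt (there p∈)  = p∈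

  -- The first entry is the least partial sum, as all entries are positive; the argument then
  -- repeats on the tails.
  prefixes-injective : ∀ {s xs ys} → All (0 <_) xs → All (0 <_) ys →
                       (∀ {p} → p ∈ prefixes s xs → p ∈ prefixes s ys) →
                       (∀ {p} → p ∈ prefixes s ys → p ∈ prefixes s xs) → xs ≡ ys
  prefixes-injective {xs = []}     {[]}     _ _ f g = refl
  prefixes-injective {xs = []}     {_ ∷ _}  _ _ f g with () ← g (here refl)
  prefixes-injective {xs = _ ∷ _}  {[]}     _ _ f g with () ← f (here refl)
  prefixes-injective {s} {i ∷ xs} {j ∷ ys} (0<i ∷ h) (0<j ∷ k) f g
    with refl ← +-cancelˡ-≡ s i j (≤-antisym (prefixes-head {s} {i} h (g (here refl))) (prefixes-head {s} {j} k (f (here refl)))) =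
    cong (i ∷_) (prefixes-injective h k
      (λ p∈ → prefixes-tail {s} {i} (prefixes-> h p∈) (f (there p∈)))
      (λ p∈ → prefixes-tail {s} {i} (prefixes-> k p∈) (g (there p∈))))

  ∈-prefixes-sizes⁻ : ∀ E a B {p} → p ∈ prefixes 0 (sizes E B a) →
                      ∃[ b ] b < B × Arc E a b × p ≡ sum (sizes E (suc b) a)
  ∈-prefixes-sizes⁻ E a (suc b) {p} p∈ with E a b in eq
  ... | false = let (c , c<b , q) = ∈-prefixes-sizes⁻ E a b (subst (λ l → p ∈ prefixes 0 l) (++-identityʳ _) p∈)
                in c , m<n⇒m<1+n c<b , q
  ... | true with ∈-++⁻ (prefixes 0 (sizes E b a)) (subst (p ∈_) (prefixes-snoc 0 (sizes E b a) (size E a b)) p∈)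
  ...   | inj₁ p∈′ = let (c , c<b , q) = ∈-prefixes-sizes⁻ E a b p∈′ in c , m<n⇒m<1+n c<b , q
  ...   | inj₂ (here p≡) = b , ≤-refl , eq ,
    trans p≡ (cong (λ e → sum (sizes E b a ++ (if e then size E a b ∷ [] else []))) (sym eq))

  ∈-prefixes-sizes⁺ : ∀ E a B {b} → b < B → Arc E a b → sum (sizes E (suc b) a) ∈ prefixes 0 (sizes E B a)
  ∈-prefixes-sizes⁺ E a (suc B) {b} b<1+B e with b ≟ B
  ... | yes refl = subst (λ t → sum (sizes E b a ++ (if t then size E a b ∷ [] else [])) ∈
                                prefixes 0 (sizes E b a ++ (if t then size E a b ∷ [] else []))) (sym e)
    (subst (sum (sizes E b a ++ size E a b ∷ []) ∈_) (sym (prefixes-snoc 0 (sizes E b a) _))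
      (∈-++⁺ʳ (prefixes 0 (sizes E b a)) (here refl)))
  ... | no b≢B with E a B
  ...   | false = subst (λ l → _ ∈ prefixes 0 l) (sym (++-identityʳ (sizes E B a)))
          (∈-prefixes-sizes⁺ E a B (≤∧≢⇒< (≤-pred b<1+B) b≢B) e)
  ...   | true  = subst (_ ∈_) (sym (prefixes-snoc 0 (sizes E B a) _))
          (∈-++⁺ˡ (∈-prefixes-sizes⁺ E a B (≤∧≢⇒< (≤-pred b<1+B) b≢B) e))

  sizes-all : ∀ {P : ℕ → Set} {E} → (∀ {a b} → Arc E a b → P (size E a b)) → ∀ B a → All P (sizes E B a)
  sizes-all h zero    a = []
  sizes-all {P} {E} h (suc b) a = All.++⁺ (sizes-all h b a) (last (E a b) refl)
    where
    last : ∀ t → E a b ≡ t → All P (if t then size E a b ∷ [] else [])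
    last true  e = h e ∷ []
    last false _ = []

  bool-ext : ∀ {b c : Bool} → (b ≡ true → c ≡ true) → (c ≡ true → b ≡ true) → b ≡ c
  bool-ext {true}  {c}     f g = sym (f refl)
  bool-ext {false} {true}  f g = g refl
  bool-ext {false} {false} f g = refl

  Word : Set
  Word = ℕ → List ℕ

  weights : Word → ℕ → ℕ
  weights W x = Σ< x (sum ∘ W)

  -- v is the first vertex after u whose height exceeds that of suc u by p, the height of x
  -- being x - weights x, moved to both sides because it may be negative.
  record Reach (W : Word) (u v p : ℕ) : Set where
    constructor reach
    field
      forward : u < v
      level   : v + weights W (suc u) ≡ suc u + weights W v + p
      first   : ∀ {x} → x < v → u < x → x + weights W v < v + weights W x

  module _ (W : Word) where

    abstract
      reach? : ∀ u v p → Dec (Reach W u v p)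
      reach? u v p with (u <? v) ×-dec (v + weights W (suc u) ≟ suc u + weights W v + p) ×-dec
                        allUpTo? (λ x → (u <? x) →-dec (x + weights W v <? v + weights W x)) v
      ... | yes (f , l , h) = yes (reach f l h)
      ... | no ¬r = no λ r → ¬r (Reach.forward r , Reach.level r , Reach.first r)

    arcs : Arcs
    arcs u v = does (any? (reach? u v) (prefixes 0 (W u)))

    arc⁻ : ∀ {u v} → Arc arcs u v → ∃[ p ] p ∈ prefixes 0 (W u) × Reach W u v p
    arc⁻ {u} {v} e with any? (reach? u v) (prefixes 0 (W u))
    ... | yes h = find h
    arc⁻ () | no _

    arc⁺ : ∀ {u v p} → p ∈ prefixes 0 (W u) → Reach W u v p → Arc arcs u v
    arc⁺ {u} {v} p∈ r with any? (reach? u v) (prefixes 0 (W u))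
    ... | yes _ = refl
    ... | no ¬h = contradiction (lose p∈ r) ¬h

    -- If w came before v, it would be strictly lower than v although its level is at least as high.
    reach-mono : ∀ {u v w p q} → Reach W u v p → Reach W u w q → p ≤ q → v ≤ w
    reach-mono {u} {v} {w} {p} {q} r s p≤q = ≮⇒≥ λ w<v →
      lia 8 (λ u v w p q cu cv cw → v ⊕ cu ≂ # 1 ⊕ u ⊕ cv ⊕ p ⇒ w ⊕ cu ≂ # 1 ⊕ u ⊕ cw ⊕ q ⇒ p ≼ q ⇒ w ⊕ cv ≺ v ⊕ cw ⇒ ⊢⊥) (1 ∷ 1 ∷ 0 ∷ 1 ∷ 1 ∷ []) []
        u v w p q (weights W (suc u)) (weights W v) (weights W w)
        (Reach.level r) (Reach.level s) p≤q (Reach.first r w<v (Reach.forward s))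

    -- In heights: v is at most one above u. The step from u to suc u adds 1 and subtracts sum (W
    -- u), and p regains at most that sum.
    reach-≤ : ∀ {u v p} → Reach W u v p → p ≤ sum (W u) → v + weights W u ≤ suc u + weights W v
    reach-≤ {u} {v} {p} r p≤ = lia 6 (λ u v p s cu cv → v ⊕ (cu ⊕ s) ≂ # 1 ⊕ u ⊕ cv ⊕ p ⇒ p ≼ s ⇒ ⊢ v ⊕ cu ≼ # 1 ⊕ u ⊕ cv) (1 ∷ 1 ∷ 1 ∷ []) []
      u v p (sum (W u)) (weights W u) (weights W v) (Reach.level r) p≤

  weights-+ : ∀ {W p} → Periodic p W → ∀ x → weights W (p + x) ≡ weights W p + weights W x
  weights-+ {W} {p} per x = trans (Σ-split p x _) (cong (weights W p +_) (Σ-ext x λ i → cong sum (per i)))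

  module Periodicity {W : Word} {p r : ℕ} (per : Periodic p W) (weight : weights W p + r ≡ p) (0<r : 0 < r) where

    -- A period after u the height is larger by r ≥ 1, hence at least that of v; a first passage
    -- cannot come later than that.
    reach-short : ∀ {u v q} → Reach W u v q → q ≤ sum (W u) → v ≤ p + u
    reach-short {u} {v} {q} rc q≤ = ≮⇒≥ λ lt →
      lia 7 (λ u v n c r cu cv → v ⊕ cu ≼ # 1 ⊕ u ⊕ cv ⇒ n ⊕ u ⊕ cv ≺ v ⊕ (c ⊕ cu) ⇒ c ⊕ r ≂ n ⇒ # 0 ≺ r ⇒ ⊢⊥) (1 ∷ 1 ∷ 0 ∷ 1 ∷ 1 ∷ []) []
        u v p (weights W p) r (weights W u) (weights W v)
        (reach-≤ W rc q≤)
        (subst (λ c → p + u + weights W v < v + c) (weights-+ per u) (Reach.first rc lt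
          (lia 4 (λ u n c r → c ⊕ r ≂ n ⇒ # 0 ≺ r ⇒ ⊢ u ≺ n ⊕ u) (1 ∷ 1 ∷ 1 ∷ []) [] u p (weights W p) r weight 0<r)))
        weight 0<r

    -- One step raises the height by at most 1, so the first vertex that meets or exceeds the level
    -- meets it exactly. A period after u the level has been met or exceeded, which bounds the
    -- search.
    reach-exists : ∀ u q → 0 < q → q ≤ sum (W u) → ∃[ v ] Reach W u v q
    reach-exists u q 0<q q≤ with least (λ k → suc u + weights W (suc u + k) + q ≤? suc u + k + weights W (suc u)) (p ∸ 1) high
      where
      n≡ : 1 + (p ∸ 1) ≡ p
      n≡ = m+[n∸m]≡n (lia 3 (λ n c r → c ⊕ r ≂ n ⇒ # 0 ≺ r ⇒ ⊢ # 1 ≼ n) (1 ∷ 1 ∷ 1 ∷ []) [] p (weights W p) r weight 0<r)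
      end : suc u + (p ∸ 1) ≡ p + u
      end = lia 3 (λ u m n → # 1 ⊕ m ≂ n ⇒ ⊢ # 1 ⊕ u ⊕ m ≂ n ⊕ u) (1 ∷ 1 ∷ []) (1 ∷ 0 ∷ 1 ∷ []) u (p ∸ 1) p n≡
      high : suc u + weights W (suc u + (p ∸ 1)) + q ≤ suc u + (p ∸ 1) + weights W (suc u)
      high = subst (λ x → suc u + weights W x + q ≤ x + weights W (suc u)) (sym end)
        (subst (λ c → suc u + c + q ≤ p + u + weights W (suc u)) (sym (weights-+ per u))
          (lia 7 (λ u c cu q n s r → q ≼ s ⇒ c ⊕ r ≂ n ⇒ # 0 ≺ r ⇒ ⊢ # 1 ⊕ u ⊕ (c ⊕ cu) ⊕ q ≼ n ⊕ u ⊕ (cu ⊕ s)) (1 ∷ 1 ∷ 1 ∷ 0 ∷ 1 ∷ []) []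
            u (weights W p) (weights W u) q p (sum (W u)) r q≤ weight 0<r))
    -- At suc u itself the level is not met, because q is positive.
    ... | zero , _ , h , _ = ⊥-elim (lia 3 (λ u c q → # 1 ⊕ u ⊕ c ⊕ q ≼ # 1 ⊕ u ⊕ c ⇒ # 0 ≺ q ⇒ ⊢⊥) (1 ∷ 1 ∷ []) []
            u (weights W (suc u)) q (subst (λ x → suc u + weights W x + q ≤ x + weights W (suc u)) (+-identityʳ (suc u)) h) 0<q)
    ... | suc k , _ , h , below = suc u + suc k , reach (m≤m+n (suc u) (suc k)) level first
      where
      before : suc u + k + weights W (suc u) < suc u + weights W (suc u + k) + q
      before = ≰⇒> (below k ≤-refl)
      level : suc u + suc k + weights W (suc u) ≡ suc u + weights W (suc u + suc k) + q
      level = ≤-antisym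
        (subst (λ x → x + weights W (suc u) ≤ suc u + weights W x + q) (sym (+-suc (suc u) k))
          (lia 6 (λ u k a b s q → # 1 ⊕ u ⊕ k ⊕ a ≺ # 1 ⊕ u ⊕ b ⊕ q ⇒ ⊢ # 1 ⊕ (# 1 ⊕ u ⊕ k) ⊕ a ≼ # 1 ⊕ u ⊕ (b ⊕ s) ⊕ q) (1 ∷ 1 ∷ []) []
            u k (weights W (suc u)) (weights W (suc u + k)) (sum (W (suc u + k))) q before)) h
      first : ∀ {x} → x < suc u + suc k → u < x → x + weights W (suc u + suc k) < suc u + suc k + weights W x
      first {x} x<v u<x with j , refl ← offset u<x =
        lia 7 (λ x v a b c u q → x ⊕ a ≺ # 1 ⊕ u ⊕ b ⊕ q ⇒ v ⊕ a ≂ # 1 ⊕ u ⊕ c ⊕ q ⇒ ⊢ x ⊕ c ≺ v ⊕ b) (1 ∷ 0 ∷ 1 ∷ 1 ∷ []) []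
          (suc u + j) (suc u + suc k) (weights W (suc u)) (weights W (suc u + j)) (weights W (suc u + suc k)) u q
          (≰⇒> (below j (+-cancelˡ-< (suc u) _ _ x<v))) level

    reach-translate : ∀ {u v q} → Reach W u v q → Reach W (p + u) (p + v) q
    reach-translate {u} {v} {q} rc = reach (+-monoʳ-< p (Reach.forward rc)) level first
      where
      level : p + v + weights W (suc (p + u)) ≡ suc (p + u) + weights W (p + v) + q
      level = subst (λ x → p + v + weights W x ≡ x + weights W (p + v) + q) (+-suc p u)
        (subst₂ (λ a b → p + v + a ≡ p + suc u + b + q) (sym (weights-+ per (suc u))) (sym (weights-+ per v))
          (lia 7 (λ p u v a b c q → v ⊕ a ≂ # 1 ⊕ u ⊕ b ⊕ q ⇒ ⊢ p ⊕ v ⊕ (c ⊕ a) ≂ p ⊕ (# 1 ⊕ u) ⊕ (c ⊕ b) ⊕ q) (1 ∷ 1 ∷ []) (1 ∷ 0 ∷ 1 ∷ [])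
            p u v (weights W (suc u)) (weights W v) (weights W p) q (Reach.level rc)))
      first : ∀ {x} → x < p + v → p + u < x → x + weights W (p + v) < p + v + weights W x
      first x<v u<x with y , refl ← offset (≤-trans (m≤m+n p u) (<⇒≤ u<x))
        rewrite weights-+ per v | weights-+ per y =
        lia 6 (λ p y v a b c → y ⊕ b ≺ v ⊕ a ⇒ ⊢ p ⊕ y ⊕ (c ⊕ b) ≺ p ⊕ v ⊕ (c ⊕ a)) (1 ∷ 1 ∷ []) []
          p y v (weights W y) (weights W v) (weights W p)
          (Reach.first rc (+-cancelˡ-< p _ _ x<v) (+-cancelˡ-< p _ _ u<x))

    reach-untranslate : ∀ {u v q} → Reach W (p + u) (p + v) q → Reach W u v q
    reach-untranslate {u} {v} {q} rc = reach (+-cancelˡ-< p _ _ (Reach.forward rc)) level first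
      where
      level : v + weights W (suc u) ≡ suc u + weights W v + q
      level = lia 7 (λ p u v a b c q → p ⊕ v ⊕ (c ⊕ a) ≂ p ⊕ (# 1 ⊕ u) ⊕ (c ⊕ b) ⊕ q ⇒ ⊢ v ⊕ a ≂ # 1 ⊕ u ⊕ b ⊕ q) (1 ∷ 1 ∷ []) (1 ∷ 0 ∷ 1 ∷ [])
          p u v (weights W (suc u)) (weights W v) (weights W p) q
          (subst₂ (λ a b → p + v + a ≡ p + suc u + b + q) (weights-+ per (suc u)) (weights-+ per v)
            (subst (λ x → p + v + weights W x ≡ x + weights W (p + v) + q) (sym (+-suc p u)) (Reach.level rc)))
      first : ∀ {x} → x < v → u < x → x + weights W v < v + weights W x
      first {x} x<v u<x =
        lia 6 (λ p y v a b c → p ⊕ y ⊕ (c ⊕ b) ≺ p ⊕ v ⊕ (c ⊕ a) ⇒ ⊢ y ⊕ b ≺ v ⊕ a) (1 ∷ 1 ∷ []) []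
          p x v (weights W x) (weights W v) (weights W p)
          (subst₂ (λ a b → p + x + a < p + v + b) (weights-+ per v) (weights-+ per x)
            (Reach.first rc (+-monoʳ-< p x<v) (+-monoʳ-< p u<x)))

    arcs-periodic : ∀ u v → arcs W (p + u) (p + v) ≡ arcs W u v
    arcs-periodic u v = bool-ext
      (λ e → let (q , q∈ , rc) = arc⁻ W e in arc⁺ W (subst (λ l → q ∈ prefixes 0 l) (per u) q∈) (reach-untranslate rc))
      (λ e → let (q , q∈ , rc) = arc⁻ W e in arc⁺ W (subst (λ l → q ∈ prefixes 0 l) (sym (per u)) q∈) (reach-translate rc))

  module WordArcs {W : Word} {N r : ℕ} (positive : ∀ x → All (0 <_) (W x)) (per : Periodic N W)
                  (weight : weights W N + r ≡ N) (2≤r : 2 ≤ r) where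

    open Periodicity per weight (<⇒≤ 2≤r) public

    -- For `short`: after N steps the height has risen by r ≥ 2, but an arc ends at most one above
    -- its start. For `nested`: an end d beyond b would make the heights at c, b, d strictly
    -- increasing, while d is at most one above c.
    family : Family N (arcs W)
    family = record
      { long = λ e → let (_ , p∈ , rc) = arc⁻ W e in long (prefixes-> (positive _) p∈) rc
      ; short = λ e → let (_ , p∈ , rc) = arc⁻ W e in short rc (prefixes-≤ p∈)
      ; periodic = arcs-periodic
      ; nested = λ e f a<c c<b → let (_ , _ , rc) = arc⁻ W e ; (_ , q∈ , rd) = arc⁻ W f in
          nested rc rd (prefixes-≤ q∈) a<c c<b }
      where
      long : ∀ {u v p} → 0 < p → Reach W u v p → 2 + u ≤ v
      long {u} {v} {p} 0<p rc with m≤n⇒m<n∨m≡n (Reach.forward rc)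
      ... | inj₁ lt = lt
      ... | inj₂ refl = ⊥-elim (lia 3 (λ u c p → # 1 ⊕ u ⊕ c ≂ # 1 ⊕ u ⊕ c ⊕ p ⇒ # 0 ≺ p ⇒ ⊢⊥) (1 ∷ 0 ∷ 1 ∷ []) [] u (weights W v) p (Reach.level rc) 0<p)
      short : ∀ {u v p} → Reach W u v p → p ≤ sum (W u) → v < N + u
      short {u} {v} {p} rc p≤ = ≤∧≢⇒< (reach-short rc p≤) λ { refl →
        lia 5 (λ n u c r cu → n ⊕ u ⊕ cu ≼ # 1 ⊕ u ⊕ (c ⊕ cu) ⇒ c ⊕ r ≂ n ⇒ # 2 ≼ r ⇒ ⊢⊥) (1 ∷ 1 ∷ 0 ∷ 1 ∷ []) [] N u (weights W N) r (weights W u)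
          (subst (λ c → N + u + weights W u ≤ suc u + c) (weights-+ per u) (reach-≤ W rc p≤)) weight 2≤r }
      nested : ∀ {a b c d p q} → Reach W a b p → Reach W c d q → q ≤ sum (W c) → a < c → c < b → d ≤ b
      nested {a} {b} {c} {d} rc rd q≤ a<c c<b = ≮⇒≥ λ b<d →
        lia 6 (λ b c d x y z → b ⊕ z ≺ d ⊕ x ⇒ c ⊕ x ≺ b ⊕ y ⇒ d ⊕ y ≼ # 1 ⊕ c ⊕ z ⇒ ⊢⊥) (1 ∷ 1 ∷ 1 ∷ []) []
          b c d (weights W b) (weights W c) (weights W d)
          (Reach.first rd b<d c<b) (Reach.first rc c<b a<c) (reach-≤ W rd q≤)

    open FamilyProperties family

    private
      to-top : ∀ {x y} → Reach W x y (sum (W x)) → total x ≡ upto x y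
      to-top {x} {y} rc = trans
        (total≡Σ x (suc y) λ e → let (_ , p∈ , rd) = arc⁻ W e in s≤s (reach-mono W rd rc (prefixes-≤ p∈)))
        (sym (sum-sizes (arcs W) (suc y) x))

      no-arcs : ∀ {x} → sum (W x) ≡ 0 → total x ≡ sum (W x)
      no-arcs {x} eq = trans (total≡Σ x 0 λ e → let (_ , p∈ , _) = arc⁻ W e in
        ⊥-elim (<⇒≱ (prefixes-> (positive x) p∈) (≤-trans (prefixes-≤ p∈) (≤-reflexive eq)))) (sym eq)

      -- Mutual induction on the length of the arc. `under-arc` expresses that length through the
      -- sizes, `Reach.level` through the letters; the contributions of the vertices strictly inside
      -- agree by induction, so what remains at u agrees too.
      upto≡level : ∀ k {u v p} → v ≤ u + k → p ∈ prefixes 0 (W u) → Reach W u v p → upto u v ≡ p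
      total≡sum : ∀ k {x y} → y ≤ x + k → Reach W x y (sum (W x)) → 0 < sum (W x) → total x ≡ sum (W x)

      total≡sum k y≤ rc 0<s = trans (to-top rc) (upto≡level k y≤ (sum-prefix 0 (W _) 0<s) rc)

      upto≡level zero {u} {v} v≤u p∈ rc =
        ⊥-elim (lia 2 (λ u v → v ≼ u ⊕ # 0 ⇒ u ≺ v ⇒ ⊢⊥) (1 ∷ 1 ∷ []) [] u v v≤u (Reach.forward rc))
      upto≡level (suc k) {u} {v} {p} v≤ p∈ rc with j , refl ← offset (Reach.forward rc) =
        lia 6 (λ u j t a b p → j ≂ t ⊕ b ⇒ # 1 ⊕ u ⊕ j ⊕ a ≂ # 1 ⊕ u ⊕ (a ⊕ b) ⊕ p ⇒ ⊢ t ≂ p) (1 ∷ 1 ∷ 0 ∷ 0 ∷ 1 ∷ []) (1 ∷ 0 ∷ 1 ∷ 1 ∷ [])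
          u j (upto u v) (weights W (suc u)) (Σ< j (λ t → sum (W (suc u + t)))) p
          (trans (under-arc u j e) (cong (upto u v +_) (Σ-cong j inner)))
          (subst (λ c → v + weights W (suc u) ≡ suc u + c + p) (Σ-split (suc u) j _) (Reach.level rc))
        where
        e : Arc (arcs W) u (suc u + j)
        e = arc⁺ W p∈ rc
        inner : ∀ t → t < j → total (suc u + t) ≡ sum (W (suc u + t))
        inner t t<j with sum (W (suc u + t)) ≟ 0
        ... | yes eq = no-arcs eq
        ... | no s≢0 with reach-exists (suc u + t) _ (n≢0⇒n>0 s≢0) ≤-refl
        ...   | y , rd = total≡sum k
          (lia 5 (λ u j t k y → y ≼ # 1 ⊕ u ⊕ j ⇒ # 1 ⊕ u ⊕ j ≼ u ⊕ (# 1 ⊕ k) ⇒ ⊢ y ≼ # 1 ⊕ u ⊕ t ⊕ k) (1 ∷ 1 ∷ 1 ∷ []) [] u j t k y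
            (nested e (arc⁺ W (sum-prefix 0 (W _) (n≢0⇒n>0 s≢0)) rd) (m≤m+n (suc u) t) (+-monoʳ-< (suc u) t<j)) v≤)
          rd (n≢0⇒n>0 s≢0)

    -- Both lists have the same partial sums, the levels of the arcs from u, and
    -- `prefixes-injective` applies.
    word≡ : ∀ u → word u ≡ W u
    word≡ u = prefixes-injective (sizes-all size>0 (N + u) u) (positive u) into onto
      where
      into : ∀ {q} → q ∈ prefixes 0 (word u) → q ∈ prefixes 0 (W u)
      into q∈ with ∈-prefixes-sizes⁻ (arcs W) u (N + u) q∈
      ... | b , _ , e , refl with arc⁻ W e
      ...   | p , p∈ , rc = subst (_∈ prefixes 0 (W u)) (sym (upto≡level b (m≤n+m b u) p∈ rc)) p∈
      onto : ∀ {q} → q ∈ prefixes 0 (W u) → q ∈ prefixes 0 (word u)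
      onto {q} q∈ with reach-exists u q (prefixes-> (positive u) q∈) (prefixes-≤ q∈)
      ... | v , rc = subst (_∈ prefixes 0 (word u)) (upto≡level v (m≤n+m v u) q∈ rc)
        (∈-prefixes-sizes⁺ (arcs W) u (N + u) (short (arc⁺ W q∈ rc)) (arc⁺ W q∈ rc))

  module FamilyWord {N : ℕ} {E : Arcs} (family : Family N E) where

    open FamilyProperties family

    private
      -- `under-arc` supplies the level of the end, and `before-end` shows that earlier vertices
      -- stay below it.
      arc-reach : ∀ {u v} → Arc E u v → Reach word u v (upto u v)
      arc-reach {u} {v} e = reach (proper e) level first
        where
        level : v + weights word (suc u) ≡ suc u + weights word v + upto u v
        level with j , refl ← offset (proper e) =
          lia 6 (λ u j a b c t → c ≂ a ⊕ b ⇒ j ≂ t ⊕ b ⇒ ⊢ # 1 ⊕ u ⊕ j ⊕ a ≂ # 1 ⊕ u ⊕ c ⊕ t) (1 ∷ 1 ∷ 0 ∷ 0 ∷ 1 ∷ []) (1 ∷ 0 ∷ 1 ∷ 1 ∷ [])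
            u j (weights word (suc u)) (Σ< j (λ t → total (suc u + t))) (weights word v) (upto u v)
            (Σ-split (suc u) j total) (under-arc u j e)
        first : ∀ {x} → x < v → u < x → x + weights word v < v + weights word x
        first {x} x<v u<x with k , refl ← offset x<v =
          lia 5 (λ x k a b c → c ≂ a ⊕ b ⇒ b ≼ k ⇒ ⊢ x ⊕ c ≺ # 1 ⊕ x ⊕ k ⊕ a) (1 ∷ 1 ∷ 1 ∷ []) []
            x k (weights word x) (Σ< (suc k) (λ t → total (x + t))) (weights word v)
            (trans (cong (weights word) (sym (+-suc x k))) (Σ-split x (suc k) total)) (before-end u x k e u<x)

    arcs≡ : ∀ u v → arcs word u v ≡ E u v
    arcs≡ u v = bool-ext from to
      where
      to : Arc E u v → Arc (arcs word) u v
      to e = arc⁺ word (∈-prefixes-sizes⁺ E u (N + u) (short e) e) (arc-reach e)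
      from : Arc (arcs word) u v → Arc E u v
      from f with arc⁻ word f
      ... | p , p∈ , rc with ∈-prefixes-sizes⁻ E u (N + u) p∈
      -- Both ends are first passages at the same level, so `reach-mono` used in both directions
      -- identifies them.
      ...   | b , _ , e , refl = subst (Arc E u)
        (≤-antisym (reach-mono word (arc-reach e) rc ≤-refl) (reach-mono word rc (arc-reach e) ≤-refl)) e

-- From arcs on the line to chords of the polygon

module Polygon where
  open import Data.Bool.Base using (Bool; true; _∧_; _∨_; T)
  open import Data.Bool.Properties using (T-≡; T-∧; T-∨)
  open import Data.Empty using (⊥)
  open import Data.Fin.Base using (Fin; toℕ)
  open import Data.Fin.Properties using (toℕ-injective; toℕ-fromℕ<; toℕ<n)
  open import Data.List.Base using ([]; _∷_)
  open import Data.Nat.Base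
  open import Data.Nat.DivMod
  open import Data.Nat.Properties
  open import Data.Product.Base using (∃-syntax; _×_; _,_)
  open import Data.Sum.Base using (_⊎_; inj₁; inj₂; [_,_]′)
  open import Data.Vec.Base using (tabulate; lookup)
  open import Data.Vec.Properties using (lookup∘tabulate; lookup⇒[]=; []=⇒lookup)
  open import Function.Base using (_∘_)
  open import Function.Bundles using (Equivalence)
  open import Relation.Binary.PropositionalEquality
  open import Relation.Nullary.Decidable.Core using (yes; no)
  open import Relation.Nullary.Negation using (¬_; contradiction)

  open import Defs
  open Linear
  open Sums
  open Arcs

  module _ {N : ℕ} .{{_ : NonZero N}} where

    rep : ℕ → Fin N
    rep x = x mod N

    toℕ-rep : ∀ x → toℕ (rep x) ≡ x % N
    toℕ-rep x = toℕ-fromℕ< (m%n<n x N)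

    rep-cong : ∀ {x y} → x % N ≡ y % N → rep x ≡ rep y
    rep-cong {x} {y} eq = toℕ-injective (trans (toℕ-rep x) (trans eq (sym (toℕ-rep y))))

    toℕ-rep-< : ∀ {x} → x < N → toℕ (rep x) ≡ x
    toℕ-rep-< {x} x<N = trans (toℕ-rep x) (m<n⇒m%n≡m x<N)

    rep-toℕ : ∀ i → rep (toℕ i) ≡ i
    rep-toℕ i = toℕ-injective (toℕ-rep-< (toℕ<n i))

    rep-shift : ∀ x → rep (N + x) ≡ rep x
    rep-shift x = rep-cong (trans (cong (_% N) (+-comm N x)) ([m+n]%n≡m%n x N))

    rep-shifts : ∀ k x → rep (k * N + x) ≡ rep x
    rep-shifts k x = rep-cong (trans (cong (_% N) (+-comm (k * N) x)) ([m+kn]%n≡m%n x k N))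

    rep-+ : ∀ a {x y} → rep x ≡ rep y → rep (a + x) ≡ rep (a + y)
    rep-+ a {x} {y} eq = rep-cong (trans (%-distribˡ-+ a x N)
      (trans (cong (λ t → (a % N + t) % N) (trans (sym (toℕ-rep x)) (trans (cong toℕ eq) (toℕ-rep y))))
        (sym (%-distribˡ-+ a y N))))

    next-rep : ∀ x → next (rep x) ≡ rep (suc x)
    next-rep x = rep-+ 1 (rep-toℕ (rep x))

    abstract
      rep-≤ : ∀ {x y} → rep x ≡ rep y → x ≤ y → ∃[ k ] y ≡ k * N + x
      rep-≤ {x} {y} eq x≤y = y / N ∸ x / N , (begin
        y                               ≡⟨ m≡m%n+[m/n]*n y N ⟩
        y % N + y / N * N               ≡⟨ cong₂ _+_ (sym same) (cong (_* N) (sym (m∸n+n≡m (/-monoˡ-≤ N x≤y)))) ⟩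
        x % N + (k + x / N) * N         ≡⟨ cong (x % N +_) (*-distribʳ-+ N k (x / N)) ⟩
        x % N + (k * N + x / N * N)     ≡⟨ x∙yz≈y∙xz (x % N) (k * N) _ ⟩
        k * N + (x % N + x / N * N)     ≡⟨ cong (k * N +_) (m≡m%n+[m/n]*n x N) ⟨
        k * N + x                       ∎)
        where
        open ≡-Reasoning
        open import Algebra.Properties.CommutativeSemigroup +-commutativeSemigroup using (x∙yz≈y∙xz)
        k : ℕ
        k = y / N ∸ x / N
        same : x % N ≡ y % N
        same = trans (sym (toℕ-rep x)) (trans (cong toℕ eq) (toℕ-rep y))

    rep-injective : ∀ {x y} → rep x ≡ rep y → x ≤ y → y < N + x → x ≡ y
    rep-injective {x} eq x≤y y< with rep-≤ eq x≤y
    ... | zero  , refl = refl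
    ... | suc k , refl = contradiction y< (≤⇒≯ (+-monoˡ-≤ x (m≤m+n N (k * N))))

    abstract
      -- If x is not below y, it exceeds y by less than a period, so congruence forces equality and
      -- k = 0.
      align : ∀ {x y} → rep x ≡ rep y → x < N + y → ∃[ k ] y ≡ k * N + x
      align {x} {y} eq x< with ≤-total x y
      ... | inj₁ x≤y = rep-≤ eq x≤y
      ... | inj₂ y≤x = 0 , rep-injective (sym eq) y≤x x<

      -- The number congruent to i in the window from u to N + u.
      lift : ℕ → Fin N → ℕ
      lift u i = u + (toℕ i + pred N * u) % N

      rep-lift : ∀ u i → rep (lift u i) ≡ i
      rep-lift u i = trans (rep-+ u (rep-cong {y = toℕ i + pred N * u} (m%n%n≡m%n _ N)))
        (trans (cong rep total) (trans (rep-shifts u (toℕ i)) (rep-toℕ i)))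
        where
        -- In `lift` the term `pred N * u` stands for -u modulo N; adding u leaves i and a multiple
        -- of N.
        total : u + (toℕ i + pred N * u) ≡ u * N + toℕ i
        total = begin
          u + (toℕ i + pred N * u) ≡⟨ x∙yz≈xz∙y u (toℕ i) _ ⟩
          suc (pred N) * u + toℕ i ≡⟨ cong (λ n → n * u + toℕ i) (suc-pred N) ⟩
          N * u + toℕ i            ≡⟨ cong (_+ toℕ i) (*-comm N u) ⟩
          u * N + toℕ i            ∎
          where
          open ≡-Reasoning
          open import Algebra.Properties.CommutativeSemigroup +-commutativeSemigroup using (x∙yz≈xz∙y)

      lift-≥ : ∀ u i → u ≤ lift u i
      lift-≥ u i = m≤m+n u _

      lift-< : ∀ u i → lift u i < N + u
      lift-< u i = subst (lift u i <_) (+-comm u N) (+-monoʳ-< u (m%n<n _ N))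

    lift-unique : ∀ {u i y} → rep y ≡ i → u ≤ y → y < N + u → lift u i ≡ y
    lift-unique {u} {i} {y} eq u≤y y< with ≤-total (lift u i) y
    ... | inj₁ l≤y = rep-injective (trans (rep-lift u i) (sym eq)) l≤y (<-≤-trans y< (+-monoʳ-≤ N (lift-≥ u i)))
    ... | inj₂ y≤l = sym (rep-injective (trans eq (sym (rep-lift u i))) y≤l (<-≤-trans (lift-< u i) (+-monoʳ-≤ N u≤y)))

    lift-shifts : ∀ k u i → lift (k * N + u) i ≡ k * N + lift u i
    lift-shifts k u i = lift-unique (trans (rep-shifts k _) (rep-lift u i)) (+-monoʳ-≤ (k * N) (lift-≥ u i))
      (lia 4 (λ m l n u → l ≺ n ⊕ u ⇒ ⊢ m ⊕ l ≺ n ⊕ (m ⊕ u)) (1 ∷ 1 ∷ []) [] (k * N) (lift u i) N u (lift-< u i))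

    -- After shifting x into the first period, the disjuncts of `Cyclic` correspond to neither,
    -- both, or only the last of y and z having passed the multiple of N.
    cyclic-intro : ∀ {x y z} → x < y → y < z → z < N + x → Cyclic (rep x) (rep y) (rep z)
    cyclic-intro {x} {y} {z} x<y y<z z< = main
      where
      k a : ℕ
      k = x / N
      a = x % N
      x≡ : x ≡ k * N + a
      x≡ = trans (m≡m%n+[m/n]*n x N) (+-comm a (k * N))
      a<N : a < N
      a<N = m%n<n x N
      main : Cyclic (rep x) (rep y) (rep z)
      main with s , refl ← offset (≤-trans (subst (k * N ≤_) (sym x≡) (m≤m+n _ a)) (<⇒≤ x<y))
           with t , refl ← offset (≤-trans (m≤m+n (k * N) s) (<⇒≤ y<z)) =
        subst₂ (λ b c → Cyclic (rep x) b c) (sym (rep-shifts k s)) (sym (rep-shifts k t)) (go (s <? N) (t <? N))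
        where
        a<s : a < s
        a<s = +-cancelˡ-< (k * N) _ _ (subst (_< k * N + s) x≡ x<y)
        s<t : s < t
        s<t = +-cancelˡ-< (k * N) _ _ y<z
        t<Na : t < N + a
        t<Na = lia 5 (λ m t n a x → m ⊕ t ≺ n ⊕ x ⇒ x ≂ m ⊕ a ⇒ ⊢ t ≺ n ⊕ a) (1 ∷ 1 ∷ 0 ∷ 1 ∷ []) [] (k * N) t N a x z< x≡
        A = toℕ-rep x
        go : _ → _ → Cyclic (rep x) (rep s) (rep t)
        go (yes s<N) (yes t<N) = inj₁
          (subst₂ _<_ (sym A) (sym (toℕ-rep-< s<N)) a<s , subst₂ _<_ (sym (toℕ-rep-< s<N)) (sym (toℕ-rep-< t<N)) s<t)
        go (no s≮N) (yes t<N) = contradiction (<-trans s<t t<N) s≮N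
        go (yes s<N) (no t≮N) with t′ , refl ← offset (≮⇒≥ t≮N) = inj₂ (inj₂
          (subst₂ _<_ (sym T′) (sym A) (+-cancelˡ-< N _ _ t<Na) , subst₂ _<_ (sym A) (sym (toℕ-rep-< s<N)) a<s))
          where
          T′ : toℕ (rep (N + t′)) ≡ t′
          T′ = trans (cong toℕ (rep-shift t′)) (toℕ-rep-< (<-trans (+-cancelˡ-< N _ _ t<Na) a<N))
        go (no s≮N) (no t≮N) with s′ , refl ← offset (≮⇒≥ s≮N) with t′ , refl ← offset (≮⇒≥ t≮N) = inj₂ (inj₁
          (subst₂ _<_ (sym S′) (sym T′) (+-cancelˡ-< N _ _ s<t) , subst₂ _<_ (sym T′) (sym A) t′<a))
          where
          t′<a : t′ < a
          t′<a = +-cancelˡ-< N _ _ t<Na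
          T′ : toℕ (rep (N + t′)) ≡ t′
          T′ = trans (cong toℕ (rep-shift t′)) (toℕ-rep-< (<-trans t′<a a<N))
          S′ : toℕ (rep (N + s′)) ≡ s′
          S′ = trans (cong toℕ (rep-shift s′)) (toℕ-rep-< (<-trans (+-cancelˡ-< N _ _ s<t) (<-trans t′<a a<N)))

    -- Each disjunct tells which of b and c must be lifted to the next period to come after a.
    cyclic-elim : ∀ {x a b c} → rep x ≡ a → Cyclic a b c →
                  ∃[ y ] ∃[ z ] x < y × y < z × z < N + x × rep y ≡ b × rep z ≡ c
    cyclic-elim {x} {a} {b} {c} refl cyc = main (base cyc)
      where
      A = x % N
      k = x / N
      x≡ : x ≡ k * N + toℕ a
      x≡ = trans (m≡m%n+[m/n]*n x N) (trans (+-comm A (k * N)) (cong (k * N +_) (sym (toℕ-rep x))))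
      base : Cyclic a b c → ∃[ y ] ∃[ z ] toℕ a < y × y < z × z < N + toℕ a × rep y ≡ b × rep z ≡ c
      base (inj₁ (p , q)) = toℕ b , toℕ c , p , q , <-≤-trans (toℕ<n c) (m≤m+n N _) , rep-toℕ b , rep-toℕ c
      base (inj₂ (inj₁ (p , q))) = N + toℕ b , N + toℕ c , <-≤-trans (toℕ<n a) (m≤m+n N _) ,
        +-monoʳ-< N p , +-monoʳ-< N q , trans (rep-shift _) (rep-toℕ b) , trans (rep-shift _) (rep-toℕ c)
      base (inj₂ (inj₂ (p , q))) = toℕ b , N + toℕ c , q , <-≤-trans (toℕ<n b) (m≤m+n N _) ,
        +-monoʳ-< N p , rep-toℕ b , trans (rep-shift _) (rep-toℕ c)
      main : _ → ∃[ y ] ∃[ z ] x < y × y < z × z < N + x × rep y ≡ b × rep z ≡ c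
      main (y , z , p , q , r , eb , ec) = k * N + y , k * N + z ,
        subst (_< k * N + y) (sym x≡) (+-monoʳ-< (k * N) p) , +-monoʳ-< (k * N) q ,
        lia 5 (λ m z n a x → z ≺ n ⊕ a ⇒ x ≂ m ⊕ a ⇒ ⊢ m ⊕ z ≺ n ⊕ x) (1 ∷ 0 ∷ 1 ∷ 1 ∷ []) [] (k * N) z N (toℕ a) x r x≡ ,
        trans (rep-shifts k y) eb , trans (rep-shifts k z) ec

    crosses-swap : ∀ {a b c d : Fin N} → Crosses a b c d → Crosses a b d c
    crosses-swap = [ inj₂ , inj₁ ]′

    -- The bound on y excludes arcs of length N - 1: they are sides of the polygon and not
    -- diagonals.
    Chord : Arcs → Fin N → Fin N → Set
    Chord E a b = ∃[ x ] ∃[ y ] Arc E x y × suc y < N + x × ((rep x ≡ a × rep y ≡ b) ⊎ (rep x ≡ b × rep y ≡ a))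

    -- Tests the one lift that starts in the first period; by periodicity this decides all lifts.
    directed : Arcs → Fin N → Fin N → Bool
    directed E a b = E (toℕ a) (lift (toℕ a) b) ∧ (suc (lift (toℕ a) b) <ᵇ N + toℕ a)

    chords : Arcs → ChordSet N
    chords E = tabulate λ a → tabulate λ b → directed E a b ∨ directed E b a

    bit : ChordSet N → ℕ → ℕ → Bool
    bit D x y = lookup (lookup D (rep x)) (rep y)

    bit⇒∈ : ∀ {D x y} → bit D x y ≡ true → rep x ─ rep y ∈ᶜ D
    bit⇒∈ {D} {x} {y} = lookup⇒[]= (rep y) (lookup D (rep x))

    ∈⇒bit : ∀ {D x y a b} → rep x ≡ a → rep y ≡ b → a ─ b ∈ᶜ D → bit D x y ≡ true
    ∈⇒bit refl refl = []=⇒lookup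

    module _ {E : Arcs} (family : Family N E) where
      open FamilyProperties family

      arc-shifts : ∀ k {x y} → Arc E x y → Arc E (k * N + x) (k * N + y)
      arc-shifts zero    e = e
      arc-shifts (suc k) {x} {y} e = trans (cong₂ E (+-assoc N _ x) (+-assoc N _ y)) (trans (periodic _ _) (arc-shifts k e))

      arc-unshifts : ∀ k {x y} → Arc E (k * N + x) (k * N + y) → Arc E x y
      arc-unshifts zero    e = e
      arc-unshifts (suc k) {x} {y} e = arc-unshifts k
        (trans (sym (periodic _ _)) (trans (sym (cong₂ E (+-assoc N _ x) (+-assoc N _ y))) e))

      record Based (x y : ℕ) : Set where
        constructor based
        field
          {k x₀ y₀} : ℕ
          start     : x ≡ k * N + x₀
          stop      : y ≡ k * N + y₀
          bound     : x₀ < N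
          arc₀      : Arc E x₀ y₀

      rebase : ∀ {x y} → Arc E x y → Based x y
      rebase {x} {y} e with offset (≤-trans (≤-trans (m≤n+m (x / N * N) (x % N)) (≤-reflexive (sym (m≡m%n+[m/n]*n x N)))) (<⇒≤ (proper e)))
      ... | y₀ , eq = based {k = x / N} x≡ eq (m%n<n x N) (arc-unshifts (x / N) (subst₂ (Arc E) x≡ eq e))
        where
        x≡ : x ≡ x / N * N + x % N
        x≡ = trans (m≡m%n+[m/n]*n x N) (+-comm (x % N) _)

      chords⁻ : ∀ {a b} → a ─ b ∈ᶜ chords E → Chord E a b
      chords⁻ {a} {b} a─b with Equivalence.to (T-∨ {directed E a b}) (Equivalence.from T-≡
          (trans (sym (trans (cong (λ r → lookup r b) (lookup∘tabulate _ a)) (lookup∘tabulate _ b))) ([]=⇒lookup a─b)))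
      ... | inj₁ t = let (p , q) = Equivalence.to (T-∧ {E (toℕ a) (lift (toℕ a) b)}) t in
        toℕ a , lift (toℕ a) b , Equivalence.to T-≡ p , <ᵇ⇒< _ _ q , inj₁ (rep-toℕ a , rep-lift _ b)
      ... | inj₂ t = let (p , q) = Equivalence.to (T-∧ {E (toℕ b) (lift (toℕ b) a)}) t in
        toℕ b , lift (toℕ b) a , Equivalence.to T-≡ p , <ᵇ⇒< _ _ q , inj₂ (rep-toℕ b , rep-lift _ a)

      private
        direct : ∀ {x y} → Arc E x y → suc y < N + x → T (directed E (rep x) (rep y))
        direct {x} {y} e y< with rebase e
        ... | based {k} {x₀} {y₀} refl refl x₀<N e₀ = Equivalence.from T-∧
          (Equivalence.from T-≡ (subst₂ (Arc E) (sym X) (sym Y) e₀) ,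
           <⇒<ᵇ (subst₂ (λ y x → suc y < N + x) (sym Y) (sym X)
             (lia 4 (λ m x y n → # 1 ⊕ (m ⊕ y) ≺ n ⊕ (m ⊕ x) ⇒ ⊢ # 1 ⊕ y ≺ n ⊕ x) (1 ∷ 1 ∷ []) [] (k * N) x₀ y₀ N y<)))
          where
          X : toℕ (rep (k * N + x₀)) ≡ x₀
          X = trans (cong toℕ (rep-shifts k x₀)) (toℕ-rep-< x₀<N)
          Y : lift (toℕ (rep (k * N + x₀))) (rep (k * N + y₀)) ≡ y₀
          Y = trans (cong (λ u → lift u _) X) (lift-unique (sym (rep-shifts k y₀)) (<⇒≤ (proper e₀)) (short e₀))

      chords⁺ : ∀ {a b} → Chord E a b → a ─ b ∈ᶜ chords E
      chords⁺ {a} {b} (x , y , e , y< , ends) = lookup⇒[]= b (lookup (chords E) a)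
        (trans (trans (cong (λ r → lookup r b) (lookup∘tabulate _ a)) (lookup∘tabulate _ b))
          (Equivalence.to T-≡ (Equivalence.from (T-∨ {directed E a b}) (orient ends))))
        where
        orient : _ → T (directed E a b) ⊎ T (directed E b a)
        orient (inj₁ (refl , refl)) = inj₁ (direct e y<)
        orient (inj₂ (refl , refl)) = inj₂ (direct e y<)

      private
        -- A translate of the arc is moved over Y, and the lifts of t fall beyond its ends. The
        -- bound N ≤ Y ensures that the translate has a natural number as its start.
        separate : ∀ {x y s t Y} → Arc E x y → Cyclic (rep x) s (rep y) → Cyclic (rep y) t (rep x) →
                   rep Y ≡ s → N ≤ Y →
                   ∃[ a ] ∃[ b ] Arc E a b × a < Y × Y < b × (∀ {Z} → rep Z ≡ t → a ≤ Z → Z ≤ b → ⊥)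
        separate {s = s} {t} {Y} e c d refl N≤Y with rebase e
        ... | based {k} {x} {y} refl refl x<N e₀
          with cyclic-elim {x} (sym (rep-shifts k x)) c | cyclic-elim {y} (sym (rep-shifts k y)) d
        ... | y₁ , z₁ , x<y₁ , y₁<z₁ , z₁< , y₁≡ , z₁≡ | y₂ , z₂ , y<y₂ , y₂<z₂ , z₂< , y₂≡ , z₂≡
          with refl ← trans (sym (lift-unique (trans z₁≡ (rep-shifts k y)) (<⇒≤ (<-trans x<y₁ y₁<z₁)) z₁<))
                            (lift-unique refl (<⇒≤ (proper e₀)) (short e₀))
          with refl ← trans (sym (lift-unique (trans z₂≡ (trans (rep-shifts k x) (sym (rep-shift x)))) (<⇒≤ (<-trans y<y₂ y₂<z₂)) z₂<))
                            (lift-unique refl (<⇒≤ (short e₀)) (+-monoʳ-< N (proper e₀)))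
          with align y₁≡ (lia 5 (λ y y₁ n x Y → y₁ ≺ y ⇒ y ≺ n ⊕ x ⇒ x ≺ n ⇒ n ≼ Y ⇒ ⊢ y₁ ≺ n ⊕ Y) (1 ∷ 1 ∷ 1 ∷ 1 ∷ 1 ∷ []) [] y y₁ N x Y y₁<z₁ (short e₀) x<N N≤Y)
        ... | j , refl = j * N + x , j * N + y , arc-shifts j e₀ , +-monoʳ-< (j * N) x<y₁ , +-monoʳ-< (j * N) y₁<z₁ , outside
          where
          outside : ∀ {Z} → rep Z ≡ t → j * N + x ≤ Z → Z ≤ j * N + y → ⊥
          outside {Z} Z≡ lo hi = <⇒≱ (+-monoʳ-< (j * N) y<y₂) (subst (_≤ j * N + y) same hi)
            where
            lo′ = lia 4 (λ m x y z → x ≺ y ⇒ y ≺ z ⇒ ⊢ m ⊕ x ≼ m ⊕ z) (1 ∷ 1 ∷ 1 ∷ []) [] (j * N) x y y₂ (proper e₀) y<y₂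
            hi′ = lia 4 (λ m x y n → y ≺ n ⊕ x ⇒ ⊢ m ⊕ y ≺ n ⊕ (m ⊕ x)) (1 ∷ 1 ∷ []) [] (j * N) x y₂ N y₂<z₂
            same : Z ≡ j * N + y₂
            same = trans (sym (lift-unique refl lo (≤-<-trans hi
                (lia 4 (λ m x y n → y ≺ n ⊕ x ⇒ ⊢ m ⊕ y ≺ n ⊕ (m ⊕ x)) (1 ∷ 1 ∷ []) [] (j * N) x y N (short e₀)))))
              (trans (cong (lift (j * N + x)) (trans Z≡ (trans (sym y₂≡) (sym (rep-shifts j y₂))))) (lift-unique refl lo′ hi′))

      -- Crossing restated on the line: an arc strictly over Y that does not reach Z even with its
      -- ends.
      Separated : ℕ → ℕ → Set
      Separated Y Z = ∃[ a ] ∃[ b ] Arc E a b × a < Y × Y < b × (a ≤ Z → Z ≤ b → ⊥)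

      crosses⇒separated : ∀ {a b s t Y Z} → Chord E a b → Crosses a b s t → rep Y ≡ s → rep Z ≡ t →
                          N ≤ Y → N ≤ Z → Separated Y Z ⊎ Separated Z Y
      crosses⇒separated {Y = Y} {Z} (x , y , e , _ , ends) cr Y≡ Z≡ N≤Y N≤Z = go ends cr
        where
        sep : ∀ {s t Y Z} → rep Y ≡ s → rep Z ≡ t → N ≤ Y → Cyclic (rep x) s (rep y) → Cyclic (rep y) t (rep x) → Separated Y Z
        sep Y≡ Z≡ N≤Y c d = let (a , b , f , l , r , o) = separate e c d Y≡ N≤Y in a , b , f , l , r , o Z≡
        go : _ → _ → Separated Y Z ⊎ Separated Z Y
        go (inj₁ (refl , refl)) (inj₁ (c , d)) = inj₁ (sep Y≡ Z≡ N≤Y c d)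
        go (inj₁ (refl , refl)) (inj₂ (c , d)) = inj₂ (sep Z≡ Y≡ N≤Z c d)
        go (inj₂ (refl , refl)) (inj₁ (c , d)) = inj₂ (sep Z≡ Y≡ N≤Z d c)
        go (inj₂ (refl , refl)) (inj₂ (c , d)) = inj₁ (sep Y≡ Z≡ N≤Y d c)

      separated⇒crosses : ∀ {x y Y Z} → Arc E x y → x < Y → Y < y → y < Z → Z < N + x →
                          ∃[ a ] ∃[ b ] a ─ b ∈ᶜ chords E × Crosses a b (rep Y) (rep Z)
      separated⇒crosses {x} {y} {Y} {Z} e x<Y Y<y y<Z Z< = rep x , rep y ,
        chords⁺ (x , y , e , ≤-<-trans y<Z Z< , inj₁ (refl , refl)) ,
        inj₁ (cyclic-intro x<Y Y<y (short e) ,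
              subst (Cyclic (rep y) (rep Z)) (rep-shift x) (cyclic-intro y<Z Z< (+-monoʳ-< N (proper e))))

      isDissection : IsDissection (chords E)
      isDissection = record
        { symmetric = λ c → let (x , y , e , y< , ends) = chords⁻ c in
            chords⁺ (x , y , e , y< , [ inj₂ , inj₁ ]′ ends)
        ; diagonals = λ c → let (x , y , e , y< , ends) = chords⁻ c in diagonal (long e) (short e) y< ends
        ; noncrossing = λ c d cr → let (x , y , e , _ , ends) = chords⁻ d in crossing (chords⁻ c) e ends cr }
        where
        distinct : ∀ {x y} → x < y → y < N + x → rep x ≢ rep y
        distinct x<y y< eq = <⇒≢ x<y (rep-injective eq (<⇒≤ x<y) y<)
        diagonal′ : ∀ {x y} → 2 + x ≤ y → y < N + x → suc y < N + x → IsDiagonal (rep x) (rep y)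
        diagonal′ {x} {y} lo y< hi = distinct (<⇒≤ lo) y< ,
          (λ eq → distinct lo (≤-trans y< (+-monoʳ-≤ N (n≤1+n x))) (trans (sym (next-rep x)) eq)) ,
          λ eq → distinct hi (<-≤-trans (+-monoʳ-< N (<⇒≤ lo)) (+-monoʳ-≤ N (n≤1+n y)))
            (trans (sym (next-rep y)) (trans eq (sym (rep-shift x))))
        diagonal : ∀ {x y a b} → 2 + x ≤ y → y < N + x → suc y < N + x →
                   (rep x ≡ a × rep y ≡ b) ⊎ (rep x ≡ b × rep y ≡ a) → IsDiagonal a b
        diagonal lo y< hi (inj₁ (refl , refl)) = diagonal′ lo y< hi
        diagonal lo y< hi (inj₂ (refl , refl)) = let (p , q , r) = diagonal′ lo y< hi in p ∘ sym , r , q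
        -- By `nested`, an arc strictly over one end of another arc reaches the other end as well.
        apart : ∀ {Y Z} → Arc E Y Z → Separated Y Z ⊎ Separated Z Y → ⊥
        apart e (inj₁ (a , b , f , a<Y , Y<b , out)) =
          out (<⇒≤ (<-trans a<Y (proper e))) (nested f e a<Y Y<b)
        apart {Y} {Z} e (inj₂ (a , b , f , a<Z , Z<b , out)) with ≤-<-connex a Y
        ... | inj₁ a≤Y = out a≤Y (<⇒≤ (<-trans (proper e) Z<b))
        ... | inj₂ Y<a = <⇒≱ Z<b (nested e f Y<a a<Z)
        crossing : ∀ {a b c d x y} → Chord E a b → Arc E x y →
                   (rep x ≡ c × rep y ≡ d) ⊎ (rep x ≡ d × rep y ≡ c) → ¬ Crosses a b c d
        -- The arc is moved up one period to meet the bounds N ≤ Y and N ≤ Z.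
        crossing {x = x} {y} ch e ends cr = apart (trans (periodic x y) e) (go ends cr)
          where
          sep = λ cr → crosses⇒separated ch cr (rep-shift x) (rep-shift y) (m≤m+n N x) (m≤m+n N y)
          go : _ → _ → Separated (N + x) (N + y) ⊎ Separated (N + y) (N + x)
          go (inj₁ (refl , refl)) cr = sep cr
          go (inj₂ (refl , refl)) cr = sep (crosses-swap cr)

-- Subgons of the dissection of a family

module Subgons where
  open import Data.Bool.Base using (true; false)
  open import Data.Empty using (⊥; ⊥-elim)
  open import Data.Fin.Base using (Fin; toℕ; zero; suc)
  open import Data.Fin.Properties using (all?; any?) renaming (_≟_ to _≟ᶠ_)
  open import Data.Fin.Subset using (Subset; _∈_; ∣_∣; inside; outside; _⊆_; ⁅_⁆; _∪_)
  open import Data.Fin.Subset.Properties using (_∈?_; ⊆-antisym; p⊆q⇒∣p∣≤∣q∣; ∣⁅x⁆∣≡1; x∈p∪q⁺; x∈⁅x⁆)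
  open import Data.List.Base using ([]; _∷_; List)
  open import Data.Nat.Base
  open import Data.Nat.Properties
  open import Data.Product.Base using (∃-syntax; _×_; _,_; proj₁; proj₂)
  open import Data.Sum.Base using (_⊎_; inj₁; inj₂; [_,_]′)
  open import Data.Vec.Base using (tabulate; []; _∷_)
  open import Data.Vec.Properties using (lookup∘tabulate; lookup⇒[]=; []=⇒lookup)
  open import Function.Base using (_∘_)
  open import Function.Bundles using (mk⇔)
  open import Relation.Binary.PropositionalEquality
  open import Relation.Nullary.Decidable.Core using (Dec; yes; no; does; _×-dec_; _⊎-dec_; _→-dec_; ¬?)
  open import Relation.Nullary.Negation using (¬_; contradiction)

  open import Defs
  open Linear
  open Sums
  open Card
  open Arcs
  open Polygon

  subset : ∀ {n} {P : Fin n → Set} → (∀ i → Dec (P i)) → Subset n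
  subset P? = tabulate (does ∘ P?)

  ∈-subset⁺ : ∀ {n} {P : Fin n → Set} (P? : ∀ i → Dec (P i)) {i} → P i → i ∈ subset P?
  ∈-subset⁺ P? {i} p = lookup⇒[]= i _ (trans (lookup∘tabulate _ i) (true! (P? i)))
    where
    true! : (d : Dec _) → does d ≡ inside
    true! (yes _) = refl
    true! (no ¬p) = contradiction p ¬p

  ∈-subset⁻ : ∀ {n} {P : Fin n → Set} (P? : ∀ i → Dec (P i)) {i} → i ∈ subset P? → P i
  ∈-subset⁻ P? {i} i∈ with P? i | trans (sym (lookup∘tabulate (does ∘ P?) i)) ([]=⇒lookup i∈)
  ... | yes p | _ = p
  ... | no _  | ()

  ∣subset∣ : ∀ {n} {P : Fin n → Set} (P? : ∀ i → Dec (P i)) (f : ℕ → ℕ) →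
             (∀ i → 𝟙 (P? i) ≡ f (toℕ i)) → ∣ subset P? ∣ ≡ Σ< n f
  ∣subset∣ {zero}  P? f h = refl
  ∣subset∣ {suc n} P? f h = trans (step (P? zero) (h zero)) (sym (Σ-split 1 n f))
    where
    step : (d : Dec _) → 𝟙 d ≡ f 0 → ∣ does d ∷ subset (P? ∘ suc) ∣ ≡ f 0 + Σ< n (f ∘ suc)
    step (yes _) eq = cong₂ _+_ eq (∣subset∣ (P? ∘ suc) (f ∘ suc) (h ∘ suc))
    step (no _)  eq = cong₂ _+_ eq (∣subset∣ (P? ∘ suc) (f ∘ suc) (h ∘ suc))

  ∣∪∣ : ∀ {n} (p q : Subset n) → ∣ p ∪ q ∣ ≤ ∣ p ∣ + ∣ q ∣
  ∣∪∣ []            []            = z≤n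
  ∣∪∣ (inside  ∷ p) (inside  ∷ q) = s≤s (≤-trans (∣∪∣ p q) (+-monoʳ-≤ ∣ p ∣ (n≤1+n _)))
  ∣∪∣ (inside  ∷ p) (outside ∷ q) = s≤s (∣∪∣ p q)
  ∣∪∣ (outside ∷ p) (inside  ∷ q) = ≤-trans (s≤s (∣∪∣ p q)) (≤-reflexive (sym (+-suc ∣ p ∣ _)))
  ∣∪∣ (outside ∷ p) (outside ∷ q) = ∣∪∣ p q

  third-element : ∀ {n} (S : Subset n) → 3 ≤ ∣ S ∣ → ∀ p q → ∃[ i ] i ∈ S × i ≢ p × i ≢ q
  third-element S 3≤ p q with any? (λ i → (i ∈? S) ×-dec ¬? (i ≟ᶠ p) ×-dec ¬? (i ≟ᶠ q))
  ... | yes found = found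
  ... | no none = contradiction (≤-trans 3≤ (≤-trans (p⊆q⇒∣p∣≤∣q∣ sub)
      (≤-trans (∣∪∣ ⁅ p ⁆ ⁅ q ⁆) (≤-reflexive (cong₂ _+_ (∣⁅x⁆∣≡1 p) (∣⁅x⁆∣≡1 q)))))) λ { (s≤s (s≤s ())) }
    where
    sub : S ⊆ ⁅ p ⁆ ∪ ⁅ q ⁆
    sub {i} i∈ with i ≟ᶠ p | i ≟ᶠ q
    ... | yes refl | _        = x∈p∪q⁺ (inj₁ (x∈⁅x⁆ p))
    ... | no _     | yes refl = x∈p∪q⁺ (inj₂ (x∈⁅x⁆ q))
    ... | no i≢p   | no i≢q   = ⊥-elim (none (i , i∈ , i≢p , i≢q))

  tally : ℕ → List ℕ → ℕ
  tally i []      = 0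
  tally i (j ∷ l) = 𝟙 (j ≟ i) + tally i l

  module _ {N : ℕ} .{{_ : NonZero N}} {E : Arcs} (family : Family N E) where
    open FamilyProperties family

    InRegion : ℕ → ℕ → ℕ → Set
    InRegion u v y = y ≡ u ⊎ y ≡ v ⊎ Own E u v y

    inRegion? : ∀ u v y → Dec (InRegion u v y)
    inRegion? u v y = (y ≟ u) ⊎-dec (y ≟ v) ⊎-dec own? E u v y

    abstract
      region : ℕ → ℕ → Subset N
      region u v = subset λ i → inRegion? u v (lift u i)

      -- Tested at N + i, because an arc over the vertex i itself may have to start before 0.
      outer : Subset N
      outer = subset λ i → ¬? (covered? (N + toℕ i))

      region⁺ : ∀ {u v i} → InRegion u v (lift u i) → i ∈ region u v
      region⁺ {u} {v} = ∈-subset⁺ (λ i → inRegion? u v (lift u i))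

      region⁻ : ∀ {u v i} → i ∈ region u v → InRegion u v (lift u i)
      region⁻ {u} {v} = ∈-subset⁻ (λ i → inRegion? u v (lift u i))

      outer⁺ : ∀ {i} → ¬ Covered (N + toℕ i) → i ∈ outer
      outer⁺ = ∈-subset⁺ (λ i → ¬? (covered? (N + toℕ i)))

      outer⁻ : ∀ {i} → i ∈ outer → ¬ Covered (N + toℕ i)
      outer⁻ = ∈-subset⁻ (λ i → ¬? (covered? (N + toℕ i)))

      ∣outer∣ : ∣ outer ∣ ≡ uncovered
      ∣outer∣ = ∣subset∣ {n = N} (λ i → ¬? (covered? (N + toℕ i))) (λ y → 𝟙 (¬? (covered? (N + y)))) λ i → refl

      -- In a window that starts at u, the lift of the class of u + t is u + t itself, so membership
      -- splits into the start, the end and the owned vertices.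
      ∣region∣ : ∀ {u v} → Arc E u v → ∣ region u v ∣ ≡ 2 + size E u v
      ∣region∣ {u} {v} e with l , refl ← offset (<⇒≤ (proper e)) = begin
        ∣ region u v ∣
          ≡⟨ ∣subset∣ (λ i → inRegion? u v (lift u i)) f (λ i → cong (λ j → 𝟙 (inRegion? u v (lift u j))) (sym (rep-toℕ i))) ⟩
        Σ< N f
          ≡⟨ Σ-window N f (λ x → cong (λ j → 𝟙 (inRegion? u v (lift u j))) (rep-shift x)) u ⟨
        Σ< N (λ t → f (u + t))
          ≡⟨ Σ-cong N (λ t t<N → trans (cong (λ y → 𝟙 (inRegion? u v y)) (lift-unique refl (m≤m+n u t) (in-window t<N))) (parts (t ≟ 0) (t ≟ l) (own? E u v (u + t)))) ⟩
        Σ< N (λ t → 𝟙 (t ≟ 0) + (𝟙 (t ≟ l) + 𝟙 (own? E u v (u + t))))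
          ≡⟨ trans (Σ-+ N _ _) (cong (Σ< N (λ t → 𝟙 (t ≟ 0)) +_) (Σ-+ N _ _)) ⟩
        Σ< N (λ t → 𝟙 (t ≟ 0)) + (Σ< N (λ t → 𝟙 (t ≟ l)) + Σ< N (λ t → 𝟙 (own? E u v (u + t))))
          ≡⟨ cong₂ _+_ (once 0 (≤-<-trans z≤n l<N)) (cong₂ _+_ (once l l<N) (sym (size-window u l l<N))) ⟩
        2 + size E u v ∎
        where
        open ≡-Reasoning
        f : ℕ → ℕ
        f x = 𝟙 (inRegion? u v (lift u (rep x)))
        l<N : l < N
        l<N = lia 3 (λ u l n → u ⊕ l ≺ n ⊕ u ⇒ ⊢ l ≺ n) (1 ∷ 1 ∷ []) [] u l N (short e)
        0<l : 0 < l
        0<l = lia 2 (λ u l → u ≺ u ⊕ l ⇒ ⊢ # 0 ≺ l) (1 ∷ 1 ∷ []) [] u l (proper e)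
        in-window : ∀ {t} → t < N → u + t < N + u
        in-window {t} t<N = lia 3 (λ u t n → t ≺ n ⇒ ⊢ u ⊕ t ≺ n ⊕ u) (1 ∷ 1 ∷ []) [] u t N t<N
        once : ∀ k → k < N → Σ< N (λ t → 𝟙 (t ≟ k)) ≡ 1
        once k k<N = trans (Σ-single N k _ k<N λ t _ t≢k → 𝟙-no (t ≟ k) t≢k) (𝟙-yes (k ≟ k) refl)
        parts : ∀ {t} (a : Dec (t ≡ 0)) (b : Dec (t ≡ l)) (c : Dec (Own E u v (u + t))) →
                𝟙 (inRegion? u v (u + t)) ≡ 𝟙 a + (𝟙 b + 𝟙 c)
        parts (yes refl) (yes refl) _ = contradiction 0<l λ ()
        parts (yes refl) (no _) (yes o) = contradiction (Own.left o) (≤⇒≯ (≤-reflexive (+-identityʳ u)))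
        parts (yes refl) (no _) (no _) = 𝟙-yes (inRegion? u v _) (inj₁ (+-identityʳ u))
        parts (no _) (yes refl) (yes o) = contradiction (Own.right o) (<-irrefl refl)
        parts (no _) (yes refl) (no _) = 𝟙-yes (inRegion? u v _) (inj₂ (inj₁ refl))
        parts (no _) (no _) (yes o) = 𝟙-yes (inRegion? u v _) (inj₂ (inj₂ o))
        parts (no t≢0) (no t≢l) (no ¬o) = 𝟙-no (inRegion? u v _)
          [ (λ eq → t≢0 (+-cancelˡ-≡ u _ _ (trans eq (sym (+-identityʳ u))))) , [ t≢l ∘ +-cancelˡ-≡ u _ _ , ¬o ]′ ]′

    private
      inRegion-bounds : ∀ {u v y} → Arc E u v → InRegion u v y → u ≤ y × y ≤ v
      inRegion-bounds e (inj₁ refl)        = ≤-refl , <⇒≤ (proper e)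
      inRegion-bounds e (inj₂ (inj₁ refl)) = <⇒≤ (proper e) , ≤-refl
      inRegion-bounds e (inj₂ (inj₂ o))    = <⇒≤ (Own.left o) , <⇒≤ (Own.right o)

      inRegion-shift : ∀ {u v y} → InRegion u v y → InRegion (N + u) (N + v) (N + y)
      inRegion-shift (inj₁ refl)        = inj₁ refl
      inRegion-shift (inj₂ (inj₁ refl)) = inj₂ (inj₁ refl)
      inRegion-shift (inj₂ (inj₂ o))    = inj₂ (inj₂ (own-periodic o))

      -- Suppose an arc is over y. If it starts before u, `nested` makes it cover the whole region.
      -- If it lies within [u , v], then y is owned by (u , v) and the two arcs coincide. If it ends
      -- beyond v, it must start at u and contains z.
      together : ∀ {u v y z} → Arc E u v → InRegion u v y → InRegion u v z → ¬ Separated family y z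
      together {u} {v} {y} {z} e iy iz (a , b , f , a<y , y<b , out) with ≤-<-connex u a | ≤-<-connex b v
      ... | inj₂ a<u | _ = out (≤-trans (<⇒≤ a<u) (proj₁ (inRegion-bounds e iz)))
        (≤-trans (proj₂ (inRegion-bounds e iz)) (nested f e a<u (≤-<-trans (proj₁ (inRegion-bounds e iy)) y<b)))
      ... | inj₁ u≤a | inj₁ b≤v = inner iy
        where
        inner : InRegion u v y → ⊥
        inner (inj₁ refl)        = <⇒≱ a<y u≤a
        inner (inj₂ (inj₁ refl)) = <⇒≱ y<b b≤v
        inner (inj₂ (inj₂ o)) with Own.smallest o f u≤a a<y y<b b≤v
        ... | refl , refl = out (proj₁ (inRegion-bounds e iz)) (proj₂ (inRegion-bounds e iz))
      ... | inj₁ u≤a | inj₂ v<b with m≤n⇒m<n∨m≡n u≤a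
      ...   | inj₁ u<a = <⇒≱ v<b (nested e f u<a (<-≤-trans a<y (proj₂ (inRegion-bounds e iy))))
      ...   | inj₂ refl = out (proj₁ (inRegion-bounds e iz)) (≤-trans (proj₂ (inRegion-bounds e iz)) (<⇒≤ v<b))

      region-unseparated : ∀ {u v s t a b} → Arc E u v → s ∈ region u v → t ∈ region u v →
                           a ─ b ∈ᶜ chords E → ¬ Crosses a b s t
      region-unseparated {u} {v} {s} {t} e s∈ t∈ c cr with
        crosses⇒separated family (chords⁻ family c) cr (trans (rep-shift _) (rep-lift u s)) (trans (rep-shift _) (rep-lift u t))
          (m≤m+n N _) (m≤m+n N _)
      ... | inj₁ sep = together (trans (periodic u v) e) (inRegion-shift (region⁻ s∈)) (inRegion-shift (region⁻ t∈)) sep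
      ... | inj₂ sep = together (trans (periodic u v) e) (inRegion-shift (region⁻ t∈)) (inRegion-shift (region⁻ s∈)) sep

      rep∈region : ∀ {u v y} → Arc E u v → InRegion u v y → rep y ∈ region u v
      rep∈region {u} {v} {y} e iy = region⁺ (subst (InRegion u v) (sym (lift-unique refl lo (≤-<-trans hi (short e)))) iy)
        where
        lo = proj₁ (inRegion-bounds e iy)
        hi = proj₂ (inRegion-bounds e iy)

      shifted∈region : ∀ {u v y} → Arc E u v → InRegion u v y → rep (N + y) ∈ region u v
      shifted∈region {u} {v} {y} e iy = subst (_∈ region u v) (sym (rep-shift y)) (rep∈region e iy)

      covers : ∀ {a b x} → Arc E a b → a < x → x < b → Covered x
      covers {a} {b} {x} e a<x x<b = a , a<x , b , <-trans (short e) (+-monoʳ-< N a<x) , e , x<b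

      covers-rep : ∀ {a b x y} → Arc E a b → a < x → x < b → N ≤ y → rep x ≡ rep y → Covered y
      covers-rep {x = x} {y} e a<x x<b N≤y eq with rebase family e
      ... | based {k} {a} {b} refl refl a<N e₀ with x₀ , refl ← offset (≤-trans (m≤m+n (k * N) a) (<⇒≤ a<x))
        with align (trans (sym (rep-shifts k x₀)) eq)
               (lia 5 (λ x b n a y → x ≺ b ⇒ b ≺ n ⊕ a ⇒ a ≺ n ⇒ n ≼ y ⇒ ⊢ x ≺ n ⊕ y) (1 ∷ 1 ∷ 1 ∷ 1 ∷ 1 ∷ []) [] x₀ b N a y (+-cancelˡ-< (k * N) _ _ x<b) (short e₀) a<N N≤y)
      ... | j , refl = covers (arc-shifts family j e₀) (+-monoʳ-< (j * N) (+-cancelˡ-< (k * N) _ _ a<x))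
        (+-monoʳ-< (j * N) (+-cancelˡ-< (k * N) _ _ x<b))

      outer-unseparated : ∀ {s t a b} → s ∈ outer → t ∈ outer → a ─ b ∈ᶜ chords E → ¬ Crosses a b s t
      outer-unseparated {s} {t} s∈ t∈ c cr with
        crosses⇒separated family (chords⁻ family c) cr (trans (rep-shift _) (rep-toℕ s)) (trans (rep-shift _) (rep-toℕ t))
          (m≤m+n N _) (m≤m+n N _)
      ... | inj₁ (a , b , e , l , r , _) = outer⁻ s∈ (covers e l r)
      ... | inj₂ (a , b , e , l , r , _) = outer⁻ t∈ (covers e l r)

    -- For maximality take the lift of w in the window of u. Beyond v, the arc separates it from a
    -- vertex directly under the arc. Strictly inside, its owner is (u , v), or else separates it
    -- from the end v or from the copy N + u of the start.
    region-isSubgon : ∀ {u v} → Arc E u v → IsSubgon (chords E) (region u v)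
    region-isSubgon {u} {v} e = record { unseparated = region-unseparated e ; maximal = maximal }
      where
      maximal : ∀ {w} → (∀ {s a b} → s ∈ region u v → a ─ b ∈ᶜ chords E → ¬ Crosses a b w s) → w ∈ region u v
      maximal {w} free = subst (_∈ region u v) (rep-lift u w) (go (<-cmp y v))
        where
        open import Relation.Binary.Definitions using (tri<; tri≈; tri>)
        y = lift u w
        clash : ∀ {z} → rep z ∈ region u v → ∃[ a ] ∃[ b ] a ─ b ∈ᶜ chords E × Crosses a b (rep y) (rep z) → ⊥
        clash z∈ (a , b , c , cr) = free z∈ c (subst (λ w → Crosses a b w _) (rep-lift u w) cr)
        go : _ → rep y ∈ region u v
        go (tri≈ _ y≡v _) = rep∈region e (inj₂ (inj₁ y≡v))
        go (tri> _ _ v<y) with directly-under e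
        ... | x , o with separated⇒crosses family e (Own.left o) (Own.right o) v<y (lift-< u w)
        ...   | a , b , c , cr = ⊥-elim (clash (rep∈region e (inj₂ (inj₂ o))) (a , b , c , crosses-swap {a = a} {b} cr))
        go (tri< y<v _ _) with m≤n⇒m<n∨m≡n (lift-≥ u w)
        ... | inj₂ u≡y = rep∈region e (inj₁ (sym u≡y))
        ... | inj₁ u<y with own-exists E e u<y y<v
        ...   | c , d , u≤c , d≤v , o with m≤n⇒m<n∨m≡n d≤v
        ...     | inj₁ d<v = ⊥-elim (clash (rep∈region e (inj₂ (inj₁ refl)))
                    (separated⇒crosses family (Own.arc o) (Own.left o) (Own.right o) d<v (<-≤-trans (short e) (+-monoʳ-≤ N u≤c))))
        ...     | inj₂ refl with m≤n⇒m<n∨m≡n u≤c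
        ...       | inj₁ u<c = ⊥-elim (clash (shifted∈region e (inj₁ refl))
                    (separated⇒crosses family (Own.arc o) (Own.left o) (Own.right o) (short e) (+-monoʳ-< N u<c)))
        ...       | inj₂ refl = rep∈region e (inj₂ (inj₂ o))

    -- If an arc passed over w, an uncovered vertex other than the two ends of that arc would be
    -- separated from w; three uncovered vertices provide one. A root that is a side or a central
    -- diagonal has only two and contributes no subgon.
    outer-isSubgon : 3 ≤ ∣ outer ∣ → IsSubgon (chords E) outer
    outer-isSubgon 3≤ = record { unseparated = outer-unseparated ; maximal = maximal }
      where
      maximal : ∀ {w} → (∀ {s a b} → s ∈ outer → a ─ b ∈ᶜ chords E → ¬ Crosses a b w s) → w ∈ outer
      maximal {w} free = outer⁺ λ (c , c<w , d , _ , e , w<d) →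
        let (z , z∈ , z≢c , z≢d) = third-element outer 3≤ (rep c) (rep d)
            Z    = lift c z
            c≢Z  = λ eq → z≢c (trans (sym (rep-lift c z)) (cong rep (sym eq)))
            d≢Z  = λ eq → z≢d (trans (sym (rep-lift c z)) (cong rep (sym eq)))
            c<Z  = ≤∧≢⇒< (lift-≥ c z) c≢Z
            Z≮d  = λ Z<d → outer⁻ z∈ (covers-rep e c<Z Z<d (m≤m+n N (toℕ z))
                     (trans (rep-lift c z) (sym (trans (rep-shift _) (rep-toℕ z)))))
            (a , b , ch , cr) = separated⇒crosses family e c<w w<d (≤∧≢⇒< (≮⇒≥ Z≮d) d≢Z) (lift-< c z)
        in free z∈ ch (subst₂ (Crosses a b) (trans (rep-shift _) (rep-toℕ w)) (rep-lift c z) cr)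

    private
      Within : Subset N → ℕ → ℕ → Set
      Within S u v = ∀ i → i ∈ S → lift u i ≤ v

      within? : ∀ S u v → Dec (Within S u v)
      within? S u v = all? λ i → (i ∈? S) →-dec (lift u i ≤? v)

      -- Indexed by length, so that `least` picks a shortest arc over S.
      Hull : Subset N → ℕ → Set
      Hull S l = ∃[ u ] u < N × Arc E u (u + l) × Within S u (u + l)

      abstract
        hull? : ∀ S l → Dec (Hull S l)
        hull? S l = anyUpTo? (λ u → arc? E u (u + l) ×-dec within? S u (u + l)) N

        some-hull? : ∀ S → Dec (∃[ l ] l < N × Hull S l)
        some-hull? S = anyUpTo? (hull? S) N

      hull : ∀ {S u l} → Arc E u (u + l) → Within S u (u + l) → Hull S l
      hull {S} {u} {l} e within with rebase family e
      ... | based {k} {u₀} {v₀} refl eq u₀<N e₀ with refl ← +-cancelˡ-≡ (k * N) (u₀ + l) v₀ (trans (sym (+-assoc (k * N) u₀ l)) eq) =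
        u₀ , u₀<N , e₀ , λ i i∈ → +-cancelˡ-≤ (k * N) _ _
          (subst₂ _≤_ (lift-shifts k u₀ i) (+-assoc (k * N) u₀ l) (within i i∈))

      -- A vertex of S strictly under the arc would be separated from any vertex of S beyond it.
      spans : ∀ {S} → IsSubgon (chords E) S → ∀ {c d y} → Arc E c d → c < y → y < d → rep y ∈ S → Within S c d
      spans {S} sub {c} {d} {y} e c<y y<d y∈ i i∈ = ≮⇒≥ λ d<l →
        let (a , b , ch , cr) = separated⇒crosses family e c<y y<d d<l (lift-< c i)
        in IsSubgon.unseparated sub y∈ i∈ ch (subst (Crosses a b (rep y)) (rep-lift c i) cr)

    -- Take a shortest arc that spans S. A vertex of S with a shorter owner would, by `spans`, give
    -- a shorter spanning arc, so S lies in the region of the chosen one. If no arc spans S, then no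
    -- vertex of S is covered. The reverse inclusions come from the maximality of S.
    classify : ∀ {S} → IsSubgon (chords E) S → (∃[ u ] ∃[ v ] u < N × Arc E u v × S ≡ region u v) ⊎ S ≡ outer
    classify {S} sub with some-hull? S
    ... | yes (l , _ , h) with least (hull? S) l h
    ...   | m , _ , (u , u<N , e , within) , shortest = inj₁ (u , u + m , u<N , e , ⊆-antisym into onto)
      where
      into : S ⊆ region u (u + m)
      into {i} i∈ = subst (_∈ region u (u + m)) (rep-lift u i) (go (m≤n⇒m<n∨m≡n (lift-≥ u i)) (m≤n⇒m<n∨m≡n (within i i∈)))
        where
        go : _ → _ → rep (lift u i) ∈ region u (u + m)
        go (inj₂ eq) _ = rep∈region e (inj₁ (sym eq))
        go (inj₁ _) (inj₂ eq) = rep∈region e (inj₂ (inj₁ eq))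
        go (inj₁ u<y) (inj₁ y<v) with own-exists E e u<y y<v
        ... | c , d , u≤c , d≤v , o with k , refl ← offset (<⇒≤ (proper (Own.arc o))) with k <? m
        ...   | yes k<m = ⊥-elim (shortest k k<m (hull (Own.arc o)
                  (spans sub (Own.arc o) (Own.left o) (Own.right o) (subst (_∈ S) (sym (rep-lift u i)) i∈))))
        ...   | no k≮m = rep∈region e (inj₂ (inj₂ (subst₂ (λ c d → Own E c d (lift u i)) c≡u v≡ o)))
          where
          c≡u : c ≡ u
          c≡u = lia 4 (λ u c k m → u ≼ c ⇒ c ⊕ k ≼ u ⊕ m ⇒ m ≼ k ⇒ ⊢ c ≂ u) (1 ∷ 1 ∷ 1 ∷ []) (1 ∷ 0 ∷ 0 ∷ 1 ∷ []) u c k m u≤c d≤v (≮⇒≥ k≮m)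
          v≡ : c + k ≡ u + m
          v≡ = lia 4 (λ u c k m → u ≼ c ⇒ c ⊕ k ≼ u ⊕ m ⇒ m ≼ k ⇒ ⊢ c ⊕ k ≂ u ⊕ m) (1 ∷ 0 ∷ 1 ∷ []) (1 ∷ 1 ∷ 0 ∷ 1 ∷ []) u c k m u≤c d≤v (≮⇒≥ k≮m)
      onto : region u (u + m) ⊆ S
      onto i∈ = IsSubgon.maximal sub λ s∈ ch → region-unseparated e i∈ (into s∈) ch
    classify {S} sub | no none = inj₂ (⊆-antisym into onto)
      where
      into : S ⊆ outer
      into {i} i∈ = outer⁺ uncover
        where
        uncover : ¬ Covered (N + toℕ i)
        uncover (c , c<i , d , _ , e , i<d) with k , refl ← offset (<⇒≤ (proper e)) =
          none (k , lia 3 (λ c k n → c ⊕ k ≺ n ⊕ c ⇒ ⊢ k ≺ n) (1 ∷ 1 ∷ []) [] c k N (short e) ,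
            hull e (spans sub e c<i i<d (subst (_∈ S) (sym (trans (rep-shift _) (rep-toℕ i))) i∈)))
      onto : outer ⊆ S
      onto i∈ = IsSubgon.maximal sub λ s∈ ch → outer-unseparated i∈ (into s∈) ch

    private
      abstract
        -- A vertex owned by (u , v) determines which translate (A , B) of (a , b) to compare with
        -- (U , V). If U were left of A, its class would reappear at N + U ≤ B ≤ V, too far for an
        -- arc; an end V beyond B is excluded by `nested` or, when A is U, by membership.
        region-⊆ : ∀ {u v a b} → Arc E u v → Arc E a b → a < N → region u v ⊆ region a b →
                   ∃[ k ] k * N + a ≤ N + u × N + v ≤ k * N + b
        region-⊆ {u} {v} {a} {b} e f a<N sub with directly-under e
        ... | x , o with inRegion-bounds f (region⁻ (sub (rep∈region e (inj₂ (inj₂ o)))))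
        ...   | a≤X , X≤b with align (trans (rep-lift a (rep x)) (sym (rep-shift x)))
                (lia 4 (λ l n a x → l ≺ n ⊕ a ⇒ a ≺ n ⇒ ⊢ l ≺ n ⊕ (n ⊕ x)) (1 ∷ 1 ∷ 1 ∷ []) [] (lift a (rep x)) N a x (lift-< a (rep x)) a<N)
        ...     | k , eq = k , left , right
          where
          A B U V : ℕ
          A = k * N + a
          B = k * N + b
          U = N + u
          V = N + v
          A≤x : A ≤ N + x
          A≤x = subst (A ≤_) (sym eq) (+-monoʳ-≤ (k * N) a≤X)
          x≤B : N + x ≤ B
          x≤B = subst (_≤ B) (sym eq) (+-monoʳ-≤ (k * N) X≤b)
          e′ : Arc E U V
          e′ = trans (periodic u v) e
          f′ : Arc E A B
          f′ = arc-shifts family k f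
          inside-B : ∀ {y} → InRegion u v y → ∀ {Y} → rep Y ≡ rep y → A ≤ Y → Y < N + A → Y ≤ B
          inside-B iy eq lo hi = subst (_≤ B) (trans (sym (lift-shifts k a _)) (lift-unique eq lo hi))
            (+-monoʳ-≤ (k * N) (proj₂ (inRegion-bounds f (region⁻ (sub (rep∈region e iy))))))
          left : A ≤ U
          left = ≮⇒≥ λ U<A →
            let x<V = +-monoʳ-< N (Own.right o)
                A<V = ≤-<-trans A≤x x<V
                B≤V = nested e′ f′ U<A A<V
                NU≤B = inside-B (inj₁ refl) (trans (rep-shift _) (rep-shift u)) (<⇒≤ (<-trans A<V (short e′))) (+-monoʳ-< N U<A)
            in <⇒≱ (short e′) (≤-trans NU≤B B≤V)
          right : V ≤ B
          right with m≤n⇒m<n∨m≡n left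
          ... | inj₁ A<U = nested f′ e′ A<U (<-≤-trans (+-monoʳ-< N (Own.left o)) x≤B)
          ... | inj₂ A≡U = inside-B (inj₂ (inj₁ refl)) (rep-shift v) (≤-trans (≤-reflexive A≡U) (<⇒≤ (proper e′)))
                             (subst (λ z → V < N + z) (sym A≡U) (short e′))

    -- The two inclusions bound each length by the other, which leaves equality; starts below N then
    -- exclude a proper translate.
    region-injective : ∀ {u v a b} → Arc E u v → Arc E a b → u < N → a < N → region u v ≡ region a b → u ≡ a × v ≡ b
    region-injective {u} {v} {a} {b} e f u<N a<N eq
      with region-⊆ e f a<N (λ {i} → subst (i ∈_) eq) | region-⊆ f e u<N (λ {i} → subst (i ∈_) (sym eq))
    ... | k , p , q | j , p′ , q′ = u≡a ,
      lia 7 (λ n u v a b k j → k ⊕ a ≼ n ⊕ u ⇒ n ⊕ v ≼ k ⊕ b ⇒ j ⊕ u ≼ n ⊕ a ⇒ n ⊕ b ≼ j ⊕ v ⇒ u ≂ a ⇒ ⊢ v ≂ b) (1 ∷ 1 ∷ 0 ∷ 0 ∷ 0 ∷ 1 ∷ 1 ∷ []) (1 ∷ 0 ∷ 1 ∷ 1 ∷ 1 ∷ [])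
        N u v a b (k * N) (j * N) p q p′ q′ u≡a
      where
      shift : k * N + a ≡ N + u
      shift = lia 7 (λ n u v a b k j → k ⊕ a ≼ n ⊕ u ⇒ n ⊕ v ≼ k ⊕ b ⇒ j ⊕ u ≼ n ⊕ a ⇒ n ⊕ b ≼ j ⊕ v ⇒ ⊢ k ⊕ a ≂ n ⊕ u) (1 ∷ 0 ∷ 0 ∷ 0 ∷ 1 ∷ []) (1 ∷ 1 ∷ 1 ∷ 1 ∷ [])
        N u v a b (k * N) (j * N) p q p′ q′
      u≡a : u ≡ a
      u≡a = trans (sym (toℕ-rep-< u<N)) (trans (cong toℕ
        (trans (sym (rep-shift u)) (trans (cong rep (sym shift)) (rep-shifts k a)))) (toℕ-rep-< a<N))

    region≢outer : ∀ {u v} → Arc E u v → region u v ≢ outer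
    region≢outer {u} {v} e eq with directly-under e
    ... | x , o = outer⁻ (subst (rep x ∈_) eq (rep∈region e (inj₂ (inj₂ o))))
      (covers-rep (Own.arc o) (Own.left o) (Own.right o) (m≤m+n N _) (sym (trans (rep-shift _) (rep-toℕ (rep x)))))

    tally-sizes : ∀ i B u → tally i (sizes E B u) ≡ Σ< B (λ v → 𝟙 (arc? E u v ×-dec (size E u v ≟ i)))
    tally-sizes i zero    u = refl
    tally-sizes i (suc v) u = trans (tally-++ (sizes E v u) _) (cong₂ _+_ (tally-sizes i v u) (last (E u v) refl))
      where
      open import Data.List.Base using (_++_)
      open import Data.Bool.Base using (if_then_else_)
      tally-++ : ∀ l m → tally i (l ++ m) ≡ tally i l + tally i m
      tally-++ []      m = refl
      tally-++ (j ∷ l) m = trans (cong (𝟙 (j ≟ i) +_) (tally-++ l m)) (sym (+-assoc (𝟙 (j ≟ i)) _ _))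
      last : ∀ t → E u v ≡ t → tally i (if t then size E u v ∷ [] else []) ≡ 𝟙 (arc? E u v ×-dec (size E u v ≟ i))
      last true  e = trans (+-identityʳ _) (𝟙-cong (size E u v ≟ i) (arc? E u v ×-dec (size E u v ≟ i)) (e ,_) proj₂)
      last false e = sym (𝟙-no (arc? E u v ×-dec (size E u v ≟ i)) λ { (e′ , _) → contradiction (trans (sym e) e′) λ () })

    -- A subgon under an arc has two vertices more than the arc owns, so i + 3 vertices correspond
    -- to the letter suc i. The last summand is the outer subgon.
    subgon-count : ∀ i → HasCard (λ S → IsSubgon (chords E) S × ∣ S ∣ ≡ i + 3)
                                 (Σ< N (λ u → tally (suc i) (word u)) + 𝟙 (uncovered ≟ i + 3))
    subgon-count i = card-⇔ (λ S → mk⇔ to from)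
      (card-⊎ (λ { (_ , _ , _ , e , _ , refl) (eq , _) → region≢outer e eq })
        (subst (HasCard Region) (Σ-cong N row) regions) (outers (uncovered ≟ i + 3)))
      where
      Cell : ℕ → ℕ → Set
      Cell u v = Arc E u v × size E u v ≡ suc i
      cell? : ∀ u v → Dec (Cell u v)
      cell? u v = arc? E u v ×-dec (size E u v ≟ suc i)
      Region Outer : Subset N → Set
      Region S = ∃[ u ] ∃[ v ] u < N × Arc E u v × size E u v ≡ suc i × S ≡ region u v
      Outer S = S ≡ outer × uncovered ≡ i + 3
      row : ∀ u → u < N → Σ< (N + N) (λ v → 𝟙 (cell? u v)) ≡ tally (suc i) (word u)
      row u u<N = trans (Σ-support (N + N) (N + u) _
          (λ v NN≤v → 𝟙-no (cell? u v) λ (e , _) → <⇒≱ (short e) (≤-trans (+-monoʳ-≤ N (<⇒≤ u<N)) NN≤v))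
          (λ v Nu≤v → 𝟙-no (cell? u v) λ (e , _) → <⇒≱ (short e) Nu≤v))
        (sym (tally-sizes (suc i) (N + u) u))
      regions : HasCard Region (Σ< N (λ u → Σ< (N + N) (λ v → 𝟙 (cell? u v))))
      regions = card-image {P = λ (u , v) → u < N × v < N + N × Cell u v} (λ (u , v) → region u v)
        (λ (u<N , _ , e , _) (a<N , _ , f , _) eq →
          let (p , q) = region-injective e f u<N a<N eq in cong₂ _,_ p q)
        (λ {(u , v)} (u<N , _ , e , sz) → u , v , u<N , e , sz , refl)
        (λ { (u , v , u<N , e , sz , refl) →
          (u , v) , (u<N , <-trans (short e) (+-monoʳ-< N u<N) , e , sz) , refl })
        (card-<< N (N + N) cell?)
      outers : (d : Dec (uncovered ≡ i + 3)) → HasCard Outer (𝟙 d)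
      outers (yes eq) = card-singleton outer (refl , eq) proj₁
      outers (no neq) = card-∅ λ _ → neq ∘ proj₂
      size↔ : ∀ {n} → 2 + n ≡ i + 3 → n ≡ suc i
      size↔ {n} = lia 2 (λ n i → # 2 ⊕ n ≂ i ⊕ # 3 ⇒ ⊢ n ≂ # 1 ⊕ i) (1 ∷ 1 ∷ []) (1 ∷ 0 ∷ 1 ∷ []) n i
      size↔′ : ∀ {n} → n ≡ suc i → 2 + n ≡ i + 3
      size↔′ {n} = lia 2 (λ n i → n ≂ # 1 ⊕ i ⇒ ⊢ # 2 ⊕ n ≂ i ⊕ # 3) (1 ∷ 1 ∷ []) (1 ∷ 0 ∷ 1 ∷ []) n i
      to : ∀ {S} → Region S ⊎ Outer S → IsSubgon (chords E) S × ∣ S ∣ ≡ i + 3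
      to (inj₁ (u , v , u<N , e , sz , refl)) = region-isSubgon e , trans (∣region∣ e) (size↔′ sz)
      to (inj₂ (refl , eq)) =
        outer-isSubgon (≤-trans (m≤n+m 3 i) (≤-reflexive (trans (sym eq) (sym ∣outer∣)))) , trans ∣outer∣ eq
      from : ∀ {S} → IsSubgon (chords E) S × ∣ S ∣ ≡ i + 3 → Region S ⊎ Outer S
      from (sub , card) with classify sub
      ... | inj₁ (u , v , u<N , e , refl) = inj₁ (u , v , u<N , e , size↔ (trans (sym (∣region∣ e)) card) , refl)
      ... | inj₂ refl = inj₂ (refl , trans (sym ∣outer∣) card)

-- Rotations, invariance and translation

module Rotation where
  open import Data.Bool.Base using (true; _∧_; _∨_)
  open import Data.Empty using (⊥)
  open import Data.Fin.Base using (toℕ)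
  open import Data.Fin.Subset.Properties using (⊆-antisym)
  import Data.Integer.Base as ℤ
  open import Data.List.Base using ([]; _∷_)
  open import Data.Nat.Base
  open import Data.Nat.DivMod
  open import Data.Nat.GCD using (gcd; gcd[m,n]∣m; gcd-GCD; module Bézout)
  open import Data.Nat.Divisibility using (_∣_; divides)
  open import Data.Nat.ListAction using (sum)
  open import Data.Nat.Properties
  open import Data.Product.Base using (_×_; _,_)
  open import Data.Sum.Base using (_⊎_; inj₁; inj₂; [_,_]′)
  open import Data.Vec.Base using (tabulate; lookup)
  open import Data.Vec.Properties using (lookup∘tabulate; tabulate∘lookup; tabulate-cong)
  open import Function.Base using (id)
  open import Function.Bundles using (Equivalence; Inverse; _⇔_; mk⇔; _↔_)
  open import Function.Endo.Propositional using () renaming (_^_ to iterate)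
  open import Relation.Binary.PropositionalEquality

  open import Defs
  open Linear
  open Sums
  open Arcs
  open Words using (bool-ext)
  open Polygon
  open Subgons

  open Equivalence using (to; from)

  iterate-cancel : ∀ {A : Set} (σ : A ↔ A) m x → iterate A (Inverse.to σ) m (iterate A (Inverse.from σ) m x) ≡ x
  iterate-cancel σ zero    x = refl
  iterate-cancel {A} σ (suc m) x = trans (commute m (Inverse.from σ y))
    (trans (cong (iterate A (Inverse.to σ) m) (Inverse.inverseˡ σ refl)) (iterate-cancel σ m x))
    where
    y : A
    y = iterate A (Inverse.from σ) m x
    commute : ∀ m x → Inverse.to σ (iterate A (Inverse.to σ) m x) ≡ iterate A (Inverse.to σ) m (Inverse.to σ x)
    commute zero    x = refl
    commute (suc m) x = cong (Inverse.to σ) (commute m x)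

  iterate-cancel′ : ∀ {A : Set} (σ : A ↔ A) m x → iterate A (Inverse.from σ) m (iterate A (Inverse.to σ) m x) ≡ x
  iterate-cancel′ σ zero    x = refl
  iterate-cancel′ {A} σ (suc m) x = trans (commute m (Inverse.to σ y))
    (trans (cong (iterate A (Inverse.from σ) m) (Inverse.inverseʳ σ refl)) (iterate-cancel′ σ m x))
    where
    y : A
    y = iterate A (Inverse.to σ) m x
    commute : ∀ m x → Inverse.from σ (iterate A (Inverse.from σ) m x) ≡ iterate A (Inverse.from σ) m (Inverse.from σ x)
    commute zero    x = refl
    commute (suc m) x = cong (Inverse.from σ) (commute m x)

  fixed-∣∣ : ∀ {A : Set} (σ : A ↔ A) j x → ((σ ^ℤ j) x ≡ x) ⇔ ((σ ^ℤ (ℤ.+ ℤ.∣ j ∣)) x ≡ x)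
  fixed-∣∣ σ (ℤ.+ n)    x = mk⇔ id id
  fixed-∣∣ {A} σ ℤ.-[1+ n ] x = mk⇔
    (λ eq → trans (cong (iterate A (Inverse.to σ) (suc n)) (sym eq)) (iterate-cancel σ (suc n) x))
    (λ eq → trans (cong (iterate A (Inverse.from σ) (suc n)) (sym eq)) (iterate-cancel′ σ (suc n) x))

  module _ {N : ℕ} .{{_ : NonZero N}} where

    chordset-ext : ∀ {D D′ : ChordSet N} → (∀ a b → a ─ b ∈ᶜ D → a ─ b ∈ᶜ D′) →
                   (∀ a b → a ─ b ∈ᶜ D′ → a ─ b ∈ᶜ D) → D ≡ D′
    chordset-ext {D} {D′} f g = trans (sym (tabulate∘lookup D))
      (trans (tabulate-cong λ a → ⊆-antisym (λ {b} → f a b) (λ {b} → g a b)) (tabulate∘lookup D′))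

    rotate : ℕ → ChordSet N → ChordSet N
    rotate m = rotation ^ℤ (ℤ.+ m)

    -- `image` looks up preimages, and the inverse of the vertex rotation is `next`; so m rotations
    -- add m to both arguments.
    bit-rotate : ∀ m D x y → bit (rotate m D) x y ≡ bit D (m + x) (m + y)
    bit-rotate zero    D x y = refl
    bit-rotate (suc m) D x y = begin
      lookup (lookup (image vertexRotation D′) (rep x)) (rep y)
        ≡⟨ cong (λ r → lookup r (rep y)) (lookup∘tabulate _ (rep x)) ⟩
      lookup (tabulate λ b → lookup (lookup D′ (next (rep x))) (next b)) (rep y)
        ≡⟨ lookup∘tabulate _ (rep y) ⟩
      lookup (lookup D′ (next (rep x))) (next (rep y))
        ≡⟨ cong₂ (λ a b → lookup (lookup D′ a) b) (next-rep x) (next-rep y) ⟩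
      bit D′ (suc x) (suc y)
        ≡⟨ bit-rotate m D (suc x) (suc y) ⟩
      bit D (m + suc x) (m + suc y)
        ≡⟨ cong₂ (bit D) (+-suc m x) (+-suc m y) ⟩
      bit D (suc m + x) (suc m + y) ∎
      where
      open ≡-Reasoning
      D′ : ChordSet N
      D′ = rotate m D

    bit-ext : ∀ {D D′} → (∀ x y → bit D x y ≡ bit D′ x y) → D ≡ D′
    bit-ext {D} {D′} h = chordset-ext (λ a b → move {D} {D′} a b h) (λ a b → move {D′} {D} a b (λ x y → sym (h x y)))
      where
      move : ∀ {D D′} a b → (∀ x y → bit D x y ≡ bit D′ x y) → a ─ b ∈ᶜ D → a ─ b ∈ᶜ D′
      move {D} {D′} a b h c = subst₂ (λ a b → a ─ b ∈ᶜ D′) (rep-toℕ a) (rep-toℕ b)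
        (bit⇒∈ {D = D′} (trans (sym (h (toℕ a) (toℕ b))) (∈⇒bit {D = D} (rep-toℕ a) (rep-toℕ b) c)))

    Invariant : ChordSet N → ℕ → Set
    Invariant D m = ∀ x y → bit D (m + x) (m + y) ≡ bit D x y

    fixed⇔invariant : ∀ D m → (rotate m D ≡ D) ⇔ Invariant D m
    fixed⇔invariant D m = mk⇔ (λ eq x y → trans (sym (bit-rotate m D x y)) (cong (λ D → bit D x y) eq))
                             (λ inv → bit-ext λ x y → trans (bit-rotate m D x y) (inv x y))

    invariant-N : ∀ D → Invariant D N
    invariant-N D x y = cong₂ (λ a b → lookup (lookup D a) b) (rep-shift x) (rep-shift y)

    invariant-+ : ∀ {D m n} → Invariant D m → Invariant D n → Invariant D (m + n)
    invariant-+ {D} {m} {n} f g x y =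
      trans (cong₂ (bit D) (+-assoc m n x) (+-assoc m n y)) (trans (f _ _) (g x y))

    invariant-* : ∀ {D m} → Invariant D m → ∀ k → Invariant D (k * m)
    invariant-* {D} f zero    x y = refl
    invariant-* {D} {m} f (suc k) = invariant-+ {D} {m} {k * m} f (invariant-* {D} {m} f k)

    invariant-cancel : ∀ {D m n} → Invariant D (m + n) → Invariant D n → Invariant D m
    invariant-cancel {D} {m} {n} f g x y = trans (sym (g (m + x) (m + y)))
      (trans (cong₂ (bit D) (swap x) (swap y)) (f x y))
      where
      swap : ∀ x → n + (m + x) ≡ m + n + x
      swap x = lia 3 (λ n m x → ⊢ n ⊕ (m ⊕ x) ≂ m ⊕ n ⊕ x) (1 ∷ []) (1 ∷ []) n m x

    -- The numbers under which D is invariant are closed under sums and differences and contain N,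
    -- so Bézout applies in one direction and multiples in the other.
    invariant-gcd : ∀ {D} m → Invariant D m ⇔ Invariant D (gcd m N)
    invariant-gcd {D} m = mk⇔ (λ inv → go inv (Bézout.identity (gcd-GCD m N))) back
      where
      inv-N* : ∀ k → Invariant D (k * N)
      inv-N* = invariant-* {D} {N} (invariant-N D)
      go : Invariant D m → Bézout.Identity.Identity (gcd m N) m N → Invariant D (gcd m N)
      go inv (Bézout.Identity.+- x y eq) =
        invariant-cancel {D} {gcd m N} {y * N} (subst (Invariant D) (sym eq) (invariant-* {D} {m} inv x)) (inv-N* y)
      go inv (Bézout.Identity.-+ x y eq) =
        invariant-cancel {D} {gcd m N} {x * m} (subst (Invariant D) (sym eq) (inv-N* y)) (invariant-* {D} {m} inv x)
      back : Invariant D (gcd m N) → Invariant D m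
      back inv with gcd[m,n]∣m m N
      ... | divides q eq = subst (Invariant D) (sym eq) (invariant-* {D} {gcd m N} inv q)

    -- `pred N * p` serves as -p modulo N.
    rep-cancel : ∀ p {x y} → rep {N} (p + x) ≡ rep (p + y) → rep {N} x ≡ rep y
    rep-cancel p {x} {y} eq = trans (sym (whole x)) (trans (rep-+ (pred N * p) eq) (whole y))
      where
      whole : ∀ x → rep (pred N * p + (p + x)) ≡ rep x
      whole x = trans (cong rep (trans (sym (+-assoc (pred N * p) p x)) (cong (_+ x)
        (trans (+-comm (pred N * p) p) (trans (cong (_* p) (suc-pred N)) (*-comm N p)))))) (rep-shifts p x)

    translate-family : ∀ p {E} → Family N E → Family N (translate p E)
    translate-family p {E} family = record
      { long = λ {a} {b} e → lia 3 (λ p a b → # 2 ⊕ (p ⊕ a) ≼ p ⊕ b ⇒ ⊢ # 2 ⊕ a ≼ b) (1 ∷ 1 ∷ []) [] p a b (long e)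
      ; short = λ {a} {b} e → lia 4 (λ p a b n → p ⊕ b ≺ n ⊕ (p ⊕ a) ⇒ ⊢ b ≺ n ⊕ a) (1 ∷ 1 ∷ []) [] p a b N (short e)
      ; periodic = λ a b → trans (cong₂ E (swap a) (swap b)) (periodic (p + a) (p + b))
      ; nested = λ e f a<c c<b → +-cancelˡ-≤ p _ _ (nested e f (+-monoʳ-< p a<c) (+-monoʳ-< p c<b)) }
      where
      open Family family
      swap : ∀ x → p + (N + x) ≡ N + (p + x)
      swap x = lia 3 (λ n p x → ⊢ p ⊕ (n ⊕ x) ≂ n ⊕ (p ⊕ x)) (1 ∷ []) (1 ∷ []) N p x

    bit-translate : ∀ p {E} → Family N E → ∀ x y → bit (chords (translate p E)) x y ≡ bit (chords E) (p + x) (p + y)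
    bit-translate p {E} family x y = bool-ext
      (λ t → ∈⇒bit {D = chords E} refl refl (chords⁺ family (forth (chords⁻ family′ (bit⇒∈ {D = chords (translate p E)} t)))))
      (λ t → ∈⇒bit {D = chords (translate p E)} refl refl (chords⁺ family′ (back (chords⁻ family (bit⇒∈ {D = chords E} t)))))
      where
      family′ = translate-family p family
      forth : Chord (translate p E) (rep x) (rep y) → Chord E (rep (p + x)) (rep (p + y))
      forth (a , b , e , b< , ends) = p + a , p + b , e ,
        lia 4 (λ p a b n → # 1 ⊕ b ≺ n ⊕ a ⇒ ⊢ # 1 ⊕ (p ⊕ b) ≺ n ⊕ (p ⊕ a)) (1 ∷ 1 ∷ []) [] p a b N b< ,
        [ (λ (q , r) → inj₁ (rep-+ p q , rep-+ p r)) , (λ (q , r) → inj₂ (rep-+ p q , rep-+ p r)) ]′ ends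
      back : Chord E (rep (p + x)) (rep (p + y)) → Chord (translate p E) (rep x) (rep y)
      back (a , b , e , b< , ends)
        -- The arc is first moved up by p periods, so that p can be subtracted within ℕ.
        with a′ , eqa ← offset {p} {p * N + a} (≤-trans (m≤m*n p N) (m≤m+n (p * N) a))
        with b′ , eqb ← offset {p} {p * N + b} (≤-trans (m≤m*n p N) (m≤m+n (p * N) b)) =
        a′ , b′ , subst₂ (Arc E) eqa eqb (arc-shifts family p e) ,
        lia 7 (λ p a b n m c d → # 1 ⊕ b ≺ n ⊕ a ⇒ m ⊕ a ≂ p ⊕ c ⇒ m ⊕ b ≂ p ⊕ d ⇒ ⊢ # 1 ⊕ d ≺ n ⊕ c) (1 ∷ 0 ∷ 1 ∷ 1 ∷ 0 ∷ 1 ∷ []) [] p a b N (p * N) a′ b′ b< eqa eqb ,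
        [ (λ (q , r) → inj₁ (drop eqa q , drop eqb r)) , (λ (q , r) → inj₂ (drop eqa q , drop eqb r)) ]′ ends
        where
        drop : ∀ {a a′ z} → p * N + a ≡ p + a′ → rep a ≡ rep (p + z) → rep a′ ≡ rep z
        drop {a} eq q = rep-cancel p (trans (cong rep (sym eq)) (trans (rep-shifts p a) q))

    rotate-chords : ∀ {E} → Family N E → rotate 1 (chords E) ≡ chords (translate 1 E)
    rotate-chords {E} family = bit-ext λ x y → trans (bit-rotate 1 (chords E) x y) (sym (bit-translate 1 family x y))

    chords-invariant : ∀ p {E} → Family N E → (∀ a b → E (p + a) (p + b) ≡ E a b) → Invariant (chords E) p
    chords-invariant p {E} family per x y = trans (sym (bit-translate p family x y))
      (cong (λ D → bit D x y) (tabulate-cong λ a → tabulate-cong λ b → cong₂ _∨_ (same a b) (same b a)))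
      where
      same : ∀ a b → directed (translate p E) a b ≡ directed E a b
      same a b = cong (_∧ _) (per _ _)

    -- The last term stands for the subgon that no arc passes over.
    census : ∀ {E} → Family N E → ℕ → ℕ
    census family i = Σ< N (λ u → tally (suc i) (word u)) + 𝟙 (uncovered ≟ i + 3)
      where open FamilyProperties family

    -- The word is shifted by p, which a sum over a full period does not notice; equality of
    -- `uncovered` then follows from `uncovered-count`.
    census-translate : ∀ p {E} (family : Family N E) i → census (translate-family p family) i ≡ census family i
    census-translate p {E} family i = cong₂ _+_
      (trans (Σ-ext N λ u → cong (tally (suc i)) (word-translate u)) (Σ-window N _ (λ u → cong (tally (suc i)) (word-periodic N periodic u)) p))
      (cong (λ r → 𝟙 (r ≟ i + 3)) same)
      where
      open FamilyProperties family
      module F′ = FamilyProperties (translate-family p family)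
      word-translate : ∀ u → F′.word u ≡ word (p + u)
      word-translate u = trans (sizes-translate proper p (N + u) u)
        (cong (λ B → sizes E B (p + u)) (lia 3 (λ n p x → ⊢ p ⊕ (n ⊕ x) ≂ n ⊕ (p ⊕ x)) (1 ∷ []) (1 ∷ []) N p u))
      totals : Σ< N F′.total ≡ Σ< N total
      totals = trans (Σ-ext N λ u → cong sum (word-translate u))
        (Σ-window N total (λ u → cong sum (word-periodic N periodic u)) p)
      same : F′.uncovered ≡ uncovered
      same = +-cancelʳ-≡ (Σ< N total) _ _
        (trans (cong (F′.uncovered +_) (sym totals)) (trans F′.uncovered-count (sym uncovered-count)))

    module _ {D : ChordSet N} (dissection : IsDissection D) where
      open IsDissection dissection

      bit-sym : ∀ {x y} → bit D x y ≡ true → bit D y x ≡ true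
      bit-sym t = ∈⇒bit {D = D} refl refl (symmetric (bit⇒∈ {D = D} t))

      bit-nested : ∀ {a b c d} → bit D a b ≡ true → bit D c d ≡ true → a < c → c < b → b < d → d < N + a → ⊥
      bit-nested {a} {b} {c} {d} p q a<c c<b b<d d< = noncrossing (bit⇒∈ {D = D} p) (bit⇒∈ {D = D} q)
        (inj₁ (cyclic-intro a<c c<b (<-trans b<d d<) ,
               subst (Cyclic (rep b) (rep d)) (rep-shift a) (cyclic-intro b<d d< (+-monoʳ-< N (<-trans a<c c<b)))))

      private
        lift-cases : ∀ a b → a ─ b ∈ᶜ D → let x = toℕ a ; y = lift x b in
                     2 + x ≤ y × suc y < N + x × bit D x y ≡ true
        lift-cases a b c with diagonals c
        ... | a≢b , na≢b , nb≢a = lo , hi , ∈⇒bit {D = D} (rep-toℕ a) (rep-lift x b) c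
          where
          x y : ℕ
          x = toℕ a
          y = lift x b
          ya : rep y ≡ b
          ya = rep-lift x b
          x<y : x < y
          x<y = ≤∧≢⇒< (lift-≥ x b) λ eq → a≢b (trans (sym (rep-toℕ a)) (trans (cong rep eq) ya))
          lo : 2 + x ≤ y
          lo = ≤∧≢⇒< x<y λ eq → na≢b (trans (cong next (sym (rep-toℕ a))) (trans (next-rep x) (trans (cong rep eq) ya)))
          hi : suc y < N + x
          hi = ≤∧≢⇒< (lift-< x b) λ eq → nb≢a (trans (cong next (sym ya)) (trans (next-rep y)
                 (trans (cong rep eq) (trans (rep-shift x) (rep-toℕ a)))))

      module _ {E : Arcs} (family : Family N E)
               (sound : ∀ {x y} → Arc E x y → suc y < N + x → bit D x y ≡ true)
               (choice : ∀ {x y} → 2 + x ≤ y → suc y < N + x → bit D x y ≡ true → Arc E x y ⊎ Arc E y (N + x)) where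

        -- Chords are unordered, so it is enough that each diagonal is an arc in one of its two
        -- directions; `choice` supplies one.
        chords≡ : chords E ≡ D
        chords≡ = chordset-ext into onto
          where
          into : ∀ a b → a ─ b ∈ᶜ chords E → a ─ b ∈ᶜ D
          into a b c with chords⁻ family c
          ... | x , y , e , y< , inj₁ (refl , refl) = bit⇒∈ {D = D} (sound e y<)
          ... | x , y , e , y< , inj₂ (refl , refl) = symmetric (bit⇒∈ {D = D} (sound e y<))
          onto : ∀ a b → a ─ b ∈ᶜ D → a ─ b ∈ᶜ chords E
          onto a b c with lift-cases a b c
          ... | lo , hi , t with choice lo hi t
          ...   | inj₁ e = chords⁺ family (toℕ a , lift (toℕ a) b , e , hi , inj₁ (rep-toℕ a , rep-lift _ b))
          ...   | inj₂ e = chords⁺ family (lift (toℕ a) b , N + toℕ a , e , lia 3 (λ n x y → # 2 ⊕ x ≼ y ⇒ ⊢ # 2 ⊕ (n ⊕ x) ≼ n ⊕ y) (1 ∷ 1 ∷ []) [] N (toℕ a) (lift (toℕ a) b) lo ,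
                    inj₂ (rep-lift _ b , trans (rep-shift _) (rep-toℕ a)))

-- Directing the diagonals of a dissection

module Choices where
  open import Data.Bool.Base using (Bool; true; _∧_)
  import Data.Bool.Properties as Bool
  open import Data.Empty using (⊥; ⊥-elim)
  open import Data.List.Base using ([]; _∷_)
  open import Data.Nat.Base
  open import Data.Nat.DivMod
  open import Data.Nat.Properties
  open import Data.Product.Base using (_×_; _,_; proj₁; proj₂)
  open import Data.Sum.Base using (_⊎_; inj₁; inj₂; [_,_]′)
  open import Data.Vec.Base using (lookup)
  open import Relation.Binary.PropositionalEquality
  open import Relation.Nullary.Decidable.Core using (Dec; yes; no; does; _×-dec_; _⊎-dec_)
  open import Relation.Nullary.Negation using (contradiction)

  open import Defs
  open Linear
  open Sums
  open Arcs
  open Words using (bool-ext)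
  open Polygon
  open Rotation

  does-true : ∀ {P : Set} (d : Dec P) → does d ≡ true → P
  does-true (yes p) _ = p

  true-does : ∀ {P : Set} (d : Dec P) → P → does d ≡ true
  true-does (yes _) _ = refl
  true-does (no ¬p) p = contradiction p ¬p

  module _ {N : ℕ} .{{_ : NonZero N}} where

    private
      -- Congruent ends less than a period apart determine an arc up to translation by a multiple of
      -- N.
      same-arc : ∀ {E} → Family N E → ∀ {x y x′ y′} → Arc E x′ y′ → rep {N} x′ ≡ rep x → rep {N} y′ ≡ rep y →
                 x ≤ y → y < N + x → Arc E x y
      same-arc {E} family {x} {y} {x′} {y′} e ex ey x≤y y< with ≤-total x′ x
      ... | inj₁ x′≤x with k , refl ← rep-≤ {N} ex x′≤x = subst (Arc E (k * N + x′))
        (trans (sym (lift-unique refl (+-monoʳ-≤ (k * N) (<⇒≤ (proper e)))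
                 (lia 4 (λ m x y n → y ≺ n ⊕ x ⇒ ⊢ m ⊕ y ≺ n ⊕ (m ⊕ x)) (1 ∷ 1 ∷ []) [] (k * N) x′ y′ N (short e))))
          (lift-unique (trans (sym ey) (sym (rep-shifts k y′))) x≤y y<))
        (arc-shifts family k e)
        where open FamilyProperties family
      ... | inj₂ x≤x′ with k , refl ← rep-≤ {N} (sym ex) x≤x′ = arc-unshifts family k (subst (Arc E (k * N + x))
        (trans (sym (lift-unique refl (<⇒≤ (proper e)) (short e)))
          (lift-unique (trans (rep-shifts k y) (sym ey)) (+-monoʳ-≤ (k * N) x≤y)
            (lia 4 (λ m x y n → y ≺ n ⊕ x ⇒ ⊢ m ⊕ y ≺ n ⊕ (m ⊕ x)) (1 ∷ 1 ∷ []) [] (k * N) x y N y<))) e)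
        where open FamilyProperties family

      transfer : ∀ {E F} → Family N E → Family N F → chords {N} E ≡ chords F → ∀ {x y} → Arc E x y → suc y < N + x →
                 Arc F x y ⊎ Arc F y (N + x)
      transfer {E} {F} e-family f-family eq {x} {y} e y<
        with chords⁻ f-family (subst (λ D → rep x ─ rep y ∈ᶜ D) eq (chords⁺ e-family (x , y , e , y< , inj₁ (refl , refl))))
      ... | _ , _ , f , _ , inj₁ (p , q) = inj₁ (same-arc f-family f p q (<⇒≤ (proper e)) (short e))
        where open FamilyProperties e-family
      ... | _ , _ , f , _ , inj₂ (p , q) = inj₂ (same-arc f-family f p (trans q (sym (rep-shift x))) (<⇒≤ (short e)) (+-monoʳ-< N (proper e)))
        where open FamilyProperties e-family

    module Symmetric {M : ℕ} (2M≤N : M + M ≤ N) (0<M : 0 < M) where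

      Within : Arcs → Set
      Within E = ∀ {x y} → Arc E x y → y ≤ M + x

      -- If F contains the reversed arc, both directions have length at most M, and M + M ≤ N leaves
      -- only a diameter of length exactly M. Its reversal is its own translate by M.
      arcs-⊆ : ∀ {E F} → Family N E → Family N F → Within E → Within F → (∀ a b → F (M + a) (M + b) ≡ F a b) →
               chords {N} E ≡ chords F → ∀ {x y} → Arc E x y → Arc F x y
      arcs-⊆ {E} {F} e-family f-family e-within f-within per eq {x} {y} e
        with transfer e-family f-family eq e
               (lia 4 (λ m n x y → m ⊕ m ≼ n ⇒ y ≼ m ⊕ x ⇒ # 2 ⊕ x ≼ y ⇒ ⊢ # 1 ⊕ y ≺ n ⊕ x) (1 ∷ 1 ∷ 2 ∷ 1 ∷ []) [] M N x y 2M≤N (e-within e) (Family.long e-family e))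
      ... | inj₁ f = f
      ... | inj₂ f = trans (sym (per x y)) (subst₂ (Arc F)
        (lia 4 (λ m n x y → m ⊕ m ≼ n ⇒ y ≼ m ⊕ x ⇒ n ⊕ x ≼ m ⊕ y ⇒ ⊢ y ≂ m ⊕ x) (1 ∷ 0 ∷ 1 ∷ []) (1 ∷ 1 ∷ 0 ∷ 1 ∷ []) M N x y 2M≤N (e-within e) (f-within f))
        (lia 4 (λ m n x y → m ⊕ m ≼ n ⇒ y ≼ m ⊕ x ⇒ n ⊕ x ≼ m ⊕ y ⇒ ⊢ n ⊕ x ≂ m ⊕ y) (1 ∷ 1 ∷ []) (1 ∷ 0 ∷ 1 ∷ 1 ∷ []) M N x y 2M≤N (e-within e) (f-within f)) f)

      arcs-determined : ∀ {E F} → Family N E → Family N F → Within E → Within F →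
        (∀ a b → E (M + a) (M + b) ≡ E a b) → (∀ a b → F (M + a) (M + b) ≡ F a b) →
        chords {N} E ≡ chords F → ∀ x y → E x y ≡ F x y
      arcs-determined e-family f-family ew fw ep fp eq x y = bool-ext
        (arcs-⊆ e-family f-family ew fw fp eq) (arcs-⊆ f-family e-family fw ew ep (sym eq))

      module _ {D : ChordSet N} (dissection : IsDissection D) (inv : Invariant D M) where

        private
          Short : ℕ → ℕ → Set
          Short x y = 2 + x ≤ y × y ≤ M + x

          short? : ∀ x y → Dec (Short x y)
          short? x y = (2 + x ≤? y) ×-dec (y ≤? M + x)

        -- Of the two sides of a diagonal of a symmetric dissection at least one has at most M edges.
        short-arcs : Arcs
        short-arcs x y = bit D x y ∧ does (short? x y)

        private
          arc⁻ : ∀ {x y} → Arc short-arcs x y → bit D x y ≡ true × Short x y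
          arc⁻ {x} {y} e = Bool.∧-conicalˡ _ _ e , does-true (short? x y) (Bool.∧-conicalʳ (bit D x y) _ e)

          arc⁺ : ∀ {x y} → bit D x y ≡ true → Short x y → Arc short-arcs x y
          arc⁺ {x} {y} t s = cong₂ _∧_ t (true-does (short? x y) s)

        short-arcs-periodic : ∀ p → Invariant D p → ∀ a b → short-arcs (p + a) (p + b) ≡ short-arcs a b
        short-arcs-periodic p inv a b = bool-ext
          (λ e → let (t , l , s) = arc⁻ e in arc⁺ (trans (sym (inv a b)) t)
            (lia 3 (λ p a b → # 2 ⊕ (p ⊕ a) ≼ p ⊕ b ⇒ ⊢ # 2 ⊕ a ≼ b) (1 ∷ 1 ∷ []) [] p a b l ,
             lia 4 (λ p a b m → p ⊕ b ≼ m ⊕ (p ⊕ a) ⇒ ⊢ b ≼ m ⊕ a) (1 ∷ 1 ∷ []) [] p a b M s))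
          (λ e → let (t , l , s) = arc⁻ e in arc⁺ (trans (inv a b) t)
            (lia 3 (λ p a b → # 2 ⊕ a ≼ b ⇒ ⊢ # 2 ⊕ (p ⊕ a) ≼ p ⊕ b) (1 ∷ 1 ∷ []) [] p a b l ,
             lia 4 (λ p a b m → b ≼ m ⊕ a ⇒ ⊢ p ⊕ b ≼ m ⊕ (p ⊕ a)) (1 ∷ 1 ∷ []) [] p a b M s))

        short-family : Family N short-arcs
        short-family = record
          { long = λ e → proj₁ (proj₂ (arc⁻ e))
          ; short = λ {a} {b} e → lia 4 (λ m n a b → m ⊕ m ≼ n ⇒ # 0 ≺ m ⇒ b ≼ m ⊕ a ⇒ ⊢ b ≺ n ⊕ a) (1 ∷ 1 ∷ 1 ∷ 1 ∷ []) [] M N a b 2M≤N 0<M (proj₂ (proj₂ (arc⁻ e)))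
          ; periodic = short-arcs-periodic N (invariant-N D)
          -- If b < d, then d ≤ M + c < M + b ≤ N + a, so all four ends lie within one turn and the
          -- diagonals themselves would cross.
          ; nested = λ {a} {b} {c} {d} e f a<c c<b → ≮⇒≥ λ b<d →
              bit-nested dissection (proj₁ (arc⁻ e)) (proj₁ (arc⁻ f)) a<c c<b b<d
                (lia 6 (λ m n a b c d → m ⊕ m ≼ n ⇒ b ≼ m ⊕ a ⇒ d ≼ m ⊕ c ⇒ c ≺ b ⇒ ⊢ d ≺ n ⊕ a) (1 ∷ 1 ∷ 1 ∷ 1 ∷ 1 ∷ []) [] M N a b c d 2M≤N
                  (proj₂ (proj₂ (arc⁻ e))) (proj₂ (proj₂ (arc⁻ f))) c<b) }

        short-chords : chords short-arcs ≡ D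
        short-chords = chords≡ dissection short-family (λ e _ → proj₁ (arc⁻ e)) choice
          where
          choice : ∀ {x y} → 2 + x ≤ y → suc y < N + x → bit D x y ≡ true → Arc short-arcs x y ⊎ Arc short-arcs y (N + x)
          choice {x} {y} lo hi t with ≤-<-connex y (M + x) | ≤-<-connex (N + x) (M + y)
          ... | inj₁ y≤ | _      = inj₁ (arc⁺ t (lo , y≤))
          ... | inj₂ _  | inj₁ ≤ = inj₂ (arc⁺ (trans (cong (λ i → lookup (lookup D (rep y)) i) (rep-shift x))
                                                (bit-sym dissection t)) (hi , ≤))
          -- A diagonal with more than M edges on both sides crosses its image under rotation by M,
          -- which is also in D.
          ... | inj₂ Mx<y | inj₂ My< = ⊥-elim (bit-nested dissection t (trans (inv x y) t) (m<n+m x 0<M) Mx<y (m<n+m y 0<M) My<)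

    module Rooted (3≤N : 3 ≤ N) where

      -- The side between vertex N - 1 and vertex 0, taken the long way round, so that every
      -- diagonal lies under it.
      RootArc : Arcs → Set
      RootArc E = Arc E 0 (pred N)

      private
        pred≡ : suc (pred N) ≡ N
        pred≡ = suc-pred N

        %-+ : ∀ x {t} → x % N + t < N → (x + t) % N ≡ x % N + t
        %-+ x {t} lt = trans (cong (_% N) eq) (trans ([m+kn]%n≡m%n (x % N + t) (x / N) N) (m<n⇒m%n≡m lt))
          where
          eq : x + t ≡ x % N + t + x / N * N
          eq = lia 4 (λ x t r q → x ≂ r ⊕ q ⇒ ⊢ x ⊕ t ≂ r ⊕ t ⊕ q) (1 ∷ 1 ∷ []) (1 ∷ 0 ∷ 1 ∷ []) x t (x % N) (x / N * N) (m≡m%n+[m/n]*n x N)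

        %-wrap : ∀ x {t} → N ≤ x % N + t → t < N → N + (x + t) % N ≡ x % N + t
        %-wrap x {t} ge lt with s , eq ← offset ge = trans (cong (N +_) (trans (cong (_% N) whole)
            (trans ([m+kn]%n≡m%n s (suc (x / N)) N) (m<n⇒m%n≡m s<N)))) (sym eq)
          where
          whole : x + t ≡ s + suc (x / N) * N
          whole = lia 6 (λ x t r q n s → x ≂ r ⊕ q ⇒ r ⊕ t ≂ n ⊕ s ⇒ ⊢ x ⊕ t ≂ s ⊕ (n ⊕ q)) (1 ∷ 1 ∷ 0 ∷ 1 ∷ []) (1 ∷ 0 ∷ 1 ∷ 0 ∷ 1 ∷ [])
            x t (x % N) (x / N * N) N s (m≡m%n+[m/n]*n x N) eq
          s<N : s < N
          s<N = lia 4 (λ r t n s → r ⊕ t ≂ n ⊕ s ⇒ t ≺ n ⇒ r ≺ n ⇒ ⊢ s ≺ n) (1 ∷ 1 ∷ 1 ∷ 0 ∷ 1 ∷ []) [] (x % N) t N s eq lt (m%n<n x N)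

        -- Both ends lie in the same period, that is, the arc does not reach the next multiple of N.
        Window : ℕ → ℕ → Set
        Window x y = x < y × x % N + (y ∸ x) < N

      -- An arc that reaches the next multiple of N crosses a translate of the root arc or is too
      -- long. Starts congruent to 0 or N - 1 are ends of root arcs and need their own argument.
      windowed : ∀ {E} → Family N E → RootArc E → ∀ {x y} → Arc E x y → Window x y
      windowed {E} family root {x} {y} e = proper e , ≰⇒> beyond
        where
        open FamilyProperties family
        kN a : ℕ
        kN = x / N * N
        a  = x % N
        x≡ : x ≡ kN + a
        x≡ = trans (m≡m%n+[m/n]*n x N) (+-comm a kN)
        ℓ : (y ∸ x) + x ≡ y
        ℓ = m∸n+n≡m (<⇒≤ (proper e))
        root-at : ∀ k → Arc E (k * N + 0) (k * N + pred N)
        root-at k = arc-shifts family k root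
        beyond : N ≤ a + (y ∸ x) → ⊥
        beyond N≤ with a ≟ 0 | suc a ≟ N
        ... | yes a≡0 | _ = lia 5 (λ n a t x y → n ≼ a ⊕ t ⇒ a ≂ # 0 ⇒ t ⊕ x ≂ y ⇒ y ≺ n ⊕ x ⇒ ⊢⊥) (1 ∷ 1 ∷ 0 ∷ 1 ∷ 0 ∷ 1 ∷ []) [] N a (y ∸ x) x y N≤ a≡0 ℓ (short e)
        ... | no _ | yes 1+a≡N = lia 6 (λ k n a x y p → n ⊕ k ⊕ p ≼ y ⇒ y ≺ n ⊕ x ⇒ x ≂ k ⊕ a ⇒ # 1 ⊕ a ≂ n ⇒ # 1 ⊕ p ≂ n ⇒ ⊢⊥) (0 ∷ 1 ∷ 1 ∷ 0 ∷ 1 ∷ 0 ∷ 1 ∷ 1 ∷ []) []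
              kN N a x y (pred N)
              (nested e (root-at (suc (x / N)))
                (lia 4 (λ k n a x → x ≂ k ⊕ a ⇒ # 1 ⊕ a ≂ n ⇒ ⊢ x ≺ n ⊕ k ⊕ # 0) (1 ∷ 1 ∷ 0 ∷ 1 ∷ []) [] kN N a x x≡ 1+a≡N)
                (lia 5 (λ k n a x y → x ≂ k ⊕ a ⇒ # 1 ⊕ a ≂ n ⇒ # 2 ⊕ x ≼ y ⇒ ⊢ n ⊕ k ⊕ # 0 ≺ y) (1 ∷ 1 ∷ 0 ∷ 1 ∷ 0 ∷ 1 ∷ []) [] kN N a x y x≡ 1+a≡N (long e)))
              (short e) x≡ 1+a≡N pred≡
        ... | no a≢0 | no 1+a≢N = lia 7 (λ k n a x y p t → y ≼ k ⊕ p ⇒ n ≼ a ⊕ t ⇒ t ⊕ x ≂ y ⇒ x ≂ k ⊕ a ⇒ # 1 ⊕ p ≂ n ⇒ ⊢⊥) (1 ∷ 0 ∷ 0 ∷ 1 ∷ 1 ∷ 0 ∷ 1 ∷ 1 ∷ []) []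
              kN N a x y (pred N) (y ∸ x)
              (nested (root-at (x / N)) e
                (lia 3 (λ k a x → x ≂ k ⊕ a ⇒ # 0 ≺ a ⇒ ⊢ k ⊕ # 0 ≺ x) (1 ∷ 1 ∷ 0 ∷ 1 ∷ []) [] kN a x x≡ (n≢0⇒n>0 a≢0))
                (lia 5 (λ k a x p n → x ≂ k ⊕ a ⇒ # 1 ⊕ p ≂ n ⇒ # 1 ⊕ a ≺ n ⇒ ⊢ x ≺ k ⊕ p) (1 ∷ 1 ∷ 0 ∷ 1 ∷ 1 ∷ []) [] kN a x (pred N) N x≡ pred≡ (≤∧≢⇒< (m%n<n x N) 1+a≢N)))
              N≤ ℓ x≡ pred≡

      -- A diagonal and its reversal cannot both stay within a period, so the direction agrees. An
      -- arc of length N - 1 is no diagonal; it must be a translate of the root arc, which F has by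
      -- hypothesis.
      arcs-⊆ : ∀ {E F} → Family N E → Family N F → RootArc E → RootArc F →
               chords {N} E ≡ chords F → ∀ {x y} → Arc E x y → Arc F x y
      arcs-⊆ {E} {F} e-family f-family e-root f-root eq {x} {y} e with suc y <? N + x
      ... | yes y< with transfer e-family f-family eq e y<
      ...   | inj₁ f = f
      ...   | inj₂ f = ⊥-elim (lia 7 (λ a t x y n s b → t ⊕ x ≂ y ⇒ s ⊕ y ≂ n ⊕ x ⇒ b ≂ a ⊕ t ⇒ b ⊕ s ≺ n ⇒ ⊢⊥) (1 ∷ 0 ∷ 1 ∷ 0 ∷ 1 ∷ 0 ∷ 1 ∷ []) []
                (x % N) (y ∸ x) x y N (N + x ∸ y) (y % N)
                ℓ (m∸n+n≡m (<⇒≤ (proj₁ wf))) y%N (proj₂ wf))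
        where
        we = windowed e-family e-root e
        wf = windowed f-family f-root f
        ℓ : (y ∸ x) + x ≡ y
        ℓ = m∸n+n≡m (<⇒≤ (proj₁ we))
        y%N : y % N ≡ x % N + (y ∸ x)
        y%N = trans (cong (_% N) (trans (sym ℓ) (+-comm (y ∸ x) x))) (%-+ x (proj₂ we))
      arcs-⊆ {E} {F} e-family f-family e-root f-root eq {x} {y} e | no y≮ =
        subst₂ (Arc F) (trans (+-identityʳ _) x≡′)
          (lia 5 (λ k p x y n → k ≂ x ⇒ # 1 ⊕ p ≂ n ⇒ n ⊕ x ≼ # 1 ⊕ y ⇒ y ≺ n ⊕ x ⇒ ⊢ k ⊕ p ≂ y) (1 ∷ 0 ∷ 1 ∷ 1 ∷ 0 ∷ 1 ∷ []) (1 ∷ 1 ∷ 0 ∷ 0 ∷ 1 ∷ 0 ∷ 1 ∷ []) (x / N * N) (pred N) x y N x≡′ pred≡ (≮⇒≥ y≮) (Family.short e-family e))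
          (arc-shifts f-family (x / N) f-root)
        where
        we = windowed e-family e-root e
        x≡′ : x / N * N ≡ x
        x≡′ = lia 6 (λ k a t x y n → x ≂ a ⊕ k ⇒ t ⊕ x ≂ y ⇒ a ⊕ t ≺ n ⇒ n ⊕ x ≼ # 1 ⊕ y ⇒ ⊢ k ≂ x) (1 ∷ 0 ∷ 0 ∷ 0 ∷ 0 ∷ 0 ∷ 1 ∷ []) (1 ∷ 1 ∷ 1 ∷ 0 ∷ 1 ∷ 1 ∷ [])
          (x / N * N) (x % N) (y ∸ x) x y N (m≡m%n+[m/n]*n x N) (m∸n+n≡m (<⇒≤ (proj₁ we))) (proj₂ we) (≮⇒≥ y≮)

      arcs-determined : ∀ {E F} → Family N E → Family N F → RootArc E → RootArc F →
                        chords {N} E ≡ chords F → ∀ x y → E x y ≡ F x y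
      arcs-determined e-family f-family er fr eq x y = bool-ext
        (arcs-⊆ e-family f-family er fr eq) (arcs-⊆ f-family e-family fr er (sym eq))

      module _ {D : ChordSet N} (dissection : IsDissection D) where

        private
          Root : ℕ → ℕ → Set
          Root x y = x % N ≡ 0 × y ≡ pred N + x

          -- Each diagonal in the direction that does not reach a multiple of N, together with the
          -- translates of the root arc.
          Chosen : ℕ → ℕ → Set
          Chosen x y = Window x y × (bit D x y ≡ true ⊎ Root x y)

          chosen? : ∀ x y → Dec (Chosen x y)
          chosen? x y = ((x <? y) ×-dec (x % N + (y ∸ x) <? N)) ×-dec
            ((bit D x y Bool.≟ true) ⊎-dec ((x % N ≟ 0) ×-dec (y ≟ pred N + x)))

        rooted-arcs : Arcs
        rooted-arcs x y = does (chosen? x y)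

        private
          arc⁻ : ∀ {x y} → Arc rooted-arcs x y → Chosen x y
          arc⁻ {x} {y} = does-true (chosen? x y)

          arc⁺ : ∀ {x y} → Chosen x y → Arc rooted-arcs x y
          arc⁺ {x} {y} = true-does (chosen? x y)

          length : ∀ {x y} → Window x y → (y ∸ x) + x ≡ y
          length w = m∸n+n≡m (<⇒≤ (proj₁ w))

          chosen-shift : ∀ {x y} → Chosen x y → Chosen (N + x) (N + y)
          chosen-shift {x} {y} ((x<y , w) , c) =
            (+-monoʳ-< N x<y , subst₂ (λ r t → r + t < N) (sym x%) (sym ([m+n]∸[m+o]≡n∸o N y x)) w) ,
            [ (λ t → inj₁ (trans (invariant-N D x y) t)) ,
              (λ (r , eq) → inj₂ (trans x% r , lia 4 (λ n p x y → y ≂ p ⊕ x ⇒ ⊢ n ⊕ y ≂ p ⊕ (n ⊕ x)) (1 ∷ 1 ∷ []) (1 ∷ 0 ∷ 1 ∷ []) N (pred N) x y eq)) ]′ c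
            where
            x% : (N + x) % N ≡ x % N
            x% = trans (cong (_% N) (+-comm N x)) ([m+n]%n≡m%n x N)

          chosen-unshift : ∀ {x y} → Chosen (N + x) (N + y) → Chosen x y
          chosen-unshift {x} {y} ((x<y , w) , c) =
            (+-cancelˡ-< N _ _ x<y , subst₂ (λ r t → r + t < N) x% ([m+n]∸[m+o]≡n∸o N y x) w) ,
            [ (λ t → inj₁ (trans (sym (invariant-N D x y)) t)) ,
              (λ (r , eq) → inj₂ (trans (sym x%) r , lia 4 (λ n p x y → n ⊕ y ≂ p ⊕ (n ⊕ x) ⇒ ⊢ y ≂ p ⊕ x) (1 ∷ 1 ∷ []) (1 ∷ 0 ∷ 1 ∷ []) N (pred N) x y eq)) ]′ c
            where
            x% : (N + x) % N ≡ x % N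
            x% = trans (cong (_% N) (+-comm N x)) ([m+n]%n≡m%n x N)

          inner : ∀ {a c y} → Window a y → a < c → c < y → c % N + a ≡ a % N + c
          inner {a} {c} {y} w a<c c<y with t , refl ← offset (<⇒≤ a<c) =
            lia 4 (λ r q a t → q ≂ r ⊕ t ⇒ ⊢ q ⊕ a ≂ r ⊕ (a ⊕ t)) (1 ∷ 1 ∷ []) (1 ∷ 0 ∷ 1 ∷ []) (a % N) ((a + t) % N) a t
              (%-+ a (lia 6 (λ r s t a y n → s ⊕ a ≂ y ⇒ r ⊕ s ≺ n ⇒ a ⊕ t ≺ y ⇒ ⊢ r ⊕ t ≺ n) (1 ∷ 1 ∷ 1 ∷ 0 ∷ 1 ∷ []) [] (a % N) (y ∸ a) t a y N (length w) (proj₂ w) c<y))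

          -- The inner arc is not a root arc, since its start is no multiple of N; an outer root arc
          -- fills the whole period; two diagonals do not cross.
          chosen-nested : ∀ {a b c d} → Chosen a b → Chosen c d → a < c → c < b → d ≤ b
          chosen-nested {a} {b} {c} {d} (w , p) (w′ , q) a<c c<b = ≮⇒≥ (cross p q)
            where
            c% : c % N + a ≡ a % N + c
            c% = inner w a<c c<b
            d< : d < N + a
            d< = lia 7 (λ r q t a c d n → q ⊕ a ≂ r ⊕ c ⇒ t ⊕ c ≂ d ⇒ q ⊕ t ≺ n ⇒ ⊢ d ≺ n ⊕ a) (1 ∷ 1 ∷ 0 ∷ 1 ∷ 0 ∷ 1 ∷ []) []
              (a % N) (c % N) (d ∸ c) a c d N c% (length w′) (proj₂ w′)
            cross : bit D a b ≡ true ⊎ Root a b → bit D c d ≡ true ⊎ Root c d → b < d → ⊥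
            cross _ (inj₂ (c%≡0 , _)) b<d = lia 4 (λ r q a c → q ⊕ a ≂ r ⊕ c ⇒ q ≂ # 0 ⇒ a ≺ c ⇒ ⊢⊥) (1 ∷ 1 ∷ 0 ∷ 0 ∷ 1 ∷ []) [] (a % N) (c % N) a c c% c%≡0 a<c
            cross (inj₂ (_ , refl)) (inj₁ _) b<d = lia 4 (λ p n a d → # 1 ⊕ p ≂ n ⇒ p ⊕ a ≺ d ⇒ d ≺ n ⊕ a ⇒ ⊢⊥) (1 ∷ 1 ∷ 0 ∷ 1 ∷ []) [] (pred N) N a d pred≡ b<d d<
            cross (inj₁ t) (inj₁ u) b<d = bit-nested dissection t u a<c c<b b<d d<

          chosen-long : ∀ {a b} → Chosen a b → 2 + a ≤ b
          chosen-long {a} {b} ((a<b , _) , inj₁ t) = ≤∧≢⇒< a<b λ { refl →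
            proj₁ (proj₂ (IsDissection.diagonals dissection (bit⇒∈ {D = D} t))) (next-rep a) }
          chosen-long {a} ((_ , _) , inj₂ (_ , refl)) = lia 3 (λ n p a → # 3 ≼ n ⇒ # 1 ⊕ p ≂ n ⇒ ⊢ # 2 ⊕ a ≼ p ⊕ a) (1 ∷ 0 ∷ 1 ∷ 1 ∷ []) [] N (pred N) a 3≤N pred≡

        rooted-family : Family N rooted-arcs
        rooted-family = record
          { long = λ e → chosen-long (arc⁻ e)
          ; short = λ {a} {b} e → let (w , _) = arc⁻ e in
              lia 5 (λ r t a b n → t ⊕ a ≂ b ⇒ r ⊕ t ≺ n ⇒ ⊢ b ≺ n ⊕ a) (1 ∷ 1 ∷ 0 ∷ 1 ∷ []) [] (a % N) (b ∸ a) a b N (length w) (proj₂ w)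
          ; periodic = λ a b → bool-ext (λ e → arc⁺ (chosen-unshift (arc⁻ e))) (λ e → arc⁺ (chosen-shift (arc⁻ e)))
          ; nested = λ e f → chosen-nested (arc⁻ e) (arc⁻ f) }

        rooted-root : RootArc rooted-arcs
        rooted-root = arc⁺ ((lia 2 (λ n p → # 3 ≼ n ⇒ # 1 ⊕ p ≂ n ⇒ ⊢ # 0 ≺ p) (1 ∷ 0 ∷ 1 ∷ 1 ∷ []) [] N (pred N) 3≤N pred≡ ,
            subst (λ r → r + pred N < N) (sym 0%) (≤-reflexive pred≡)) , inj₂ (0% , sym (+-identityʳ _)))
          where
          0% : 0 % N ≡ 0
          0% = m<n⇒m%n≡m (<⇒≤ (<⇒≤ 3≤N))

        rooted-chords : chords rooted-arcs ≡ D
        rooted-chords = chords≡ dissection rooted-family sound choice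
          where
          sound : ∀ {x y} → Arc rooted-arcs x y → suc y < N + x → bit D x y ≡ true
          sound {x} {y} e y< with arc⁻ e
          ... | _ , inj₁ t = t
          ... | _ , inj₂ (_ , refl) = ⊥-elim (lia 3 (λ n p x → # 1 ⊕ p ≂ n ⇒ # 1 ⊕ (p ⊕ x) ≺ n ⊕ x ⇒ ⊢⊥) (1 ∷ 0 ∷ 1 ∷ []) [] N (pred N) x pred≡ y<)
          choice : ∀ {x y} → 2 + x ≤ y → suc y < N + x → bit D x y ≡ true → Arc rooted-arcs x y ⊎ Arc rooted-arcs y (N + x)
          choice {x} {y} lo hi t with x % N + (y ∸ x) <? N
          ... | yes w = inj₁ (arc⁺ ((<⇒≤ lo , w) , inj₁ t))
          -- If the arc from x to y leaves its period, then the one from y to N + x does not.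
          ... | no ¬w = inj₂ (arc⁺ ((<⇒≤ hi ,
              (lia 7 (λ r q t s x y n → n ⊕ q ≂ r ⊕ t ⇒ t ⊕ x ≂ y ⇒ s ⊕ y ≂ n ⊕ x ⇒ r ≺ n ⇒ ⊢ q ⊕ s ≺ n) (1 ∷ 1 ∷ 1 ∷ 0 ∷ 1 ∷ 0 ∷ 1 ∷ []) []
                (x % N) (y % N) (y ∸ x) (N + x ∸ y) x y N y% ℓ (m∸n+n≡m (<⇒≤ (<⇒≤ hi))) (m%n<n x N))) ,
              inj₁ (trans (cong (λ i → lookup (lookup D (rep y)) i) (rep-shift x)) (bit-sym dissection t))))
            where
            ℓ : (y ∸ x) + x ≡ y
            ℓ = m∸n+n≡m (<⇒≤ (<⇒≤ lo))
            y% : N + y % N ≡ x % N + (y ∸ x)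
            y% = trans (cong (λ z → N + z % N) (trans (sym ℓ) (+-comm (y ∸ x) x)))
              (%-wrap x (≮⇒≥ ¬w) (lia 4 (λ t x y n → t ⊕ x ≂ y ⇒ # 1 ⊕ y ≺ n ⊕ x ⇒ ⊢ t ≺ n) (1 ∷ 1 ∷ 1 ∷ []) [] (y ∸ x) x y N ℓ hi))

-- Counting arrangements and ballot sequences

module Flat where
  open import Data.Empty using (⊥; ⊥-elim)
  open import Data.Fin.Base using (Fin; zero; suc; toℕ; fromℕ<)
  open import Data.Fin.Properties using (_≟_; toℕ-injective; toℕ-fromℕ<)
  open import Data.List.Base using (List; []; _∷_; map)
  open import Data.List.Properties using (∷-injective)
  open import Data.List.Relation.Unary.All as All using (All; []; _∷_)
  open import Data.Nat.Base
  open import Data.Nat.ListAction using (sum)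
  open import Data.Nat.Properties hiding (_≟_)
  import Data.Nat.Properties as ℕ
  open import Data.Product.Base using (∃-syntax; _×_; _,_; proj₁; proj₂)
  open import Data.Vec.Base as Vec using (Vec; []; _∷_; lookup; updateAt)
  open import Data.Vec.Properties using (lookup∘updateAt; lookup∘updateAt′)
  open import Function.Base using (_∘_)
  open import Function.Bundles using (_⇔_; mk⇔; Equivalence)
  open import Relation.Binary.PropositionalEquality
  open import Relation.Nullary.Decidable.Core using (yes; no)
  open import Relation.Nullary.Negation using (¬_; contradiction)

  open import Defs using (HasCard)
  open Linear
  open Sums
  open Card
  open Words using (Word; weights)
  open Subgons using (tally)

  ΣF-cong : ∀ k {f g : Fin k → ℕ} → (∀ i → f i ≡ g i) → ΣF k f ≡ ΣF k g
  ΣF-cong zero    h = refl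
  ΣF-cong (suc k) h = cong₂ _+_ (h zero) (ΣF-cong k (h ∘ suc))

  ΣF-0 : ∀ k → ΣF k (λ _ → 0) ≡ 0
  ΣF-0 zero    = refl
  ΣF-0 (suc k) = ΣF-0 k

  ΣF-*ʳ : ∀ k (f : Fin k → ℕ) a → ΣF k f * a ≡ ΣF k (λ i → f i * a)
  ΣF-*ʳ zero    f a = refl
  ΣF-*ʳ (suc k) f a = trans (*-distribʳ-+ a (f zero) _) (cong (f zero * a +_) (ΣF-*ʳ k (f ∘ suc) a))

  ΣF-+ : ∀ k (f g : Fin k → ℕ) → ΣF k (λ i → f i + g i) ≡ ΣF k f + ΣF k g
  ΣF-+ zero    f g = refl
  ΣF-+ (suc k) f g = trans (cong (f zero + g zero +_) (ΣF-+ k (f ∘ suc) (g ∘ suc)))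
    (lia 4 (λ a b c d → ⊢ a ⊕ b ⊕ (c ⊕ d) ≂ a ⊕ c ⊕ (b ⊕ d)) (1 ∷ []) (1 ∷ []) (f zero) (g zero) _ _)

  ΣF-lookup : ∀ {k} (ν : Vec ℕ k) → ΣF k (lookup ν) ≡ Vec.sum ν
  ΣF-lookup []      = refl
  ΣF-lookup (m ∷ ν) = cong (m +_) (ΣF-lookup ν)

  ΣF-≤ : ∀ k (f : Fin k → ℕ) i → f i ≤ ΣF k f
  ΣF-≤ (suc k) f zero    = m≤m+n _ _
  ΣF-≤ (suc k) f (suc i) = ≤-trans (ΣF-≤ k (f ∘ suc) i) (m≤n+m _ (f zero))

  remove : ∀ {k} → Vec ℕ k → Fin k → Vec ℕ k
  remove ν c = updateAt ν c pred

  ΣF-remove : ∀ {k} (g : Fin k → ℕ) (ν : Vec ℕ k) c {p} → lookup ν c ≡ suc p →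
              ΣF k (λ i → g i * lookup ν i) ≡ g c + ΣF k (λ i → g i * lookup (remove ν c) i)
  ΣF-remove g (m ∷ ν) zero {p} refl = trans (cong₂ _+_ (*-suc (g zero) p) refl) (+-assoc (g zero) (g zero * p) _)
  ΣF-remove g (m ∷ ν) (suc c) eq = trans (cong (g zero * m +_) (ΣF-remove (g ∘ suc) ν c eq))
    (lia 3 (λ a b c → ⊢ a ⊕ (b ⊕ c) ≂ b ⊕ (a ⊕ c)) (1 ∷ []) (1 ∷ []) (g zero * m) (g (suc c)) _)

  sum-remove : ∀ {k} (ν : Vec ℕ k) c {p} → lookup ν c ≡ suc p → Vec.sum ν ≡ suc (Vec.sum (remove ν c))
  sum-remove (m ∷ ν) zero    refl = refl
  sum-remove (m ∷ ν) (suc c) eq   = trans (cong (m +_) (sum-remove ν c eq)) (+-suc m _)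

  ∏!-remove : ∀ {k} (ν : Vec ℕ k) c {p} → lookup ν c ≡ suc p → ∏! ν ≡ suc p * ∏! (remove ν c)
  ∏!-remove (m ∷ ν) zero    {p} refl = *-assoc (suc p) (p !) (∏! ν)
  ∏!-remove (m ∷ ν) (suc c) {p} eq   = trans (cong (m ! *_) (∏!-remove ν c eq))
    (trans (sym (*-assoc (m !) (suc p) _)) (trans (cong (_* ∏! (remove ν c)) (*-comm (m !) (suc p))) (*-assoc (suc p) (m !) _)))

  occ : ∀ {k} → Fin k → List (Fin k) → ℕ
  occ c []      = 0
  occ c (x ∷ v) = 𝟙 (x ≟ c) + occ c v

  Content : ∀ {k} → Vec ℕ k → List (Fin k) → Set
  Content ν v = ∀ c → occ c v ≡ lookup ν c

  private
    content-cons : ∀ {k} {ν : Vec ℕ k} {c v p} → lookup ν c ≡ suc p → Content ν (c ∷ v) ⇔ Content (remove ν c) v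
    content-cons {ν = ν} {c} {v} {p} eq = mk⇔ forth back
      where
      forth : Content ν (c ∷ v) → Content (remove ν c) v
      forth h x with c ≟ x | h x
      ... | yes refl | e = trans (cong pred e) (sym (lookup∘updateAt c ν))
      ... | no c≢x   | e = trans e (sym (lookup∘updateAt′ x c (c≢x ∘ sym) ν))
      back : Content (remove ν c) v → Content ν (c ∷ v)
      back h x with c ≟ x
      ... | yes refl = trans (cong suc (trans (h c) (trans (lookup∘updateAt c ν) (cong pred eq)))) (sym eq)
      ... | no c≢x   = trans (h x) (lookup∘updateAt′ x c (c≢x ∘ sym) ν)

    content-head : ∀ {k} {ν : Vec ℕ k} {c v} → Content ν (c ∷ v) → lookup ν c ≢ 0
    content-head {c = c} h eq with c ≟ c | h c
    ... | yes _ | e = contradiction (trans e eq) λ ()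
    ... | no c≢c | _ = c≢c refl

    content-[] : ∀ {k} (ν : Vec ℕ k) → Vec.sum ν ≡ 0 → Content ν []
    content-[] ν eq c = sym (n≤0⇒n≡0 (≤-trans (ΣF-≤ _ (lookup ν) c) (≤-reflexive (trans (ΣF-lookup ν) eq))))

    content-0 : ∀ {k} {ν : Vec ℕ k} → Vec.sum ν ≡ 0 → ∀ {v} → Content ν v → v ≡ []
    content-0 eq {[]}    h = refl
    content-0 {ν = ν} eq {c ∷ v} h = contradiction
      (sym (content-[] ν eq c)) (content-head {ν = ν} {c} {v} h)

    content-suc : ∀ {k} {ν : Vec ℕ k} {L} → Vec.sum ν ≡ suc L → ¬ Content ν []
    content-suc {k} {ν} eq h = contradiction (trans (sym eq) (trans (sym (ΣF-lookup ν)) (trans (ΣF-cong k (sym ∘ h)) (ΣF-0 k)))) λ ()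

    ∏!-0 : ∀ {k} (ν : Vec ℕ k) → Vec.sum ν ≡ 0 → ∏! ν ≡ 1
    ∏!-0 []         eq = refl
    ∏!-0 (zero ∷ ν) eq = trans (+-identityʳ _) (∏!-0 ν eq)

    by-head : ∀ {k} {P : List (Fin k) → Set} {m : Fin k → ℕ} → ¬ P [] →
              (∀ c → HasCard (λ v → P (c ∷ v)) (m c)) → HasCard P (ΣF k m)
    by-head {k} {P} {m} ¬[] h = card-⇔ (λ v → mk⇔ (λ { (c , w , refl , p) → p }) split)
      (card-⋃ k {λ c v → ∃[ w ] v ≡ c ∷ w × P v} (λ { (w , refl , _) (w′ , refl , _) → refl })
        λ c → card-image (c ∷_) (λ _ _ e → proj₂ (∷-injective e)) (λ {w} p → w , refl , p)
                (λ { (w , refl , p) → w , p , refl }) (h c))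
      where
      split : ∀ {v} → P v → ∃[ c ] ∃[ w ] v ≡ c ∷ w × P v
      split {[]}    p = ⊥-elim (¬[] p)
      split {c ∷ w} p = c , w , refl , p

  -- Words with first letter c contribute ν c times L ! to the product with `∏! ν`, and the entries
  -- of ν add up to suc L.
  arrangements : ∀ {k} L (ν : Vec ℕ k) → Vec.sum ν ≡ L → ∃[ m ] HasCard (Content ν) m × m * ∏! ν ≡ L !
  arrangements zero ν eq = 1 , card-singleton [] (content-[] ν eq) (content-0 {ν = ν} eq) ,
    trans (+-identityʳ _) (∏!-0 ν eq)
  arrangements {k} (suc L) ν eq = ΣF k (proj₁ ∘ step) , by-head (content-suc {ν = ν} eq) (proj₁ ∘ proj₂ ∘ step) , (begin
    ΣF k (proj₁ ∘ step) * ∏! ν             ≡⟨ ΣF-*ʳ k _ (∏! ν) ⟩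
    ΣF k (λ c → proj₁ (step c) * ∏! ν)     ≡⟨ ΣF-cong k (proj₂ ∘ proj₂ ∘ step) ⟩
    ΣF k (λ c → lookup ν c * L !)          ≡⟨ ΣF-*ʳ k (lookup ν) (L !) ⟨
    ΣF k (lookup ν) * L !                  ≡⟨ cong (_* L !) (trans (ΣF-lookup ν) eq) ⟩
    suc L !                                ∎)
    where
    open ≡-Reasoning
    step : ∀ c → ∃[ m ] HasCard (λ v → Content ν (c ∷ v)) m × m * ∏! ν ≡ lookup ν c * L !
    step c with lookup ν c in ν≡
    ... | zero  = 0 , card-∅ (λ v h → content-head {ν = ν} {c} {v} h ν≡) , refl
    ... | suc p with arrangements L (remove ν c) (suc-injective (trans (sym (sum-remove ν c ν≡)) eq))
    ...   | m , h , m≡ = m , card-⇔ (λ v → let e = content-cons {ν = ν} {v = v} ν≡ in mk⇔ (Equivalence.from e) (Equivalence.to e)) h , (begin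
      m * ∏! ν                            ≡⟨ cong (m *_) (∏!-remove ν c ν≡) ⟩
      m * (suc p * ∏! (remove ν c))       ≡⟨ x∙yz≈y∙xz m (suc p) _ ⟩
      suc p * (m * ∏! (remove ν c))       ≡⟨ cong (suc p *_) m≡ ⟩
      suc p * L !                         ∎)
      where open import Algebra.Properties.CommutativeSemigroup *-commutativeSemigroup using (x∙yz≈y∙xz)

  -- A path from height h that goes down 1 at `zero` and up toℕ c at any other letter c, is positive
  -- before every letter and ends at 0. These are the preorder words of h plane trees, `zero` being
  -- a leaf and suc i a node with toℕ i + 2 children.
  Ballot : ∀ {k} → ℕ → List (Fin (suc k)) → Set
  Ballot h       []          = h ≡ 0
  Ballot zero    (_ ∷ _)     = ⊥
  Ballot (suc h) (zero ∷ v)  = Ballot h v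
  Ballot (suc h) (suc i ∷ v) = Ballot (suc h + suc (toℕ i)) v

  private
    Balanced : ∀ {k} → Vec ℕ (suc k) → ℕ → Set
    Balanced {k} ν h = h + ΣF (suc k) (λ c → toℕ c * lookup ν c) ≡ lookup ν zero

    -- The count of the cycle lemma, a fraction h / (L + 1) of all arrangements, multiplied out to
    -- stay in ℕ. It is proved here by induction on the first letter.
    BallotCount : ∀ {k} → ℕ → Vec ℕ (suc k) → ℕ → Set
    BallotCount L ν h = ∃[ m ] HasCard (λ v → Content ν v × Ballot h v) m × m * ∏! ν ≡ h * L !

    no-ballots : ∀ {k} L (ν : Vec ℕ (suc k)) → Vec.sum ν ≡ suc L → BallotCount L ν 0
    no-ballots L ν eq = 0 , card-∅ empty , refl
      where
      empty : ∀ v → ¬ (Content ν v × Ballot zero v)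
      empty []      (h , _)  = content-suc {ν = ν} eq h
      empty (_ ∷ _) (_ , ())

  module BallotStep {k} (L : ℕ) (ν : Vec ℕ (suc k)) (h : ℕ) (eq : Vec.sum ν ≡ suc L) (balance : Balanced ν (suc h))
    (ih : ∀ K → L ≡ suc K → ∀ (ν′ : Vec ℕ (suc k)) h′ → Vec.sum ν′ ≡ suc K → Balanced ν′ h′ → BallotCount K ν′ h′) where

    height : Fin (suc k) → ℕ
    height zero    = h
    height (suc i) = suc h + suc (toℕ i)
    -- The induction hypothesis covers only nonempty remainders, so a word of one letter is counted
    -- directly.
    share : ℕ → Fin (suc k) → ℕ
    share zero    c = lookup ν c
    share (suc K) c = lookup ν c * (height c * K !)
    down : ∀ {c v} → Ballot (suc h) (c ∷ v) ⇔ Ballot (height c) v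
    down {zero}  = mk⇔ (λ b → b) (λ b → b)
    down {suc i} = mk⇔ (λ b → b) (λ b → b)
    rebalance : ∀ c {p} → lookup ν c ≡ suc p →
                height c + ΣF (suc k) (λ x → toℕ x * lookup (remove ν c) x) ≡ lookup (remove ν c) zero
    rebalance zero {p} ν≡ = suc-injective (begin
      suc (h + ΣF (suc k) (λ x → toℕ x * lookup (remove ν zero) x)) ≡⟨ cong (suc h +_) (ΣF-remove toℕ ν zero ν≡) ⟨
      suc h + ΣF (suc k) (λ x → toℕ x * lookup ν x)                 ≡⟨ trans balance ν≡ ⟩
      suc p                                                         ≡⟨ cong suc (trans (lookup∘updateAt zero ν) (cong pred ν≡)) ⟨
      suc (lookup (remove ν zero) zero)                             ∎)
      where open ≡-Reasoning
    rebalance (suc i) {p} ν≡ = begin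
      suc h + suc (toℕ i) + ΣF (suc k) (λ x → toℕ x * lookup (remove ν (suc i)) x)   ≡⟨ +-assoc (suc h) _ _ ⟩
      suc h + (suc (toℕ i) + ΣF (suc k) (λ x → toℕ x * lookup (remove ν (suc i)) x)) ≡⟨ cong (suc h +_) (ΣF-remove toℕ ν (suc i) ν≡) ⟨
      suc h + ΣF (suc k) (λ x → toℕ x * lookup ν x)                                   ≡⟨ balance ⟩
      lookup ν zero                                                                   ≡⟨ lookup∘updateAt′ zero (suc i) (λ ()) ν ⟨
      lookup (remove ν (suc i)) zero                                                  ∎
      where open ≡-Reasoning
    rest : ∀ c L → Vec.sum (remove ν c) ≡ L → ∀ {p} → lookup ν c ≡ suc p →
           (∀ K → L ≡ suc K → ∃[ m ] HasCard (λ v → Content (remove ν c) v × Ballot (height c) v) m ×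
                                     m * ∏! (remove ν c) ≡ height c * K !) →
           ∃[ m ] HasCard (λ v → Content (remove ν c) v × Ballot (height c) v) m ×
                  suc p * (m * ∏! (remove ν c)) ≡ share L c
    rest c zero sum≡ {p} ν≡ _ = 1 ,
      card-singleton [] (content-[] (remove ν c) sum≡ , height≡0) (content-0 {ν = remove ν c} sum≡ ∘ proj₁) ,
      trans (cong (suc p *_) (trans (+-identityʳ _) (∏!-0 (remove ν c) sum≡))) (trans (*-identityʳ (suc p)) (sym ν≡))
      where
      height≡0 : height c ≡ 0
      height≡0 = n≤0⇒n≡0 (≤-trans (m≤m+n _ _) (≤-trans (≤-reflexive (rebalance c ν≡))
        (≤-reflexive (sym (content-[] (remove ν c) sum≡ zero)))))
    rest c (suc K) sum≡ {p} ν≡ ih = let (m , card , m≡) = ih K refl in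
      m , card , cong₂ _*_ (sym ν≡) m≡
    step : ∀ c → ∃[ m ] HasCard (λ v → Content ν (c ∷ v) × Ballot (suc h) (c ∷ v)) m × m * ∏! ν ≡ share L c
    step c = by-count (lookup ν c) refl
      where
      by-count : ∀ q → lookup ν c ≡ q →
                 ∃[ m ] HasCard (λ v → Content ν (c ∷ v) × Ballot (suc h) (c ∷ v)) m × m * ∏! ν ≡ share L c
      by-count zero    ν≡ = 0 , card-∅ (λ v (h , _) → content-head {ν = ν} {c} {v} h ν≡) , sym (none L)
        where
        none : ∀ L → share L c ≡ 0
        none zero    = ν≡
        none (suc K) = cong (_* (height c * K !)) ν≡
      by-count (suc p) ν≡ =
        let sum≡ = suc-injective (trans (sym (sum-remove ν c ν≡)) eq)
            (m , card , m≡) = rest c L sum≡ ν≡ λ K L≡ → ih K L≡ (remove ν c) (height c) (trans sum≡ L≡) (rebalance c ν≡)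
            e = λ {v} → content-cons {ν = ν} {c} {v} ν≡
        in m , card-⇔ (λ v → mk⇔ (λ (x , b) → Equivalence.from (e {v}) x , Equivalence.from (down {c} {v}) b)
                                (λ (x , b) → Equivalence.to (e {v}) x , Equivalence.to (down {c} {v}) b)) card ,
           trans (cong (m *_) (∏!-remove ν c ν≡)) (trans (x∙yz≈y∙xz m (suc p) _) m≡)
        where open import Algebra.Properties.CommutativeSemigroup *-commutativeSemigroup using (x∙yz≈y∙xz)
    -- Write H for suc h and suc L for the number of letters. The heights after the first letter,
    -- weighted by ν, add up to H (L + 1) + Σ c ν c - ν 0, which `balance` turns into H L. Adding ν
    -- 0 to both sides avoids the subtraction.
    final : ∀ L → Vec.sum ν ≡ suc L → ΣF (suc k) (share L) ≡ suc h * L !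
    final zero eq = trans (ΣF-lookup ν) (trans eq (sym (trans (*-identityʳ (suc h)) h≡0)))
      where
      h≡0 : suc h ≡ 1
      h≡0 = lia 3 (λ h w m → # 1 ⊕ h ⊕ w ≂ m ⇒ m ≼ # 1 ⇒ ⊢ # 1 ⊕ h ≂ # 1) (1 ∷ 1 ∷ 1 ∷ []) (1 ∷ []) h _ (lookup ν zero) balance
        (≤-trans (ΣF-≤ (suc k) (lookup ν) zero) (≤-reflexive (trans (ΣF-lookup ν) eq)))
    final (suc K) eq = begin
      ΣF (suc k) (λ c → lookup ν c * (height c * K !))
        ≡⟨ ΣF-cong (suc k) (λ c → sym (*-assoc (lookup ν c) (height c) (K !))) ⟩
      ΣF (suc k) (λ c → lookup ν c * height c * K !)
        ≡⟨ ΣF-*ʳ (suc k) (λ c → lookup ν c * height c) (K !) ⟨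
      ΣF (suc k) (λ c → lookup ν c * height c) * K !
        ≡⟨ cong (_* K !) (+-cancelʳ-≡ (lookup ν zero) _ _ total) ⟩
      suc h * suc K * K !
        ≡⟨ *-assoc (suc h) (suc K) (K !) ⟩
      suc h * suc K ! ∎
      where
      open ≡-Reasoning
      part : ∀ c → lookup ν (suc c) * height (suc c) ≡ lookup ν (suc c) * suc h + toℕ (suc c) * lookup ν (suc c)
      part c = trans (*-distribˡ-+ (lookup ν (suc c)) (suc h) _) (cong (lookup ν (suc c) * suc h +_) (*-comm (lookup ν (suc c)) _))
      total : ΣF (suc k) (λ c → lookup ν c * height c) + lookup ν zero ≡ suc h * suc K + lookup ν zero
      total = begin
        m * h + ΣF k (λ c → lookup ν (suc c) * height (suc c)) + m
          ≡⟨ cong (λ t → m * h + t + m) (trans (ΣF-cong k part) (ΣF-+ k _ _)) ⟩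
        m * h + (ΣF k (λ c → lookup ν (suc c) * suc h) + w) + m
          ≡⟨ lia 4 (λ a s w m → ⊢ a ⊕ (s ⊕ w) ⊕ m ≂ m ⊕ a ⊕ s ⊕ w) (1 ∷ []) (1 ∷ []) (m * h) (ΣF k (λ c → lookup ν (suc c) * suc h)) w m ⟩
        m + m * h + ΣF k (λ c → lookup ν (suc c) * suc h) + w
          ≡⟨ cong (λ t → t + ΣF k (λ c → lookup ν (suc c) * suc h) + w) (*-suc m h) ⟨
        ΣF (suc k) (λ c → lookup ν c * suc h) + w
          ≡⟨ cong (_+ w) (trans (sym (ΣF-*ʳ (suc k) (lookup ν) (suc h))) (cong (_* suc h) (trans (ΣF-lookup ν) eq))) ⟩
        suc (suc K) * suc h + w
          ≡⟨ cong (_+ w) (*-comm (suc (suc K)) (suc h)) ⟩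
        suc h * suc (suc K) + w
          ≡⟨ cong (_+ w) (*-suc (suc h) (suc K)) ⟩
        suc h + suc h * suc K + w
          ≡⟨ lia 4 (λ h a w m → # 1 ⊕ h ⊕ w ≂ m ⇒ ⊢ # 1 ⊕ h ⊕ a ⊕ w ≂ a ⊕ m) (1 ∷ 1 ∷ []) (1 ∷ 0 ∷ 1 ∷ []) h (suc h * suc K) w m balance ⟩
        suc h * suc K + m ∎
        where
        m w : ℕ
        m = lookup ν zero
        w = ΣF k (λ c → toℕ (suc c) * lookup ν (suc c))

    result : BallotCount L ν (suc h)
    result = ΣF (suc k) (proj₁ ∘ step) ,
      by-head (content-suc {ν = ν} eq ∘ proj₁) (proj₁ ∘ proj₂ ∘ step) ,
      trans (ΣF-*ʳ (suc k) (proj₁ ∘ step) (∏! ν)) (trans (ΣF-cong (suc k) (proj₂ ∘ proj₂ ∘ step)) (final L eq))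

  ballots : ∀ {k} L (ν : Vec ℕ (suc k)) h → Vec.sum ν ≡ suc L →
            h + ΣF (suc k) (λ c → toℕ c * lookup ν c) ≡ lookup ν zero →
            ∃[ m ] HasCard (λ v → Content ν v × Ballot h v) m × m * ∏! ν ≡ h * L !
  ballots L       ν zero    eq balance = no-ballots L ν eq
  ballots zero    ν (suc h) eq balance = BallotStep.result zero ν h eq balance λ K ()
  ballots (suc L) ν (suc h) eq balance = BallotStep.result (suc L) ν h eq balance λ { K refl → ballots L }

  -- The letter zero ends a block, and suc i stands for a subgon with toℕ i + 3 vertices.
  blocks : ∀ {k} → List (Fin (suc k)) → Word
  blocks []          x       = []
  blocks (zero ∷ v)  zero    = []
  blocks (zero ∷ v)  (suc x) = blocks v x
  blocks (suc i ∷ v) zero    = suc (toℕ i) ∷ blocks v zero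
  blocks (suc i ∷ v) (suc x) = blocks v (suc x)

  blocks-positive : ∀ {k} (v : List (Fin (suc k))) x → All (0 <_) (blocks v x)
  blocks-positive []          x       = []
  blocks-positive (zero ∷ v)  zero    = []
  blocks-positive (zero ∷ v)  (suc x) = blocks-positive v x
  blocks-positive (suc i ∷ v) zero    = z<s ∷ blocks-positive v zero
  blocks-positive (suc i ∷ v) (suc x) = blocks-positive v (suc x)

  private
    Σ-head : ∀ n f → Σ< (suc n) f ≡ f 0 + Σ< n (f ∘ suc)
    Σ-head n f = Σ-split 1 n f

  tally-blocks : ∀ {k} (v : List (Fin (suc k))) i →
                 Σ< (suc (occ zero v)) (λ x → tally (suc (toℕ i)) (blocks v x)) ≡ occ (suc i) v
  tally-blocks []         i = refl
  tally-blocks (zero ∷ v) i = trans (Σ-head (suc (occ zero v)) _) (tally-blocks v i)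
  tally-blocks (suc j ∷ v) i = trans (Σ-head (occ zero v) _) (trans
    (+-assoc (𝟙 (suc (toℕ j) ℕ.≟ suc (toℕ i))) (tally (suc (toℕ i)) (blocks v 0))
      (Σ< (occ zero v) (λ x → tally (suc (toℕ i)) (blocks v (suc x)))))
    (cong₂ _+_ (𝟙-cong (suc (toℕ j) ℕ.≟ suc (toℕ i)) (suc j ≟ suc i)
        (cong suc ∘ toℕ-injective ∘ suc-injective) (λ { refl → refl }))
      (trans (sym (Σ-head (occ zero v) _)) (tally-blocks v i))))

  weights-zero : ∀ {k} (v : List (Fin (suc k))) x → weights (blocks (zero ∷ v)) (suc x) ≡ weights (blocks v) x
  weights-zero v x = Σ-head x _

  weights-suc : ∀ {k} i (v : List (Fin (suc k))) x →
                weights (blocks (suc i ∷ v)) (suc x) ≡ suc (toℕ i) + weights (blocks v) (suc x)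
  weights-suc i v x = trans (Σ-head x _) (trans (+-assoc (suc (toℕ i)) _ _)
    (cong (suc (toℕ i) +_) (sym (Σ-head x _))))

  load : ∀ {k} → List (Fin k) → ℕ
  load v = sum (map toℕ v)

  weights-blocks : ∀ {k} (v : List (Fin (suc k))) → weights (blocks v) (suc (occ zero v)) ≡ load v
  weights-blocks []          = refl
  weights-blocks (zero ∷ v)  = trans (weights-zero v (suc (occ zero v))) (weights-blocks v)
  weights-blocks (suc i ∷ v) = trans (weights-suc i v (occ zero v)) (cong (suc (toℕ i) +_) (weights-blocks v))

  ΣF-*0 : ∀ k (g : Fin k → ℕ) → ΣF k (λ c → g c * 0) ≡ 0
  ΣF-*0 zero    g = refl
  ΣF-*0 (suc k) g = cong₂ _+_ (*-zeroʳ (g zero)) (ΣF-*0 k (g ∘ suc))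

  ΣF-delta : ∀ {k} (x : Fin k) (g : Fin k → ℕ) → ΣF k (λ c → g c * 𝟙 (x ≟ c)) ≡ g x
  ΣF-delta {suc k} zero    g = trans (cong₂ _+_ (*-identityʳ (g zero)) (ΣF-*0 k (g ∘ suc))) (+-identityʳ _)
  ΣF-delta {suc k} (suc x) g = trans (cong₂ _+_ (*-zeroʳ (g zero))
    (ΣF-cong k λ c → cong (g (suc c) *_) (𝟙-cong (suc x ≟ suc c) (x ≟ c) (λ { refl → refl }) (cong suc)))) (ΣF-delta x (g ∘ suc))

  load-content : ∀ {k} {ν : Vec ℕ k} v → Content ν v → load v ≡ ΣF k (λ c → toℕ c * lookup ν c)
  load-content {k} {ν} v h = trans (go v) (ΣF-cong k λ c → cong (toℕ c *_) (h c))
    where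
    go : ∀ {k} (v : List (Fin k)) → load v ≡ ΣF k (λ c → toℕ c * occ c v)
    go {k} [] = sym (ΣF-*0 k toℕ)
    go {k} (x ∷ v) = sym (trans (ΣF-cong k λ c → *-distribˡ-+ (toℕ c) (𝟙 (x ≟ c)) (occ c v))
      (trans (ΣF-+ k _ _) (cong₂ _+_ (ΣF-delta x toℕ) (sym (go v)))))

  -- Past the last block `blocks` is empty as well, so blocks alone do not reveal trailing
  -- separators; their number is therefore compared first.
  blocks-injective : ∀ {k} {v w : List (Fin (suc k))} → occ zero v ≡ occ zero w →
                     (∀ x → x ≤ occ zero v → blocks v x ≡ blocks w x) → v ≡ w
  blocks-injective {v = []}        {[]}        e h = refl
  blocks-injective {v = []}        {suc i ∷ w} e h = contradiction (h 0 z≤n) λ ()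
  blocks-injective {v = suc i ∷ v} {[]}        e h = contradiction (h 0 z≤n) λ ()
  blocks-injective {v = zero ∷ v}  {zero ∷ w}  e h = cong (zero ∷_) (blocks-injective (suc-injective e) λ x x≤ → h (suc x) (s≤s x≤))
  blocks-injective {v = zero ∷ v}  {suc i ∷ w} e h = contradiction (h 0 z≤n) λ ()
  blocks-injective {v = suc i ∷ v} {zero ∷ w}  e h = contradiction (h 0 z≤n) λ ()
  blocks-injective {v = suc i ∷ v} {suc j ∷ w} e h with ∷-injective (h 0 z≤n)
  ... | i≡j , tail = cong₂ _∷_ (cong suc (toℕ-injective (suc-injective i≡j)))
    (blocks-injective e λ { zero _ → tail ; (suc x) x≤ → h (suc x) x≤ })

  blocks-surjective : ∀ {k} m (W : Word) → (∀ x → All (λ j → 0 < j × j ≤ k) (W x)) →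
                      ∃[ v ] occ {suc k} zero v ≡ m × (∀ x → x ≤ m → blocks v x ≡ W x)
  blocks-surjective {k} m W ok = let (v , o , h₀ , h) = prepend m W (W 0) (ok 0) (rest m W ok) in
    v , o , λ { zero _ → h₀ ; (suc x) x≤ → h x x≤ }
    where
    Later : ℕ → Word → List ℕ → Set
    Later m W l = ∃[ v ] occ {suc k} zero v ≡ m × blocks v 0 ≡ l × (∀ x → suc x ≤ m → blocks v (suc x) ≡ W (suc x))
    prepend : ∀ m W l → All (λ j → 0 < j × j ≤ k) l → Later m W [] → Later m W l
    prepend m W []          []                w = w
    prepend m W (suc j ∷ l) ((_ , j<k) ∷ h) w with prepend m W l h w
    ... | v , o , h₀ , h = suc (fromℕ< j<k) ∷ v , o , cong₂ _∷_ (cong suc (toℕ-fromℕ< j<k)) h₀ , h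
    rest : ∀ m W → (∀ x → All (λ j → 0 < j × j ≤ k) (W x)) → Later m W []
    rest zero    W ok = [] , refl , refl , λ x ()
    rest (suc m) W ok with prepend m (W ∘ suc) (W 1) (ok 1) (rest m (W ∘ suc) (ok ∘ suc))
    ... | v , o , h₀ , h = zero ∷ v , cong suc o , refl , λ { zero _ → h₀ ; (suc x) x≤ → h x (≤-pred x≤) }

  -- Only `zero` lowers the path, so positivity has to be tested just at the start and after each
  -- `zero` but the last; the given total makes the path end at 0.
  ballot⇔ : ∀ {k} h (v : List (Fin (suc k))) → h + load v ≡ occ zero v →
            Ballot h v ⇔ (∀ x → x < occ zero v → x < h + weights (blocks v) x)
  ballot⇔ h       []          eq = mk⇔ (λ _ x ()) (λ _ → trans (sym (+-identityʳ h)) eq)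
  ballot⇔ zero    (zero ∷ v)  eq = mk⇔ (λ ()) (λ f → contradiction (f 0 z<s) λ ())
  ballot⇔ (suc h) (zero ∷ v)  eq = mk⇔
    (λ b → λ { zero _ → z<s
             ; (suc x) x< → s≤s (subst (λ w → x < h + w) (sym (weights-zero v x)) (Equivalence.to ih b x (≤-pred x<))) })
    (λ f → Equivalence.from ih λ x x< → ≤-pred (subst (λ w → suc x < suc h + w) (weights-zero v x) (f (suc x) (s≤s x<))))
    where ih = ballot⇔ h v (suc-injective eq)
  ballot⇔ zero    (suc i ∷ v) eq = mk⇔ (λ ())
    (λ f → contradiction (f 0 (subst (0 <_) eq z<s)) λ ())
  ballot⇔ (suc h) (suc i ∷ v) eq = mk⇔
    (λ b → λ { zero _ → z<s
             ; (suc x) x< → subst (suc x <_) (trans (+-assoc (suc h) (suc (toℕ i)) _) (cong (suc h +_) (sym (weights-suc i v x))))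
                 (Equivalence.to ih b (suc x) x<) })
    (λ f → Equivalence.from ih λ { zero _ → z<s
             ; (suc x) x< → subst (suc x <_) (sym (trans (+-assoc (suc h) (suc (toℕ i)) _) (cong (suc h +_) (sym (weights-suc i v x)))))
                 (f (suc x) x<) })
    where ih = ballot⇔ (suc h + suc (toℕ i)) v (trans (+-assoc (suc h) (suc (toℕ i)) _) eq)

open import Algebra.Bundles using (CommutativeRing)

-- q-numbers and q-factorials in a commutative ring

module QAnalog {c ℓ} (R : CommutativeRing c ℓ) (q : CommutativeRing.Carrier R) where
  open import Data.Fin.Base using (Fin; zero; suc; toℕ)
  open import Data.Nat.Base as ℕ using (ℕ; zero; suc)
  import Data.Nat.Properties as ℕ
  open import Data.Product.Base using (∃-syntax; _,_)
  open import Data.Vec.Base as Vec using (Vec; []; _∷_; lookup; tabulate)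
  import Relation.Binary.PropositionalEquality as ≡
  open ≡ using (_≡_)
  import Relation.Binary.Reasoning.Setoid

  open CommutativeRing R hiding (zero)
  open import Algebra.Properties.Ring ring using (-‿distribˡ-*)
  open import Algebra.Solver.Ring.NaturalCoefficients.Default commutativeSemiring using (solve; _:=_; _:+_; _:*_)

  open Relation.Binary.Reasoning.Setoid setoid

  infix 4 _∣_
  _∣_ : Carrier → Carrier → Set _
  a ∣ b = ∃[ x ] x * a ≈ b

  infixr 8 _^_
  _^_ : Carrier → ℕ → Carrier
  x ^ zero  = 1#
  x ^ suc n = x * x ^ n

  ^-+ : ∀ x m n → x ^ (m ℕ.+ n) ≈ x ^ m * x ^ n
  ^-+ x zero    n = sym (*-identityˡ _)
  ^-+ x (suc m) n = trans (*-congˡ (^-+ x m n)) (sym (*-assoc x _ _))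

  [_] : ℕ → Carrier
  [ zero  ] = 0#
  [ suc n ] = 1# + q * [ n ]

  []-+ : ∀ m n → [ m ℕ.+ n ] ≈ [ m ] + q ^ m * [ n ]
  []-+ zero    n = sym (trans (+-identityˡ _) (*-identityˡ _))
  []-+ (suc m) n = trans (+-congˡ (*-congˡ ([]-+ m n)))
    (solve 5 (λ a b c d e → (a :+ b :* (c :+ d :* e)) := ((a :+ b :* c) :+ (b :* d) :* e)) refl 1# q [ m ] (q ^ m) [ n ])

  infix 9 _!
  _! : ℕ → Carrier
  zero  ! = 1#
  suc n ! = n ! * [ suc n ]

  factorials : ∀ {k} → Vec ℕ k → Carrier
  factorials []      = 1#
  factorials (m ∷ μ) = m ! * factorials μ

  -- The quotient is the q-binomial coefficient, built by the q-Pascal recurrence since R has no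
  -- division.
  !-∣ : ∀ a b → a ! * b ! ∣ (a ℕ.+ b) !
  !-∣ zero    b = 1# , trans (*-identityˡ _) (*-identityˡ _)
  !-∣ (suc a) zero = 1# , trans (*-identityˡ _) (trans (*-identityʳ _) (reflexive (≡.cong _! (≡.sym (ℕ.+-identityʳ (suc a))))))
  !-∣ (suc a) (suc b) with !-∣ a (suc b) | !-∣ (suc a) b
  ... | x , p | y , r = x + q ^ suc a * y , (begin
    (x + q ^ suc a * y) * ((a ! * [ suc a ]) * (b ! * [ suc b ]))
      ≈⟨ solve 7 (λ x y t a a′ b b′ → (x :+ t :* y) :* ((a :* a′) :* (b :* b′)) :=
           ((x :* (a :* (b :* b′))) :* a′ :+ (y :* ((a :* a′) :* b)) :* (t :* b′))) refl x y (q ^ suc a) (a !) [ suc a ] (b !) [ suc b ] ⟩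
    (x * (a ! * suc b !)) * [ suc a ] + (y * (suc a ! * b !)) * (q ^ suc a * [ suc b ])
      ≈⟨ +-cong (*-congʳ p) (*-congʳ (trans r (reflexive (≡.cong _! (≡.sym (ℕ.+-suc a b)))))) ⟩
    (a ℕ.+ suc b) ! * [ suc a ] + (a ℕ.+ suc b) ! * (q ^ suc a * [ suc b ])
      ≈⟨ distribˡ _ _ _ ⟨
    (a ℕ.+ suc b) ! * ([ suc a ] + q ^ suc a * [ suc b ])
      ≈⟨ *-congˡ ([]-+ (suc a) (suc b)) ⟨
    (suc a ℕ.+ suc b) ! ∎)

  !-∣-sum : ∀ {k} N (μ : Vec ℕ k) → N ! * factorials μ ∣ (N ℕ.+ Vec.sum μ) !
  !-∣-sum N []      = 1# , trans (*-identityˡ _) (trans (*-identityʳ _) (reflexive (≡.cong _! (≡.sym (ℕ.+-identityʳ N)))))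
  !-∣-sum N (m ∷ μ) with !-∣ N m | !-∣-sum (N ℕ.+ m) μ
  ... | x , p | y , r = y * x , (begin
    (y * x) * (N ! * (m ! * factorials μ))
      ≈⟨ solve 5 (λ x y a b t → (y :* x) :* (a :* (b :* t)) := y :* ((x :* (a :* b)) :* t)) refl x y (N !) (m !) (factorials μ) ⟩
    y * ((x * (N ! * m !)) * factorials μ) ≈⟨ *-congˡ (*-congʳ p) ⟩
    y * ((N ℕ.+ m) ! * factorials μ)       ≈⟨ r ⟩
    (N ℕ.+ m ℕ.+ Vec.sum μ) !              ≡⟨ ≡.cong _! (ℕ.+-assoc N m _) ⟩
    (N ℕ.+ (m ℕ.+ Vec.sum μ)) !            ∎)

  -- Lowering the part μᵢ by one gives a q-multinomial coefficient of K; the factor [μᵢ] restores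
  -- the missing factor of [μᵢ] !.
  part-∣ : ∀ {k} N (μ : Vec ℕ k) i K → N ℕ.+ Vec.sum μ ≡ suc K → N ! * factorials μ ∣ [ lookup μ i ] * K !
  part-∣ N (zero  ∷ μ) zero K eq = 0# , trans (zeroˡ _) (sym (zeroˡ _))
  part-∣ N (suc m ∷ μ) zero K eq with !-∣-sum N (m ∷ μ)
  ... | x , p = x , (begin
    x * (N ! * ((m ! * [ suc m ]) * factorials μ))
      ≈⟨ solve 5 (λ x a b b′ t → x :* (a :* ((b :* b′) :* t)) := b′ :* (x :* (a :* (b :* t)))) refl x (N !) (m !) [ suc m ] (factorials μ) ⟩
    [ suc m ] * (x * (N ! * (m ! * factorials μ))) ≈⟨ *-congˡ p ⟩
    [ suc m ] * (N ℕ.+ (m ℕ.+ Vec.sum μ)) !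
      ≡⟨ ≡.cong (λ n → [ suc m ] * n !) (ℕ.suc-injective (≡.trans (≡.sym (ℕ.+-suc N _)) eq)) ⟩
    [ suc m ] * K ! ∎)
  part-∣ N (m ∷ μ) (suc i) K eq with !-∣ N m | part-∣ (N ℕ.+ m) μ i K (≡.trans (ℕ.+-assoc N m _) eq)
  ... | x , p | y , r = y * x , (begin
    (y * x) * (N ! * (m ! * factorials μ))
      ≈⟨ solve 5 (λ x y a b t → (y :* x) :* (a :* (b :* t)) := y :* ((x :* (a :* b)) :* t)) refl x y (N !) (m !) (factorials μ) ⟩
    y * ((x * (N ! * m !)) * factorials μ) ≈⟨ *-congˡ (*-congʳ p) ⟩
    y * ((N ℕ.+ m) ! * factorials μ)       ≈⟨ r ⟩
    [ lookup μ i ] * K !                   ∎)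

  private
    module _ {Y X : Carrier} where
      J-+ : ∀ a b → Y ∣ [ a ] * X → Y ∣ [ b ] * X → Y ∣ [ a ℕ.+ b ] * X
      J-+ a b (x , p) (y , r) = x + q ^ a * y , (begin
        (x + q ^ a * y) * Y              ≈⟨ solve 4 (λ x y t z → (x :+ t :* y) :* z := (x :* z :+ t :* (y :* z))) refl x y (q ^ a) Y ⟩
        x * Y + q ^ a * (y * Y)          ≈⟨ +-cong p (*-congˡ r) ⟩
        [ a ] * X + q ^ a * ([ b ] * X)  ≈⟨ solve 4 (λ a t b z → (a :* z :+ t :* (b :* z)) := (a :+ t :* b) :* z) refl [ a ] (q ^ a) [ b ] X ⟩
        ([ a ] + q ^ a * [ b ]) * X      ≈⟨ *-congʳ ([]-+ a b) ⟨
        [ a ℕ.+ b ] * X                  ∎)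

      J-0 : Y ∣ [ 0 ] * X
      J-0 = 0# , trans (zeroˡ _) (sym (zeroˡ _))

      J-* : ∀ k a → Y ∣ [ a ] * X → Y ∣ [ k ℕ.* a ] * X
      J-* zero    a j = J-0
      J-* (suc k) a j = J-+ a (k ℕ.* a) j (J-* k a j)

      J-sum : ∀ {k} (f : Fin k → ℕ) → (∀ i → Y ∣ [ f i ] * X) → Y ∣ [ Vec.sum (tabulate f) ] * X
      J-sum {zero}  f h = J-0
      J-sum {suc k} f h = J-+ (f zero) _ (h zero) (J-sum (λ i → f (suc i)) (λ i → h (suc i)))

  -- The numbers a for which the quotient times [a] is a polynomial are closed
  -- under addition and contain suc n and every part, hence also n; and
  -- 1 = [suc n] - q [n].
  quotient : ∀ {k} n (μ : Vec ℕ k) → n ≡ Vec.sum (tabulate λ i → suc (toℕ i) ℕ.* lookup μ i) →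
             suc n ! * factorials μ ∣ (n ℕ.+ Vec.sum μ) !
  quotient n μ eq with !-∣-sum n μ | J-sum _ (λ i → J-* (suc (toℕ i)) (lookup μ i) (part-∣ (suc n) μ i _ ≡.refl))
  ... | x , p | y , r = x + - (q * y) , (begin
    (x + - (q * y)) * ((n ! * [ suc n ]) * factorials μ)
      ≈⟨ solve 5 (λ x w a s t → (x :+ w) :* ((a :* s) :* t) := (s :* (x :* (a :* t)) :+ w :* ((a :* s) :* t))) refl
           x (- (q * y)) (n !) [ suc n ] (factorials μ) ⟩
    [ suc n ] * (x * (n ! * factorials μ)) + - (q * y) * (suc n ! * factorials μ)
      ≈⟨ +-cong (*-congˡ p) (trans (sym (-‿distribˡ-* _ _)) (-‿cong (trans (*-assoc q y _)
           (*-congˡ (trans r (*-congʳ (reflexive (≡.cong [_] (≡.sym eq))))))))) ⟩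
    (1# + q * [ n ]) * X + - (q * ([ n ] * X))
      ≈⟨ solve 5 (λ o q n x z → (o :+ q :* n) :* x :+ z := o :* x :+ (q :* (n :* x) :+ z)) refl 1# q [ n ] X _ ⟩
    1# * X + (q * ([ n ] * X) + - (q * ([ n ] * X)))
      ≈⟨ trans (+-congˡ (-‿inverseʳ _)) (+-identityʳ _) ⟩
    1# * X ≈⟨ *-identityˡ X ⟩
    X ∎)
    where
    X : Carrier
    X = (n ℕ.+ Vec.sum μ) !

  -- The factors of c d + e ! divisible by [d] are separated from the others.
  module Block (d′ : ℕ) where
    d : ℕ
    d = suc d′

    -- The q-number [c] with q ^ d in place of q. Where q ^ d = 1 its value is c.
    geometric : ℕ → Carrier
    geometric zero    = 0#
    geometric (suc c) = 1# + q ^ d * geometric c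

    rising : ℕ → ℕ → Carrier
    rising a zero    = 1#
    rising a (suc e) = rising a e * [ a ℕ.+ suc e ]

    -- The factorial of c d with one factor [d] removed from each of [d], [2 d], ..., [c d].
    blocks : ℕ → Carrier
    blocks zero    = 1#
    blocks (suc c) = (blocks c * rising (c ℕ.* d) d′) * geometric (suc c)

    cofactor : ℕ → ℕ → Carrier
    cofactor c e = blocks c * rising (c ℕ.* d) e

    []-* : ∀ c → [ c ℕ.* d ] ≈ [ d ] * geometric c
    []-* zero    = sym (zeroʳ _)
    []-* (suc c) = trans ([]-+ d (c ℕ.* d)) (trans (+-congˡ (*-congˡ ([]-* c)))
      (trans (+-congʳ (sym (*-identityʳ [ d ])))
        (solve 4 (λ o a t g → (a :* o :+ t :* (a :* g)) := a :* (o :+ t :* g)) refl 1# [ d ] (q ^ d) (geometric c))))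

    !-rising : ∀ a e → (a ℕ.+ e) ! ≈ a ! * rising a e
    !-rising a zero    = trans (reflexive (≡.cong _! (ℕ.+-identityʳ a))) (sym (*-identityʳ _))
    !-rising a (suc e) = begin
      (a ℕ.+ suc e) !                  ≡⟨ ≡.cong _! (ℕ.+-suc a e) ⟩
      (a ℕ.+ e) ! * [ suc (a ℕ.+ e) ]  ≈⟨ *-cong (!-rising a e) (reflexive (≡.cong [_] (≡.sym (ℕ.+-suc a e)))) ⟩
      (a ! * rising a e) * [ a ℕ.+ suc e ] ≈⟨ *-assoc _ _ _ ⟩
      a ! * rising a (suc e)           ∎

    !-blocks : ∀ c → (c ℕ.* d) ! ≈ [ d ] ^ c * blocks c
    !-blocks zero    = sym (*-identityˡ _)
    !-blocks (suc c) = begin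
      (suc c ℕ.* d) !
        ≡⟨ ≡.cong _! (≡.cong suc (ℕ.+-comm d′ (c ℕ.* d))) ⟩
      (c ℕ.* d ℕ.+ d′) ! * [ suc (c ℕ.* d ℕ.+ d′) ]
        ≡⟨ ≡.cong (λ n → (c ℕ.* d ℕ.+ d′) ! * [ suc n ]) (ℕ.+-comm (c ℕ.* d) d′) ⟩
      (c ℕ.* d ℕ.+ d′) ! * [ suc c ℕ.* d ]
        ≈⟨ *-cong (trans (!-rising (c ℕ.* d) d′) (*-congʳ (!-blocks c))) ([]-* (suc c)) ⟩
      (([ d ] ^ c * blocks c) * rising (c ℕ.* d) d′) * ([ d ] * geometric (suc c))
        ≈⟨ solve 5 (λ t b r a g → ((t :* b) :* r) :* (a :* g) := (a :* t) :* ((b :* r) :* g)) refl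
             ([ d ] ^ c) (blocks c) (rising (c ℕ.* d) d′) [ d ] (geometric (suc c)) ⟩
      [ d ] ^ suc c * blocks (suc c) ∎

    !-cofactor : ∀ c e → (c ℕ.* d ℕ.+ e) ! ≈ [ d ] ^ c * cofactor c e
    !-cofactor c e = trans (!-rising (c ℕ.* d) e) (trans (*-congʳ (!-blocks c)) (*-assoc _ _ _))

    cofactors : ∀ {k} → Vec ℕ k → Vec ℕ k → Carrier
    cofactors []       []       = 1#
    cofactors (c ∷ cs) (e ∷ es) = cofactor c e * cofactors cs es

    factorials-cofactors : ∀ {k} (cs es : Vec ℕ k) →
      factorials (Vec.zipWith (λ c e → c ℕ.* d ℕ.+ e) cs es) ≈ [ d ] ^ Vec.sum cs * cofactors cs es
    factorials-cofactors []       []       = sym (*-identityˡ _)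
    factorials-cofactors (c ∷ cs) (e ∷ es) = begin
      (c ℕ.* d ℕ.+ e) ! * factorials (Vec.zipWith (λ c e → c ℕ.* d ℕ.+ e) cs es)
        ≈⟨ *-cong (!-cofactor c e) (factorials-cofactors cs es) ⟩
      ([ d ] ^ c * cofactor c e) * ([ d ] ^ Vec.sum cs * cofactors cs es)
        ≈⟨ solve 4 (λ a b c d → (a :* b) :* (c :* d) := (a :* c) :* (b :* d)) refl _ _ _ _ ⟩
      ([ d ] ^ c * [ d ] ^ Vec.sum cs) * (cofactor c e * cofactors cs es)
        ≈⟨ *-congʳ (^-+ [ d ] c (Vec.sum cs)) ⟨
      [ d ] ^ (c ℕ.+ Vec.sum cs) * (cofactor c e * cofactors cs es) ∎

-- The ring ℤ[q] and evaluation in a field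

module Polynomials where
  open import Algebra.Apartness.Bundles using (HeytingField; HeytingCommutativeRing)
  open import Algebra.Bundles using (CommutativeRing)
  open import Data.Integer.Base as ℤ using (ℤ; +_; -[1+_]; _⊖_)
  import Data.Integer.Properties as ℤ
  open import Data.List.Base as List using (List; []; _∷_; map)
  open import Data.Nat.Base as ℕ using (ℕ; zero; suc)
  import Data.Nat.Properties as ℕ
  open import Data.Product.Base using (_,_)
  open import Data.Sum.Base using (inj₁; inj₂)
  open import Level using (0ℓ)
  open import Relation.Binary.PropositionalEquality hiding (setoid)
  open import Relation.Binary.Bundles using (Setoid)
  import Relation.Binary.Reasoning.Setoid
  open import Algebra.Properties.CommutativeSemigroup ℤ.+-commutativeSemigroup using (interchange; x∙yz≈y∙xz)

  open import Defs

  infix 4 _≋_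
  -- A record, because `_≈ₚ_` unfolds to a function type from which p and r cannot be inferred.
  record _≋_ (p r : Poly) : Set where
    constructor pointwise
    field
      at : p ≈ₚ r

  open _≋_

  ≋-setoid : Setoid 0ℓ 0ℓ
  ≋-setoid = record
    { Carrier = Poly ; _≈_ = _≋_
    ; isEquivalence = record
      { refl = pointwise λ _ → refl
      ; sym = λ e → pointwise λ i → sym (at e i)
      ; trans = λ e f → pointwise λ i → trans (at e i) (at f i) } }

  module ≋ = Setoid ≋-setoid

  coeff-+ : ∀ p r i → coeff (p +ₚ r) i ≡ coeff p i ℤ.+ coeff r i
  coeff-+ []      r       i       = sym (ℤ.+-identityˡ _)
  coeff-+ (a ∷ p) []      i       = sym (ℤ.+-identityʳ _)
  coeff-+ (a ∷ p) (b ∷ r) zero    = refl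
  coeff-+ (a ∷ p) (b ∷ r) (suc i) = coeff-+ p r i

  coeff-map : ∀ a r i → coeff (map (a ℤ.*_) r) i ≡ a ℤ.* coeff r i
  coeff-map a []      i       = sym (ℤ.*-zeroʳ a)
  coeff-map a (b ∷ r) zero    = refl
  coeff-map a (b ∷ r) (suc i) = coeff-map a r i

  shift : Poly → Poly
  shift p = + 0 ∷ p

  coeff-cons-* : ∀ a p r i → coeff ((a ∷ p) *ₚ r) i ≡ a ℤ.* coeff r i ℤ.+ coeff (shift (p *ₚ r)) i
  coeff-cons-* a p r i = trans (coeff-+ (map (a ℤ.*_) r) _ i) (cong (ℤ._+ coeff (shift (p *ₚ r)) i) (coeff-map a r i))

  shift-cong : ∀ {p r} → p ≋ r → shift p ≋ shift r
  shift-cong e = pointwise λ { zero → refl ; (suc i) → at e i }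

  +ₚ-cong : ∀ {p p′ r r′} → p ≋ p′ → r ≋ r′ → p +ₚ r ≋ p′ +ₚ r′
  +ₚ-cong {p} {p′} {r} {r′} e f = pointwise λ i →
    trans (coeff-+ p r i) (trans (cong₂ ℤ._+_ (at e i) (at f i)) (sym (coeff-+ p′ r′ i)))

  *ₚ-congʳ : ∀ p {r s} → r ≋ s → p *ₚ r ≋ p *ₚ s
  *ₚ-congʳ []      e = ≋.refl
  *ₚ-congʳ (a ∷ p) {r} {s} e = pointwise λ i → trans (coeff-cons-* a p r i)
    (trans (cong₂ ℤ._+_ (cong (a ℤ.*_) (at e i)) (at (shift-cong (*ₚ-congʳ p e)) i)) (sym (coeff-cons-* a p s i)))

  *ₚ-zeroʳ : ∀ p → p *ₚ [] ≋ []
  *ₚ-zeroʳ []      = ≋.refl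
  *ₚ-zeroʳ (a ∷ p) = pointwise λ { zero → refl ; (suc i) → at (*ₚ-zeroʳ p) i }

  -- The mirror image of the defining equation of the product; commutativity follows by induction.
  *ₚ-cons : ∀ p b r → p *ₚ (b ∷ r) ≋ map (b ℤ.*_) p +ₚ shift (p *ₚ r)
  *ₚ-cons []      b r = pointwise λ { zero → refl ; (suc i) → refl }
  *ₚ-cons (a ∷ p) b r = pointwise λ
    { zero    → cong (ℤ._+ + 0) (ℤ.*-comm a b)
    ; (suc i) → begin
        coeff (map (a ℤ.*_) r +ₚ p *ₚ (b ∷ r)) i
          ≡⟨ coeff-+ (map (a ℤ.*_) r) _ i ⟩
        coeff (map (a ℤ.*_) r) i ℤ.+ coeff (p *ₚ (b ∷ r)) i
          ≡⟨ cong (λ z → coeff (map (a ℤ.*_) r) i ℤ.+ z) (trans (at (*ₚ-cons p b r) i) (coeff-+ (map (b ℤ.*_) p) _ i)) ⟩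
        coeff (map (a ℤ.*_) r) i ℤ.+ (coeff (map (b ℤ.*_) p) i ℤ.+ coeff (shift (p *ₚ r)) i)
          ≡⟨ x∙yz≈y∙xz (coeff (map (a ℤ.*_) r) i) (coeff (map (b ℤ.*_) p) i) (coeff (shift (p *ₚ r)) i) ⟩
        coeff (map (b ℤ.*_) p) i ℤ.+ (coeff (map (a ℤ.*_) r) i ℤ.+ coeff (shift (p *ₚ r)) i)
          ≡⟨ cong (λ z → coeff (map (b ℤ.*_) p) i ℤ.+ z) (coeff-+ (map (a ℤ.*_) r) _ i) ⟨
        coeff (map (b ℤ.*_) p) i ℤ.+ coeff ((a ∷ p) *ₚ r) i
          ≡⟨ coeff-+ (map (b ℤ.*_) p) _ i ⟨
        coeff (map (b ℤ.*_) p +ₚ (a ∷ p) *ₚ r) i ∎ }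
    where open ≡-Reasoning

  *ₚ-comm : ∀ p r → p *ₚ r ≋ r *ₚ p
  *ₚ-comm []      r = ≋.sym (*ₚ-zeroʳ r)
  *ₚ-comm (a ∷ p) r = ≋.trans (+ₚ-cong (≋.refl {map (a ℤ.*_) r}) (shift-cong (*ₚ-comm p r))) (≋.sym (*ₚ-cons r a p))

  *ₚ-cong : ∀ {p p′ r r′} → p ≋ p′ → r ≋ r′ → p *ₚ r ≋ p′ *ₚ r′
  *ₚ-cong {p} {p′} {r} {r′} e f = ≋.trans (*ₚ-congʳ p f) (≋.trans (*ₚ-comm p r′) (≋.trans (*ₚ-congʳ r′ e) (*ₚ-comm r′ p′)))

  *ₚ-distribˡ : ∀ p r s → p *ₚ (r +ₚ s) ≋ p *ₚ r +ₚ p *ₚ s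
  *ₚ-distribˡ []      r s = ≋.refl
  *ₚ-distribˡ (a ∷ p) r s = pointwise λ i → begin
    coeff ((a ∷ p) *ₚ (r +ₚ s)) i
      ≡⟨ coeff-cons-* a p (r +ₚ s) i ⟩
    a ℤ.* coeff (r +ₚ s) i ℤ.+ coeff (shift (p *ₚ (r +ₚ s))) i
      ≡⟨ cong₂ ℤ._+_ (trans (cong (a ℤ.*_) (coeff-+ r s i)) (ℤ.*-distribˡ-+ a _ _)) (tail i) ⟩
    (a ℤ.* coeff r i ℤ.+ a ℤ.* coeff s i) ℤ.+ (coeff (shift (p *ₚ r)) i ℤ.+ coeff (shift (p *ₚ s)) i)
      ≡⟨ interchange (a ℤ.* coeff r i) _ _ _ ⟩
    (a ℤ.* coeff r i ℤ.+ coeff (shift (p *ₚ r)) i) ℤ.+ (a ℤ.* coeff s i ℤ.+ coeff (shift (p *ₚ s)) i)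
      ≡⟨ cong₂ ℤ._+_ (coeff-cons-* a p r i) (coeff-cons-* a p s i) ⟨
    coeff ((a ∷ p) *ₚ r) i ℤ.+ coeff ((a ∷ p) *ₚ s) i
      ≡⟨ coeff-+ ((a ∷ p) *ₚ r) _ i ⟨
    coeff ((a ∷ p) *ₚ r +ₚ (a ∷ p) *ₚ s) i ∎
    where
    open ≡-Reasoning
    tail : ∀ i → coeff (shift (p *ₚ (r +ₚ s))) i ≡ coeff (shift (p *ₚ r)) i ℤ.+ coeff (shift (p *ₚ s)) i
    tail zero    = refl
    tail (suc i) = trans (at (*ₚ-distribˡ p r s) i) (coeff-+ (p *ₚ r) _ i)

  *ₚ-distribʳ : ∀ p r s → (r +ₚ s) *ₚ p ≋ r *ₚ p +ₚ s *ₚ p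
  *ₚ-distribʳ p r s = ≋.trans (*ₚ-comm (r +ₚ s) p) (≋.trans (*ₚ-distribˡ p r s) (+ₚ-cong (*ₚ-comm p r) (*ₚ-comm p s)))

  shift-* : ∀ p r → shift p *ₚ r ≋ shift (p *ₚ r)
  shift-* p r = pointwise λ i → trans (coeff-cons-* (+ 0) p r i) (ℤ.+-identityˡ _)

  map-* : ∀ a p r → map (a ℤ.*_) p *ₚ r ≋ map (a ℤ.*_) (p *ₚ r)
  map-* a []      r = ≋.refl
  map-* a (b ∷ p) r = pointwise λ i → begin
    coeff ((a ℤ.* b ∷ map (a ℤ.*_) p) *ₚ r) i
      ≡⟨ coeff-cons-* (a ℤ.* b) (map (a ℤ.*_) p) r i ⟩
    a ℤ.* b ℤ.* coeff r i ℤ.+ coeff (shift (map (a ℤ.*_) p *ₚ r)) i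
      ≡⟨ cong₂ ℤ._+_ (ℤ.*-assoc a b _) (tail i) ⟩
    a ℤ.* (b ℤ.* coeff r i) ℤ.+ a ℤ.* coeff (shift (p *ₚ r)) i
      ≡⟨ ℤ.*-distribˡ-+ a _ _ ⟨
    a ℤ.* (b ℤ.* coeff r i ℤ.+ coeff (shift (p *ₚ r)) i)
      ≡⟨ cong (a ℤ.*_) (coeff-cons-* b p r i) ⟨
    a ℤ.* coeff ((b ∷ p) *ₚ r) i
      ≡⟨ coeff-map a ((b ∷ p) *ₚ r) i ⟨
    coeff (map (a ℤ.*_) ((b ∷ p) *ₚ r)) i ∎
    where
    open ≡-Reasoning
    tail : ∀ i → coeff (shift (map (a ℤ.*_) p *ₚ r)) i ≡ a ℤ.* coeff (shift (p *ₚ r)) i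
    tail zero    = sym (ℤ.*-zeroʳ a)
    tail (suc i) = trans (at (map-* a p r) i) (coeff-map a (p *ₚ r) i)

  *ₚ-assoc : ∀ p r s → (p *ₚ r) *ₚ s ≋ p *ₚ (r *ₚ s)
  *ₚ-assoc []      r s = ≋.refl
  *ₚ-assoc (a ∷ p) r s = ≋.trans (*ₚ-distribʳ s (map (a ℤ.*_) r) (shift (p *ₚ r)))
    (+ₚ-cong (map-* a r s) (≋.trans (shift-* (p *ₚ r) s) (shift-cong (*ₚ-assoc p r s))))

  *ₚ-identityˡ : ∀ p → 1ₚ *ₚ p ≋ p
  *ₚ-identityˡ p = pointwise λ i → trans (coeff-cons-* (+ 1) [] p i)
    (trans (cong₂ ℤ._+_ (ℤ.*-identityˡ (coeff p i)) (nil i)) (ℤ.+-identityʳ _))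
    where
    nil : ∀ i → coeff (shift []) i ≡ + 0
    nil zero    = refl
    nil (suc i) = refl

  -ₚ_ : Poly → Poly
  -ₚ_ = map (λ a → ℤ.- a)

  coeff-neg : ∀ p i → coeff (-ₚ p) i ≡ ℤ.- coeff p i
  coeff-neg []      i       = refl
  coeff-neg (a ∷ p) zero    = refl
  coeff-neg (a ∷ p) (suc i) = coeff-neg p i

  polynomialRing : CommutativeRing 0ℓ 0ℓ
  polynomialRing = record
    { Carrier = Poly ; _≈_ = _≋_ ; _+_ = _+ₚ_ ; _*_ = _*ₚ_ ; -_ = -ₚ_ ; 0# = [] ; 1# = 1ₚ
    ; isCommutativeRing = record
      { isRing = record
        { +-isAbelianGroup = record
          { isGroup = record
            { isMonoid = record
              { isSemigroup = record
                { isMagma = record { isEquivalence = ≋.isEquivalence ; ∙-cong = +ₚ-cong }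
                ; assoc = λ p r s → pointwise λ i →
                    trans (coeff-+ (p +ₚ r) s i) (trans (cong (ℤ._+ coeff s i) (coeff-+ p r i))
                      (trans (ℤ.+-assoc (coeff p i) _ _) (sym (trans (coeff-+ p (r +ₚ s) i) (cong (λ z → coeff p i ℤ.+ z) (coeff-+ r s i)))))) }
              ; identity = (λ p → ≋.refl) , λ p → pointwise λ i → trans (coeff-+ p [] i) (ℤ.+-identityʳ _) }
            ; inverse = (λ p → pointwise λ i → trans (coeff-+ (-ₚ p) p i) (trans (cong (ℤ._+ coeff p i) (coeff-neg p i)) (ℤ.+-inverseˡ (coeff p i))))
                      , (λ p → pointwise λ i → trans (coeff-+ p (-ₚ p) i) (trans (cong (λ z → coeff p i ℤ.+ z) (coeff-neg p i)) (ℤ.+-inverseʳ (coeff p i))))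
            ; ⁻¹-cong = λ {p} {r} e → pointwise λ i → trans (coeff-neg p i) (trans (cong (λ a → ℤ.- a) (at e i)) (sym (coeff-neg r i))) }
          ; comm = λ p r → pointwise λ i → trans (coeff-+ p r i) (trans (ℤ.+-comm (coeff p i) _) (sym (coeff-+ r p i))) }
        ; *-cong = *ₚ-cong
        ; *-assoc = *ₚ-assoc
        ; *-identity = *ₚ-identityˡ , λ p → ≋.trans (*ₚ-comm p 1ₚ) (*ₚ-identityˡ p)
        ; distrib = *ₚ-distribˡ , *ₚ-distribʳ }
      ; *-comm = *ₚ-comm } }

  X : Poly
  X = + 0 ∷ + 1 ∷ []

  -- Horner's form, which matches the recursion [n + 1] = 1 + q [n] with a list of ones.
  cons-≋ : ∀ a p → a ∷ p ≋ (a ∷ []) +ₚ X *ₚ p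
  cons-≋ a p = pointwise λ i → sym (trans (coeff-+ (a ∷ []) (X *ₚ p) i)
    (trans (cong (λ z → coeff (a ∷ []) i ℤ.+ z) (trans (at (shift-* 1ₚ p) i) (at (shift-cong (*ₚ-identityˡ p)) i))) (parts i)))
    where
    parts : ∀ i → coeff (a ∷ []) i ℤ.+ coeff (shift p) i ≡ coeff (a ∷ p) i
    parts zero    = ℤ.+-identityʳ a
    parts (suc i) = ℤ.+-identityˡ _

  -- A polynomial with constant term 1 is not a zero divisor: the coefficients of
  -- the other factor vanish one after another.
  unit-cancel : ∀ p {h} → (+ 1 ∷ p) *ₚ h ≋ [] → h ≋ []
  unit-cancel p {h} e = pointwise λ i → below (suc i) i ℕ.≤-refl
    where
    low : ∀ p m → (∀ i → i ℕ.< m → coeff h i ≡ + 0) → ∀ i → i ℕ.< m → coeff (p *ₚ h) i ≡ + 0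
    low []      m z i i<m = refl
    low (a ∷ p) m z i i<m = trans (coeff-cons-* a p h i)
      (cong₂ ℤ._+_ (trans (cong (a ℤ.*_) (z i i<m)) (ℤ.*-zeroʳ a)) (tail i i<m))
      where
      tail : ∀ i → i ℕ.< m → coeff (shift (p *ₚ h)) i ≡ + 0
      tail zero    _   = refl
      tail (suc i) i<m = low p m z i (ℕ.<-trans (ℕ.n<1+n i) i<m)
    below : ∀ m i → i ℕ.< m → coeff h i ≡ + 0
    below (suc m) i i<1+m with ℕ.m≤n⇒m<n∨m≡n (ℕ.≤-pred i<1+m)
    ... | inj₁ i<m = below m i i<m
    ... | inj₂ refl = begin
      coeff h i                                               ≡⟨ ℤ.*-identityˡ _ ⟨
      + 1 ℤ.* coeff h i                                       ≡⟨ ℤ.+-identityʳ _ ⟨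
      + 1 ℤ.* coeff h i ℤ.+ + 0                               ≡⟨ cong (λ z → + 1 ℤ.* coeff h i ℤ.+ z) (rest i (below i)) ⟨
      + 1 ℤ.* coeff h i ℤ.+ coeff (shift (p *ₚ h)) i          ≡⟨ coeff-cons-* (+ 1) p h i ⟨
      coeff ((+ 1 ∷ p) *ₚ h) i                                ≡⟨ at e i ⟩
      + 0                                                     ∎
      where
      open ≡-Reasoning
      rest : ∀ m → (∀ i → i ℕ.< m → coeff h i ≡ + 0) → coeff (shift (p *ₚ h)) m ≡ + 0
      rest zero    z = refl
      rest (suc m) z = low p (suc m) z m ℕ.≤-refl

  module Evaluation {c ℓ₁ ℓ₂} (F : HeytingField c ℓ₁ ℓ₂) where
    private
      R : CommutativeRing c ℓ₁
      R = HeytingCommutativeRing.commutativeRing (HeytingField.heytingCommutativeRing F)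

    open CommutativeRing R hiding (zero) renaming (sym to ≈-sym; trans to ≈-trans; refl to ≈-refl)
    open import Algebra.Properties.Semiring.Mult (CommutativeRing.semiring R) using (×-homo-+; ×1-homo-*)
    open import Algebra.Properties.Ring ring using (-‿distribˡ-*; -‿distribʳ-*; -0#≈0#; -‿involutive; -‿+-comm)
    open Relation.Binary.Reasoning.Setoid setoid
    import Algebra.Properties.CommutativeSemigroup +-commutativeSemigroup as +S
    import Algebra.Properties.CommutativeSemigroup *-commutativeSemigroup as *S

    fromℤ-neg : ∀ a → fromℤ F (ℤ.- a) ≈ - fromℤ F a
    fromℤ-neg (+ zero)  = ≈-sym -0#≈0#
    fromℤ-neg (+ suc n) = ≈-refl
    fromℤ-neg -[1+ n ]  = ≈-sym (-‿involutive _)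

    fromℤ-⊖ : ∀ m n → fromℤ F (m ⊖ n) ≈ fromℕ F m + - fromℕ F n
    fromℤ-⊖ m       zero    = ≈-sym (≈-trans (+-congˡ -0#≈0#) (+-identityʳ _))
    fromℤ-⊖ zero    (suc n) = ≈-sym (+-identityˡ _)
    fromℤ-⊖ (suc m) (suc n) = begin
      fromℤ F (suc m ⊖ suc n)                    ≡⟨ cong (fromℤ F) (ℤ.[1+m]⊖[1+n]≡m⊖n m n) ⟩
      fromℤ F (m ⊖ n)                            ≈⟨ fromℤ-⊖ m n ⟩
      fromℕ F m + - fromℕ F n                    ≈⟨ +-identityˡ _ ⟨
      0# + (fromℕ F m + - fromℕ F n)             ≈⟨ +-congʳ (-‿inverseʳ 1#) ⟨
      (1# + - 1#) + (fromℕ F m + - fromℕ F n)    ≈⟨ +S.interchange 1# (- 1#) _ _ ⟩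
      (1# + fromℕ F m) + (- 1# + - fromℕ F n)    ≈⟨ +-congˡ (-‿+-comm 1# _) ⟩
      fromℕ F (suc m) + - fromℕ F (suc n)        ∎

    fromℤ-+ : ∀ a b → fromℤ F (a ℤ.+ b) ≈ fromℤ F a + fromℤ F b
    fromℤ-+ (+ m)    (+ n)    = ×-homo-+ 1# m n
    fromℤ-+ (+ m)    -[1+ n ] = fromℤ-⊖ m (suc n)
    fromℤ-+ -[1+ m ] (+ n)    = ≈-trans (fromℤ-⊖ n (suc m)) (+-comm _ _)
    fromℤ-+ -[1+ m ] -[1+ n ] = ≈-trans (-‿cong (≈-trans (reflexive (cong (fromℕ F) (cong suc (sym (ℕ.+-suc m n))))) (×-homo-+ 1# (suc m) (suc n))))
      (≈-sym (-‿+-comm _ _))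

    private
      fromℤ-pos-* : ∀ m b → fromℤ F (+ m ℤ.* b) ≈ fromℤ F (+ m) * fromℤ F b
      fromℤ-pos-* m (+ n) = ≈-trans (reflexive (cong (fromℤ F) (sym (ℤ.pos-* m n)))) (×1-homo-* m n)
      fromℤ-pos-* m -[1+ n ] = ≈-trans (reflexive (cong (fromℤ F) (sym (ℤ.neg-distribʳ-* (+ m) (+ suc n)))))
        (≈-trans (fromℤ-neg (+ m ℤ.* + suc n)) (≈-trans (-‿cong (fromℤ-pos-* m (+ suc n))) (-‿distribʳ-* _ _)))

    fromℤ-* : ∀ a b → fromℤ F (a ℤ.* b) ≈ fromℤ F a * fromℤ F b
    fromℤ-* (+ m)    b = fromℤ-pos-* m b
    fromℤ-* -[1+ m ] b = ≈-trans (reflexive (cong (fromℤ F) (sym (ℤ.neg-distribˡ-* (+ suc m) b))))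
      (≈-trans (fromℤ-neg (+ suc m ℤ.* b)) (≈-trans (-‿cong (fromℤ-pos-* (suc m) b)) (-‿distribˡ-* _ _)))

    module _ (x : Carrier) where

      -- Evaluation runs over the list, so trailing zeros have to be shown harmless before it can
      -- respect `_≋_`.
      eval-zero : ∀ p → p ≋ [] → eval F p x ≈ 0#
      eval-zero []      e = ≈-refl
      eval-zero (a ∷ p) e = ≈-trans (+-cong (reflexive (cong (fromℤ F) (at e 0)))
        (≈-trans (*-congˡ (eval-zero p (pointwise λ i → at e (suc i)))) (zeroʳ x))) (+-identityˡ _)

      eval-cong : ∀ {p r} → p ≋ r → eval F p x ≈ eval F r x
      eval-cong {[]}    {r}     e = ≈-sym (eval-zero r (≋.sym e))
      eval-cong {a ∷ p} {[]}    e = eval-zero (a ∷ p) e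
      eval-cong {a ∷ p} {b ∷ r} e = +-cong (reflexive (cong (fromℤ F) (at e 0)))
        (*-congˡ (eval-cong {p} {r} (pointwise λ i → at e (suc i))))

      eval-+ : ∀ p r → eval F (p +ₚ r) x ≈ eval F p x + eval F r x
      eval-+ []      r       = ≈-sym (+-identityˡ _)
      eval-+ (a ∷ p) []      = ≈-sym (+-identityʳ _)
      eval-+ (a ∷ p) (b ∷ r) = begin
        fromℤ F (a ℤ.+ b) + x * eval F (p +ₚ r) x
          ≈⟨ +-cong (fromℤ-+ a b) (≈-trans (*-congˡ (eval-+ p r)) (distribˡ x _ _)) ⟩
        (fromℤ F a + fromℤ F b) + (x * eval F p x + x * eval F r x)
          ≈⟨ +S.interchange _ _ _ _ ⟩
        (fromℤ F a + x * eval F p x) + (fromℤ F b + x * eval F r x) ∎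

      eval-map : ∀ a p → eval F (map (a ℤ.*_) p) x ≈ fromℤ F a * eval F p x
      eval-map a []      = ≈-sym (zeroʳ _)
      eval-map a (b ∷ p) = begin
        fromℤ F (a ℤ.* b) + x * eval F (map (a ℤ.*_) p) x    ≈⟨ +-cong (fromℤ-* a b) (*-congˡ (eval-map a p)) ⟩
        fromℤ F a * fromℤ F b + x * (fromℤ F a * eval F p x) ≈⟨ +-congˡ (*S.x∙yz≈y∙xz x _ _) ⟩
        fromℤ F a * fromℤ F b + fromℤ F a * (x * eval F p x) ≈⟨ distribˡ _ _ _ ⟨
        fromℤ F a * (fromℤ F b + x * eval F p x)             ∎

      eval-* : ∀ p r → eval F (p *ₚ r) x ≈ eval F p x * eval F r x
      eval-* []      r = ≈-sym (zeroˡ _)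
      eval-* (a ∷ p) r = begin
        eval F (map (a ℤ.*_) r +ₚ shift (p *ₚ r)) x        ≈⟨ eval-+ (map (a ℤ.*_) r) _ ⟩
        eval F (map (a ℤ.*_) r) x + (0# + x * eval F (p *ₚ r) x)
          ≈⟨ +-cong (eval-map a r) (≈-trans (+-identityˡ _) (≈-trans (*-congˡ (eval-* p r)) (≈-sym (*-assoc x _ _)))) ⟩
        fromℤ F a * eval F r x + (x * eval F p x) * eval F r x ≈⟨ distribʳ _ _ _ ⟨
        (fromℤ F a + x * eval F p x) * eval F r x            ∎

      eval-1 : eval F 1ₚ x ≈ 1#
      eval-1 = ≈-trans (+-cong (+-identityʳ 1#) (zeroʳ x)) (+-identityʳ 1#)

      eval-X : eval F X x ≈ x
      eval-X = ≈-trans (+-identityˡ _) (≈-trans (*-congˡ eval-1) (*-identityʳ x))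

-- q-analogues under ring maps and at a root of unity

module QValues where
  open import Algebra.Bundles using (CommutativeRing; Semiring)
  open import Algebra.Definitions.RawSemiring using () renaming (_×_ to multiple)
  open import Data.Nat.Base as ℕ using (ℕ; zero; suc)
  import Data.Nat.Properties as ℕ
  open import Level using (_⊔_)
  open import Data.Vec.Base as Vec using (Vec; []; _∷_)
  import Relation.Binary.PropositionalEquality as ≡
  open ≡ using (_≡_)
  import Relation.Binary.Reasoning.Setoid

  open Sums using (∏!)

  record RingMap {c ℓ c′ ℓ′} (R : CommutativeRing c ℓ) (S : CommutativeRing c′ ℓ′)
                 (h : CommutativeRing.Carrier R → CommutativeRing.Carrier S) : Set (c ⊔ ℓ′) where
    private
      module R = CommutativeRing R
      module S = CommutativeRing S
    field
      h-+ : ∀ x y → h (x R.+ y) S.≈ h x S.+ h y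
      h-* : ∀ x y → h (x R.* y) S.≈ h x S.* h y
      h-0 : h R.0# S.≈ S.0#
      h-1 : h R.1# S.≈ S.1#

  module Homomorphic {c ℓ c′ ℓ′} (R : CommutativeRing c ℓ) (S : CommutativeRing c′ ℓ′)
    (q : CommutativeRing.Carrier R) (r : CommutativeRing.Carrier S)
    {h : CommutativeRing.Carrier R → CommutativeRing.Carrier S}
    (map : RingMap R S h) (h-q : CommutativeRing._≈_ S (h q) r) where

    open RingMap map
    open CommutativeRing S hiding (zero)
    private
      module Q = QAnalog R q
      module Q′ = QAnalog S r

    h-[] : ∀ n → h Q.[ n ] ≈ Q′.[ n ]
    h-[] zero    = h-0
    h-[] (suc n) = trans (h-+ _ _) (+-cong h-1 (trans (h-* _ _) (*-cong h-q (h-[] n))))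

    h-^ : ∀ {x y} → h x ≈ y → ∀ n → h (x Q.^ n) ≈ y Q′.^ n
    h-^ e zero    = h-1
    h-^ e (suc n) = trans (h-* _ _) (*-cong e (h-^ e n))

    h-! : ∀ n → h (n Q.!) ≈ n Q′.!
    h-! zero    = h-1
    h-! (suc n) = trans (h-* _ _) (*-cong (h-! n) (h-[] (suc n)))

    h-factorials : ∀ {k} (μ : Vec ℕ k) → h (Q.factorials μ) ≈ Q′.factorials μ
    h-factorials []      = h-1
    h-factorials (m ∷ μ) = trans (h-* _ _) (*-cong (h-! m) (h-factorials μ))

    module _ (d′ : ℕ) where
      private
        module B = Q.Block d′
        module B′ = Q′.Block d′

      h-rising : ∀ a e → h (B.rising a e) ≈ B′.rising a e
      h-rising a zero    = h-1
      h-rising a (suc e) = trans (h-* _ _) (*-cong (h-rising a e) (h-[] (a ℕ.+ suc e)))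

      h-geometric : ∀ c → h (B.geometric c) ≈ B′.geometric c
      h-geometric zero    = h-0
      h-geometric (suc c) = trans (h-+ _ _) (+-cong h-1 (trans (h-* _ _) (*-cong (h-^ h-q B.d) (h-geometric c))))

      h-blocks : ∀ c → h (B.blocks c) ≈ B′.blocks c
      h-blocks zero    = h-1
      h-blocks (suc c) = trans (h-* _ _) (*-cong (trans (h-* _ _) (*-cong (h-blocks c) (h-rising _ d′))) (h-geometric (suc c)))

      h-cofactor : ∀ c e → h (B.cofactor c e) ≈ B′.cofactor c e
      h-cofactor c e = trans (h-* _ _) (*-cong (h-blocks c) (h-rising _ e))

      h-cofactors : ∀ {k} (cs es : Vec ℕ k) → h (B.cofactors cs es) ≈ B′.cofactors cs es
      h-cofactors []       []       = h-1
      h-cofactors (c ∷ cs) (e ∷ es) = trans (h-* _ _) (*-cong (h-cofactor c e) (h-cofactors cs es))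

  module AtRoot {c ℓ} (R : CommutativeRing c ℓ) (q : CommutativeRing.Carrier R) (d′ : ℕ)
    ([d]≈0 : CommutativeRing._≈_ R (QAnalog.[_] R q (suc d′)) (CommutativeRing.0# R))
    (q^d≈1 : CommutativeRing._≈_ R (QAnalog._^_ R q q (suc d′)) (CommutativeRing.1# R)) where

    open CommutativeRing R hiding (zero)
    open QAnalog R q
    open Block d′
    open import Algebra.Properties.Semiring.Mult semiring using (×1-homo-*)
    open import Algebra.Solver.Ring.NaturalCoefficients.Default commutativeSemiring using (solve; _:=_; _:*_)
    open Relation.Binary.Reasoning.Setoid setoid

    ι : ℕ → Carrier
    ι n = multiple (Semiring.rawSemiring (CommutativeRing.semiring R)) n 1#

    -- The common value of the products of the d - 1 factors between consecutive multiples of d.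
    γ : Carrier
    γ = d′ !

    ^-wrap : ∀ c → q ^ (c ℕ.* d) ≈ 1#
    ^-wrap zero    = refl
    ^-wrap (suc c) = trans (^-+ q d (c ℕ.* d)) (trans (*-cong q^d≈1 (^-wrap c)) (*-identityˡ 1#))

    []-wrap : ∀ c t → [ c ℕ.* d ℕ.+ t ] ≈ [ t ]
    []-wrap c t = begin
      [ c ℕ.* d ℕ.+ t ]                     ≈⟨ []-+ (c ℕ.* d) t ⟩
      [ c ℕ.* d ] + q ^ (c ℕ.* d) * [ t ]   ≈⟨ +-cong (trans ([]-* c) (trans (*-congʳ [d]≈0) (zeroˡ _))) (*-congʳ (^-wrap c)) ⟩
      0# + 1# * [ t ]                       ≈⟨ trans (+-identityˡ _) (*-identityˡ _) ⟩
      [ t ]                                 ∎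

    rising-wrap : ∀ c e → rising (c ℕ.* d) e ≈ e !
    rising-wrap c zero    = refl
    rising-wrap c (suc e) = *-cong (rising-wrap c e) ([]-wrap c (suc e))

    geometric-value : ∀ c → geometric c ≈ ι c
    geometric-value zero    = refl
    geometric-value (suc c) = +-congˡ (trans (*-cong q^d≈1 (geometric-value c)) (*-identityˡ _))

    -- Each quotient [i d] / [d] takes the value i, and each run between multiples of d the value γ.
    blocks-value : ∀ c → blocks c ≈ γ ^ c * ι (c ℕ.!)
    blocks-value zero    = sym (trans (*-identityˡ _) (+-identityʳ 1#))
    blocks-value (suc c) = begin
      (blocks c * rising (c ℕ.* d) d′) * geometric (suc c)
        ≈⟨ *-cong (*-cong (blocks-value c) (rising-wrap c d′)) (geometric-value (suc c)) ⟩
      ((γ ^ c * ι (c ℕ.!)) * γ) * ι (suc c)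
        ≈⟨ solve 4 (λ a b c d → ((a :* b) :* c) :* d := (c :* a) :* (d :* b)) refl (γ ^ c) (ι (c ℕ.!)) γ (ι (suc c)) ⟩
      (γ * γ ^ c) * (ι (suc c) * ι (c ℕ.!))
        ≈⟨ *-congˡ (×1-homo-* (suc c) (c ℕ.!)) ⟨
      γ ^ suc c * ι (suc c ℕ.!) ∎

    cofactor-value : ∀ c e → cofactor c e ≈ γ ^ c * ι (c ℕ.!) * e !
    cofactor-value c e = *-cong (blocks-value c) (rising-wrap c e)

    cofactors-value : ∀ {k} (cs es : Vec ℕ k) → cofactors cs es ≈ γ ^ Vec.sum cs * ι (∏! cs) * factorials es
    cofactors-value []       []       = sym (trans (*-identityʳ _) (trans (*-identityˡ _) (+-identityʳ 1#)))
    cofactors-value (c ∷ cs) (e ∷ es) = begin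
      cofactor c e * cofactors cs es
        ≈⟨ *-cong (cofactor-value c e) (cofactors-value cs es) ⟩
      (γ ^ c * ι (c ℕ.!) * e !) * (γ ^ Vec.sum cs * ι (∏! cs) * factorials es)
        ≈⟨ solve 6 (λ a b c x y z → ((a :* b) :* c) :* ((x :* y) :* z) := ((a :* x) :* (b :* y)) :* (c :* z)) refl
             (γ ^ c) (ι (c ℕ.!)) (e !) (γ ^ Vec.sum cs) (ι (∏! cs)) (factorials es) ⟩
      (γ ^ c * γ ^ Vec.sum cs) * (ι (c ℕ.!) * ι (∏! cs)) * (e ! * factorials es)
        ≈⟨ *-congʳ (*-cong (^-+ γ c (Vec.sum cs)) (×1-homo-* (c ℕ.!) (∏! cs))) ⟨
      γ ^ (c ℕ.+ Vec.sum cs) * ι (c ℕ.! ℕ.* ∏! cs) * (e ! * factorials es) ∎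

-- Values of the quotient at powers of ζ

module FieldValues where
  open import Algebra.Apartness.Bundles using (HeytingField; HeytingCommutativeRing)
  open import Algebra.Bundles using (CommutativeRing)
  open import Algebra.Definitions.RawSemiring using () renaming (_^_ to power)
  open import Data.Fin.Base using (zero; suc)
  import Data.Integer.Base as ℤ
  open import Data.List.Base using ([]; _∷_)
  open import Data.Nat.Base as ℕ using (ℕ; zero; suc; NonZero)
  import Data.Nat.Properties as ℕ
  open import Data.Nat.Divisibility using (_∣_; divides)
  open import Data.Nat.GCD using (gcd; gcd[m,n]∣m; gcd-GCD; module Bézout)
  open import Data.Product.Base using (_,_; proj₁)
  open import Data.Vec.Base as Vec using (Vec; []; _∷_; lookup)
  open import Relation.Binary.PropositionalEquality as ≡ using (_≡_)
  import Relation.Binary.Reasoning.Setoid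
  open import Relation.Nullary.Negation using (¬_)

  open import Defs hiding (semiring)
  import Defs
  open Sums using (∏!; ∏!≢0)
  open Polynomials
  open QValues

  private
    module P = CommutativeRing polynomialRing
    module PQ = QAnalog polynomialRing X

  []-poly : ∀ n → PQ.[ n ] ≋ [ n ]q
  []-poly zero    = ≋.refl
  []-poly (suc n) = ≋.trans (P.+-congˡ {1ₚ} (P.*-congˡ {X} ([]-poly n))) (≋.sym (cons-≋ (ℤ.+ 1) [ n ]q))

  !-poly : ∀ n → n PQ.! ≋ [ n ]q!
  !-poly zero    = ≋.refl
  !-poly (suc n) = P.*-cong (!-poly n) ([]-poly (suc n))

  factorials-poly : ∀ {k} (μ : Vec ℕ k) → PQ.factorials μ ≋ Vec.foldr′ _*ₚ_ 1ₚ (Vec.map [_]q! μ)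
  factorials-poly []      = ≋.refl
  factorials-poly (m ∷ μ) = P.*-cong (!-poly m) (factorials-poly μ)

  []-cancel : ∀ d {p r} → PQ.[ suc d ] *ₚ p ≋ PQ.[ suc d ] *ₚ r → p ≋ r
  []-cancel d {p} {r} e = begin
    p                    ≈⟨ P.+-identityʳ p ⟨
    p +ₚ []              ≈⟨ P.+-congˡ {p} (P.-‿inverseˡ r) ⟨
    p +ₚ ((-ₚ r) +ₚ r)   ≈⟨ P.+-assoc p (-ₚ r) r ⟨
    (p +ₚ (-ₚ r)) +ₚ r   ≈⟨ P.+-congʳ {r} (unit-cancel [ d ]q zero-product) ⟩
    [] +ₚ r              ≈⟨ P.+-identityˡ r ⟩
    r                    ∎
    where
    open Relation.Binary.Reasoning.Setoid ≋-setoid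
    open import Algebra.Properties.Ring P.ring using (-‿distribʳ-*)
    D = PQ.[ suc d ]
    zero-product : [ suc d ]q *ₚ (p +ₚ (-ₚ r)) ≋ []
    zero-product = begin
      [ suc d ]q *ₚ (p +ₚ (-ₚ r))     ≈⟨ P.*-congʳ {p +ₚ (-ₚ r)} ([]-poly (suc d)) ⟨
      D *ₚ (p +ₚ (-ₚ r))              ≈⟨ P.distribˡ D p (-ₚ r) ⟩
      D *ₚ p +ₚ D *ₚ (-ₚ r)           ≈⟨ P.+-cong e (≋.sym (-‿distribʳ-* D r)) ⟩
      D *ₚ r +ₚ (-ₚ (D *ₚ r))         ≈⟨ P.-‿inverseʳ (D *ₚ r) ⟩
      []                              ∎

  []^-cancel : ∀ d c {p r} → (PQ.[ suc d ] PQ.^ c) *ₚ p ≋ (PQ.[ suc d ] PQ.^ c) *ₚ r → p ≋ r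
  []^-cancel d zero    {p} {r} e = ≋.trans (≋.sym (*ₚ-identityˡ p)) (≋.trans e (*ₚ-identityˡ r))
  []^-cancel d (suc c) {p} {r} e = []^-cancel d c ([]-cancel d
    (≋.trans (≋.sym (*ₚ-assoc D (D PQ.^ c) p)) (≋.trans e (*ₚ-assoc D (D PQ.^ c) r))))
    where D = PQ.[ suc d ]

  -- The power of [d] common to both sides is cancelled; t is the exponent left in the numerator.
  -- The remainder of n + 1 is d - 1 because d divides n + 2.
  reduced : ∀ d′ {k} f n (μ : Vec ℕ k) M c e (cs es : Vec ℕ k) t → let open PQ.Block d′ in
    f *ₚ (suc n PQ.! *ₚ PQ.factorials μ) ≋ (n ℕ.+ Vec.sum μ) PQ.! →
    suc n ≡ M ℕ.* d ℕ.+ d′ → n ℕ.+ Vec.sum μ ≡ c ℕ.* d ℕ.+ e →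
    μ ≡ Vec.zipWith (λ c e → c ℕ.* d ℕ.+ e) cs es → c ≡ (M ℕ.+ Vec.sum cs) ℕ.+ t →
    f *ₚ (cofactor M d′ *ₚ cofactors cs es) ≋ (PQ.[ d ] PQ.^ t) *ₚ cofactor c e
  reduced d′ f n μ M c e cs es t f-eq n≡ k≡ ≡.refl ≡.refl = []^-cancel d′ (M ℕ.+ Vec.sum cs) (begin
    (D PQ.^ (M ℕ.+ Vec.sum cs)) *ₚ (f *ₚ (cofactor M d′ *ₚ cofactors cs es))
      ≈⟨ P.*-congʳ {f *ₚ (cofactor M d′ *ₚ cofactors cs es)} (PQ.^-+ D M (Vec.sum cs)) ⟩
    ((D PQ.^ M) *ₚ (D PQ.^ Vec.sum cs)) *ₚ (f *ₚ (cofactor M d′ *ₚ cofactors cs es))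
      ≈⟨ solve 5 (λ a b f x y → (a :* b) :* (f :* (x :* y)) := f :* ((a :* x) :* (b :* y))) ≋.refl
           (D PQ.^ M) (D PQ.^ Vec.sum cs) f (cofactor M d′) (cofactors cs es) ⟩
    f *ₚ (((D PQ.^ M) *ₚ cofactor M d′) *ₚ ((D PQ.^ Vec.sum cs) *ₚ cofactors cs es))
      ≈⟨ P.*-congˡ {f} (P.*-cong (≋.trans (P.reflexive (≡.cong PQ._! n≡)) (!-cofactor M d′)) (factorials-cofactors cs es)) ⟨
    f *ₚ (suc n PQ.! *ₚ PQ.factorials μ)
      ≈⟨ f-eq ⟩
    (n ℕ.+ Vec.sum μ) PQ.!
      ≈⟨ ≋.trans (P.reflexive (≡.cong PQ._! k≡)) (!-cofactor c e) ⟩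
    (D PQ.^ (M ℕ.+ Vec.sum cs ℕ.+ t)) *ₚ cofactor c e
      ≈⟨ P.*-congʳ {cofactor c e} (PQ.^-+ D (M ℕ.+ Vec.sum cs) t) ⟩
    ((D PQ.^ (M ℕ.+ Vec.sum cs)) *ₚ (D PQ.^ t)) *ₚ cofactor c e
      ≈⟨ *ₚ-assoc (D PQ.^ (M ℕ.+ Vec.sum cs)) (D PQ.^ t) (cofactor c e) ⟩
    (D PQ.^ (M ℕ.+ Vec.sum cs)) *ₚ ((D PQ.^ t) *ₚ cofactor c e) ∎)
    where
    open PQ.Block d′
    open Relation.Binary.Reasoning.Setoid ≋-setoid
    open import Algebra.Solver.Ring.NaturalCoefficients.Default P.commutativeSemiring using (solve; _:=_; _:*_)
    D = PQ.[ d ]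

  module FieldValue {c ℓ₁ ℓ₂} (F : HeytingField c ℓ₁ ℓ₂) (char0 : CharacteristicZero F) where

    private
      R : CommutativeRing c ℓ₁
      R = HeytingCommutativeRing.commutativeRing (HeytingField.heytingCommutativeRing F)

    open CommutativeRing R hiding (zero)
    open HeytingField F using (_#_; #⇒invertible; tight)
    open import Algebra.Properties.Ring ring using (-‿distribˡ-*; -‿distribʳ-*; x∙y⁻¹≈ε⇒x≈y)
    open import Algebra.Properties.Semiring.Mult semiring using (×1-homo-*)
    open import Algebra.Properties.Semiring.Exp semiring using (^-homo-*; ^-assocʳ)
    open import Algebra.Solver.Ring.NaturalCoefficients.Default commutativeSemiring using (solve; _:=_; _:*_)
    open Relation.Binary.Reasoning.Setoid setoid

    infix 4 _≉0
    _≉0 : Carrier → Set ℓ₁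
    x ≉0 = ¬ (x ≈ 0#)

    -- Equality in a Heyting field need not be decidable. If y were apart from 0 it would be
    -- invertible and x would vanish; tightness turns this refutation into y ≈ 0.
    ≉0-cancel : ∀ {x y} → x ≉0 → x * y ≈ 0# → y ≈ 0#
    ≉0-cancel {x} {y} x≉0 xy≈0 = proj₁ (tight y 0#) λ y#0 →
      let (z , _ , yz≈1) = #⇒invertible y#0 in x≉0 (begin
        x                      ≈⟨ *-identityʳ x ⟨
        x * 1#                 ≈⟨ *-congˡ yz≈1 ⟨
        x * ((y - 0#) * z)     ≈⟨ *-congˡ (*-congʳ (trans (+-congˡ -0#≈0#) (+-identityʳ y))) ⟩
        x * (y * z)            ≈⟨ *-assoc x y z ⟨
        (x * y) * z            ≈⟨ *-congʳ xy≈0 ⟩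
        0# * z                 ≈⟨ zeroˡ z ⟩
        0#                     ∎)
      where open import Algebra.Properties.Ring ring using (-0#≈0#)

    ≉0-* : ∀ {x y} → x ≉0 → y ≉0 → x * y ≉0
    ≉0-* x≉0 y≉0 e = y≉0 (≉0-cancel x≉0 e)

    *-cancel : ∀ {x y z} → x ≉0 → x * y ≈ x * z → y ≈ z
    *-cancel {x} {y} {z} x≉0 e = x∙y⁻¹≈ε⇒x≈y y z (≉0-cancel x≉0 (begin
      x * (y - z)       ≈⟨ distribˡ x y (- z) ⟩
      x * y + x * - z   ≈⟨ +-cong e (sym (-‿distribʳ-* x z)) ⟩
      x * z - x * z     ≈⟨ -‿inverseʳ _ ⟩
      0#                ∎))

    1≉0 : 1# ≉0
    1≉0 e = char0 0 (trans (+-identityʳ 1#) e)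

    fromℕ≉0 : ∀ n → .{{NonZero n}} → fromℕ F n ≉0
    fromℕ≉0 (suc n) = char0 n

    evaluation : ∀ ω → RingMap polynomialRing R (λ p → eval F p ω)
    evaluation ω = record { h-+ = eval-+ ω ; h-* = eval-* ω ; h-0 = refl ; h-1 = eval-1 ω }
      where open Evaluation F

    module AtOne {ω : Carrier} (ω≈1 : ω ≈ 1#) where
      open Evaluation F
      open QAnalog R ω

      []-one : ∀ n → [ n ] ≈ fromℕ F n
      []-one zero    = refl
      []-one (suc n) = +-congˡ (trans (*-cong ω≈1 ([]-one n)) (*-identityˡ _))

      !-one : ∀ n → n ! ≈ fromℕ F (n ℕ.!)
      !-one zero    = sym (+-identityʳ 1#)
      !-one (suc n) = trans (*-cong (!-one n) ([]-one (suc n))) (trans (*-comm _ _) (sym (×1-homo-* (suc n) (n ℕ.!))))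

      factorials-one : ∀ {k} (μ : Vec ℕ k) → factorials μ ≈ fromℕ F (∏! μ)
      factorials-one []      = sym (+-identityʳ 1#)
      factorials-one (m ∷ μ) = trans (*-cong (!-one m) (factorials-one μ)) (sym (×1-homo-* (m ℕ.!) (∏! μ)))

      open Homomorphic polynomialRing R X ω (evaluation ω) (eval-X ω)

      -- At 1 all factorials are ordinary ones, and in characteristic 0 the denominator does not
      -- vanish, so the equation can be divided.
      value-one : ∀ {k} f n (μ : Vec ℕ k) m →
        f *ₚ (suc n PQ.! *ₚ PQ.factorials μ) ≋ (n ℕ.+ Vec.sum μ) PQ.! →
        m ℕ.* (suc n ℕ.! ℕ.* ∏! μ) ≡ (n ℕ.+ Vec.sum μ) ℕ.! → eval F f ω ≈ fromℕ F m
      value-one f n μ m f-eq m-eq = *-cancel (fromℕ≉0 B {{ℕ.m*n≢0 (suc n ℕ.!) (∏! μ) {{suc n ℕ.!≢0}} {{∏!≢0 μ}}}}) (begin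
        fromℕ F B * eval F f ω
          ≈⟨ *-comm _ _ ⟩
        eval F f ω * fromℕ F B
          ≈⟨ *-congˡ (trans (*-cong (!-one (suc n)) (factorials-one μ)) (sym (×1-homo-* (suc n ℕ.!) (∏! μ)))) ⟨
        eval F f ω * (suc n ! * factorials μ)
          ≈⟨ *-congˡ (trans (eval-* ω (suc n PQ.!) (PQ.factorials μ)) (*-cong (h-! (suc n)) (h-factorials μ))) ⟨
        eval F f ω * eval F (suc n PQ.! *ₚ PQ.factorials μ) ω
          ≈⟨ eval-* ω f _ ⟨
        eval F (f *ₚ (suc n PQ.! *ₚ PQ.factorials μ)) ω
          ≈⟨ eval-cong ω f-eq ⟩
        eval F ((n ℕ.+ Vec.sum μ) PQ.!) ω
          ≈⟨ trans (h-! (n ℕ.+ Vec.sum μ)) (!-one (n ℕ.+ Vec.sum μ)) ⟩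
        fromℕ F ((n ℕ.+ Vec.sum μ) ℕ.!)
          ≡⟨ ≡.cong (fromℕ F) (≡.trans (≡.sym m-eq) (ℕ.*-comm m B)) ⟩
        fromℕ F (B ℕ.* m)
          ≈⟨ ×1-homo-* B m ⟩
        fromℕ F B * fromℕ F m ∎)
        where B = suc n ℕ.! ℕ.* ∏! μ

    module AtPrimitive {ω : Carrier} (d″ : ℕ) (root : QAnalog._^_ R ω ω (suc (suc d″)) ≈ 1#)
      (minimal : ∀ t → 0 ℕ.< t → t ℕ.< suc (suc d″) → ¬ (QAnalog._^_ R ω ω t ≈ 1#)) where
      open Evaluation F
      open QAnalog R ω
      open Homomorphic polynomialRing R X ω (evaluation ω) (eval-X ω)

      private
        d′ : ℕ
        d′ = suc d″
        module PB = PQ.Block d′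

      open Block d′

      [1]≈1 : [ 1 ] ≈ 1#
      [1]≈1 = trans (+-congˡ (zeroʳ ω)) (+-identityʳ 1#)

      -- Two ways to write [t + 1]: splitting off the first or the last power. Both `[]≉0` and
      -- `[d]≈0` follow from it.
      1+ω[] : ∀ t → 1# + ω * [ t ] ≈ [ t ] + ω ^ t
      1+ω[] t = begin
        1# + ω * [ t ]         ≡⟨ ≡.cong [_] (ℕ.+-comm 1 t) ⟩
        [ t ℕ.+ 1 ]            ≈⟨ []-+ t 1 ⟩
        [ t ] + ω ^ t * [ 1 ]  ≈⟨ +-congˡ (trans (*-congˡ [1]≈1) (*-identityʳ _)) ⟩
        [ t ] + ω ^ t          ∎

      []≉0 : ∀ t → 0 ℕ.< t → t ℕ.< d → [ t ] ≉0
      []≉0 t 0<t t<d e = minimal t 0<t t<d (begin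
        ω ^ t            ≈⟨ trans (+-congʳ e) (+-identityˡ _) ⟨
        [ t ] + ω ^ t    ≈⟨ 1+ω[] t ⟨
        1# + ω * [ t ]   ≈⟨ +-congˡ (trans (*-congˡ e) (zeroʳ ω)) ⟩
        1# + 0#          ≈⟨ +-identityʳ 1# ⟩
        1#               ∎)

      [d]≈0 : [ d ] ≈ 0#
      [d]≈0 = ≉0-cancel ω-1≉0 (begin
        (ω - 1#) * [ d ]            ≈⟨ distribʳ [ d ] ω (- 1#) ⟩
        ω * [ d ] + - 1# * [ d ]    ≈⟨ +-cong ω[d]≈[d] (trans (sym (-‿distribˡ-* 1# [ d ])) (-‿cong (*-identityˡ _))) ⟩
        [ d ] - [ d ]               ≈⟨ -‿inverseʳ _ ⟩
        0#                          ∎)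
        where
        open import Algebra.Properties.Group +-group using (∙-cancelˡ)
        -- Since d ≥ 2, the exponent 1 lies below the order of ω.
        ω-1≉0 : ω - 1# ≉0
        ω-1≉0 e = minimal 1 (ℕ.s≤s ℕ.z≤n) (ℕ.s≤s (ℕ.s≤s ℕ.z≤n)) (trans (*-identityʳ ω) (x∙y⁻¹≈ε⇒x≈y ω 1# e))
        ω[d]≈[d] : ω * [ d ] ≈ [ d ]
        ω[d]≈[d] = ∙-cancelˡ 1# _ _ (trans (1+ω[] d) (trans (+-congˡ root) (+-comm [ d ] 1#)))

      open AtRoot R ω d′ [d]≈0 root

      !≉0 : ∀ e → e ℕ.< d → e ! ≉0
      !≉0 zero    _   = 1≉0
      !≉0 (suc e) e<d = ≉0-* (!≉0 e (ℕ.<-trans (ℕ.n<1+n e) e<d)) ([]≉0 (suc e) (ℕ.s≤s ℕ.z≤n) e<d)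

      factorials≉0 : ∀ {k} (es : Vec ℕ k) → (∀ i → lookup es i ℕ.< d) → factorials es ≉0
      factorials≉0 []       h = 1≉0
      factorials≉0 (e ∷ es) h = ≉0-* (!≉0 e (h zero)) (factorials≉0 es (λ i → h (suc i)))

      -- Entries with sum at most 1 are 0 or 1, and [1] = 1.
      factorials≈1 : ∀ {k} (es : Vec ℕ k) → Vec.sum es ℕ.≤ 1 → factorials es ≈ 1#
      factorials≈1 []                  h           = refl
      factorials≈1 (zero ∷ es)         h           = trans (*-identityˡ _) (factorials≈1 es h)
      factorials≈1 (suc zero ∷ es)     (ℕ.s≤s h)   = trans
        (*-cong (trans (*-identityˡ _) [1]≈1) (factorials≈1 es (ℕ.≤-trans h ℕ.z≤n))) (*-identityˡ 1#)
      factorials≈1 (suc (suc e) ∷ es)  (ℕ.s≤s ())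

      γ≉0 : γ ≉0
      γ≉0 = !≉0 d′ ℕ.≤-refl

      ^≉0 : ∀ {x} → x ≉0 → ∀ n → x ^ n ≉0
      ^≉0 h zero    = 1≉0
      ^≉0 h (suc n) = ≉0-* h (^≉0 h n)

      module _ {k} {f n} {μ : Vec ℕ k} {M c e} {cs es : Vec ℕ k}
        (f-eq : f *ₚ (suc n PQ.! *ₚ PQ.factorials μ) ≋ (n ℕ.+ Vec.sum μ) PQ.!)
        (n≡ : suc n ≡ M ℕ.* d ℕ.+ d′) (k≡ : n ℕ.+ Vec.sum μ ≡ c ℕ.* d ℕ.+ e)
        (μ≡ : μ ≡ Vec.zipWith (λ c e → c ℕ.* d ℕ.+ e) cs es) where

        private
          -- The value of the denominator after its powers of [d] have been removed; it is nonzero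
          -- when all remainders are below d.
          B : Carrier
          B = (γ ^ M * fromℕ F (M ℕ.!) * γ) * (γ ^ Vec.sum cs * fromℕ F (∏! cs) * factorials es)

          evaluated : ∀ t → c ≡ (M ℕ.+ Vec.sum cs) ℕ.+ t →
                      eval F f ω * B ≈ [ d ] ^ t * (γ ^ c * fromℕ F (c ℕ.!) * e !)
          evaluated t c≡ = begin
            eval F f ω * B
              ≈⟨ *-congˡ (*-cong (cofactor-value M d′) (cofactors-value cs es)) ⟨
            eval F f ω * (cofactor M d′ * cofactors cs es)
              ≈⟨ *-congˡ (trans (eval-* ω (PB.cofactor M d′) (PB.cofactors cs es)) (*-cong (h-cofactor d′ M d′) (h-cofactors d′ cs es))) ⟨
            eval F f ω * eval F (PB.cofactor M d′ *ₚ PB.cofactors cs es) ω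
              ≈⟨ eval-* ω f _ ⟨
            eval F (f *ₚ (PB.cofactor M d′ *ₚ PB.cofactors cs es)) ω
              ≈⟨ eval-cong ω (reduced d′ f n μ M c e cs es t f-eq n≡ k≡ μ≡ c≡) ⟩
            eval F ((PQ.[ d ] PQ.^ t) *ₚ PB.cofactor c e) ω
              ≈⟨ trans (eval-* ω (PQ.[ d ] PQ.^ t) (PB.cofactor c e)) (*-cong (h-^ (h-[] d) t) (h-cofactor d′ c e)) ⟩
            [ d ] ^ t * cofactor c e
              ≈⟨ *-congˡ (cofactor-value c e) ⟩
            [ d ] ^ t * (γ ^ c * fromℕ F (c ℕ.!) * e !) ∎

        value-zero : ∀ t → c ≡ (M ℕ.+ Vec.sum cs) ℕ.+ suc t → (∀ i → lookup es i ℕ.< d) → eval F f ω ≈ 0#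
        value-zero t c≡ small = ≉0-cancel B≉0 (begin
          B * eval F f ω    ≈⟨ *-comm _ _ ⟩
          eval F f ω * B    ≈⟨ evaluated (suc t) c≡ ⟩
          ([ d ] * [ d ] ^ t) * _ ≈⟨ *-congʳ (trans (*-congʳ [d]≈0) (zeroˡ _)) ⟩
          0# * _            ≈⟨ zeroˡ _ ⟩
          0#                ∎)
          where
          B≉0 : B ≉0
          B≉0 = ≉0-* (≉0-* (≉0-* (^≉0 γ≉0 M) (fromℕ≉0 (M ℕ.!) {{M ℕ.!≢0}})) γ≉0)
                     (≉0-* (≉0-* (^≉0 γ≉0 (Vec.sum cs)) (fromℕ≉0 (∏! cs) {{∏!≢0 cs}})) (factorials≉0 es small))

        -- The remainder d - 1 of n + 1 leaves one extra factor γ in the denominator; e ! ≈ γ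
        -- provides the same factor in the numerator.
        value-count : ∀ m → c ≡ M ℕ.+ Vec.sum cs → e ! ≈ γ → factorials es ≈ 1# →
                      m ℕ.* (M ℕ.! ℕ.* ∏! cs) ≡ c ℕ.! → eval F f ω ≈ fromℕ F m
        value-count m c≡ e≈γ es≈1 m≡ = *-cancel Z≉0 (begin
          Z * eval F f ω
            ≈⟨ solve 6 (λ a g b i j f → ((a :* b) :* g) :* (i :* j) :* f := f :* (((a :* i) :* g) :* ((b :* j)))) refl
                 (γ ^ M) γ (γ ^ Vec.sum cs) (fromℕ F (M ℕ.!)) (fromℕ F (∏! cs)) (eval F f ω) ⟩
          eval F f ω * ((γ ^ M * fromℕ F (M ℕ.!) * γ) * (γ ^ Vec.sum cs * fromℕ F (∏! cs)))
            ≈⟨ *-congˡ (*-congˡ (trans (*-congˡ es≈1) (*-identityʳ _))) ⟨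
          eval F f ω * B
            ≈⟨ evaluated 0 (≡.trans c≡ (≡.sym (ℕ.+-identityʳ _))) ⟩
          1# * (γ ^ c * fromℕ F (c ℕ.!) * e !)
            ≈⟨ trans (*-identityˡ _) (*-cong (*-cong γ^c c!) e≈γ) ⟩
          (γ ^ M * γ ^ Vec.sum cs) * (fromℕ F m * (fromℕ F (M ℕ.!) * fromℕ F (∏! cs))) * γ
            ≈⟨ solve 6 (λ a g b i j m → ((a :* b) :* (m :* (i :* j))) :* g := ((a :* b) :* g) :* (i :* j) :* m) refl
                 (γ ^ M) γ (γ ^ Vec.sum cs) (fromℕ F (M ℕ.!)) (fromℕ F (∏! cs)) (fromℕ F m) ⟩
          Z * fromℕ F m ∎)
          where
          Z : Carrier
          Z = ((γ ^ M * γ ^ Vec.sum cs) * γ) * (fromℕ F (M ℕ.!) * fromℕ F (∏! cs))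
          Z≉0 : Z ≉0
          Z≉0 = ≉0-* (≉0-* (≉0-* (^≉0 γ≉0 M) (^≉0 γ≉0 (Vec.sum cs))) γ≉0)
                     (≉0-* (fromℕ≉0 (M ℕ.!) {{M ℕ.!≢0}}) (fromℕ≉0 (∏! cs) {{∏!≢0 cs}}))
          γ^c : γ ^ c ≈ γ ^ M * γ ^ Vec.sum cs
          γ^c = trans (reflexive (≡.cong (γ ^_) c≡)) (^-+ γ M (Vec.sum cs))
          c! : fromℕ F (c ℕ.!) ≈ fromℕ F m * (fromℕ F (M ℕ.!) * fromℕ F (∏! cs))
          c! = trans (reflexive (≡.cong (fromℕ F) (≡.sym m≡)))
            (trans (×1-homo-* m _) (*-congˡ (×1-homo-* (M ℕ.!) (∏! cs))))

    module Powers {N : ℕ} (z : PrimitiveRoot F N) where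
      open PrimitiveRoot z

      private
        pow : Carrier → ℕ → Carrier
        pow = power (Defs.semiring F)

        Trivial : ℕ → Set ℓ₁
        Trivial e = pow ζ e ≈ 1#

        trivial-+ : ∀ {a b} → Trivial a → Trivial b → Trivial (a ℕ.+ b)
        trivial-+ {a} {b} p r = trans (^-homo-* ζ a b) (trans (*-cong p r) (*-identityˡ 1#))

        trivial-* : ∀ {a} → Trivial a → ∀ k → Trivial (k ℕ.* a)
        trivial-* p zero    = refl
        trivial-* {a} p (suc k) = trivial-+ {a} p (trivial-* {a} p k)

        trivial-cancel : ∀ {a b} → Trivial (a ℕ.+ b) → Trivial b → Trivial a
        trivial-cancel {a} {b} p r = begin
          pow ζ a             ≈⟨ *-identityʳ _ ⟨
          pow ζ a * 1#        ≈⟨ *-congˡ r ⟨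
          pow ζ a * pow ζ b   ≈⟨ ^-homo-* ζ a b ⟨
          pow ζ (a ℕ.+ b)     ≈⟨ p ⟩
          1#                  ∎

        inverse-pow : ∀ e → pow ζ e * pow ζ⁻¹ e ≈ 1#
        inverse-pow zero    = *-identityˡ 1#
        inverse-pow (suc e) = begin
          (ζ * pow ζ e) * (ζ⁻¹ * pow ζ⁻¹ e) ≈⟨ solve 4 (λ a b c d → (a :* b) :* (c :* d) := (a :* c) :* (b :* d)) refl _ _ _ _ ⟩
          (ζ * ζ⁻¹) * (pow ζ e * pow ζ⁻¹ e) ≈⟨ *-cong inverse (inverse-pow e) ⟩
          1# * 1#                           ≈⟨ *-identityˡ 1# ⟩
          1#                                ∎

        -- For negative j the corresponding power of ζ⁻¹ is 1, and hence so is that of ζ, its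
        -- inverse.
        to-trivial : ∀ j t → pow (ζ^ j) t ≈ 1# → Trivial (ℤ.∣ j ∣ ℕ.* t)
        to-trivial (ℤ.+ m)    t p = trans (sym (^-assocʳ ζ m t)) p
        to-trivial ℤ.-[1+ m ] t p = begin
          pow ζ e                 ≈⟨ *-identityʳ _ ⟨
          pow ζ e * 1#            ≈⟨ *-congˡ (trans (sym (^-assocʳ ζ⁻¹ (suc m) t)) p) ⟨
          pow ζ e * pow ζ⁻¹ e     ≈⟨ inverse-pow e ⟩
          1#                      ∎
          where e = suc m ℕ.* t

        from-trivial : ∀ j t → Trivial (ℤ.∣ j ∣ ℕ.* t) → pow (ζ^ j) t ≈ 1#
        from-trivial (ℤ.+ m)    t p = trans (^-assocʳ ζ m t) p
        from-trivial ℤ.-[1+ m ] t p = begin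
          pow (pow ζ⁻¹ (suc m)) t ≈⟨ ^-assocʳ ζ⁻¹ (suc m) t ⟩
          pow ζ⁻¹ e               ≈⟨ *-identityˡ _ ⟨
          1# * pow ζ⁻¹ e          ≈⟨ *-congʳ p ⟨
          pow ζ e * pow ζ⁻¹ e     ≈⟨ inverse-pow e ⟩
          1#                      ∎
          where e = suc m ℕ.* t

        power≡ : ∀ x t → QAnalog._^_ R x x t ≡ pow x t
        power≡ x zero    = ≡.refl
        power≡ x (suc t) = ≡.cong (x *_) (power≡ x t)

      module _ (j : ℤ.ℤ) {d} (N≡ : N ≡ d ℕ.* gcd ℤ.∣ j ∣ N) where
        private
          m g : ℕ
          m = ℤ.∣ j ∣
          g = gcd m N

        -- As g divides m and N = d g, the exponent m d is a multiple of N.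
        root-power : QAnalog._^_ R (ζ^ j) (ζ^ j) d ≈ 1#
        root-power = trans (reflexive (power≡ (ζ^ j) d)) (from-trivial j d (go (gcd[m,n]∣m m N)))
          where
          go : g ∣ m → Trivial (m ℕ.* d)
          go (divides q eq) = ≡.subst Trivial (≡.sym md≡) (trivial-* {N} root q)
            where
            md≡ : m ℕ.* d ≡ q ℕ.* N
            md≡ = ≡.trans (≡.cong (ℕ._* d) eq) (≡.trans (ℕ.*-assoc q g d)
              (≡.cong (q ℕ.*_) (≡.trans (ℕ.*-comm g d) (≡.sym N≡))))

        -- From ζ^(m t) = 1 and ζ^N = 1 Bézout yields ζ^(g t) = 1, although 0 < g t < N.
        root-minimal : .{{NonZero N}} → ∀ t → 0 ℕ.< t → t ℕ.< d → ¬ (QAnalog._^_ R (ζ^ j) (ζ^ j) t ≈ 1#)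
        root-minimal t 0<t t<d p = minimal (g ℕ.* t)
          (ℕ.*-mono-< 0<g 0<t)
          (≡.subst (g ℕ.* t ℕ.<_) (≡.trans (ℕ.*-comm g d) (≡.sym N≡)) (ℕ.*-monoʳ-< g {{ℕ.>-nonZero 0<g}} t<d))
          (go (Bézout.identity (gcd-GCD m N)))
          where
          0<g : 0 ℕ.< g
          0<g = ℕ.n≢0⇒n>0 λ g≡0 → ℕ.≢-nonZero⁻¹ N (≡.trans N≡ (≡.trans (≡.cong (d ℕ.*_) g≡0) (ℕ.*-zeroʳ d)))
          mt : Trivial (m ℕ.* t)
          mt = to-trivial j t (trans (sym (reflexive (power≡ (ζ^ j) t))) p)
          scaled : ∀ a b c → a ℕ.+ b ≡ c → a ℕ.* t ℕ.+ b ℕ.* t ≡ c ℕ.* t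
          scaled a b c eq = ≡.trans (≡.sym (ℕ.*-distribʳ-+ t a b)) (≡.cong (ℕ._* t) eq)
          xm : ∀ x → Trivial (x ℕ.* m ℕ.* t)
          xm x = ≡.subst Trivial (≡.sym (ℕ.*-assoc x m t)) (trivial-* {m ℕ.* t} mt x)
          yN : ∀ y → Trivial (y ℕ.* N ℕ.* t)
          yN y = ≡.subst Trivial (ℕ.*-comm t (y ℕ.* N))
            (trivial-* {y ℕ.* N} (trivial-* {N} root y) t)
          go : Bézout.Identity.Identity g m N → Trivial (g ℕ.* t)
          go (Bézout.Identity.+- x y eq) =
            trivial-cancel {g ℕ.* t} (≡.subst Trivial (≡.sym (scaled g (y ℕ.* N) (x ℕ.* m) eq)) (xm x)) (yN y)
          go (Bézout.Identity.-+ x y eq) =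
            trivial-cancel {g ℕ.* t} (≡.subst Trivial (≡.sym (scaled g (x ℕ.* m) (y ℕ.* N) eq)) (yN y)) (xm x)

-- Counting fixed dissections

module Count where
  open import Data.Bool.Base using (_∧_; _∨_)
  open import Data.Empty using (⊥)
  open import Data.Fin.Base using (Fin; zero; suc; toℕ)
  open import Data.Fin.Subset using (∣_∣)
  open import Data.Fin.Subset.Properties using (∣p∣≤n)
  open import Data.List.Base using (List; []; _∷_)
  open import Data.List.Membership.Propositional using (_∈_)
  open import Data.List.Relation.Unary.All as All using (All; []; _∷_)
  open import Data.Nat.Base
  open import Data.Nat.DivMod
  open import Data.Nat.ListAction using (sum)
  open import Data.Nat.Properties
  open import Data.Product.Base using (∃-syntax; _×_; _,_; proj₁; proj₂)
  open import Data.Vec.Base as Vec using (Vec; []; _∷_; lookup; tabulate)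
  import Data.Vec.Properties as Vec
  open import Function.Base using (_∘_)
  open import Function.Bundles using (_⇔_; mk⇔; Equivalence)
  open import Relation.Binary.PropositionalEquality
  open import Relation.Nullary.Decidable.Core using (Dec; yes; no; ¬?)

  open import Defs
  open Linear
  open Sums
  open Card
  open Arcs
  open Words
  open Polygon
  open Subgons
  open Rotation
  open Choices
  open Flat

  weight≡ΣF : ∀ {n} (μ : Vec ℕ n) → weight μ ≡ ΣF n (λ i → suc (toℕ i) * lookup μ i)
  weight≡ΣF {n} μ = go n _
    where
    go : ∀ n (f : Fin n → ℕ) → Vec.sum (tabulate f) ≡ ΣF n f
    go zero    f = refl
    go (suc n) f = cong (f zero +_) (go n (f ∘ suc))

  chords-cong : ∀ {N} .{{_ : NonZero N}} {E F : Arcs} → (∀ x y → E x y ≡ F x y) → chords {N} E ≡ chords F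
  chords-cong {N} {E} {F} h = Vec.tabulate-cong λ a → Vec.tabulate-cong λ b → cong₂ _∨_ (same a b) (same b a)
    where
    same : ∀ (a b : Fin N) → directed E a b ≡ directed F a b
    same a b = cong (_∧ _) (h _ _)

  arcs-cong : ∀ {V W : Word} → (∀ x → V x ≡ W x) → ∀ x y → arcs V x y ≡ arcs W x y
  arcs-cong {V} {W} h x y = bool-ext (move h) (move (sym ∘ h))
    where
    move : ∀ {V W : Word} → (∀ x → V x ≡ W x) → Arc (arcs V) x y → Arc (arcs W) x y
    move {V} {W} h e with arc⁻ V e
    ... | p , p∈ , reach f l fst = arc⁺ W (subst (λ l → p ∈ prefixes 0 l) (h x) p∈)
      (reach f (subst₂ (λ a b → y + a ≡ suc x + b + p) (w (suc x)) (w y) l)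
        (λ {z} lt gt → subst₂ (λ a b → z + a < y + b) (w y) (w z) (fst lt gt)))
      where
      w : ∀ z → weights V z ≡ weights W z
      w z = Σ-ext z (cong sum ∘ h)

  module _ {n : ℕ} where

    N : ℕ
    N = 2 + n

    family⇒𝒜 : ∀ {μ : Vec ℕ n} {E} (family : Family N E) →
               (∀ i → census family (toℕ i) ≡ lookup μ i) → 𝒜 μ (chords E)
    family⇒𝒜 family h = record
      { dissection = isDissection family
      ; type = λ i → subst (HasCard _) (h i) (subgon-count family (toℕ i)) }

    𝒜⇒census : ∀ {μ : Vec ℕ n} {E} (family : Family N E) → 𝒜 μ (chords E) → ∀ i → census family (toℕ i) ≡ lookup μ i
    𝒜⇒census family a i = card-unique (λ S → mk⇔ (λ x → x) (λ x → x)) (subgon-count family (toℕ i)) (𝒜.type a i)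

    -- A letter j gives a subgon with j + 2 vertices, and there are only n + 2 to choose from.
    letters-bounded : ∀ {E} (family : Family N E) → let open FamilyProperties family in
                      ∀ x → All (λ j → 0 < j × j ≤ n) (word x)
    letters-bounded family x = sizes-all (λ e → size>0 e ,
      +-cancelˡ-≤ 2 _ _ (≤-trans (≤-reflexive (sym (∣region∣ family e))) (∣p∣≤n (region family _ _)))) (N + x) x
      where open FamilyProperties family

    cyclic-word : ∀ M .{{_ : NonZero M}} → List (Fin (suc n)) → Word
    cyclic-word M v x = blocks v (x % M)

    cyclic-word-periodic : ∀ M .{{_ : NonZero M}} v → Periodic M (cyclic-word M v)
    cyclic-word-periodic M v x = cong (blocks v) (trans (cong (_% M) (+-comm M x)) ([m+n]%n≡m%n x M))

    module Coded {W : Word} {r : ℕ} (positive : ∀ x → All (0 <_) (W x)) (per : Periodic N W)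
                 (weight : weights W N + r ≡ N) (2≤r : 2 ≤ r) where
      open WordArcs positive per weight 2≤r public

      uncovered≡ : FamilyProperties.uncovered family ≡ r
      uncovered≡ = +-cancelʳ-≡ (weights W N) _ _ (trans
        (cong (uncovered +_) (Σ-ext N λ u → cong sum (sym (word≡ u))))
        (trans uncovered-count (trans (sym weight) (+-comm _ r))))
        where open FamilyProperties family

      census≡ : ∀ i → census family i ≡ Σ< N (λ u → tally (suc i) (W u)) + 𝟙 (r ≟ i + 3)
      census≡ i = cong₂ _+_ (Σ-ext N λ u → cong (tally (suc i)) (word≡ u)) (cong (λ u → 𝟙 (u ≟ i + 3)) uncovered≡)

    coded-injective : ∀ {V W : Word} {r s} (p : ∀ x → All (0 <_) (V x)) (p′ : Periodic N V) (w : weights V N + r ≡ N) (l : 2 ≤ r)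
                      (q : ∀ x → All (0 <_) (W x)) (q′ : Periodic N W) (x : weights W N + s ≡ N) (m : 2 ≤ s) →
                      (∀ x y → arcs V x y ≡ arcs W x y) → ∀ x → V x ≡ W x
    coded-injective p p′ w l q q′ x m h u = trans (sym (Coded.word≡ p p′ w l u))
      (trans (sizes-cong h (N + u) u) (Coded.word≡ q q′ x m u))

    -- Here r is the number of vertices of the root, a central subgon or a central diagonal, and μ′
    -- counts the orbits of the other subgons. With r = 2 the indicator vanishes for every i, as a
    -- diagonal is no subgon.
    module Symmetric-count {d M′ r : ℕ} {μ μ′ : Vec ℕ n} (2≤d : 2 ≤ d) (dM≡N : d * suc M′ ≡ N)
      (rest : r + d * weight μ′ ≡ N) (2≤r : 2 ≤ r)
      (type : ∀ i → lookup μ i ≡ d * lookup μ′ i + 𝟙 (r ≟ toℕ i + 3)) where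

      private
        M : ℕ
        M = suc M′

        -- M′ separators cut the letters into M blocks, one for each vertex of a period.
        ν : Vec ℕ (suc n)
        ν = M′ ∷ μ′

        instance
          d≢0 : NonZero d
          d≢0 = >-nonZero (<⇒≤ 2≤d)

        2M≤N : M + M ≤ N
        2M≤N = ≤-trans (≤-reflexive (cong (M +_) (sym (+-identityʳ M)))) (≤-trans (*-monoˡ-≤ M 2≤d) (≤-reflexive dM≡N))

        wt<M : weight μ′ < M
        wt<M = *-cancelˡ-< d _ _ (lia 4 (λ r w n m → r ⊕ w ≂ n ⇒ # 2 ≼ r ⇒ m ≂ n ⇒ ⊢ w ≺ m) (1 ∷ 0 ∷ 1 ∷ 1 ∷ 1 ∷ []) [] r (d * weight μ′) N (d * M) rest 2≤r dM≡N)

        Symmetric-word : Word → Set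
        Symmetric-word W = (∀ x → All (0 <_) (W x)) × Periodic M W × weights W M ≡ weight μ′

        module Sym {W : Word} (s : Symmetric-word W) where
          positive = proj₁ s
          per-M : Periodic M W
          per-M = proj₁ (proj₂ s)
          per-N : Periodic N W
          per-N x = trans (cong (λ k → W (k + x)) (sym dM≡N)) (periodic-* per-M d x)
          total-M : weights W M + (M ∸ weight μ′) ≡ M
          total-M = trans (cong (_+ (M ∸ weight μ′)) (proj₂ (proj₂ s))) (m+[n∸m]≡n (<⇒≤ wt<M))
          total-N : weights W N + r ≡ N
          total-N = trans (cong (_+ r) (trans (cong (weights W) (sym dM≡N)) (trans (Σ-periods d M (sum ∘ W) (cong sum ∘ per-M))
            (cong (d *_) (proj₂ (proj₂ s)))))) (trans (+-comm _ r) rest)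
          -- Read with period M instead of N, the word still has a positive rise, so arcs have
          -- length at most M.
          module P = Periodicity {r = M ∸ weight μ′} per-M total-M (m<n⇒0<n∸m wt<M)
          open Coded positive per-N total-N 2≤r public
          within : ∀ {x y} → Arc (arcs W) x y → y ≤ M + x
          within e = let (p , p∈ , rc) = arc⁻ W e in P.reach-short rc (prefixes-≤ p∈)

        letter-sum : ∀ W i → Periodic M W → Σ< N (λ u → tally (suc i) (W u)) ≡ d * Σ< M (λ u → tally (suc i) (W u))
        letter-sum W i per = trans (cong (λ k → Σ< k (λ u → tally (suc i) (W u))) (sym dM≡N))
          (Σ-periods d M _ (cong (tally (suc i)) ∘ per))

        code : List (Fin (suc n)) → Word
        code = cyclic-word M

        code≡ : ∀ v {x} → x < M → code v x ≡ blocks v x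
        code≡ v x<M = cong (blocks v) (m<n⇒m%n≡m x<M)

        code-tally : ∀ {v} → Content ν v → ∀ i → Σ< M (λ u → tally (suc (toℕ i)) (code v u)) ≡ lookup μ′ i
        code-tally {v} c i = trans (Σ-cong M λ u u<M → cong (tally (suc (toℕ i))) (code≡ v u<M))
          (trans (cong (λ m → Σ< (suc m) (λ u → tally (suc (toℕ i)) (blocks v u))) (sym (c zero)))
            (trans (tally-blocks v i) (c (suc i))))

        code-weight : ∀ {v} → Content ν v → weights (code v) M ≡ weight μ′
        code-weight {v} c = trans (Σ-cong M λ u u<M → cong sum (code≡ v u<M))
          (trans (cong (weights (blocks v) ∘ suc) (sym (c zero)))
            (trans (weights-blocks v) (trans (load-content {ν = ν} v c) (sym (weight≡ΣF μ′)))))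

        code-symmetric : ∀ {v} → Content ν v → Symmetric-word (code v)
        code-symmetric {v} c = (λ x → blocks-positive v (x % M)) , cyclic-word-periodic M v , code-weight {v} c

        dissect : List (Fin (suc n)) → ChordSet N
        dissect v = chords (arcs (code v))

        Fixed : ChordSet N → Set
        Fixed D = 𝒜 μ D × Invariant D M

        sound : ∀ {v} → Content ν v → Fixed (dissect v)
        sound {v} c = family⇒𝒜 S.family (λ i → trans (S.census≡ (toℕ i))
            (trans (cong (_+ 𝟙 (r ≟ toℕ i + 3)) (trans (letter-sum (code v) (toℕ i) S.per-M) (cong (d *_) (code-tally {v} c i))))
              (sym (type i)))) ,
          chords-invariant M S.family S.P.arcs-periodic
          where module S = Sym (code-symmetric {v} c)

        injective : ∀ {v w} → Content ν v → Content ν w → dissect v ≡ dissect w → v ≡ w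
        injective {v} {w} c e eq = blocks-injective (trans (c zero) (sym (e zero))) λ x x≤ →
          let x<M = s≤s (≤-trans x≤ (≤-reflexive (c zero)))
          in trans (sym (code≡ v x<M)) (trans (coded-injective V.positive V.per-N V.total-N 2≤r W.positive W.per-N W.total-N 2≤r
               (Symmetric.arcs-determined 2M≤N z<s V.family W.family V.within W.within V.P.arcs-periodic W.P.arcs-periodic eq) x)
               (code≡ w x<M))
          where
          module V = Sym (code-symmetric {v} c)
          module W = Sym (code-symmetric {w} e)

        -- Only quotients are compared: that the outer subgon of a given dissection has r vertices
        -- is not known beforehand, but both indicators are at most 1 < d.
        multiples : ∀ {a b e f} → e ≤ 1 → f ≤ 1 → d * a + e ≡ d * b + f → a ≡ b
        multiples {a} {b} {e} {f} e≤1 f≤1 eq = ≤-antisym (below e≤1 f≤1 eq) (below f≤1 e≤1 (sym eq))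
          where
          below : ∀ {a b e f} → e ≤ 1 → f ≤ 1 → d * a + e ≡ d * b + f → a ≤ b
          below {a} {b} {e} {f} e≤1 f≤1 eq = ≮⇒≥ λ b<a →
            lia 5 (λ x y d e f → x ⊕ e ≂ y ⊕ f ⇒ d ⊕ y ≼ x ⇒ f ≼ # 1 ⇒ # 2 ≼ d ⇒ ⊢⊥) (1 ∷ 1 ∷ 1 ∷ 1 ∷ []) [] (d * a) (d * b) d e f eq
              (≤-trans (≤-reflexive (sym (*-suc d b))) (*-monoʳ-≤ d b<a)) f≤1 2≤d

        complete : ∀ {D} → Fixed D → ∃[ v ] Content ν v × dissect v ≡ D
        complete {D} (a , inv) = finish (blocks-surjective M′ word (letters-bounded family))
          where
          open Symmetric {N} {M} 2M≤N z<s
          family : Family N (short-arcs (𝒜.dissection a) inv)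
          family = short-family (𝒜.dissection a) inv
          open FamilyProperties family
          per : Periodic M word
          per = word-periodic M (short-arcs-periodic (𝒜.dissection a) inv M inv)
          finish : ∃[ v ] occ zero v ≡ M′ × (∀ x → x ≤ M′ → blocks v x ≡ word x) → ∃[ v ] Content ν v × dissect v ≡ D
          finish (v , o , h) = v , content , trans (chords-cong same) (short-chords (𝒜.dissection a) inv)
            where
            code-word : ∀ x → code v x ≡ word x
            code-word x = trans (h (x % M) (≤-pred (m%n<n x M))) (trans (sym (periodic-* per (x / M) (x % M)))
              (cong word (trans (+-comm _ (x % M)) (sym (m≡m%n+[m/n]*n x M)))))
            tallies : ∀ i → Σ< M (λ u → tally (suc (toℕ i)) (word u)) ≡ occ (suc i) v
            tallies i = trans (Σ-cong M λ u u<M → cong (tally (suc (toℕ i))) (sym (h u (≤-pred u<M))))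
              (trans (cong (λ m → Σ< (suc m) (λ u → tally (suc (toℕ i)) (blocks v u))) (sym o)) (tally-blocks v i))
            content : Content ν v
            content zero    = o
            content (suc i) = multiples {e = 𝟙 (uncovered ≟ toℕ i + 3)} {f = 𝟙 (r ≟ toℕ i + 3)} (𝟙≤1 (uncovered ≟ _)) (𝟙≤1 (r ≟ _))
              (trans (cong (λ t → d * t + 𝟙 (uncovered ≟ toℕ i + 3)) (sym (tallies i)))
                (trans (cong (_+ 𝟙 (uncovered ≟ toℕ i + 3)) (sym (letter-sum word (toℕ i) per)))
                  (trans (𝒜⇒census family (subst (𝒜 μ) (sym (short-chords (𝒜.dissection a) inv)) a) i) (type i))))
            same : ∀ x y → arcs (code v) x y ≡ short-arcs (𝒜.dissection a) inv x y
            same x y = trans (arcs-cong code-word x y) (FamilyWord.arcs≡ family x y)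

      -- Every arrangement of the letters over one period codes a dissection, so the count is the
      -- plain multinomial coefficient.
      count : ∃[ m ] HasCard (λ D → 𝒜 μ D × Invariant D M) m × m * (M′ ! * ∏! μ′) ≡ (M′ + Vec.sum μ′) !
      count = let (m , card , m≡) = arrangements (M′ + Vec.sum μ′) ν refl in m , card-image dissect (λ {v} {w} → injective {v} {w}) (λ {v} → sound {v}) complete card , m≡

    -- The word repeats d times within N, so every subgon under an arc comes in d copies; only the
    -- outer one can disturb divisibility.
    symmetric-types : ∀ {d M} {μ : Vec ℕ n} {D : ChordSet N} → 2 ≤ d → d * M ≡ N → 0 < M → 𝒜 μ D → Invariant D M →
                      ∃[ u ] ∀ i → ∃[ c ] lookup μ i ≡ d * c + 𝟙 (u ≟ toℕ i + 3)
    symmetric-types {d} {M} {μ} {D} 2≤d dM≡N 0<M a inv = uncovered , λ i → Σ< M (λ u → tally (suc (toℕ i)) (word u)) ,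
      trans (sym (𝒜⇒census family (subst (𝒜 μ) (sym (short-chords (𝒜.dissection a) inv)) a) i))
        (cong (_+ 𝟙 (uncovered ≟ toℕ i + 3)) (trans (cong (λ k → Σ< k (λ u → tally (suc (toℕ i)) (word u))) (sym dM≡N))
          (Σ-periods d M _ (cong (tally (suc (toℕ i))) ∘ word-periodic M (short-arcs-periodic (𝒜.dissection a) inv M inv)))))
      where
      open Symmetric {N} {M} (≤-trans (≤-reflexive (cong (M +_) (sym (+-identityʳ M)))) (≤-trans (*-monoˡ-≤ M 2≤d) (≤-reflexive dM≡N))) 0<M
      family : Family N (short-arcs (𝒜.dissection a) inv)
      family = short-family (𝒜.dissection a) inv
      open FamilyProperties family

    module Rooted-count {μ : Vec ℕ n} (1≤n : 1 ≤ n) (n≡ : n ≡ weight μ) where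

      private
        -- n + 1 separators give the N = n + 2 blocks of a whole turn.
        ν : Vec ℕ (suc n)
        ν = suc n ∷ μ

        3≤N : 3 ≤ N
        3≤N = s≤s (s≤s 1≤n)

        open Rooted {N} 3≤N

        code : List (Fin (suc n)) → Word
        code = cyclic-word N

        code≡ : ∀ v {x} → x < N → code v x ≡ blocks v x
        code≡ v x<N = cong (blocks v) (m<n⇒m%n≡m x<N)

        code-weights : ∀ v {x} → x ≤ N → weights (code v) x ≡ weights (blocks v) x
        code-weights v x≤N = Σ-cong _ λ u u<x → cong sum (code≡ v (<-≤-trans u<x x≤N))

        load≡ : ∀ {v} → Content ν v → load v ≡ n
        load≡ {v} c = trans (load-content {ν = ν} v c) (trans (sym (weight≡ΣF μ)) (sym n≡))

        code-weight : ∀ {v} → Content ν v → weights (code v) N ≡ n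
        code-weight {v} c = trans (code-weights v ≤-refl)
          (trans (cong (weights (blocks v) ∘ suc) (sym (c zero))) (trans (weights-blocks v) (load≡ {v} c)))

        module Code {v} (c : Content ν v) where
          positive : ∀ x → All (0 <_) (code v x)
          positive x = blocks-positive v (x % N)
          per : Periodic N (code v)
          per = cyclic-word-periodic N v
          -- The letters add up to n, so 2 vertices stay uncovered; the ballot condition makes them
          -- the ends of the root side.
          total-N : weights (code v) N + 2 ≡ N
          total-N = trans (cong (_+ 2) (code-weight {v} c)) (+-comm n 2)
          open Coded positive per total-N ≤-refl public

        dissect : List (Fin (suc n)) → ChordSet N
        dissect v = chords (arcs (code v))

        Coding : List (Fin (suc n)) → Set
        Coding v = Content ν v × Ballot 1 v

        heights⇔ : ∀ {v} → Content ν v → Ballot 1 v ⇔ (∀ x → x < suc n → x ≤ weights (code v) x)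
        heights⇔ {v} c = mk⇔
          (λ b x x< → subst (x ≤_) (sym (code-weights v (<⇒≤ (m<n⇒m<1+n x<)))) (≤-pred (to b x (subst (x <_) (sym (c zero)) x<))))
          (λ f → from λ x x< → let x<′ = subst (x <_) (c zero) x< in
            s≤s (subst (x ≤_) (code-weights v (<⇒≤ (m<n⇒m<1+n x<′))) (f x x<′)))
          where open Equivalence (ballot⇔ 1 v (trans (cong suc (load≡ {v} c)) (sym (c zero))))

        -- By the ballot condition the first n blocks already hold total weight n, so nothing is
        -- left for the vertices n and n + 1.
        last-block : ∀ {v} → Content ν v → Ballot 1 v → weights (code v) (suc n) ≡ n
        last-block {v} c b = ≤-antisym
          (≤-trans (m≤m+n _ (sum (code v (suc n)))) (≤-reflexive (code-weight {v} c)))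
          (≤-trans (Equivalence.to (heights⇔ {v} c) b n ≤-refl) (m≤m+n _ (sum (code v n))))

        -- Vertex n + 1 has height 1, one above vertex 0, and the ballot condition keeps all
        -- vertices between at height 0 or below: a first passage at the full sum of the letters at
        -- 0.
        root : ∀ {v} → Coding v → RootArc (arcs (code v))
        root {v} (c , b) = arc⁺ (code v) (sum-prefix 0 (code v 0) 0<s) (reach z<s level first)
          where
          f = Equivalence.to (heights⇔ {v} c) b
          0<s : 0 < sum (code v 0)
          0<s = f 1 (s≤s 1≤n)
          level : suc n + weights (code v) 1 ≡ 1 + weights (code v) (suc n) + (0 + sum (code v 0))
          level = cong (λ w → suc (w + weights (code v) 1)) (sym (last-block {v} c b))
          first : ∀ {x} → x < suc n → 0 < x → x + weights (code v) (suc n) < suc n + weights (code v) x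
          first {x} x< _ = lia 4 (λ x l n w → l ≂ n ⇒ x ≼ w ⇒ ⊢ x ⊕ l ≺ # 1 ⊕ n ⊕ w) (1 ∷ 1 ∷ 1 ∷ []) [] x _ n _ (last-block {v} c b) (f x x<)

        sound : ∀ {v} → Coding v → 𝒜 μ (dissect v)
        sound {v} (c , b) = family⇒𝒜 C.family λ i → trans (C.census≡ (toℕ i))
          (trans (cong₂ _+_ (tallies i) (none (toℕ i))) (+-identityʳ _))
          where
          module C = Code {v} c
          none : ∀ i → 𝟙 (2 ≟ i + 3) ≡ 0
          none i = 𝟙-no (2 ≟ i + 3) λ eq → lia 1 (λ i → # 2 ≂ i ⊕ # 3 ⇒ ⊢⊥) (0 ∷ 1 ∷ []) [] i eq
          tallies : ∀ i → Σ< N (λ u → tally (suc (toℕ i)) (code v u)) ≡ lookup μ i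
          tallies i = trans (Σ-cong N λ u u<N → cong (tally (suc (toℕ i))) (code≡ v u<N))
            (trans (cong (λ m → Σ< (suc m) (λ u → tally (suc (toℕ i)) (blocks v u))) (sym (c zero)))
              (trans (tally-blocks v i) (c (suc i))))

        injective : ∀ {v w} → Coding v → Coding w → dissect v ≡ dissect w → v ≡ w
        injective {v} {w} (c , b) (e , f) eq = blocks-injective (trans (c zero) (sym (e zero))) λ x x≤ →
          let x<N = s≤s (≤-trans x≤ (≤-reflexive (c zero)))
          in trans (sym (code≡ v x<N)) (trans (coded-injective V.positive V.per V.total-N ≤-refl W.positive W.per W.total-N ≤-refl
               (arcs-determined V.family W.family (root {v} (c , b)) (root {w} (e , f)) eq) x)
               (code≡ w x<N))
          where
          module V = Code {v} c
          module W = Code {w} e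

        complete : ∀ {D} → 𝒜 μ D → ∃[ v ] Coding v × dissect v ≡ D
        complete {D} a = finish (blocks-surjective (suc n) word (letters-bounded family))
          where
          E : Arcs
          E = rooted-arcs (𝒜.dissection a)
          family : Family N E
          family = rooted-family (𝒜.dissection a)
          open FamilyProperties family
          root-arc : RootArc E
          root-arc = rooted-root (𝒜.dissection a)
          -- In each period the root arc passes over every vertex except its own ends 0 and n + 1.
          few : uncovered ≤ 2
          few = ≤-trans (Σ-mono N {g = λ y → 𝟙 (y ≟ 0) + 𝟙 (y ≟ suc n)} λ y y<N → cell y y<N (y ≟ 0) (y ≟ suc n))
            (≤-reflexive (trans (Σ-+ N _ _) (cong₂ _+_ (once 0 z<s) (once (suc n) ≤-refl))))
            where
            once : ∀ k → k < N → Σ< N (λ y → 𝟙 (y ≟ k)) ≡ 1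
            once k k<N = trans (Σ-single N k _ k<N λ t _ t≢k → 𝟙-no (t ≟ k) t≢k) (𝟙-yes (k ≟ k) refl)
            cell : ∀ y → y < N → (p : Dec (y ≡ 0)) (q : Dec (y ≡ suc n)) → 𝟙 (¬? (covered? (N + y))) ≤ 𝟙 p + 𝟙 q
            cell y y<N (yes _) q = ≤-trans (𝟙≤1 (¬? (covered? (N + y)))) (m≤m+n 1 (𝟙 q))
            cell y y<N (no _) (yes _) = 𝟙≤1 (¬? (covered? (N + y)))
            cell y y<N (no y≢0) (no y≢l) = ≤-reflexive (𝟙-no (¬? (covered? (N + y))) λ nc → nc
              (N , m<m+n N (n≢0⇒n>0 y≢0) , N + suc n , +-monoʳ-< N (<-≤-trans ≤-refl (m≤m+n N y)) ,
               subst (λ x → Arc E x (N + suc n)) (+-identityʳ N) (trans (periodic 0 (suc n)) root-arc) ,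
               +-monoʳ-< N (≤∧≢⇒< (≤-pred y<N) y≢l)))
          none : ∀ i → 𝟙 (uncovered ≟ i + 3) ≡ 0
          none i = 𝟙-no (uncovered ≟ i + 3) λ eq → lia 2 (λ u i → u ≼ # 2 ⇒ u ≂ i ⊕ # 3 ⇒ ⊢⊥) (0 ∷ 1 ∷ 1 ∷ []) [] uncovered i few eq
          finish : ∃[ v ] occ zero v ≡ suc n × (∀ x → x ≤ suc n → blocks v x ≡ word x) → ∃[ v ] Coding v × dissect v ≡ D
          finish (v , o , h) = v , (content , Equivalence.from (heights⇔ {v} content) heights) ,
              trans (chords-cong same) (rooted-chords (𝒜.dissection a))
            where
            code-word : ∀ x → code v x ≡ word x
            code-word x = trans (h (x % N) (≤-pred (m%n<n x N))) (trans (sym (periodic-* (word-periodic N periodic) (x / N) (x % N)))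
              (cong word (trans (+-comm _ (x % N)) (sym (m≡m%n+[m/n]*n x N)))))
            tallies : ∀ i → Σ< N (λ u → tally (suc (toℕ i)) (word u)) ≡ occ (suc i) v
            tallies i = trans (Σ-cong N λ u u<N → cong (tally (suc (toℕ i))) (sym (h u (≤-pred u<N))))
              (trans (cong (λ m → Σ< (suc m) (λ u → tally (suc (toℕ i)) (blocks v u))) (sym o)) (tally-blocks v i))
            content : Content ν v
            content zero    = o
            content (suc i) = trans (sym (tallies i))
              (trans (sym (trans (cong (Σ< N (λ u → tally (suc (toℕ i)) (word u)) +_) (none (toℕ i))) (+-identityʳ _)))
                (𝒜⇒census family (subst (𝒜 μ) (sym (rooted-chords (𝒜.dissection a))) a) i))
            same : ∀ x y → arcs (code v) x y ≡ E x y
            same x y = trans (arcs-cong code-word x y) (FamilyWord.arcs≡ family x y)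
            -- Conversely, a root arc from 0 ends at height at most 1, so being a first passage it
            -- forces height at most 0 before its end.
            height : ∀ x → suc x < suc n → (∃[ p ] p ∈ prefixes 0 (code v 0) × Reach (code v) 0 (suc n) p) → suc x ≤ weights (code v) (suc x)
            height x x< (p , p∈ , rc) = lia 4 (λ x n l w → # 1 ⊕ x ⊕ l ≺ # 1 ⊕ n ⊕ w ⇒ # 1 ⊕ n ⊕ # 0 ≼ # 1 ⊕ l ⇒ ⊢ # 1 ⊕ x ≼ w) (1 ∷ 1 ∷ 1 ∷ []) []
              x n (weights (code v) (suc n)) (weights (code v) (suc x))
              (Reach.first rc x< z<s) (reach-≤ (code v) rc (prefixes-≤ p∈))
            heights : ∀ x → x < suc n → x ≤ weights (code v) x
            heights zero    _  = z≤n
            heights (suc x) x< = height x x< (arc⁻ (code v) (trans (same 0 (suc n)) root-arc))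

      -- `ballots` with start height 1; the result is the value of a_μ at q = 1.
      count : ∃[ m ] HasCard (𝒜 μ) m × m * (suc n ! * ∏! μ) ≡ (n + Vec.sum μ) !
      count = let (m , card , m≡) = ballots (n + Vec.sum μ) ν 1 refl (cong suc (trans (sym (weight≡ΣF μ)) (sym n≡))) in m , card-image dissect (λ {v} {w} → injective {v} {w}) (λ {v} → sound {v}) complete card , trans m≡ (*-identityˡ _)

      -- Rotation of the chords is translation of the arcs by 1, which preserves the census.
      rotate-𝒜 : ∀ {D} → 𝒜 μ D → 𝒜 μ (rotate 1 D)
      rotate-𝒜 {D} a = subst (𝒜 μ) (trans (sym (rotate-chords family)) (cong (rotate 1) chords≡D))
        (family⇒𝒜 (translate-family 1 family) λ i → trans (census-translate 1 family (toℕ i))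
          (𝒜⇒census family (subst (𝒜 μ) (sym chords≡D) a) i))
        where
        family = rooted-family (𝒜.dissection a)
        chords≡D = rooted-chords (𝒜.dissection a)

-- Matching the values with the counts

open import Algebra.Apartness.Bundles using (HeytingField; HeytingCommutativeRing)
open import Algebra.Bundles using (CommutativeRing)
open import Data.Empty using (⊥; ⊥-elim)
open import Data.Fin.Base using (Fin; zero; suc; toℕ)
open import Data.Fin.Properties using () renaming (_≟_ to _≟ᶠ_; suc-injective to sucᶠ-injective; toℕ-injective to toℕᶠ-injective)
import Data.Integer.Base as ℤ
open import Data.List.Base using ([]; _∷_)
open import Data.Nat.Base
open import Data.Nat.Divisibility using (_∣_; divides)
open import Data.Nat.DivMod
open import Data.Nat.GCD using (gcd; gcd[m,n]∣n)
open import Data.Nat.Properties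
open import Data.Product.Base using (∃-syntax; _×_; _,_; proj₁; proj₂)
open import Data.Vec.Base as Vec using (Vec; []; _∷_; lookup)
open import Data.Vec.Properties using (lookup-map)
open import Function.Base using (_∘_)
open import Function.Bundles using (mk⇔; Equivalence)
open import Level using (Level)
open import Relation.Binary.PropositionalEquality
import Relation.Binary.Reasoning.Setoid
open import Relation.Nullary.Decidable.Core using (yes; no)
open import Relation.Nullary.Negation using (¬_; contradiction)

open import Defs
open Linear
open Sums
open Card
open Rotation
open Flat
open Count
open Polynomials
open FieldValues

private
  module PQ = QAnalog polynomialRing X

  module _ {n} (f : Poly) (μ : Vec ℕ n) where
    k : ℕ
    k = Vec.sum μ

    -- The factor [k] ! sits in the denominator of the binomial and in the numerator of the
    -- multinomial; clearing denominators puts it on both sides.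
    is-aμ : f *ₚ (suc n PQ.! *ₚ PQ.factorials μ) ≋ (n + k) PQ.! → f ≐ aμ μ
    is-aμ f-eq = _≋_.at (begin
      f *ₚ (([ n + 1 ]q *ₚ ([ k ]q! *ₚ [ n + k ∸ k ]q!)) *ₚ Vec.foldr′ _*ₚ_ 1ₚ (Vec.map [_]q! μ))
        ≈⟨ P.*-congˡ {f} (P.*-cong (P.*-cong ([]-poly (n + 1)) (P.*-cong (!-poly k) (!-poly (n + k ∸ k)))) (factorials-poly μ)) ⟨
      f *ₚ ((PQ.[ n + 1 ] *ₚ (k PQ.! *ₚ (n + k ∸ k) PQ.!)) *ₚ PQ.factorials μ)
        ≡⟨ cong₂ (λ a b → f *ₚ ((PQ.[ a ] *ₚ (k PQ.! *ₚ b PQ.!)) *ₚ PQ.factorials μ)) (+-comm n 1) (m+n∸n≡m n k) ⟩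
      f *ₚ ((PQ.[ suc n ] *ₚ (k PQ.! *ₚ n PQ.!)) *ₚ PQ.factorials μ)
        ≈⟨ solve 5 (λ f a k n m → f :* ((a :* (k :* n)) :* m) := (f :* ((n :* a) :* m)) :* k) ≋.refl f PQ.[ suc n ] (k PQ.!) (n PQ.!) (PQ.factorials μ) ⟩
      (f *ₚ (suc n PQ.! *ₚ PQ.factorials μ)) *ₚ k PQ.!
        ≈⟨ P.*-cong (≋.trans f-eq (≋.trans (!-poly (n + k)) (≋.sym (*ₚ-identityˡ _)))) (!-poly k) ⟩
      (1ₚ *ₚ [ n + k ]q!) *ₚ [ k ]q! ∎)
      where
      module P = CommutativeRing polynomialRing
      open Relation.Binary.Reasoning.Setoid ≋-setoid
      open import Algebra.Solver.Ring.NaturalCoefficients.Default P.commutativeSemiring using (solve; _:=_; _:*_)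

  ΣF-𝟙≤1 : ∀ k a u → ΣF k (λ i → 𝟙 (u ≟ a + toℕ i)) ≤ 1
  ΣF-𝟙≤1 zero    a u = z≤n
  ΣF-𝟙≤1 (suc k) a u with u ≟ a + 0
  ... | yes refl = ≤-reflexive (cong suc (trans (ΣF-cong k {g = λ _ → 0} λ i → 𝟙-no (a + 0 ≟ a + suc (toℕ i)) λ eq → contradiction (+-cancelˡ-≡ a _ _ eq) λ ()) (ΣF-0 k)))
  ... | no _ = ≤-trans (≤-reflexive (ΣF-cong k λ i → cong (λ x → 𝟙 (u ≟ x)) (+-suc a (toℕ i)))) (ΣF-𝟙≤1 k (suc a) u)

  sum-zero : ∀ {k} (es : Vec ℕ k) → Vec.sum es ≡ 0 → ∀ i → lookup es i ≡ 0
  sum-zero es eq i = n≤0⇒n≡0 (≤-trans (ΣF-≤ _ (lookup es) i) (≤-reflexive (trans (ΣF-lookup es) eq)))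

  sum-one : ∀ {k} (es : Vec ℕ k) → Vec.sum es ≡ 1 → ∃[ j ] ∀ i → lookup es i ≡ 𝟙 (j ≟ᶠ i)
  sum-one (suc zero ∷ es) eq = zero , λ { zero → refl ; (suc i) → sum-zero es (suc-injective eq) i }
  sum-one (zero ∷ es) eq with sum-one es eq
  ... | j , h = suc j , λ { zero → refl ; (suc i) → trans (h i) (𝟙-cong (j ≟ᶠ i) (suc j ≟ᶠ suc i) (cong suc) sucᶠ-injective) }
  sum-one (suc (suc _) ∷ es) ()

  module Division {n} (d : ℕ) .{{_ : NonZero d}} (μ : Vec ℕ n) where
    cs es : Vec ℕ n
    cs = Vec.map (_/ d) μ
    es = Vec.map (_% d) μ

    μ≡ : μ ≡ Vec.zipWith (λ c e → c * d + e) cs es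
    μ≡ = go μ
      where
      go : ∀ {k} (μ : Vec ℕ k) → μ ≡ Vec.zipWith (λ c e → c * d + e) (Vec.map (_/ d) μ) (Vec.map (_% d) μ)
      go []      = refl
      go (m ∷ μ) = cong₂ _∷_ (trans (m≡m%n+[m/n]*n m d) (+-comm (m % d) _)) (go μ)

    es< : ∀ i → lookup es i < d
    es< i = subst (_< d) (sym (lookup-map i (_% d) μ)) (m%n<n (lookup μ i) d)

    lookup≡ : ∀ i → lookup μ i ≡ d * lookup cs i + lookup es i
    lookup≡ i = trans (m≡m%n+[m/n]*n (lookup μ i) d) (trans (+-comm (lookup μ i % d) _)
      (cong₂ _+_ (trans (*-comm _ d) (cong (d *_) (sym (lookup-map i (_/ d) μ)))) (sym (lookup-map i (_% d) μ))))

    split : ∀ (g : Fin n → ℕ) → ΣF n (λ i → g i * lookup μ i) ≡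
            d * ΣF n (λ i → g i * lookup cs i) + ΣF n (λ i → g i * lookup es i)
    split g = trans (ΣF-cong n λ i → trans (cong (g i *_) (lookup≡ i)) (*-distribˡ-+ (g i) _ _))
      (trans (ΣF-+ n _ _) (cong₂ _+_ (trans (ΣF-cong n λ i → x∙yz≈zx∙y (g i) d _) (trans (sym (ΣF-*ʳ n _ d)) (*-comm _ d))) refl))
      where
      x∙yz≈zx∙y : ∀ a b c → a * (b * c) ≡ a * c * b
      x∙yz≈zx∙y a b c = trans (cong (a *_) (*-comm b c)) (sym (*-assoc a c b))

    sum-split : Vec.sum μ ≡ d * Vec.sum cs + Vec.sum es
    sum-split = trans (sym (ones μ)) (trans (split (λ _ → 1)) (cong₂ (λ a b → d * a + b) (ones cs) (ones es)))
      where
      ones : ∀ (ν : Vec ℕ n) → ΣF n (λ i → 1 * lookup ν i) ≡ Vec.sum ν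
      ones ν = trans (ΣF-cong n λ i → *-identityˡ (lookup ν i)) (ΣF-lookup ν)

    weight-split : weight μ ≡ d * weight cs + ΣF n (λ i → suc (toℕ i) * lookup es i)
    weight-split = trans (weight≡ΣF μ) (trans (split (suc ∘ toℕ)) (cong₂ _+_ (cong (d *_) (sym (weight≡ΣF cs))) refl))

fieldRing : ∀ {c ℓ₁ ℓ₂} → HeytingField c ℓ₁ ℓ₂ → CommutativeRing c ℓ₁
fieldRing F = HeytingCommutativeRing.commutativeRing (HeytingField.heytingCommutativeRing F)

module _ {n : ℕ} .{{_ : NonZero n}} (μ : Vec ℕ n) (n≡ : n ≡ weight μ) (c ℓ₁ ℓ₂ : Level) (f : Poly)
         (f-eq : f *ₚ (QAnalog._! polynomialRing X (suc n) *ₚ QAnalog.factorials polynomialRing X μ) ≋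
                 QAnalog._! polynomialRing X (n + Vec.sum μ)) where

  Value : ℤ.ℤ → ℕ → Set _
  Value j m = ∀ (F : HeytingField c ℓ₁ ℓ₂) → CharacteristicZero F → ∀ (z : PrimitiveRoot F (2 + n)) →
              HeytingField._≈_ F (eval F f (PrimitiveRoot.ζ^ z j)) (fromℕ F m)

  Sieved : ℤ.ℤ → ℕ → Set _
  Sieved j g = ∃[ m ] HasCard (λ D → 𝒜 μ D × Invariant {2 + n} D g) m × Value j m

  module SymmetricCase (j : ℤ.ℤ) (d″ M′ : ℕ) (g≡ : gcd ℤ.∣ j ∣ (2 + n) ≡ suc M′) (N≡ : 2 + n ≡ suc (suc d″) * suc M′) where
    d′ d : ℕ
    d′ = suc d″
    d  = suc d′
    open Division d μ

    Σcs Σes : ℕ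
    Σcs = Vec.sum cs
    Σes = Vec.sum es

    N≡g : 2 + n ≡ d * gcd ℤ.∣ j ∣ (2 + n)
    N≡g = trans N≡ (cong (d *_) (sym g≡))

    n+1≡ : suc n ≡ M′ * d + d′
    n+1≡ = suc-injective (trans N≡ (trans (*-comm d (suc M′)) (trans (+-comm d (M′ * d)) (+-suc (M′ * d) d′))))

    -- Adding 2 brings in n + 2 = d M, so that all multiples of d can be collected and only Σes is
    -- left.
    n+k≡ : 2 + (n + Vec.sum μ) ≡ (M′ + Σcs) * d + d + Σes
    n+k≡ = begin
      2 + n + Vec.sum μ                     ≡⟨ cong₂ _+_ (trans N≡ (*-comm d (suc M′))) sum-split ⟩
      suc M′ * d + (d * Σcs + Σes)          ≡⟨ cong (λ x → suc M′ * d + (x + Σes)) (*-comm d Σcs) ⟩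
      d + M′ * d + (Σcs * d + Σes)          ≡⟨ lia 4 (λ d a b e → ⊢ d ⊕ a ⊕ (b ⊕ e) ≂ a ⊕ b ⊕ d ⊕ e) (1 ∷ []) (1 ∷ []) d (M′ * d) (Σcs * d) Σes ⟩
      M′ * d + Σcs * d + d + Σes            ≡⟨ cong (λ x → x + d + Σes) (*-distribʳ-+ d M′ Σcs) ⟨
      (M′ + Σcs) * d + d + Σes              ∎
      where open ≡-Reasoning

    n-weight : n ≡ d * weight cs + ΣF n (λ i → suc (toℕ i) * lookup es i)
    n-weight = trans n≡ weight-split

    module _ {F : HeytingField c ℓ₁ ℓ₂} (char0 : CharacteristicZero F) (z : PrimitiveRoot F (2 + n)) where
      open FieldValue F char0
      open AtPrimitive {PrimitiveRoot.ζ^ z j} d″ (Powers.root-power z j {d} N≡g) (Powers.root-minimal z j {d} N≡g) public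

    -- On the side of the values, n + k reaches the next multiple of d, so (n + k) ! has a factor
    -- [d] more than the denominator. On the side of the dissections, `symmetric-types` allows at
    -- most one remainder 1.
    many : 2 ≤ Σes → Sieved j (suc M′)
    many 2≤ = 0 , card-∅ none , λ F char0 z →
      value-zero char0 z {f = f} {n} {μ} {M′} {K / d} {K % d} {cs} {es} f-eq n+1≡ k≡ μ≡ (proj₁ t) (proj₂ t) es<
      where
      K : ℕ
      K = n + Vec.sum μ
      k≡ : K ≡ K / d * d + K % d
      k≡ = trans (m≡m%n+[m/n]*n K d) (+-comm (K % d) _)
      low : suc (M′ + Σcs) ≤ K / d
      low = ≤-trans (≤-reflexive (sym (m*n/n≡m (suc (M′ + Σcs)) d))) (/-monoˡ-≤ d
        (lia 4 (λ k x d e → # 2 ⊕ k ≂ x ⊕ d ⊕ e ⇒ # 2 ≼ e ⇒ ⊢ d ⊕ x ≼ k) (1 ∷ 1 ∷ 0 ∷ 1 ∷ []) [] K ((M′ + Σcs) * d) d Σes n+k≡ 2≤))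
      t : ∃[ t ] K / d ≡ (M′ + Σcs) + suc t
      t = let (t , eq) = offset low in t , trans eq (sym (+-suc (M′ + Σcs) t))
      none : ∀ D → ¬ (𝒜 μ D × Invariant D (suc M′))
      none D (a , inv) = let (u , h) = symmetric-types {d = d} (s≤s (s≤s z≤n)) (sym N≡) z<s a inv in
        contradiction (≤-trans 2≤ (≤-trans (≤-reflexive (trans (sym (ΣF-lookup es)) (ΣF-cong n (λ i → remainder u i (h i))))) (ΣF-𝟙≤1 n 3 u)))
          λ { (s≤s ()) }
        where
        remainder : ∀ u i → ∃[ c ] lookup μ i ≡ d * c + 𝟙 (u ≟ toℕ i + 3) → lookup es i ≡ 𝟙 (u ≟ 3 + toℕ i)
        remainder u i (c , eq) = trans (lookup-map i (_% d) μ) (trans (cong (_% d) (trans eq (trans (+-comm (d * c) _) (cong (𝟙 (u ≟ toℕ i + 3) +_) (*-comm d c)))))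
          (trans ([m+kn]%n≡m%n (𝟙 (u ≟ toℕ i + 3)) c d) (trans (m<n⇒m%n≡m (≤-<-trans (𝟙≤1 (u ≟ toℕ i + 3)) (s≤s z<s)))
            (cong (λ x → 𝟙 (u ≟ x)) (+-comm (toℕ i) 3)))))

    -- r is the number of vertices of the root and e the remainder of n + k modulo d: d - 1 for a
    -- central subgon, 0 for a central diagonal. In both cases [e] ! takes the value γ.
    few : ∀ r e → 2 ≤ r → r + d * weight cs ≡ 2 + n → (∀ i → lookup es i ≡ 𝟙 (r ≟ toℕ i + 3)) → Σes ≤ 1 →
          d + Σes ≡ 2 + e →
          (∀ (F : HeytingField c ℓ₁ ℓ₂) (z : PrimitiveRoot F (2 + n)) → HeytingField._≈_ F
            (QAnalog._! (fieldRing F) (PrimitiveRoot.ζ^ z j) e) (QAnalog._! (fieldRing F) (PrimitiveRoot.ζ^ z j) d′)) →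
          Sieved j (suc M′)
    few r e 2≤r rest type Σes≤1 e≡ e!≈ =
      let (m , card , m≡) = Symmetric-count.count {d = d} {M′} {r} {μ} {cs} (s≤s (s≤s z≤n)) (sym N≡) rest 2≤r
                              (λ i → trans (lookup≡ i) (cong (d * lookup cs i +_) (type i)))
      in m , card , λ F char0 z →
        value-count char0 z {f = f} {n} {μ} {M′} {M′ + Σcs} {e} {cs} {es} f-eq n+1≡ k≡ μ≡ m refl (e!≈ F z) (factorials≈1 char0 z es Σes≤1) m≡
      where
      k≡ : n + Vec.sum μ ≡ (M′ + Σcs) * d + e
      k≡ = lia 5 (λ k x d s e → # 2 ⊕ k ≂ x ⊕ d ⊕ s ⇒ d ⊕ s ≂ # 2 ⊕ e ⇒ ⊢ k ≂ x ⊕ e) (1 ∷ 1 ∷ 0 ∷ 1 ∷ []) (1 ∷ 0 ∷ 1 ∷ 0 ∷ 1 ∷ []) (n + Vec.sum μ) ((M′ + Σcs) * d) d Σes e n+k≡ e≡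

    -- The part with remainder 1 accounts for the central subgon, which has toℕ i₀ + 3 vertices.
    one : Σes ≡ 1 → Sieved j (suc M′)
    one eq = let (i₀ , h) = sum-one es eq in from i₀ h
      where
      from : ∀ i₀ → (∀ i → lookup es i ≡ 𝟙 (i₀ ≟ᶠ i)) → Sieved j (suc M′)
      from i₀ h = few (toℕ i₀ + 3) d′ (≤-trans (s≤s (s≤s z≤n)) (m≤n+m 3 (toℕ i₀))) rest type (≤-reflexive eq)
        (lia 2 (λ d s → s ≂ # 1 ⇒ ⊢ # 1 ⊕ d ⊕ s ≂ # 2 ⊕ d) (1 ∷ 1 ∷ []) (1 ∷ 0 ∷ 1 ∷ []) d′ Σes eq)
        (λ F z → CommutativeRing.refl (fieldRing F) {QAnalog._! (fieldRing F) (PrimitiveRoot.ζ^ z j) d′})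
        where
        type : ∀ i → lookup es i ≡ 𝟙 (toℕ i₀ + 3 ≟ toℕ i + 3)
        type i = trans (h i) (𝟙-cong (i₀ ≟ᶠ i) (toℕ i₀ + 3 ≟ toℕ i + 3) (λ { refl → refl })
          (toℕᶠ-injective ∘ +-cancelʳ-≡ 3 _ _))
        rest : toℕ i₀ + 3 + d * weight cs ≡ 2 + n
        rest = lia 3 (λ i w n → n ≂ w ⊕ (# 1 ⊕ i) ⇒ ⊢ i ⊕ # 3 ⊕ w ≂ # 2 ⊕ n) (1 ∷ 0 ∷ 1 ∷ []) (1 ∷ 1 ∷ []) (toℕ i₀) (d * weight cs) n
          (trans n-weight (cong (d * weight cs +_) (trans (ΣF-cong n λ i → cong (suc (toℕ i) *_) (h i)) (ΣF-delta i₀ (suc ∘ toℕ)))))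

    -- All parts are divisible by d, so d divides both n and n + 2. Hence d = 2 and the root is a
    -- diameter; here e = 0, and the empty product equals [1] !.
    none : Σes ≡ 0 → Sieved j (suc M′)
    none eq = few 2 0 ≤-refl rest type (≤-trans (≤-reflexive eq) z≤n) (cong₂ _+_ d≡2 eq) λ F z →
      unit (fieldRing F) (PrimitiveRoot.ζ^ z j) d≡2
      where
      n≡dw : n ≡ d * weight cs
      n≡dw = trans n-weight (trans (cong (d * weight cs +_)
        (trans (ΣF-cong n λ i → cong (suc (toℕ i) *_) (sum-zero es eq i)) (ΣF-*0 n (suc ∘ toℕ)))) (+-identityʳ _))
      w<M : weight cs < suc M′
      w<M = *-cancelˡ-< d _ _ (≤-trans (≤-trans (s≤s (≤-reflexive (sym n≡dw))) (n≤1+n _)) (≤-reflexive N≡))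
      d≡2 : d ≡ 2
      d≡2 = ≤-antisym (lia 4 (λ d w n m → d ⊕ w ≼ m ⇒ n ≂ w ⇒ # 2 ⊕ n ≂ m ⇒ ⊢ d ≼ # 2) (1 ∷ 0 ∷ 1 ∷ 1 ∷ 0 ∷ 1 ∷ []) [] d (d * weight cs) n (d * suc M′)
          (≤-trans (≤-reflexive (sym (*-suc d (weight cs)))) (*-monoʳ-≤ d w<M)) n≡dw N≡)
        (s≤s (s≤s z≤n))
      rest : 2 + d * weight cs ≡ 2 + n
      rest = cong (2 +_) (sym n≡dw)
      type : ∀ i → lookup es i ≡ 𝟙 (2 ≟ toℕ i + 3)
      type i = trans (sum-zero es eq i) (sym (𝟙-no (2 ≟ toℕ i + 3) λ e → lia 1 (λ i → # 2 ≂ i ⊕ # 3 ⇒ ⊢⊥) (0 ∷ 1 ∷ []) [] (toℕ i) e))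
      unit : (R : CommutativeRing c ℓ₁) (x : CommutativeRing.Carrier R) → d ≡ 2 →
             CommutativeRing._≈_ R (QAnalog._! R x 0) (QAnalog._! R x d′)
      unit R x refl = R.sym (R.trans (R.*-identityˡ _) (R.trans (R.+-congˡ (R.zeroʳ x)) (R.+-identityʳ _)))
        where module R = CommutativeRing R

    sieved : Sieved j (suc M′)
    sieved = by-remainder Σes refl
      where
      by-remainder : ∀ s → Σes ≡ s → Sieved j (suc M′)
      by-remainder zero          eq = none eq
      by-remainder (suc zero)    eq = one eq
      by-remainder (suc (suc s)) eq = many (≤-trans (s≤s (s≤s z≤n)) (≤-reflexive (sym eq)))

  module Rooted = Rooted-count {n} {μ} (>-nonZero⁻¹ n) n≡

  -- Here N divides j: every dissection is fixed and ω is 1.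
  trivial-case : ∀ j g → gcd ℤ.∣ j ∣ (2 + n) ≡ g → 2 + n ≡ 1 * g → Sieved j g
  trivial-case j g g≡ N≡ = let (m , card , m≡) = Rooted.count in m ,
    card-⇔ (λ D → mk⇔ (λ a → a , subst (Invariant D) (trans N≡ (+-identityʳ g)) (invariant-N D)) proj₁) card ,
    λ F char0 z → FieldValue.AtOne.value-one F char0
      (CommutativeRing.trans (fieldRing F) (CommutativeRing.sym (fieldRing F) (CommutativeRing.*-identityʳ (fieldRing F) _))
        (FieldValue.Powers.root-power F char0 z j {1} (trans N≡ (cong (1 *_) (sym g≡)))))
      f n μ m f-eq m≡

  by-order : ∀ j g d → gcd ℤ.∣ j ∣ (2 + n) ≡ g → 2 + n ≡ d * g → Sieved j g
  by-order j g       (suc zero)      g≡ N≡ = trivial-case j g g≡ N≡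
  by-order j (suc M′) (suc (suc d″)) g≡ N≡ = SymmetricCase.sieved j d″ M′ g≡ N≡
  by-order j zero    (suc (suc d″))  g≡ N≡ = ⊥-elim (1+n≢0 (trans N≡ (*-zeroʳ d″)))

  sieve : ∀ j → ∃[ m ] HasCard (λ D → 𝒜 μ D × (rotation ^ℤ j) D ≡ D) m × Value j m
  sieve j = go (gcd[m,n]∣n ℤ.∣ j ∣ (2 + n))
    where
    open Equivalence
    go : (gcd ℤ.∣ j ∣ (2 + n)) ∣ (2 + n) → ∃[ m ] HasCard (λ D → 𝒜 μ D × (rotation ^ℤ j) D ≡ D) m × Value j m
    go (divides d N≡) = let (m , card , value) = by-order j _ d refl N≡ in m ,
      card-⇔ (λ D → mk⇔
        (λ (a , inv) → a , from (fixed-∣∣ rotation j D) (from (fixed⇔invariant D ℤ.∣ j ∣) (from (invariant-gcd {D = D} ℤ.∣ j ∣) inv)))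
        (λ (a , eq) → a , to (invariant-gcd {D = D} ℤ.∣ j ∣) (to (fixed⇔invariant D ℤ.∣ j ∣) (to (fixed-∣∣ rotation j D) eq)))) card ,
      value

theorem2p3 : ∀ (c ℓ₁ ℓ₂ : Level) (n : ℕ) .{{_ : NonZero n}} (μ : Vec ℕ n) → n ≡ weight μ →
    ∃[ f ] (f ≐ aμ μ × ExhibitsCSP (𝒜 μ) (2 + n) rotation f c ℓ₁ ℓ₂)
theorem2p3 c ℓ₁ ℓ₂ n@(suc _) μ n≡ = let (f , f-eq) = PQ.quotient n μ n≡ in
  f , is-aμ f μ f-eq , record
    { closed = Rooted.rotate-𝒜 {n} μ n≡ c ℓ₁ ℓ₂ f f-eq
    ; order  = λ {D} _ → Equivalence.from (fixed⇔invariant D (2 + n)) (invariant-N D)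
    ; sieve  = sieve μ n≡ c ℓ₁ ℓ₂ f f-eq }
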